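{- Up to equivalence, the projective space $\mathrm{PG}(3,q)$ (with a given symplectic polarity) has exactly $1$ special spread if $q=3$, exactly $2$ special spreads if $q=5$, and exactly $14$ special spreads if $q=7$.
   Context: A symplectic polarity $\zeta$ of $\mathrm{PG}(3,q)$ is a polarity with $x\in x^\zeta$ for every point $x$. The graph $Sp(4,q)$ has the points of $\mathrm{PG}(3,q)$ as vertices, two distinct points $x,y$ being adjacent iff $y\in x^\zeta$ (i.e. $x$ and $y$ are orthogonal). A line $L$ is totally isotropic if $L^\zeta=L$. A spread is a set of lines of $\mathrm{PG}(3,q)$ partitioning its point set. For $q$ odd, a special spread (with respect to $\zeta$) is a spread $S$ consisting of lines that are not totally isotropic such that for every $\ell\in S$ there is a uniquely determined line $\ell'\in S$ such that any point of $\ell$ is orthogonal to any point of $\ell'$ (that is, $\ell'=\ell^\zeta$). Two special spreads are equivalent if there exists an automorphism of the graph $Sp(4,q)$ mapping one of them to the other. -}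

module Defs where

open import Level using (0ℓ)
open import Data.Bool.Base using (Bool; T)
open import Data.Nat.Base as ℕ using (ℕ; NonZero)
open import Data.Nat.DivMod using (_mod_)
open import Data.Fin.Base using (Fin; toℕ)
open import Data.Vec.Base using (Vec; map; zipWith; replicate; foldr′)
open import Data.Product using (∃; ∃!; _×_; proj₁)
open import Function.Bundles using (_⇔_)
open import Function.Definitions using (Bijective)
open import Algebra.Definitions using (Involutive)
open import Relation.Binary.Core using (Rel)
open import Relation.Binary.Definitions using (Antitonic₁)
open import Relation.Binary.Morphism.Structures using (IsOrderIsomorphism)
open import Relation.Binary.PropositionalEquality.Core using (_≡_)
open import Relation.Nullary.Negation.Core using (¬_)

module _ (q : ℕ) .{{_ : NonZero q}} where

  -- The integers modulo q; this is the field GF(q) when q is prime.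
  𝔽 : Set
  𝔽 = Fin q

  0𝔽 : 𝔽
  0𝔽 = 0 mod q

  _+𝔽_ _*𝔽_ : 𝔽 → 𝔽 → 𝔽
  a +𝔽 b = (toℕ a ℕ.+ toℕ b) mod q
  a *𝔽 b = (toℕ a ℕ.* toℕ b) mod q

  𝕍 : Set
  𝕍 = Vec 𝔽 4

  0𝕍 : 𝕍
  0𝕍 = replicate 4 0𝔽

  _+𝕍_ : 𝕍 → 𝕍 → 𝕍
  _+𝕍_ = zipWith _+𝔽_

  _*𝕍_ : 𝔽 → 𝕍 → 𝕍
  c *𝕍 v = map (c *𝔽_) v

  -- Subsets of the finite set 𝕍 are given by characteristic functions,
  -- so that they are the classical ones.
  record Subspace : Set where
    field
      member   : 𝕍 → Bool
      0-closed : T (member 0𝕍)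
      +-closed : ∀ u v → T (member u) → T (member v) → T (member (u +𝕍 v))
      *-closed : ∀ c v → T (member v) → T (member (c *𝕍 v))

module _ {q : ℕ} .{{_ : NonZero q}} where

  infix 4 _∈_ _⊆_ _≈_

  _∈_ : 𝕍 q → Subspace q → Set
  v ∈ U = T (Subspace.member U v)

  _⊆_ : Rel (Subspace q) 0ℓ
  U ⊆ W = ∀ v → v ∈ U → v ∈ W

  _≈_ : Rel (Subspace q) 0ℓ
  U ≈ W = U ⊆ W × W ⊆ U

  linearCombination : ∀ {k} → Vec (𝔽 q) k → Vec (𝕍 q) k → 𝕍 q
  linearCombination c b = foldr′ (_+𝕍_ q) (0𝕍 q) (zipWith (_*𝕍_ q) c b)

  LinearlyIndependent : ∀ {k} → Vec (𝕍 q) k → Set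
  LinearlyIndependent {k} b =
    ∀ c → linearCombination c b ≡ 0𝕍 q → c ≡ replicate k (0𝔽 q)

  Spans : ∀ {k} → Vec (𝕍 q) k → Subspace q → Set
  Spans b U = ∀ v → v ∈ U ⇔ ∃ λ c → linearCombination c b ≡ v

  HasDimension : ℕ → Subspace q → Set
  HasDimension k U = ∃ λ (b : Vec (𝕍 q) k) → LinearlyIndependent b × Spans b U

-- Points and lines of PG(3,q): the subspaces of vector space dimension 1 and 2.
-- They carry a basis as evidence, which the equalities below ignore.
Point Line : (q : ℕ) .{{_ : NonZero q}} → Set
Point q = ∃ λ (U : Subspace q) → HasDimension 1 U
Line  q = ∃ λ (U : Subspace q) → HasDimension 2 U

module _ {q : ℕ} .{{_ : NonZero q}} where

  infix 4 _≈ₚ_ _≈ₗ_ _on_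

  _≈ₚ_ : Rel (Point q) 0ℓ
  x ≈ₚ y = proj₁ x ≈ proj₁ y

  _≈ₗ_ : Rel (Line q) 0ℓ
  ℓ ≈ₗ m = proj₁ ℓ ≈ proj₁ m

  _on_ : Point q → Line q → Set
  x on ℓ = proj₁ x ⊆ proj₁ ℓ

module _ (q : ℕ) .{{_ : NonZero q}} where

  -- An inclusion-reversing involution of the lattice of subspaces.
  -- Compatibility of ζ with _≈_ follows from antitonic.
  record Polarity : Set where
    field
      ζ          : Subspace q → Subspace q
      antitonic  : Antitonic₁ _⊆_ _⊆_ ζ
      involutive : Involutive _≈_ ζ

  record SymplecticPolarity : Set where
    field
      polarity : Polarity
    open Polarity polarity public
    field
      absolute : ∀ (x : Point q) → proj₁ x ⊆ ζ (proj₁ x)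

  record LineSet : Set where
    field
      member : Line q → Bool
      resp-≈ : ∀ {ℓ m} → ℓ ≈ₗ m → T (member ℓ) → T (member m)

module _ {q : ℕ} .{{_ : NonZero q}} where

  infix 4 _∈ₗ_

  _∈ₗ_ : Line q → LineSet q → Set
  ℓ ∈ₗ S = T (LineSet.member S ℓ)

  IsSpread : LineSet q → Set
  IsSpread S = ∀ (x : Point q) → ∃! _≈ₗ_ λ ℓ → ℓ ∈ₗ S × x on ℓ

module _ {q : ℕ} .{{_ : NonZero q}} (P : SymplecticPolarity q) where
  open SymplecticPolarity P using (ζ)

  Orthogonal : Rel (Point q) 0ℓ
  Orthogonal x y = proj₁ y ⊆ ζ (proj₁ x)

  TotallyIsotropic : Line q → Set
  TotallyIsotropic ℓ = ζ (proj₁ ℓ) ≈ proj₁ ℓ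

  -- Adjacency in the graph Sp(4,q).
  Adjacent : Rel (Point q) 0ℓ
  Adjacent x y = ¬ (x ≈ₚ y) × Orthogonal x y

  -- A bijection on vertices preserving and reflecting adjacency.
  IsGraphAutomorphism : (Point q → Point q) → Set
  IsGraphAutomorphism = IsOrderIsomorphism _≈ₚ_ _≈ₚ_ Adjacent Adjacent

  record IsSpecialSpread (S : LineSet q) : Set where
    field
      isSpread            : IsSpread S
      notTotallyIsotropic : ∀ ℓ → ℓ ∈ₗ S → ¬ TotallyIsotropic ℓ
      partner             : ∀ ℓ → ℓ ∈ₗ S →
        ∃! _≈ₗ_ λ ℓ′ → ℓ′ ∈ₗ S ×
          (∀ x y → x on ℓ → y on ℓ′ → Orthogonal x y)

  SpecialSpread : Set
  SpecialSpread = ∃ IsSpecialSpread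

-- For a bijection φ on points: the set of images of the points of ℓ is m.
MapsLine : {q : ℕ} .{{_ : NonZero q}} → (Point q → Point q) → Rel (Line q) 0ℓ
MapsLine φ ℓ m = ∀ x → x on ℓ ⇔ φ x on m

MapsLineSet : {q : ℕ} .{{_ : NonZero q}} → (Point q → Point q) → Rel (LineSet q) 0ℓ
MapsLineSet φ S S′ =
  (∀ ℓ → ℓ ∈ₗ S → ∃ λ m → m ∈ₗ S′ × MapsLine φ ℓ m) ×
  (∀ m → m ∈ₗ S′ → ∃ λ ℓ → ℓ ∈ₗ S × MapsLine φ ℓ m)

Equivalent : {q : ℕ} .{{_ : NonZero q}} (P : SymplecticPolarity q) → Rel (SpecialSpread P) 0ℓ
Equivalent P S S′ =
  ∃ λ φ → IsGraphAutomorphism P φ × MapsLineSet φ (proj₁ S) (proj₁ S′)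

-- For an equivalence relation _∼_: the quotient has exactly n elements,
-- i.e. some n-tuple of elements of A meets every class exactly once.
ExactlyUpTo : {A : Set} → ℕ → Rel A 0ℓ → Set
ExactlyUpTo {A} n _∼_ = ∃ λ (f : Fin n → A) → Bijective _≡_ _∼_ f

-- Both ℓ and ℓ^ζ are encoded by a vector v = (s, a, b, c, d) with s² + ad − bc = 1 and its
-- negative: v determines an involution of the symplectic space F⁴ whose eigenspaces are the
-- two lines. (Thus ± v is a point off the quadric Q(4, q), whose points are the totally
-- isotropic lines, and a special spread becomes a set of (q² + 1)/2 such points.)
--
-- Every polarity ζ is orthogonality for a symplectic form in suitable coordinates, and these
-- can be chosen so that a given line of the spread becomes ⟨ε₁, ε₂⟩. The spreads containing
-- that line are found by an exhaustive search, which branches over the lines through an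
-- uncovered point and cuts a branch as soon as a similitude maps a configuration treated
-- before into the current one; the search tree is recorded as a certificate and replayed
-- in ℕ. Representatives are told apart by the number of triples of line pairs having a
-- common totally isotropic transversal, which depends only on the graph Sp(4, q).

module Submission where

open import Algebra.Bundles using (CommutativeRing)
import Algebra.Properties.CommutativeMonoid.Sum
import Algebra.Properties.Ring
import Algebra.Properties.Semiring.Mult.TCOptimised
import Algebra.Solver.Ring as RingSolver
open import Algebra.Solver.Ring.AlmostCommutativeRing using (AlmostCommutativeRing; fromCommutativeRing; _-Raw-AlmostCommutative⟶_)
open import Algebra.Structures using (IsCommutativeRing)
open import Data.Bool.Base using (Bool; true; false; T; _∧_; _∨_; not; if_then_else_)
open import Data.Bool.ListAction using (any; all)
open import Data.Bool.Properties using (T-∧; T-∨; T?)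
open import Data.Empty using (⊥; ⊥-elim)
open import Data.Fin.Base as Fin using (Fin; toℕ; combine; remQuot)
open import Data.Fin.Permutation using (permutation)
import Data.Fin.Properties as Fin
open import Data.Integer.Base as ℤ using (ℤ; -[1+_]; _⊖_)
import Data.Integer.Properties as ℤ
open import Data.List.Base as List using (List; []; _∷_; _++_; upTo; cartesianProductWith; length; filterᵇ; lookup)
open import Data.List.Membership.Propositional using (find; lose) renaming (_∈_ to _∈ˡ_)
open import Data.List.Membership.Propositional.Properties using (∈-cartesianProductWith⁺; ∈-upTo⁺; ∈-map⁺; ∈-map⁻; ∈-++⁺ˡ; ∈-++⁺ʳ; ∈-++⁻; ∈-filter⁺; ∈-filter⁻; ∈-lookup)
import Data.List.Properties as List
open import Data.List.Relation.Unary.All as All using (All; []; _∷_)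
open import Data.List.Relation.Unary.Any as Any using (Any; here; there; index)
import Data.List.Relation.Unary.Any.Properties as Any
open import Data.Maybe.Base using (Maybe; just; nothing)
open import Data.Nat.Base as ℕ using (ℕ; zero; suc; NonZero; nonZero; _≡ᵇ_)
open import Data.Nat.DivMod using (_mod_; _%_; _/_; m%n<n; %-distribˡ-+; %-distribˡ-*; m<n⇒m%n≡m; m*n%n≡0; m%n%n≡m%n)
open import Data.Nat.ListAction using () renaming (sum to sumˡ)
import Data.Nat.Properties as ℕ
open import Data.Nat.Tactic.RingSolver using (solve-∀)
open import Data.Product using (∃; ∃₂; ∃!; _×_; _,_; proj₁; proj₂)
open import Data.Sum.Base as Sum using (_⊎_; inj₁; inj₂; [_,_]′)
open import Data.Vec.Base using (Vec; []; _∷_; map; zipWith; replicate; head; tail)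
import Data.Vec.Properties as Vec
open import Function.Base using (_∘_; case_of_)
open import Function.Bundles using (_⇔_; mk⇔; module Equivalence)
open import Level using (0ℓ)
open import Relation.Binary.Definitions using (DecidableEquality)
open import Relation.Binary.Morphism.Structures using (IsOrderIsomorphism)
open import Relation.Binary.PropositionalEquality hiding (setoid)
open import Relation.Nullary using (¬_; Dec; yes; no)
open import Relation.Nullary.Decidable using (⌊_⌋; True; toWitness; fromWitness; ¬?; _→-dec_; _×-dec_)

-- A polarity is given only as an antiautomorphism of the subspace lattice and a graph automorphism
-- only as a map on points, so neither is known to be linear or semilinear. The fundamental theorem
-- of projective geometry is avoided on both sides: the form is built directly from the relation
-- `u ⟂ v`, the equivalences that are constructed are linear, and inequivalence comes from an
-- invariant phrased by orthogonality of points alone. The vector v is the Plücker vector of the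
-- line, projected from the pole of the hyperplane p12 + p34 = 0 that holds the totally isotropic
-- lines, and scaled by 1/(p12 + p34). The operators `inv v` are the self-adjoint operators of trace
-- zero; they satisfy the Clifford relation `inv v` `inv w` + `inv w` `inv v` = 2 B(v, w), where
-- B(v, v) = `norm v`. A spread is an arbitrary Boolean function on lines and is never enumerated.
-- The search proves implications: if, in some coordinates, these few lines lie in the spread, then
-- it is equivalent to a representative. A similitude is a change of coordinates and therefore
-- carries one such implication to another.

module IntegerSolver (R : CommutativeRing 0ℓ 0ℓ) where
  open CommutativeRing R hiding (refl; sym; trans; reflexive; zero)
  private module ≈ = CommutativeRing R
  open Algebra.Properties.Ring ring
  open Algebra.Properties.Semiring.Mult.TCOptimised semiring using (1+×; ×-homo-+; ×1-homo-*) renaming (_×_ to _·_)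
  open import Relation.Binary.Reasoning.Setoid setoid

  -- The coefficients are integers because equality in ℤ can be decided by evaluation, while the
  -- carrier of the ring is abstract. With this multiple operation the images of 0 and 1 reduce to
  -- `0#` and `1#`, so the constants of a solved identity match the goal definitionally.
  fromℤ : ℤ → Carrier
  fromℤ (ℤ.+ n)    = n · 1#
  fromℤ -[1+ n ] = - (suc n · 1#)

  fromℤ-⊖ : ∀ m n → fromℤ (m ⊖ n) ≈ m · 1# - n · 1#
  fromℤ-⊖ m zero = begin
    m · 1#        ≈⟨ +-identityʳ _ ⟨
    m · 1# + 0#   ≈⟨ +-congˡ -0#≈0# ⟨
    m · 1# - 0#   ∎
  fromℤ-⊖ zero (suc n) = ≈.sym (+-identityˡ _)
  fromℤ-⊖ (suc m) (suc n) = begin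
    fromℤ (suc m ⊖ suc n)                ≡⟨ cong fromℤ (ℤ.[1+m]⊖[1+n]≡m⊖n m n) ⟩
    fromℤ (m ⊖ n)                        ≈⟨ fromℤ-⊖ m n ⟩
    m · 1# - n · 1#                      ≈⟨ +-congʳ (+-identityʳ _) ⟨
    m · 1# + 0# - n · 1#                 ≈⟨ +-congʳ (+-congˡ (-‿inverseʳ 1#)) ⟨
    m · 1# + (1# - 1#) - n · 1#          ≈⟨ +-congʳ (+-assoc _ _ _) ⟨
    m · 1# + 1# - 1# - n · 1#            ≈⟨ +-assoc _ _ _ ⟩
    m · 1# + 1# + (- 1# - n · 1#)        ≈⟨ +-cong (+-comm _ _) (-‿+-comm 1# (n · 1#)) ⟩
    1# + m · 1# - (1# + n · 1#)          ≈⟨ +-cong (1+× m 1#) (-‿cong (1+× n 1#)) ⟨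
    suc m · 1# - suc n · 1#              ∎

  fromℤ-+ : ∀ i j → fromℤ (i ℤ.+ j) ≈ fromℤ i + fromℤ j
  fromℤ-+ (ℤ.+ m)    (ℤ.+ n)    = ×-homo-+ 1# m n
  fromℤ-+ (ℤ.+ m)    -[1+ n ] = fromℤ-⊖ m (suc n)
  fromℤ-+ -[1+ m ] (ℤ.+ n)    = ≈.trans (fromℤ-⊖ n (suc m)) (+-comm _ _)
  fromℤ-+ -[1+ m ] -[1+ n ] = begin
    - (suc (suc (m ℕ.+ n)) · 1#)   ≡⟨ cong (λ k → - (suc k · 1#)) (ℕ.+-suc m n) ⟨
    - ((suc m ℕ.+ suc n) · 1#)     ≈⟨ -‿cong (×-homo-+ 1# (suc m) (suc n)) ⟩
    - (suc m · 1# + suc n · 1#)    ≈⟨ -‿+-comm _ _ ⟨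
    - (suc m · 1#) - suc n · 1#    ∎

  fromℤ-neg : ∀ i → fromℤ (ℤ.- i) ≈ - fromℤ i
  fromℤ-neg (ℤ.+ zero)  = ≈.sym -0#≈0#
  fromℤ-neg (ℤ.+ suc n) = ≈.refl
  fromℤ-neg -[1+ n ]  = ≈.sym (-‿involutive _)

  fromℤ-+* : ∀ m j → fromℤ (ℤ.+ m ℤ.* j) ≈ fromℤ (ℤ.+ m) * fromℤ j
  fromℤ-+* m (ℤ.+ n) = begin
    fromℤ (ℤ.+ m ℤ.* ℤ.+ n)   ≡⟨ cong fromℤ (ℤ.pos-* m n) ⟨
    (m ℕ.* n) · 1#        ≈⟨ ×1-homo-* m n ⟩
    m · 1# * (n · 1#)     ∎
  fromℤ-+* m -[1+ n ] = begin
    fromℤ (ℤ.+ m ℤ.* -[1+ n ])        ≡⟨ cong fromℤ (ℤ.neg-distribʳ-* (ℤ.+ m) (ℤ.+ suc n)) ⟨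
    fromℤ (ℤ.- (ℤ.+ m ℤ.* ℤ.+ suc n))   ≈⟨ fromℤ-neg (ℤ.+ m ℤ.* ℤ.+ suc n) ⟩
    - fromℤ (ℤ.+ m ℤ.* ℤ.+ suc n)       ≈⟨ -‿cong (fromℤ-+* m (ℤ.+ suc n)) ⟩
    - (m · 1# * (suc n · 1#))       ≈⟨ -‿distribʳ-* _ _ ⟩
    m · 1# * - (suc n · 1#)         ∎

  fromℤ-* : ∀ i j → fromℤ (i ℤ.* j) ≈ fromℤ i * fromℤ j
  fromℤ-* (ℤ.+ m)    j = fromℤ-+* m j
  fromℤ-* -[1+ m ] j = begin
    fromℤ (-[1+ m ] ℤ.* j)          ≡⟨ cong fromℤ (ℤ.neg-distribˡ-* (ℤ.+ suc m) j) ⟨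
    fromℤ (ℤ.- (ℤ.+ suc m ℤ.* j))     ≈⟨ fromℤ-neg (ℤ.+ suc m ℤ.* j) ⟩
    - fromℤ (ℤ.+ suc m ℤ.* j)         ≈⟨ -‿cong (fromℤ-+* (suc m) j) ⟩
    - (suc m · 1# * fromℤ j)        ≈⟨ -‿distribˡ-* _ _ ⟩
    - (suc m · 1#) * fromℤ j        ∎

  almostCommutativeRing : AlmostCommutativeRing 0ℓ 0ℓ
  almostCommutativeRing = fromCommutativeRing R

  morphism : ℤ.+-*-rawRing -Raw-AlmostCommutative⟶ almostCommutativeRing
  morphism = record
    { ⟦_⟧    = fromℤ
    ; +-homo = fromℤ-+
    ; *-homo = fromℤ-*
    ; -‿homo = fromℤ-neg
    ; 0-homo = ≈.refl
    ; 1-homo = ≈.refl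
    }

  _coeff≟_ : ∀ i j → Maybe (fromℤ i ≈ fromℤ j)
  i coeff≟ j with i ℤ.≟ j
  ... | yes i≡j = just (≈.reflexive (cong fromℤ i≡j))
  ... | no  _   = nothing

  open RingSolver ℤ.+-*-rawRing almostCommutativeRing morphism _coeff≟_ public

-- Bare operations suffice, because the formulas are instantiated twice: in a field, where
-- identities are proved, and in ℕ with a substitute for negation, where the checker evaluates them.
module Formulas {A : Set} (_+_ _*_ : A → A → A) (-_ : A → A) where
  form : Vec A 4 → Vec A 4 → A
  form (x ∷ y ∷ z ∷ w ∷ []) (x′ ∷ y′ ∷ z′ ∷ w′ ∷ []) =
    ((x * y′) + (- (y * x′))) + ((z * w′) + (- (w * z′)))

  norm : Vec A 5 → A
  norm (s ∷ a ∷ b ∷ c ∷ d ∷ []) = (s * s) + ((a * d) + (- (b * c)))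

  -- In 2 by 2 blocks this is the matrix with s and -s on the diagonal, the block (a b; c d) above
  -- it and the adjugate of that block below it. The product of a block and its adjugate is its
  -- determinant, so the square is the scalar `norm v`.
  inv : Vec A 5 → Vec A 4 → Vec A 4
  inv (s ∷ a ∷ b ∷ c ∷ d ∷ []) (x ∷ y ∷ z ∷ w ∷ []) =
    ((s * x) + ((a * z) + (b * w))) ∷
    ((s * y) + ((c * z) + (d * w))) ∷
    ((d * x) + (- ((b * y) + (s * z)))) ∷
    ((a * y) + (- ((c * x) + (s * w)))) ∷ []

  -- The lines through (1, y, z, w) are parametrized by two entries a, b of their involutions.
  through : A → A → A → A → A → A → Vec A 5
  through 1# y z w a b = s ∷ a ∷ b ∷ ((a * y) + (- (w * (1# + s)))) ∷ ((b * y) + (z * (1# + s))) ∷ []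
    where s = 1# + (- ((a * z) + (b * w)))

  comb : Vec A 4 → Vec A 4 → Vec A 4 → Vec A 4 → Vec A 4 → Vec A 4
  comb (e₁ ∷ e₂ ∷ e₃ ∷ e₄ ∷ []) (f₁ ∷ f₂ ∷ f₃ ∷ f₄ ∷ []) (g₁ ∷ g₂ ∷ g₃ ∷ g₄ ∷ []) (h₁ ∷ h₂ ∷ h₃ ∷ h₄ ∷ []) (x ∷ y ∷ z ∷ w ∷ []) =
    row e₁ f₁ g₁ h₁ ∷ row e₂ f₂ g₂ h₂ ∷ row e₃ f₃ g₃ h₃ ∷ row e₄ f₄ g₄ h₄ ∷ []
    where
    row : A → A → A → A → A
    row e f g h = ((x * e) + (y * f)) + ((z * g) + (w * h))

-- Linear algebra over a field of odd characteristic

record Field : Set₁ where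
  infixl 6 _+_ _-_
  infixl 7 _*_
  infix  8 -_
  field
    Carrier           : Set
    _+_ _*_           : Carrier → Carrier → Carrier
    -_                : Carrier → Carrier
    0# 1#             : Carrier
    isCommutativeRing : IsCommutativeRing _≡_ _+_ _*_ -_ 0# 1#
    _≟_               : DecidableEquality Carrier
    inverse           : ∀ a → a ≢ 0# → ∃ λ b → a * b ≡ 1#
    1≢0               : 1# ≢ 0#
    2≢0               : 1# + 1# ≢ 0#
  commutativeRing : CommutativeRing 0ℓ 0ℓ
  commutativeRing = record { isCommutativeRing = isCommutativeRing }
  _-_ : Carrier → Carrier → Carrier
  x - y = x + - y

module Algebra (F : Field) where
  open Field F renaming (Carrier to A)
  open IntegerSolver commutativeRing public using (solve; _:=_; _:+_; _:*_; :-_; _:-_; con; Polynomial)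
  open IsCommutativeRing isCommutativeRing public
    using (+-identityˡ; +-identityʳ; *-identityˡ; *-identityʳ; zeroˡ; zeroʳ; +-comm; *-comm; -‿inverseʳ; -‿inverseˡ; *-assoc; +-assoc)
  open Formulas _+_ _*_ -_ public
  open ≡-Reasoning

  #0 #1 : ∀ {n} → Polynomial n
  #0 = con (ℤ.+ 0)
  #1 = con (ℤ.+ 1)

  x-y≡0⇒x≡y : ∀ {x y} → x - y ≡ 0# → x ≡ y
  x-y≡0⇒x≡y {x} {y} e = begin
    x            ≡⟨ solve 2 (λ x y → x := (x :- y) :+ y) refl x y ⟩
    (x - y) + y  ≡⟨ cong (_+ y) e ⟩
    0# + y       ≡⟨ +-identityˡ y ⟩
    y            ∎

  x≡y⇒x-y≡0 : ∀ {x y} → x ≡ y → x - y ≡ 0#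
  x≡y⇒x-y≡0 {x} refl = -‿inverseʳ x

  -- An equation follows from hypotheses if its two sides differ by a combination of
  -- theirs; the coefficients c are supplied and the ring solver verifies the combination.
  by₁ : ∀ {x y l r} c → l ≡ r → x - y ≡ c * (l - r) → x ≡ y
  by₁ c h e = x-y≡0⇒x≡y (trans e (trans (cong (c *_) (x≡y⇒x-y≡0 h)) (zeroʳ c)))

  by₂ : ∀ {x y l r l′ r′} c c′ → l ≡ r → l′ ≡ r′ → x - y ≡ c * (l - r) + c′ * (l′ - r′) → x ≡ y
  by₂ c c′ h h′ e = x-y≡0⇒x≡y (trans e (trans (cong₂ (λ u v → c * u + c′ * v) (x≡y⇒x-y≡0 h) (x≡y⇒x-y≡0 h′))
    (trans (cong₂ _+_ (zeroʳ c) (zeroʳ c′)) (+-identityˡ 0#))))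

  by₃ : ∀ {x y l r l′ r′ l″ r″} c c′ c″ → l ≡ r → l′ ≡ r′ → l″ ≡ r″ →
        x - y ≡ c * (l - r) + c′ * (l′ - r′) + c″ * (l″ - r″) → x ≡ y
  by₃ c c′ c″ h h′ h″ e = x-y≡0⇒x≡y (trans e (trans (cong₂ (λ u v → u + c″ * v)
      (cong₂ (λ u v → c * u + c′ * v) (x≡y⇒x-y≡0 h) (x≡y⇒x-y≡0 h′)) (x≡y⇒x-y≡0 h″))
    (trans (cong₂ _+_ (trans (cong₂ _+_ (zeroʳ c) (zeroʳ c′)) (+-identityˡ 0#)) (zeroʳ c″)) (+-identityˡ 0#))))

  noZeroDivisor : ∀ {a b} → a ≢ 0# → a * b ≡ 0# → b ≡ 0#
  noZeroDivisor {a} {b} a≢0 ab≡0 with i , ai≡1 ← inverse a a≢0 =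
    by₂ i (- b) ab≡0 ai≡1 (solve 3 (λ a b i → b :- #0 := i :* (a :* b :- #0) :+ (:- b) :* (a :* i :- #1)) refl a b i)

  *≢0 : ∀ {a b} → a ≢ 0# → b ≢ 0# → a * b ≢ 0#
  *≢0 a≢0 b≢0 = b≢0 ∘ noZeroDivisor a≢0

  -1# : A
  -1# = - 1#

  V : Set
  V = Vec A 4

  0ᵥ : V
  0ᵥ = replicate 4 0#

  infixl 6 _+ᵥ_
  infixl 7 _*ᵥ_
  _+ᵥ_ : V → V → V
  _+ᵥ_ = zipWith _+_

  _*ᵥ_ : A → V → V
  c *ᵥ v = map (c *_) v

  -ᵥ_ : V → V
  -ᵥ v = -1# *ᵥ v

  infixr 5 _⹁_
  _⹁_ : ∀ {n} {a b : A} {u v : Vec A n} → a ≡ b → u ≡ v → a ∷ u ≡ b ∷ v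
  _⹁_ = cong₂ _∷_

  ε₁ ε₂ ε₃ ε₄ : V
  ε₁ = 1# ∷ 0# ∷ 0# ∷ 0# ∷ []
  ε₂ = 0# ∷ 1# ∷ 0# ∷ 0# ∷ []
  ε₃ = 0# ∷ 0# ∷ 1# ∷ 0# ∷ []
  ε₄ = 0# ∷ 0# ∷ 0# ∷ 1# ∷ []

  comb-ε : ∀ z → comb ε₁ ε₂ ε₃ ε₄ z ≡ z
  comb-ε (x ∷ y ∷ z ∷ w ∷ []) =
    solve 4 (λ x y z w → (x :* #1 :+ y :* #0) :+ (z :* #0 :+ w :* #0) := x) refl x y z w ⹁
    solve 4 (λ x y z w → (x :* #0 :+ y :* #1) :+ (z :* #0 :+ w :* #0) := y) refl x y z w ⹁
    solve 4 (λ x y z w → (x :* #0 :+ y :* #0) :+ (z :* #1 :+ w :* #0) := z) refl x y z w ⹁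
    solve 4 (λ x y z w → (x :* #0 :+ y :* #0) :+ (z :* #0 :+ w :* #1) := w) refl x y z w ⹁ refl

  comb-sum : ∀ e f g h x y z w → comb e f g h (x ∷ y ∷ z ∷ w ∷ []) ≡ (x *ᵥ e +ᵥ y *ᵥ f) +ᵥ (z *ᵥ g +ᵥ w *ᵥ h)
  comb-sum (_ ∷ _ ∷ _ ∷ _ ∷ []) (_ ∷ _ ∷ _ ∷ _ ∷ []) (_ ∷ _ ∷ _ ∷ _ ∷ []) (_ ∷ _ ∷ _ ∷ _ ∷ []) x y z w = refl

  comb-+ : ∀ e f g h u v → comb e f g h (u +ᵥ v) ≡ comb e f g h u +ᵥ comb e f g h v
  comb-+ (e₁ ∷ e₂ ∷ e₃ ∷ e₄ ∷ []) (f₁ ∷ f₂ ∷ f₃ ∷ f₄ ∷ []) (g₁ ∷ g₂ ∷ g₃ ∷ g₄ ∷ []) (h₁ ∷ h₂ ∷ h₃ ∷ h₄ ∷ []) (x ∷ y ∷ z ∷ w ∷ []) (x′ ∷ y′ ∷ z′ ∷ w′ ∷ []) =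
    row e₁ f₁ g₁ h₁ ⹁ row e₂ f₂ g₂ h₂ ⹁ row e₃ f₃ g₃ h₃ ⹁ row e₄ f₄ g₄ h₄ ⹁ refl
    where
    row = λ e f g h → solve 12 (λ e f g h x y z w x′ y′ z′ w′ →
      ((x :+ x′) :* e :+ (y :+ y′) :* f) :+ ((z :+ z′) :* g :+ (w :+ w′) :* h) :=
      ((x :* e :+ y :* f) :+ (z :* g :+ w :* h)) :+ ((x′ :* e :+ y′ :* f) :+ (z′ :* g :+ w′ :* h))) refl e f g h x y z w x′ y′ z′ w′

  comb-* : ∀ e f g h c v → comb e f g h (c *ᵥ v) ≡ c *ᵥ comb e f g h v
  comb-* (e₁ ∷ e₂ ∷ e₃ ∷ e₄ ∷ []) (f₁ ∷ f₂ ∷ f₃ ∷ f₄ ∷ []) (g₁ ∷ g₂ ∷ g₃ ∷ g₄ ∷ []) (h₁ ∷ h₂ ∷ h₃ ∷ h₄ ∷ []) c (x ∷ y ∷ z ∷ w ∷ []) =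
    row e₁ f₁ g₁ h₁ ⹁ row e₂ f₂ g₂ h₂ ⹁ row e₃ f₃ g₃ h₃ ⹁ row e₄ f₄ g₄ h₄ ⹁ refl
    where
    row = λ e f g h → solve 9 (λ e f g h c x y z w →
      ((c :* x) :* e :+ (c :* y) :* f) :+ ((c :* z) :* g :+ (c :* w) :* h) :=
      c :* ((x :* e :+ y :* f) :+ (z :* g :+ w :* h))) refl e f g h c x y z w

  inv-+ : ∀ v x y → inv v (x +ᵥ y) ≡ inv v x +ᵥ inv v y
  inv-+ (s ∷ a ∷ b ∷ c ∷ d ∷ []) (x ∷ y ∷ z ∷ w ∷ []) (x′ ∷ y′ ∷ z′ ∷ w′ ∷ []) =
    pos s x x′ a z z′ b w w′ ⹁ pos s y y′ c z z′ d w w′ ⹁ neg d x x′ b y y′ s z z′ ⹁ neg a y y′ c x x′ s w w′ ⹁ refl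
    where
    pos = solve 9 (λ s x x′ a z z′ b w w′ → s :* (x :+ x′) :+ (a :* (z :+ z′) :+ b :* (w :+ w′)) :=
      (s :* x :+ (a :* z :+ b :* w)) :+ (s :* x′ :+ (a :* z′ :+ b :* w′))) refl
    neg = solve 9 (λ s x x′ a z z′ b w w′ → s :* (x :+ x′) :- (a :* (z :+ z′) :+ b :* (w :+ w′)) :=
      (s :* x :- (a :* z :+ b :* w)) :+ (s :* x′ :- (a :* z′ :+ b :* w′))) refl

  inv-* : ∀ v k x → inv v (k *ᵥ x) ≡ k *ᵥ inv v x
  inv-* (s ∷ a ∷ b ∷ c ∷ d ∷ []) k (x ∷ y ∷ z ∷ w ∷ []) =
    pos k s x a z b w ⹁ pos k s y c z d w ⹁ neg k d x b y s z ⹁ neg k a y c x s w ⹁ refl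
    where
    pos = solve 7 (λ k s x a z b w → s :* (k :* x) :+ (a :* (k :* z) :+ b :* (k :* w)) := k :* (s :* x :+ (a :* z :+ b :* w))) refl
    neg = solve 7 (λ k s x a z b w → s :* (k :* x) :- (a :* (k :* z) :+ b :* (k :* w)) := k :* (s :* x :- (a :* z :+ b :* w))) refl

  inv-inv : ∀ v x → inv v (inv v x) ≡ norm v *ᵥ x
  inv-inv (s ∷ a ∷ b ∷ c ∷ d ∷ []) (x ∷ y ∷ z ∷ w ∷ []) =
    solve 9 (λ s a b c d x y z w → s :* (s :* x :+ (a :* z :+ b :* w)) :+ (a :* (d :* x :- (b :* y :+ s :* z)) :+ b :* (a :* y :- (c :* x :+ s :* w)))
      := (s :* s :+ (a :* d :- b :* c)) :* x) refl s a b c d x y z w ⹁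
    solve 9 (λ s a b c d x y z w → s :* (s :* y :+ (c :* z :+ d :* w)) :+ (c :* (d :* x :- (b :* y :+ s :* z)) :+ d :* (a :* y :- (c :* x :+ s :* w)))
      := (s :* s :+ (a :* d :- b :* c)) :* y) refl s a b c d x y z w ⹁
    solve 9 (λ s a b c d x y z w → d :* (s :* x :+ (a :* z :+ b :* w)) :- (b :* (s :* y :+ (c :* z :+ d :* w)) :+ s :* (d :* x :- (b :* y :+ s :* z)))
      := (s :* s :+ (a :* d :- b :* c)) :* z) refl s a b c d x y z w ⹁
    solve 9 (λ s a b c d x y z w → a :* (s :* y :+ (c :* z :+ d :* w)) :- (c :* (s :* x :+ (a :* z :+ b :* w)) :+ s :* (a :* y :- (c :* x :+ s :* w)))
      := (s :* s :+ (a :* d :- b :* c)) :* w) refl s a b c d x y z w ⹁ refl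

  inv-selfAdjoint : ∀ v x y → form (inv v x) y ≡ form x (inv v y)
  inv-selfAdjoint (s ∷ a ∷ b ∷ c ∷ d ∷ []) (x ∷ y ∷ z ∷ w ∷ []) (X ∷ Y ∷ Z ∷ W ∷ []) =
    solve 13 (λ s a b c d x y z w X Y Z W →
      ((s :* x :+ (a :* z :+ b :* w)) :* Y :- (s :* y :+ (c :* z :+ d :* w)) :* X) :+
      ((d :* x :- (b :* y :+ s :* z)) :* W :- (a :* y :- (c :* x :+ s :* w)) :* Z) :=
      (x :* (s :* Y :+ (c :* Z :+ d :* W)) :- y :* (s :* X :+ (a :* Z :+ b :* W))) :+
      (z :* (a :* Y :- (c :* X :+ s :* W)) :- w :* (d :* X :- (b :* Y :+ s :* Z)))) refl s a b c d x y z w X Y Z W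

  neg₅ : Vec A 5 → Vec A 5
  neg₅ = map (-1# *_)

  inv-neg : ∀ v x → inv (neg₅ v) x ≡ -ᵥ inv v x
  inv-neg (s ∷ a ∷ b ∷ c ∷ d ∷ []) (x ∷ y ∷ z ∷ w ∷ []) =
    pos s x a z b w ⹁ pos s y c z d w ⹁ neg d x b y s z ⹁ neg a y c x s w ⹁ refl
    where
    pos = solve 6 (λ s x a z b w → (:- #1 :* s) :* x :+ ((:- #1 :* a) :* z :+ (:- #1 :* b) :* w) := :- #1 :* (s :* x :+ (a :* z :+ b :* w))) refl
    neg = solve 6 (λ s x a z b w → (:- #1 :* s) :* x :- ((:- #1 :* a) :* z :+ (:- #1 :* b) :* w) := :- #1 :* (s :* x :- (a :* z :+ b :* w))) refl

  norm-neg : ∀ v → norm (neg₅ v) ≡ norm v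
  norm-neg (s ∷ a ∷ b ∷ c ∷ d ∷ []) =
    solve 5 (λ s a b c d → (:- #1 :* s) :* (:- #1 :* s) :+ ((:- #1 :* a) :* (:- #1 :* d) :- (:- #1 :* b) :* (:- #1 :* c))
      := s :* s :+ (a :* d :- b :* c)) refl s a b c d

  neg-neg : ∀ v → neg₅ (neg₅ v) ≡ v
  neg-neg (s ∷ a ∷ b ∷ c ∷ d ∷ []) = e s ⹁ e a ⹁ e b ⹁ e c ⹁ e d ⹁ refl
    where e = solve 1 (λ s → :- #1 :* (:- #1 :* s) := s) refl

  -ᵥ-involutive : ∀ v → -ᵥ (-ᵥ v) ≡ v
  -ᵥ-involutive (s ∷ a ∷ b ∷ c ∷ []) = e s ⹁ e a ⹁ e b ⹁ e c ⹁ refl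
    where e = solve 1 (λ s → :- #1 :* (:- #1 :* s) := s) refl

  form-alternating : ∀ x → form x x ≡ 0#
  form-alternating (x ∷ y ∷ z ∷ w ∷ []) = solve 4 (λ x y z w → (x :* y :- y :* x) :+ (z :* w :- w :* z) := #0) refl x y z w

  form-anti : ∀ x y → form y x ≡ - form x y
  form-anti (x ∷ y ∷ z ∷ w ∷ []) (X ∷ Y ∷ Z ∷ W ∷ []) =
    solve 8 (λ x y z w X Y Z W → (X :* y :- Y :* x) :+ (Z :* w :- W :* z) := :- ((x :* Y :- y :* X) :+ (z :* W :- w :* Z))) refl x y z w X Y Z W

  form-+ʳ : ∀ x y z → form x (y +ᵥ z) ≡ form x y + form x z
  form-+ʳ (x ∷ y ∷ z ∷ w ∷ []) (a ∷ b ∷ c ∷ d ∷ []) (a′ ∷ b′ ∷ c′ ∷ d′ ∷ []) =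
    solve 12 (λ x y z w a b c d a′ b′ c′ d′ → (x :* (b :+ b′) :- y :* (a :+ a′)) :+ (z :* (d :+ d′) :- w :* (c :+ c′)) :=
      ((x :* b :- y :* a) :+ (z :* d :- w :* c)) :+ ((x :* b′ :- y :* a′) :+ (z :* d′ :- w :* c′))) refl x y z w a b c d a′ b′ c′ d′

  form-*ʳ : ∀ x k y → form x (k *ᵥ y) ≡ k * form x y
  form-*ʳ (x ∷ y ∷ z ∷ w ∷ []) k (a ∷ b ∷ c ∷ d ∷ []) =
    solve 9 (λ x y z w k a b c d → (x :* (k :* b) :- y :* (k :* a)) :+ (z :* (k :* d) :- w :* (k :* c)) :=
      k :* ((x :* b :- y :* a) :+ (z :* d :- w :* c))) refl x y z w k a b c d

  form-+ˡ : ∀ x y z → form (x +ᵥ y) z ≡ form x z + form y z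
  form-+ˡ (a ∷ b ∷ c ∷ d ∷ []) (a′ ∷ b′ ∷ c′ ∷ d′ ∷ []) (x ∷ y ∷ z ∷ w ∷ []) =
    solve 12 (λ x y z w a b c d a′ b′ c′ d′ → ((a :+ a′) :* y :- (b :+ b′) :* x) :+ ((c :+ c′) :* w :- (d :+ d′) :* z) :=
      ((a :* y :- b :* x) :+ (c :* w :- d :* z)) :+ ((a′ :* y :- b′ :* x) :+ (c′ :* w :- d′ :* z))) refl x y z w a b c d a′ b′ c′ d′

  form-*ˡ : ∀ k x y → form (k *ᵥ x) y ≡ k * form x y
  form-*ˡ k (a ∷ b ∷ c ∷ d ∷ []) (x ∷ y ∷ z ∷ w ∷ []) =
    solve 9 (λ x y z w k a b c d → (k :* a :* y :- k :* b :* x) :+ (k :* c :* w :- k :* d :* z) :=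
      k :* ((a :* y :- b :* x) :+ (c :* w :- d :* z))) refl x y z w k a b c d

  form-nondegenerate : ∀ x → (∀ y → form x y ≡ 0#) → x ≡ 0ᵥ
  form-nondegenerate (x ∷ y ∷ z ∷ w ∷ []) h =
    trans (solve 4 (λ x y z w → x := (x :* #1 :- y :* #0) :+ (z :* #0 :- w :* #0)) refl x y z w) (h ε₂) ⹁
    by₁ -1# (h ε₁) (solve 4 (λ x y z w → y :- #0 := :- #1 :* (((x :* #0 :- y :* #1) :+ (z :* #0 :- w :* #0)) :- #0)) refl x y z w) ⹁
    trans (solve 4 (λ x y z w → z := (x :* #0 :- y :* #0) :+ (z :* #1 :- w :* #0)) refl x y z w) (h ε₄) ⹁
    by₁ -1# (h ε₃) (solve 4 (λ x y z w → w :- #0 := :- #1 :* (((x :* #0 :- y :* #0) :+ (z :* #0 :- w :* #1)) :- #0)) refl x y z w) ⹁ refl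

-- Hyperbolic lines

module Lines (F : Field) where
  open Field F renaming (Carrier to A)
  open Algebra F
  open ≡-Reasoning

  first second third fourth : V → A
  first  (x ∷ _ ∷ _ ∷ _ ∷ []) = x
  second (_ ∷ y ∷ _ ∷ _ ∷ []) = y
  third  (_ ∷ _ ∷ z ∷ _ ∷ []) = z
  fourth (_ ∷ _ ∷ _ ∷ w ∷ []) = w

  -- A unit vector v encodes the hyperbolic line of the vectors fixed by inv v; - v encodes its perp.
  Fixed : Vec A 5 → V → Set
  Fixed v x = inv v x ≡ x

  +ᵥ-comm : ∀ x y → x +ᵥ y ≡ y +ᵥ x
  +ᵥ-comm (_ ∷ _ ∷ _ ∷ _ ∷ []) (_ ∷ _ ∷ _ ∷ _ ∷ []) = +-comm _ _ ⹁ +-comm _ _ ⹁ +-comm _ _ ⹁ +-comm _ _ ⹁ refl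

  1*ᵥ : ∀ x → 1# *ᵥ x ≡ x
  1*ᵥ (_ ∷ _ ∷ _ ∷ _ ∷ []) = *-identityˡ _ ⹁ *-identityˡ _ ⹁ *-identityˡ _ ⹁ *-identityˡ _ ⹁ refl

  0*ᵥ : ∀ v → 0# *ᵥ v ≡ 0ᵥ
  0*ᵥ (_ ∷ _ ∷ _ ∷ _ ∷ []) = zeroˡ _ ⹁ zeroˡ _ ⹁ zeroˡ _ ⹁ zeroˡ _ ⹁ refl

  *ᵥ0 : ∀ c → c *ᵥ 0ᵥ ≡ 0ᵥ
  *ᵥ0 c = zeroʳ _ ⹁ zeroʳ _ ⹁ zeroʳ _ ⹁ zeroʳ _ ⹁ refl

  +ᵥ0 : ∀ v → v +ᵥ 0ᵥ ≡ v
  +ᵥ0 (_ ∷ _ ∷ _ ∷ _ ∷ []) = +-identityʳ _ ⹁ +-identityʳ _ ⹁ +-identityʳ _ ⹁ +-identityʳ _ ⹁ refl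

  distribᵥ : ∀ c d v → c *ᵥ v +ᵥ d *ᵥ v ≡ (c + d) *ᵥ v
  distribᵥ c d (_ ∷ _ ∷ _ ∷ _ ∷ []) = l _ ⹁ l _ ⹁ l _ ⹁ l _ ⹁ refl
    where l = λ x → solve 3 (λ c d x → c :* x :+ d :* x := (c :+ d) :* x) refl c d x

  assocᵥ : ∀ c d v → c *ᵥ (d *ᵥ v) ≡ (c * d) *ᵥ v
  assocᵥ c d (_ ∷ _ ∷ _ ∷ _ ∷ []) = l _ ⹁ l _ ⹁ l _ ⹁ l _ ⹁ refl
    where l = λ x → solve 3 (λ c d x → c :* (d :* x) := (c :* d) :* x) refl c d x

  cancelᵥ : ∀ {c u} → u ≢ 0ᵥ → c *ᵥ u ≡ 0ᵥ → c ≡ 0#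
  cancelᵥ {c} {u} u≢0 e with c ≟ 0#
  ... | yes c≡0 = c≡0
  ... | no c≢0 with i , i-inverse ← inverse c c≢0 =
    ⊥-elim (u≢0 (begin
      u                  ≡⟨ 1*ᵥ u ⟨
      1# *ᵥ u            ≡⟨ cong (_*ᵥ u) (trans (*-comm i c) i-inverse) ⟨
      (i * c) *ᵥ u       ≡⟨ assocᵥ i c u ⟨
      i *ᵥ (c *ᵥ u)      ≡⟨ cong (i *ᵥ_) e ⟩
      i *ᵥ 0ᵥ            ≡⟨ *ᵥ0 i ⟩
      0ᵥ                 ∎))

  _≟0ᵥ : ∀ x → Dec (x ≡ 0ᵥ)
  (x ∷ y ∷ z ∷ w ∷ []) ≟0ᵥ with x ≟ 0# | y ≟ 0# | z ≟ 0# | w ≟ 0#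
  ... | yes p | yes q | yes r | yes s = yes (p ⹁ q ⹁ r ⹁ s ⹁ refl)
  ... | no ¬p | _     | _     | _     = no (¬p ∘ cong first)
  ... | yes _ | no ¬p | _     | _     = no (¬p ∘ cong second)
  ... | yes _ | yes _ | no ¬p | _     = no (¬p ∘ cong third)
  ... | yes _ | yes _ | yes _ | no ¬p = no (¬p ∘ cong fourth)

  inv-involutive : ∀ v → norm v ≡ 1# → ∀ x → inv v (inv v x) ≡ x
  inv-involutive v n x = trans (inv-inv v x) (trans (cong (_*ᵥ x) n) (1*ᵥ x))

  fixedPart : ∀ v → norm v ≡ 1# → ∀ x → Fixed v (x +ᵥ inv v x)
  fixedPart v n x = begin
    inv v (x +ᵥ inv v x)          ≡⟨ inv-+ v x (inv v x) ⟩
    inv v x +ᵥ inv v (inv v x)    ≡⟨ cong (inv v x +ᵥ_) (inv-involutive v n x) ⟩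
    inv v x +ᵥ x                  ≡⟨ +ᵥ-comm (inv v x) x ⟩
    x +ᵥ inv v x                  ∎

  Fixed-+ : ∀ v {x y} → Fixed v x → Fixed v y → Fixed v (x +ᵥ y)
  Fixed-+ v {x} {y} p q = trans (inv-+ v x y) (cong₂ _+ᵥ_ p q)

  Fixed-* : ∀ v k {x} → Fixed v x → Fixed v (k *ᵥ x)
  Fixed-* v k {x} p = trans (inv-* v k x) (cong (k *ᵥ_) p)

  Fixed-0 : ∀ v → Fixed v 0ᵥ
  Fixed-0 v = subst (Fixed v) (zeroˡ _ ⹁ zeroˡ _ ⹁ zeroˡ _ ⹁ zeroˡ _ ⹁ refl) (trans (inv-* v 0# 0ᵥ) (e (inv v 0ᵥ)))
    where
    e : ∀ x → 0# *ᵥ x ≡ 0# *ᵥ 0ᵥ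
    e (_ ∷ _ ∷ _ ∷ _ ∷ []) = z ⹁ z ⹁ z ⹁ z ⹁ refl
      where
      z : ∀ {x} → 0# * x ≡ 0# * 0#
      z = trans (zeroˡ _) (sym (zeroˡ _))

  record HyperbolicBasis (v : Vec A 5) : Set where
    field
      x y      : V
      fixed-x  : Fixed v x
      fixed-y  : Fixed v y
      form≢0   : form x y ≢ 0#
      spanning : ∀ {z} → Fixed v z → ∃₂ λ α β → α *ᵥ x +ᵥ β *ᵥ y ≡ z

  first₅ : Vec A 5 → A
  first₅ (s ∷ _) = s

  -- The two vectors are ε + `inv v` ε for ε = `ε₁`, `ε₂`, that is, doubled projections onto the
  -- line. Their form equals 2(1 + s), so they fail to be a basis only if s = -1.
  basis⁺ : ∀ v → norm v ≡ 1# → 1# + first₅ v ≢ 0# → HyperbolicBasis v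
  basis⁺ v@(s ∷ a ∷ b ∷ c ∷ d ∷ []) n 1+s≢0 = record
    { x = (1# + s) ∷ 0# ∷ d ∷ - c ∷ []
    ; y = 0# ∷ (1# + s) ∷ - b ∷ a ∷ []
    ; fixed-x =
        by₁ 1# n (solve 5 (λ s a b c d → s :* (#1 :+ s) :+ (a :* d :+ b :* (:- c)) :- (#1 :+ s) := #1 :* (s :* s :+ (a :* d :- b :* c) :- #1)) refl s a b c d) ⹁
        solve 5 (λ s a b c d → s :* #0 :+ (c :* d :+ d :* (:- c)) := #0) refl s a b c d ⹁
        solve 5 (λ s a b c d → d :* (#1 :+ s) :- (b :* #0 :+ s :* d) := d) refl s a b c d ⹁
        solve 5 (λ s a b c d → a :* #0 :- (c :* (#1 :+ s) :+ s :* (:- c)) := :- c) refl s a b c d ⹁ refl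
    ; fixed-y =
        solve 5 (λ s a b c d → s :* #0 :+ (a :* (:- b) :+ b :* a) := #0) refl s a b c d ⹁
        by₁ 1# n (solve 5 (λ s a b c d → s :* (#1 :+ s) :+ (c :* (:- b) :+ d :* a) :- (#1 :+ s) := #1 :* (s :* s :+ (a :* d :- b :* c) :- #1)) refl s a b c d) ⹁
        solve 5 (λ s a b c d → d :* #0 :- (b :* (#1 :+ s) :+ s :* (:- b)) := :- b) refl s a b c d ⹁
        solve 5 (λ s a b c d → a :* (#1 :+ s) :- (c :* #0 :+ s :* a) := a) refl s a b c d ⹁ refl
    ; form≢0 = λ f≡0 → *≢0 2≢0 1+s≢0 (by₂ 1# -1# f≡0 n (solve 5 (λ s a b c d →
        (#1 :+ #1) :* (#1 :+ s) :- #0 :=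
        #1 :* (((#1 :+ s) :* (#1 :+ s) :- #0 :* #0 :+ (d :* a :- (:- c) :* (:- b))) :- #0)
          :+ (:- #1) :* (s :* s :+ (a :* d :- b :* c) :- #1)) refl s a b c d))
    ; spanning = span }
    where
    i = proj₁ (inverse _ 1+s≢0)
    i-inverse = proj₂ (inverse _ 1+s≢0)
    span : ∀ {z} → Fixed v z → ∃₂ λ α β → α *ᵥ ((1# + s) ∷ 0# ∷ d ∷ - c ∷ []) +ᵥ β *ᵥ (0# ∷ (1# + s) ∷ - b ∷ a ∷ []) ≡ z
    span {x ∷ y ∷ z ∷ w ∷ []} fixed = x * i , y * i ,
      by₁ x i-inverse (solve 4 (λ s x y i → x :* i :* (#1 :+ s) :+ y :* i :* #0 :- x := x :* ((#1 :+ s) :* i :- #1)) refl s x y i) ⹁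
      by₁ y i-inverse (solve 4 (λ s x y i → x :* i :* #0 :+ y :* i :* (#1 :+ s) :- y := y :* ((#1 :+ s) :* i :- #1)) refl s x y i) ⹁
      by₂ i z (cong third fixed) i-inverse (solve 7 (λ s b d x y z i → x :* i :* d :+ y :* i :* (:- b) :- z :=
        i :* (d :* x :- (b :* y :+ s :* z) :- z) :+ z :* ((#1 :+ s) :* i :- #1)) refl s b d x y z i) ⹁
      by₂ i w (cong fourth fixed) i-inverse (solve 7 (λ s a c x y w i → x :* i :* (:- c) :+ y :* i :* a :- w :=
        i :* (a :* y :- (c :* x :+ s :* w) :- w) :+ w :* ((#1 :+ s) :* i :- #1)) refl s a c x y w i) ⹁ refl

  -- The doubled projections of `ε₃` and `ε₄` have form 2(1 - s), which is 4 in the remaining case s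
  -- = -1.
  basis⁻ : ∀ v → norm v ≡ 1# → 1# + first₅ v ≡ 0# → HyperbolicBasis v
  basis⁻ v@(s ∷ a ∷ b ∷ c ∷ d ∷ []) n 1+s≡0 = record
    { x = a ∷ c ∷ (1# - s) ∷ 0# ∷ []
    ; y = b ∷ d ∷ 0# ∷ (1# - s) ∷ []
    ; fixed-x =
        solve 5 (λ s a b c d → s :* a :+ (a :* (#1 :- s) :+ b :* #0) := a) refl s a b c d ⹁
        solve 5 (λ s a b c d → s :* c :+ (c :* (#1 :- s) :+ d :* #0) := c) refl s a b c d ⹁
        by₁ 1# n (solve 5 (λ s a b c d → d :* a :- (b :* c :+ s :* (#1 :- s)) :- (#1 :- s) := #1 :* (s :* s :+ (a :* d :- b :* c) :- #1)) refl s a b c d) ⹁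
        solve 5 (λ s a b c d → a :* c :- (c :* a :+ s :* #0) := #0) refl s a b c d ⹁ refl
    ; fixed-y =
        solve 5 (λ s a b c d → s :* b :+ (a :* #0 :+ b :* (#1 :- s)) := b) refl s a b c d ⹁
        solve 5 (λ s a b c d → s :* d :+ (c :* #0 :+ d :* (#1 :- s)) := d) refl s a b c d ⹁
        solve 5 (λ s a b c d → d :* b :- (b :* d :+ s :* #0) := #0) refl s a b c d ⹁
        by₁ 1# n (solve 5 (λ s a b c d → a :* d :- (c :* b :+ s :* (#1 :- s)) :- (#1 :- s) := #1 :* (s :* s :+ (a :* d :- b :* c) :- #1)) refl s a b c d) ⹁ refl
    ; form≢0 = λ f≡0 → *≢0 2≢0 1-s≢0 (by₂ 1# -1# f≡0 n (solve 5 (λ s a b c d →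
        (#1 :+ #1) :* (#1 :- s) :- #0 :=
        #1 :* ((a :* d :- c :* b :+ ((#1 :- s) :* (#1 :- s) :- #0 :* #0)) :- #0)
          :+ (:- #1) :* (s :* s :+ (a :* d :- b :* c) :- #1)) refl s a b c d))
    ; spanning = span }
    where
    1-s≢0 : 1# - s ≢ 0#
    1-s≢0 e = 2≢0 (by₂ 1# 1# 1+s≡0 e (solve 1 (λ s → (#1 :+ #1) :- #0 := #1 :* ((#1 :+ s) :- #0) :+ #1 :* ((#1 :- s) :- #0)) refl s))
    i = proj₁ (inverse _ 1-s≢0)
    i-inverse = proj₂ (inverse _ 1-s≢0)
    span : ∀ {z} → Fixed v z → ∃₂ λ α β → α *ᵥ (a ∷ c ∷ (1# - s) ∷ 0# ∷ []) +ᵥ β *ᵥ (b ∷ d ∷ 0# ∷ (1# - s) ∷ []) ≡ z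
    span {x ∷ y ∷ z ∷ w ∷ []} fixed = z * i , w * i ,
      by₂ i x (cong first fixed) i-inverse (solve 7 (λ s a b x z w i → z :* i :* a :+ w :* i :* b :- x :=
        i :* (s :* x :+ (a :* z :+ b :* w) :- x) :+ x :* ((#1 :- s) :* i :- #1)) refl s a b x z w i) ⹁
      by₂ i y (cong second fixed) i-inverse (solve 7 (λ s c d y z w i → z :* i :* c :+ w :* i :* d :- y :=
        i :* (s :* y :+ (c :* z :+ d :* w) :- y) :+ y :* ((#1 :- s) :* i :- #1)) refl s c d y z w i) ⹁
      by₁ z i-inverse (solve 4 (λ s x y i → x :* i :* (#1 :- s) :+ y :* i :* #0 :- x := x :* ((#1 :- s) :* i :- #1)) refl s z w i) ⹁
      by₁ w i-inverse (solve 4 (λ s x y i → x :* i :* #0 :+ y :* i :* (#1 :- s) :- y := y :* ((#1 :- s) :* i :- #1)) refl s z w i) ⹁ refl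

  hyperbolicBasis : ∀ v → norm v ≡ 1# → HyperbolicBasis v
  hyperbolicBasis v n with (1# + first₅ v) ≟ 0#
  ... | yes 1+s≡0 = basis⁻ v n 1+s≡0
  ... | no  1+s≢0 = basis⁺ v n 1+s≢0

  -- The involution 2π − 1, where π is the projection onto ⟨x, y⟩ along its perp.
  lineThrough : ∀ x y → form x y ≢ 0# → ∃ λ v → norm v ≡ 1# × Fixed v x × Fixed v y
  lineThrough (x ∷ y ∷ z ∷ w ∷ []) (X ∷ Y ∷ Z ∷ W ∷ []) f≢0 with i , i-inverse ← inverse _ f≢0 =
    s ∷ a ∷ b ∷ c ∷ d ∷ [] ,
    -- The Plücker relation makes ad - bc equal to k² p12 p34, and s = k p12 - 1. Hence `norm` - 1 =
    -- k p12 (k (p12 + p34) - 2), which vanishes because k = 2i and p12 + p34 is the form of the two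
    -- vectors.
    by₁ ((1# + 1# + (1# + 1#)) * (i * (x * Y - y * X))) i-inverse (solve 9 (λ x y z w X Y Z W i →
       let k = (#1 :+ #1) :* i ; s = k :* (x :* Y :- y :* X) :- #1 in
       s :* s :+ ((k :* (x :* W :- w :* X)) :* (k :* (z :* Y :- y :* Z)) :- (k :* (z :* X :- x :* Z)) :* (k :* (y :* W :- w :* Y))) :- #1 :=
       ((#1 :+ #1) :+ (#1 :+ #1)) :* (i :* (x :* Y :- y :* X)) :* (((x :* Y :- y :* X) :+ (z :* W :- w :* Z)) :* i :- #1)) refl x y z w X Y Z W i) ,
    (by₁ ((1# + 1#) * x) i-inverse (solve 9 (λ x y z w X Y Z W i →
       let k = (#1 :+ #1) :* i ; s = k :* (x :* Y :- y :* X) :- #1 ; a = k :* (x :* W :- w :* X) ; b = k :* (z :* X :- x :* Z) in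
       s :* x :+ (a :* z :+ b :* w) :- x := (#1 :+ #1) :* x :* (((x :* Y :- y :* X) :+ (z :* W :- w :* Z)) :* i :- #1)) refl x y z w X Y Z W i) ⹁
     by₁ ((1# + 1#) * y) i-inverse (solve 9 (λ x y z w X Y Z W i →
       let k = (#1 :+ #1) :* i ; s = k :* (x :* Y :- y :* X) :- #1 ; c = k :* (y :* W :- w :* Y) ; d = k :* (z :* Y :- y :* Z) in
       s :* y :+ (c :* z :+ d :* w) :- y := (#1 :+ #1) :* y :* (((x :* Y :- y :* X) :+ (z :* W :- w :* Z)) :* i :- #1)) refl x y z w X Y Z W i) ⹁
     solve 9 (λ x y z w X Y Z W i →
       let k = (#1 :+ #1) :* i ; s = k :* (x :* Y :- y :* X) :- #1 ; b = k :* (z :* X :- x :* Z) ; d = k :* (z :* Y :- y :* Z) in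
       d :* x :- (b :* y :+ s :* z) := z) refl x y z w X Y Z W i ⹁
     solve 9 (λ x y z w X Y Z W i →
       let k = (#1 :+ #1) :* i ; s = k :* (x :* Y :- y :* X) :- #1 ; a = k :* (x :* W :- w :* X) ; c = k :* (y :* W :- w :* Y) in
       a :* y :- (c :* x :+ s :* w) := w) refl x y z w X Y Z W i ⹁ refl) ,
    (by₁ ((1# + 1#) * X) i-inverse (solve 9 (λ x y z w X Y Z W i →
       let k = (#1 :+ #1) :* i ; s = k :* (x :* Y :- y :* X) :- #1 ; a = k :* (x :* W :- w :* X) ; b = k :* (z :* X :- x :* Z) in
       s :* X :+ (a :* Z :+ b :* W) :- X := (#1 :+ #1) :* X :* (((x :* Y :- y :* X) :+ (z :* W :- w :* Z)) :* i :- #1)) refl x y z w X Y Z W i) ⹁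
     by₁ ((1# + 1#) * Y) i-inverse (solve 9 (λ x y z w X Y Z W i →
       let k = (#1 :+ #1) :* i ; s = k :* (x :* Y :- y :* X) :- #1 ; c = k :* (y :* W :- w :* Y) ; d = k :* (z :* Y :- y :* Z) in
       s :* Y :+ (c :* Z :+ d :* W) :- Y := (#1 :+ #1) :* Y :* (((x :* Y :- y :* X) :+ (z :* W :- w :* Z)) :* i :- #1)) refl x y z w X Y Z W i) ⹁
     solve 9 (λ x y z w X Y Z W i →
       let k = (#1 :+ #1) :* i ; s = k :* (x :* Y :- y :* X) :- #1 ; b = k :* (z :* X :- x :* Z) ; d = k :* (z :* Y :- y :* Z) in
       d :* X :- (b :* Y :+ s :* Z) := Z) refl x y z w X Y Z W i ⹁
     solve 9 (λ x y z w X Y Z W i →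
       let k = (#1 :+ #1) :* i ; s = k :* (x :* Y :- y :* X) :- #1 ; a = k :* (x :* W :- w :* X) ; c = k :* (y :* W :- w :* Y) in
       a :* Y :- (c :* X :+ s :* W) := W) refl x y z w X Y Z W i ⹁ refl)
    where
    k = (1# + 1#) * i
    s = k * (x * Y - y * X) - 1#
    a = k * (x * W - w * X)
    b = k * (z * X - x * Z)
    c = k * (y * W - w * Y)
    d = k * (z * Y - y * Z)

  -- Being fixed gives four equations; the first, third and fourth are solved here for s, d and c.
  -- The second one and norm 1 then hold for every a and b, so the parametrization is exact: the q²
  -- pairs (a, b) match the q² lines through a point that are not totally isotropic.
  fixed⇒through : ∀ v y z w → Fixed v (1# ∷ y ∷ z ∷ w ∷ []) → ∃₂ λ a b → v ≡ through 1# y z w a b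
  fixed⇒through v@(s ∷ a ∷ b ∷ c ∷ d ∷ []) y z w fixed = a , b ,
    s≡ ⹁ refl ⹁ refl ⹁
    subst (λ s → c ≡ a * y - w * (1# + s)) s≡ (by₁ -1# (cong fourth fixed) (solve 5 (λ s a c y w →
      c :- (a :* y :- w :* (#1 :+ s)) := (:- #1) :* ((a :* y :- (c :* #1 :+ s :* w)) :- w)) refl s a c y w)) ⹁
    subst (λ s → d ≡ b * y + z * (1# + s)) s≡ (by₁ 1# (cong third fixed) (solve 5 (λ s b d y z →
      d :- (b :* y :+ z :* (#1 :+ s)) := #1 :* ((d :* #1 :- (b :* y :+ s :* z)) :- z)) refl s b d y z)) ⹁ refl
    where
    s≡ : s ≡ 1# - (a * z + b * w)
    s≡ = by₁ 1# (cong first fixed) (solve 5 (λ s a b z w → s :- (#1 :- (a :* z :+ b :* w)) := #1 :* ((s :* #1 :+ (a :* z :+ b :* w)) :- #1)) refl s a b z w)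

-- Symplectic polarities in coordinates

module Linear (F : Field) where
  open Field F renaming (Carrier to A)
  open Algebra F
  open Lines F
  open ≡-Reasoning

  module _ {B : Set} (_⊞_ : B → B → B) (_⊡_ : A → B → B) where
    record IsLinear (f : V → B) : Set where
      field
        additive    : ∀ u v → f (u +ᵥ v) ≡ f u ⊞ f v
        homogeneous : ∀ c v → f (c *ᵥ v) ≡ c ⊡ f v

    record AgreeOnBasis (f g : V → B) : Set where
      field
        at₁ : f ε₁ ≡ g ε₁
        at₂ : f ε₂ ≡ g ε₂
        at₃ : f ε₃ ≡ g ε₃
        at₄ : f ε₄ ≡ g ε₄

    -- This bridges the checker and the proofs: matrices are tested on four basis vectors and used
    -- on all vectors. The codomain is left open so that it covers linear maps as well as
    -- functionals.
    agree : ∀ {f g} → IsLinear f → IsLinear g → AgreeOnBasis f g → ∀ z → f z ≡ g z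
    agree {f} {g} lf lg e z@(z₁ ∷ z₂ ∷ z₃ ∷ z₄ ∷ []) = begin
      f z         ≡⟨ cong f (comb-ε z) ⟨
      f (comb ε₁ ε₂ ε₃ ε₄ z) ≡⟨ expand lf ⟩
      ((z₁ ⊡ f ε₁) ⊞ (z₂ ⊡ f ε₂)) ⊞ ((z₃ ⊡ f ε₃) ⊞ (z₄ ⊡ f ε₄))
        ≡⟨ cong₂ _⊞_ (cong₂ _⊞_ (cong (z₁ ⊡_) at₁) (cong (z₂ ⊡_) at₂)) (cong₂ _⊞_ (cong (z₃ ⊡_) at₃) (cong (z₄ ⊡_) at₄)) ⟩
      ((z₁ ⊡ g ε₁) ⊞ (z₂ ⊡ g ε₂)) ⊞ ((z₃ ⊡ g ε₃) ⊞ (z₄ ⊡ g ε₄)) ≡⟨ expand lg ⟨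
      g (comb ε₁ ε₂ ε₃ ε₄ z) ≡⟨ cong g (comb-ε z) ⟩
      g z         ∎
      where
      open AgreeOnBasis e
      expand : ∀ {f} → IsLinear f → f (comb ε₁ ε₂ ε₃ ε₄ z) ≡ ((z₁ ⊡ f ε₁) ⊞ (z₂ ⊡ f ε₂)) ⊞ ((z₃ ⊡ f ε₃) ⊞ (z₄ ⊡ f ε₄))
      expand {f} l = trans (additive _ _) (cong₂ _⊞_
          (trans (additive _ _) (cong₂ _⊞_ (homogeneous _ _) (homogeneous _ _)))
          (trans (additive _ _) (cong₂ _⊞_ (homogeneous _ _) (homogeneous _ _))))
        where open IsLinear l

  IsLinearMap : (V → V) → Set
  IsLinearMap = IsLinear _+ᵥ_ _*ᵥ_

  id-linear : IsLinearMap (λ z → z)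
  id-linear = record { additive = λ _ _ → refl ; homogeneous = λ _ _ → refl }

  ∘-linear : ∀ {f g} → IsLinearMap f → IsLinearMap g → IsLinearMap (f ∘ g)
  ∘-linear {f} lf lg = record
    { additive    = λ u v → trans (cong f (additive lg u v)) (additive lf _ _)
    ; homogeneous = λ c v → trans (cong f (homogeneous lg c v)) (homogeneous lf c _) }
    where open IsLinear

  inv-linear : ∀ v → IsLinearMap (inv v)
  inv-linear v = record { additive = inv-+ v ; homogeneous = inv-* v }

  comb-linear : ∀ e f g h → IsLinearMap (comb e f g h)
  comb-linear e f g h = record { additive = comb-+ e f g h ; homogeneous = comb-* e f g h }

  IsFunctional : (V → A) → Set
  IsFunctional = IsLinear _+_ _*_

  formʳ-linear : ∀ {f} x → IsLinearMap f → IsFunctional (λ y → form x (f y))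
  formʳ-linear x lf = record
    { additive    = λ u v → trans (cong (form x) (additive u v)) (form-+ʳ x _ _)
    ; homogeneous = λ c v → trans (cong (form x) (homogeneous c v)) (form-*ʳ x c _) }
    where open IsLinear lf

  formˡ-linear : ∀ {f} y → IsLinearMap f → IsFunctional (λ x → form (f x) y)
  formˡ-linear {f} y lf = record
    { additive    = λ u v → trans (cong (λ x → form x y) (additive u v)) (form-+ˡ (f u) (f v) y)
    ; homogeneous = λ c v → trans (cong (λ x → form x y) (homogeneous c v)) (form-*ˡ c (f v) y) }
    where open IsLinear lf

  scaled-linear : ∀ {f} μ → IsFunctional f → IsFunctional (λ z → μ * f z)
  scaled-linear μ lf = record
    { additive    = λ u v → trans (cong (μ *_) (additive u v)) (solve 3 (λ μ x y → μ :* (x :+ y) := μ :* x :+ μ :* y) refl μ _ _)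
    ; homogeneous = λ c v → trans (cong (μ *_) (homogeneous c v)) (solve 3 (λ μ c x → μ :* (c :* x) := c :* (μ :* x)) refl μ c _) }
    where open IsLinear lf

module Plane (F : Field) where
  open Field F renaming (Carrier to A)
  open Algebra F
  open Lines F

  det : A → A → A → A → A
  det a b a′ b′ = a * b′ - b * a′

  NonZeroPair : A → A → Set
  NonZeroPair a b = a ≢ 0# ⊎ b ≢ 0#

  nonZeroPair? : ∀ a b → (a ≡ 0# × b ≡ 0#) ⊎ NonZeroPair a b
  nonZeroPair? a b with a ≟ 0# | b ≟ 0#
  ... | no a≢0 | _        = inj₂ (inj₁ a≢0)
  ... | yes _  | no b≢0   = inj₂ (inj₂ b≢0)
  ... | yes a≡0 | yes b≡0 = inj₁ (a≡0 , b≡0)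

  parallel : ∀ {a b a′ b′} → NonZeroPair a b → det a b a′ b′ ≡ 0# → ∃ λ t → t * a ≡ a′ × t * b ≡ b′
  parallel {a} {b} {a′} {b′} (inj₁ a≢0) e with i , i-inverse ← inverse a a≢0 = a′ * i ,
    by₁ a′ i-inverse (solve 3 (λ a i a′ → a′ :* i :* a :- a′ := a′ :* (a :* i :- #1)) refl a i a′) ,
    by₂ (- i) b′ e i-inverse (solve 5 (λ a b a′ b′ i → a′ :* i :* b :- b′ := (:- i) :* ((a :* b′ :- b :* a′) :- #0) :+ b′ :* (a :* i :- #1)) refl a b a′ b′ i)
  parallel {a} {b} {a′} {b′} (inj₂ b≢0) e with i , i-inverse ← inverse b b≢0 = b′ * i ,
    by₂ i a′ e i-inverse (solve 5 (λ a b a′ b′ i → b′ :* i :* a :- a′ := i :* ((a :* b′ :- b :* a′) :- #0) :+ a′ :* (b :* i :- #1)) refl a b a′ b′ i) ,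
    by₁ b′ i-inverse (solve 3 (λ b i b′ → b′ :* i :* b :- b′ := b′ :* (b :* i :- #1)) refl b i b′)

  complement : ∀ {a b} t → NonZeroPair a b → ∃₂ λ a′ b′ → det a b a′ b′ ≡ t
  complement {a} {b} t (inj₁ a≢0) with i , i-inverse ← inverse a a≢0 = 0# , i * t ,
    by₁ t i-inverse (solve 4 (λ a b i t → a :* (i :* t) :- b :* #0 :- t := t :* (a :* i :- #1)) refl a b i t)
  complement {a} {b} t (inj₂ b≢0) with i , i-inverse ← inverse b b≢0 = - (i * t) , 0# ,
    by₁ t i-inverse (solve 4 (λ a b i t → a :* #0 :- b :* (:- (i :* t)) :- t := t :* (b :* i :- #1)) refl a b i t)

-- For x and y in the two hyperbolic planes of the standard basis, (x + y)^⊥ is spanned by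
-- x, y and one further vector; (x′ + y)^⊥ contains one of its possible choices, which
-- propagates the form from one pair (x, y) to all.
module StandardForm (F : Field) where
  open Field F renaming (Carrier to A)
  open Algebra F
  open Lines F
  open Plane F

  record OrthogonalityLike (R : V → V → Set) : Set where
    field
      R?        : ∀ u v → Dec (R u v)
      +-closed  : ∀ {u v w} → R u v → R u w → R u (v +ᵥ w)
      *-closed  : ∀ c {u v} → R u v → R u (c *ᵥ v)
      R-sym     : ∀ {u v} → R u v → R v u
      R-refl    : ∀ u → R u u
      R-zero    : ∀ u → R u 0ᵥ

  module _ {R : V → V → Set} (isR : OrthogonalityLike R)
           (R₁₃ : R ε₁ ε₃) (R₁₄ : R ε₁ ε₄) (R₂₃ : R ε₂ ε₃) (R₂₄ : R ε₂ ε₄)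
           (¬R₁₂ : ¬ R ε₁ ε₂) (¬R₃₄ : ¬ R ε₃ ε₄)
           -- The preceding hypotheses split the space into two orthogonal hyperbolic planes but
           -- leave the ratio of the forms on them undetermined. This single relation forces the
           -- ratio to be 1.
           (R-cross : R (ε₁ +ᵥ ε₃) (ε₂ +ᵥ -ᵥ ε₄)) where
    open OrthogonalityLike isR

    left right : A → A → V
    left  a b = a ∷ b ∷ 0# ∷ 0# ∷ []
    right c d = 0# ∷ 0# ∷ c ∷ d ∷ []

    left-sum : ∀ a b → a *ᵥ ε₁ +ᵥ b *ᵥ ε₂ ≡ left a b
    left-sum a b =
      solve 2 (λ a b → a :* #1 :+ b :* #0 := a) refl a b ⹁ solve 2 (λ a b → a :* #0 :+ b :* #1 := b) refl a b ⹁
      solve 2 (λ a b → a :* #0 :+ b :* #0 := #0) refl a b ⹁ solve 2 (λ a b → a :* #0 :+ b :* #0 := #0) refl a b ⹁ refl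

    right-sum : ∀ a b → a *ᵥ ε₃ +ᵥ b *ᵥ ε₄ ≡ right a b
    right-sum a b =
      solve 2 (λ a b → a :* #0 :+ b :* #0 := #0) refl a b ⹁ solve 2 (λ a b → a :* #0 :+ b :* #0 := #0) refl a b ⹁
      solve 2 (λ a b → a :* #1 :+ b :* #0 := a) refl a b ⹁ solve 2 (λ a b → a :* #0 :+ b :* #1 := b) refl a b ⹁ refl

    split : ∀ a b c d → left a b +ᵥ right c d ≡ a ∷ b ∷ c ∷ d ∷ []
    split a b c d = +-identityʳ a ⹁ +-identityʳ b ⹁ +-identityˡ c ⹁ +-identityˡ d ⹁ refl

    Rˡ-+ : ∀ {u v w} → R u w → R v w → R (u +ᵥ v) w
    Rˡ-+ p q = R-sym (+-closed (R-sym p) (R-sym q))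

    Rˡ-* : ∀ c {u v} → R u v → R (c *ᵥ u) v
    Rˡ-* c p = R-sym (*-closed c (R-sym p))

    left-right : ∀ a b c d → R (left a b) (right c d)
    left-right a b c d = subst₂ R (left-sum a b) (right-sum c d)
      (Rˡ-+ (Rˡ-* a (+-closed (*-closed c R₁₃) (*-closed d R₁₄))) (Rˡ-* b (+-closed (*-closed c R₂₃) (*-closed d R₂₄))))

    left-left : ∀ a b a′ b′ → det a b a′ b′ ≡ 0# → R (left a b) (left a′ b′)
    left-left a b a′ b′ e with nonZeroPair? a b
    ... | inj₁ (refl , refl) = R-sym (R-zero _)
    ... | inj₂ nz with t , refl , refl ← parallel nz e =
      subst (R (left a b)) (refl ⹁ refl ⹁ zeroʳ t ⹁ zeroʳ t ⹁ refl) (*-closed t (R-refl (left a b)))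

    right-right : ∀ a b a′ b′ → det a b a′ b′ ≡ 0# → R (right a b) (right a′ b′)
    right-right a b a′ b′ e with nonZeroPair? a b
    ... | inj₁ (refl , refl) = R-sym (R-zero _)
    ... | inj₂ nz with t , refl , refl ← parallel nz e =
      subst (R (right a b)) (zeroʳ t ⹁ zeroʳ t ⹁ refl ⹁ refl ⹁ refl) (*-closed t (R-refl (right a b)))

    Standard : A → A → A → A → Set
    Standard a b c d = ∀ a′ b′ c′ d′ → det a b a′ b′ + det c d c′ d′ ≡ 0# → R (a ∷ b ∷ c ∷ d ∷ []) (a′ ∷ b′ ∷ c′ ∷ d′ ∷ [])

    any-left : ∀ a b c d a′ b′ → det a b a′ b′ ≡ 0# → R (a ∷ b ∷ c ∷ d ∷ []) (left a′ b′)
    any-left a b c d a′ b′ e = subst (λ u → R u (left a′ b′)) (split a b c d) (Rˡ-+ (left-left a b a′ b′ e) (R-sym (left-right a′ b′ c d)))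

    any-right : ∀ a b c d c′ d′ → det c d c′ d′ ≡ 0# → R (a ∷ b ∷ c ∷ d ∷ []) (right c′ d′)
    any-right a b c d c′ d′ e = subst (λ u → R u (right c′ d′)) (split a b c d) (Rˡ-+ (left-right a b c′ d′) (right-right c d c′ d′ e))

    det-self : ∀ a b → det a b a b ≡ 0#
    det-self a b = solve 2 (λ a b → a :* b :- b :* a := #0) refl a b

    det-remainder : ∀ a b a′ b′ a₀ b₀ t → det a b (a′ + - (t * a₀)) (b′ + - (t * b₀)) ≡ det a b a′ b′ - t * det a b a₀ b₀
    det-remainder a b a′ b′ a₀ b₀ t = solve 7 (λ a b a′ b′ a₀ b₀ t → a :* (b′ :- t :* b₀) :- b :* (a′ :- t :* a₀) := (a :* b′ :- b :* a′) :- t :* (a :* b₀ :- b :* a₀)) refl a b a′ b′ a₀ b₀ t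

    -- (a,b,c,d)^⊥ is spanned by (a,b,0,0), (0,0,c,d) and any further vector in it.
    standardFrom : ∀ {a b c d a₀ b₀ c₀ d₀} →
                  det a b a₀ b₀ ≢ 0# → det a b a₀ b₀ + det c d c₀ d₀ ≡ 0# →
                  R (a ∷ b ∷ c ∷ d ∷ []) (a₀ ∷ b₀ ∷ c₀ ∷ d₀ ∷ []) → Standard a b c d
    standardFrom {a} {b} {c} {d} {a₀} {b₀} {c₀} {d₀} det≢0 sum≡0 r a′ b′ c′ d′ e =
      subst (R _) vec≡ (+-closed (*-closed t r) (+-closed (any-left a b c d _ _ left-det) (any-right a b c d _ _ right-det)))
      where
      i = proj₁ (inverse _ det≢0)
      i-inverse = proj₂ (inverse _ det≢0)
      t = det a b a′ b′ * i
      left-det : det a b (a′ + - (t * a₀)) (b′ + - (t * b₀)) ≡ 0#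
      left-det = trans (det-remainder a b a′ b′ a₀ b₀ t)
        (by₁ (- det a b a′ b′) i-inverse (solve 3 (λ D D₀ i → D :- D :* i :* D₀ :- #0 := (:- D) :* (D₀ :* i :- #1)) refl (det a b a′ b′) (det a b a₀ b₀) i))
      right-det : det c d (c′ + - (t * c₀)) (d′ + - (t * d₀)) ≡ 0#
      right-det = trans (det-remainder c d c′ d′ c₀ d₀ t)
        (by₃ 1# (- t) (det a b a′ b′) e sum≡0 i-inverse (solve 5 (λ D D₀ E E₀ i → E :- D :* i :* E₀ :- #0 :=
          #1 :* (D :+ E :- #0) :+ (:- (D :* i)) :* (D₀ :+ E₀ :- #0) :+ D :* (D₀ :* i :- #1)) refl
          (det a b a′ b′) (det a b a₀ b₀) (det c d c′ d′) (det c d c₀ d₀) i))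
      vec≡ : t *ᵥ (a₀ ∷ b₀ ∷ c₀ ∷ d₀ ∷ []) +ᵥ (left (a′ + - (t * a₀)) (b′ + - (t * b₀)) +ᵥ right (c′ + - (t * c₀)) (d′ + - (t * d₀))) ≡ a′ ∷ b′ ∷ c′ ∷ d′ ∷ []
      vec≡ = l a′ a₀ ⹁ l b′ b₀ ⹁ m c′ c₀ ⹁ m d′ d₀ ⹁ refl
        where
        l = λ x x₀ → solve 3 (λ t x x₀ → t :* x₀ :+ ((x :- t :* x₀) :+ #0) := x) refl t x x₀
        m = λ x x₀ → solve 3 (λ t x x₀ → t :* x₀ :+ (#0 :+ (x :- t :* x₀)) := x) refl t x x₀

    -- Write x = (a, b), x′ = (a₂, b₂), y = (c, d) and choose y₀ with det(y, y₀) = det(x, x′). Then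
    -- (x - x′) + y₀ has form zero with both x + y and x′ + y. It is related to x + y by hypothesis
    -- and to x - x′ because their left parts agree, hence to the difference x′ + y, and
    -- `standardFrom` applies.
    changeLeft : ∀ {a b c d a₂ b₂} → NonZeroPair c d → det a b a₂ b₂ ≢ 0# → Standard a b c d → Standard a₂ b₂ c d
    changeLeft {a} {b} {c} {d} {a₂} {b₂} nz det≢0 st with c₀ , d₀ , e ← complement (det a b a₂ b₂) nz =
      standardFrom {a₀ = a + - a₂} {b₀ = b + - b₂} {c₀} {d₀}
        (λ z → det≢0 (by₁ -1# z (solve 4 (λ a b x y → a :* y :- b :* x :- #0 := (:- #1) :* (x :* (b :- y) :- y :* (a :- x) :- #0)) refl a b a₂ b₂)))
        (by₁ 1# e (solve 5 (λ a b x y D → x :* (b :- y) :- y :* (a :- x) :+ D :- #0 := #1 :* (D :- (a :* y :- b :* x))) refl a b a₂ b₂ (det c d c₀ d₀)))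
        (subst (λ u → R u (a + - a₂ ∷ b + - b₂ ∷ c₀ ∷ d₀ ∷ [])) vec≡
          (Rˡ-+ (st _ _ _ _ (by₁ 1# e (solve 5 (λ a b x y D → a :* (b :- y) :- b :* (a :- x) :+ D :- #0 := #1 :* (D :- (a :* y :- b :* x))) refl a b a₂ b₂ (det c d c₀ d₀))))
                (Rˡ-* -1# (R-sym (any-left _ _ c₀ d₀ (a + - a₂) (b + - b₂) (det-self _ _))))))
      where
      vec≡ : (a ∷ b ∷ c ∷ d ∷ []) +ᵥ -1# *ᵥ left (a + - a₂) (b + - b₂) ≡ a₂ ∷ b₂ ∷ c ∷ d ∷ []
      vec≡ = l a a₂ ⹁ l b b₂ ⹁ m c ⹁ m d ⹁ refl
        where
        l = solve 2 (λ x y → x :+ (:- #1) :* (x :- y) := y) refl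
        m = solve 1 (λ x → x :+ (:- #1) :* #0 := x) refl

    changeRight : ∀ {a b c d c₂ d₂} → NonZeroPair a b → det c d c₂ d₂ ≢ 0# → Standard a b c d → Standard a b c₂ d₂
    changeRight {a} {b} {c} {d} {c₂} {d₂} nz det≢0 st with a₀ , b₀ , e ← complement (det c d c₂ d₂) nz =
      standardFrom {a₀ = a₀} {b₀} {c + - c₂} {d + - d₂}
        (λ z → det≢0 (trans (sym e) z))
        (by₁ 1# e (solve 5 (λ a b x y D → D :+ (x :* (b :- y) :- y :* (a :- x)) :- #0 := #1 :* (D :- (a :* y :- b :* x))) refl c d c₂ d₂ (det a b a₀ b₀)))
        (subst (λ u → R u (a₀ ∷ b₀ ∷ c + - c₂ ∷ d + - d₂ ∷ [])) vec≡
          (Rˡ-+ (st _ _ _ _ (by₁ 1# e (solve 5 (λ a b x y D → D :+ (a :* (b :- y) :- b :* (a :- x)) :- #0 := #1 :* (D :- (a :* y :- b :* x))) refl c d c₂ d₂ (det a b a₀ b₀))))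
                (Rˡ-* -1# (R-sym (any-right a₀ b₀ _ _ (c + - c₂) (d + - d₂) (det-self _ _))))))
      where
      vec≡ : (a ∷ b ∷ c ∷ d ∷ []) +ᵥ -1# *ᵥ right (c + - c₂) (d + - d₂) ≡ a ∷ b ∷ c₂ ∷ d₂ ∷ []
      vec≡ = m a ⹁ m b ⹁ l c c₂ ⹁ l d d₂ ⹁ refl
        where
        l = solve 2 (λ x y → x :+ (:- #1) :* (x :- y) := y) refl
        m = solve 1 (λ x → x :+ (:- #1) :* #0 := x) refl

    1≢0′ : NonZeroPair 1# 0#
    1≢0′ = inj₁ 1≢0

    standard₀ : Standard 1# 0# 1# 0#
    standard₀ = standardFrom {a₀ = 0#} {1#} {0#} { - 1#}
      (λ z → 1≢0 (by₁ 1# z (solve 0 (#1 :- #0 := #1 :* (#1 :* #1 :- #0 :* #0 :- #0)) refl)))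
      (solve 0 (#1 :* #1 :- #0 :* #0 :+ (#1 :* (:- #1) :- #0 :* #0) := #0) refl)
      (subst₂ R
        (solve 0 (#1 :+ #0 := #1) refl ⹁ solve 0 (#0 :+ #0 := #0) refl ⹁ solve 0 (#0 :+ #1 := #1) refl ⹁ solve 0 (#0 :+ #0 := #0) refl ⹁ refl)
        (solve 0 (#0 :+ (:- #1) :* #0 := #0) refl ⹁ solve 0 (#1 :+ (:- #1) :* #0 := #1) refl ⹁ solve 0 (#0 :+ (:- #1) :* #0 := #0) refl ⹁ solve 0 (#0 :+ (:- #1) :* #1 := :- #1) refl ⹁ refl)
        R-cross)

    det₁₀ : ∀ {a b} → b ≢ 0# → det 1# 0# a b ≢ 0#
    det₁₀ {a} {b} b≢0 z = b≢0 (by₁ 1# z (solve 2 (λ a b → b :- #0 := #1 :* (#1 :* b :- #0 :* a :- #0)) refl a b))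

    det₀₁ : ∀ {a b} → a ≢ 0# → det 0# 1# a b ≢ 0#
    det₀₁ {a} {b} a≢0 z = a≢0 (by₁ -1# z (solve 2 (λ a b → a :- #0 := (:- #1) :* (#0 :* b :- #1 :* a :- #0)) refl a b))

    -- A single change needs the new left part to be independent of the old one. From (1, 0) this
    -- reaches every pair with b nonzero; the pairs with a nonzero are reached by way of (0, 1).
    standard-left : ∀ {a b} → NonZeroPair a b → Standard a b 1# 0#
    standard-left (inj₂ b≢0) = changeLeft 1≢0′ (det₁₀ b≢0) standard₀
    standard-left (inj₁ a≢0) = changeLeft 1≢0′ (det₀₁ a≢0) (changeLeft 1≢0′ (det₁₀ 1≢0) standard₀)

    standard-both : ∀ {a b c d} → NonZeroPair a b → NonZeroPair c d → Standard a b c d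
    standard-both p (inj₂ d≢0) = changeRight p (det₁₀ d≢0) (standard-left p)
    standard-both p (inj₁ c≢0) = changeRight p (det₀₁ c≢0) (changeRight p (det₁₀ 1≢0) (standard-left p))

    standard : ∀ a b c d → Standard a b c d
    standard a b c d with nonZeroPair? a b | nonZeroPair? c d
    ... | inj₂ p | inj₂ p′ = standard-both p p′
    ... | inj₁ (refl , refl) | _ = λ a′ b′ c′ d′ e → subst (R _) (split a′ b′ c′ d′)
      (+-closed (any-left 0# 0# c d a′ b′ (solve 2 (λ x y → #0 :* y :- #0 :* x := #0) refl a′ b′))
                (any-right 0# 0# c d c′ d′ (by₁ 1# e (solve 3 (λ x y D → D :- #0 := #1 :* (#0 :* y :- #0 :* x :+ D :- #0)) refl a′ b′ (det c d c′ d′)))))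
    ... | inj₂ _ | inj₁ (refl , refl) = λ a′ b′ c′ d′ e → subst (R _) (split a′ b′ c′ d′)
      (+-closed (any-left a b 0# 0# a′ b′ (by₁ 1# e (solve 3 (λ x y D → D :- #0 := #1 :* (D :+ (#0 :* y :- #0 :* x) :- #0)) refl c′ d′ (det a b a′ b′))))
                (any-right a b 0# 0# c′ d′ (solve 2 (λ x y → #0 :* y :- #0 :* x := #0) refl c′ d′)))

    form⇒R : ∀ u v → form u v ≡ 0# → R u v
    form⇒R (a ∷ b ∷ c ∷ d ∷ []) (a′ ∷ b′ ∷ c′ ∷ d′ ∷ []) = standard a b c d a′ b′ c′ d′

    -- If a were nonzero, removing the coordinate a from u would leave a vector of form zero with
    -- `ε₂`, hence related to it; the difference would make `ε₁` related to `ε₂`, against `¬R₁₂`.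
    -- The other coordinates are treated alike.
    nonDegenerate : ∀ u → (∀ v → R u v) → u ≡ 0ᵥ
    nonDegenerate u@(a ∷ b ∷ c ∷ d ∷ []) r = a≡0 ⹁ b≡0 ⹁ c≡0 ⹁ d≡0 ⹁ refl
      where
      drop : ∀ {w x} k {y} → R w y → R (w +ᵥ k *ᵥ x) y → k ≢ 0# → R x y
      drop {w} {x} k p q k≢0 with i , i-inverse ← inverse k k≢0 =
        subst (λ x → R x _) (lemma w x) (Rˡ-* i (Rˡ-+ q (Rˡ-* -1# p)))
        where
        lemma : ∀ w x → i *ᵥ ((w +ᵥ k *ᵥ x) +ᵥ -1# *ᵥ w) ≡ x
        lemma (_ ∷ _ ∷ _ ∷ _ ∷ []) (_ ∷ _ ∷ _ ∷ _ ∷ []) = l _ _ ⹁ l _ _ ⹁ l _ _ ⹁ l _ _ ⹁ refl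
          where
          l = λ w x → by₁ x i-inverse (solve 4 (λ i k w x → i :* (w :+ k :* x :+ (:- #1) :* w) :- x := x :* (k :* i :- #1)) refl i k w x)
      by-contradiction : ∀ {x} → (x ≢ 0# → ⊥) → x ≡ 0#
      by-contradiction {x} f with x ≟ 0#
      ... | yes e = e
      ... | no  e = ⊥-elim (f e)
      form0 : ∀ {u v} → form u v ≡ 0# → R u v
      form0 {u} {v} = form⇒R u v
      a≡0 : a ≡ 0#
      a≡0 = by-contradiction λ a≢0 → ¬R₁₂ (drop {0# ∷ b ∷ c ∷ d ∷ []} a (form0 (solve 3 (λ b c d → #0 :* #1 :- b :* #0 :+ (c :* #0 :- d :* #0) := #0) refl b c d))
        (subst (λ u → R u ε₂) (sym (l₁ a ⹁ l₀ b a ⹁ l₀ c a ⹁ l₀ d a ⹁ refl)) (r ε₂)) a≢0)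
        where
        l₁ = solve 1 (λ a → #0 :+ a :* #1 := a) refl
        l₀ = solve 2 (λ b a → b :+ a :* #0 := b) refl
      b≡0 : b ≡ 0#
      b≡0 = by-contradiction λ b≢0 → ¬R₁₂ (R-sym (drop {a ∷ 0# ∷ c ∷ d ∷ []} b (form0 (solve 3 (λ b c d → b :* #0 :- #0 :* #1 :+ (c :* #0 :- d :* #0) := #0) refl a c d))
        (subst (λ u → R u ε₁) (sym (l₀ a b ⹁ l₁ b ⹁ l₀ c b ⹁ l₀ d b ⹁ refl)) (r ε₁)) b≢0))
        where
        l₁ = solve 1 (λ a → #0 :+ a :* #1 := a) refl
        l₀ = solve 2 (λ b a → b :+ a :* #0 := b) refl
      c≡0 : c ≡ 0#
      c≡0 = by-contradiction λ c≢0 → ¬R₃₄ (drop {a ∷ b ∷ 0# ∷ d ∷ []} c (form0 (solve 3 (λ a b d → a :* #0 :- b :* #0 :+ (#0 :* #1 :- d :* #0) := #0) refl a b d))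
        (subst (λ u → R u ε₄) (sym (l₀ a c ⹁ l₀ b c ⹁ l₁ c ⹁ l₀ d c ⹁ refl)) (r ε₄)) c≢0)
        where
        l₁ = solve 1 (λ a → #0 :+ a :* #1 := a) refl
        l₀ = solve 2 (λ b a → b :+ a :* #0 := b) refl
      d≡0 : d ≡ 0#
      d≡0 = by-contradiction λ d≢0 → ¬R₃₄ (R-sym (drop {a ∷ b ∷ c ∷ 0# ∷ []} d (form0 (solve 3 (λ a b c → a :* #0 :- b :* #0 :+ (c :* #0 :- #0 :* #1) := #0) refl a b c))
        (subst (λ u → R u ε₃) (sym (l₀ a d ⹁ l₀ b d ⹁ l₀ c d ⹁ l₁ d ⹁ refl)) (r ε₃)) d≢0))
        where
        l₁ = solve 1 (λ a → #0 :+ a :* #1 := a) refl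
        l₀ = solve 2 (λ b a → b :+ a :* #0 := b) refl

    -- If the form were nonzero, the vectors related to u would contain its form-perp, a hyperplane,
    -- together with v outside it. They would be all vectors, and u would vanish.
    R⇒form : ∀ u v → R u v → form u v ≡ 0#
    R⇒form u v r with form u v ≟ 0#
    ... | yes e = e
    ... | no form≢0 = trans (cong (λ u → form u v) (nonDegenerate u everything)) (form-0 v)
      where
      i = proj₁ (inverse _ form≢0)
      i-inverse = proj₂ (inverse _ form≢0)
      form-0 : ∀ v → form 0ᵥ v ≡ 0#
      form-0 (x ∷ y ∷ z ∷ w ∷ []) = solve 4 (λ x y z w → #0 :* y :- #0 :* x :+ (#0 :* w :- #0 :* z) := #0) refl x y z w
      everything : ∀ w → R u w
      everything w = subst (R u) (lemma w v) (+-closed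
          (form⇒R u (w +ᵥ (- t) *ᵥ v) (trans (form-+ʳ u w _) (trans (cong (λ k → form u w + k) (form-*ʳ u (- t) v))
            (by₁ (- form u w) i-inverse (solve 3 (λ D D₀ i → D :+ (:- (D :* i)) :* D₀ :- #0 := (:- D) :* (D₀ :* i :- #1)) refl (form u w) (form u v) i)))))
          (*-closed t r))
        where
        t = form u w * i
        lemma : ∀ w v → (w +ᵥ (- t) *ᵥ v) +ᵥ t *ᵥ v ≡ w
        lemma (_ ∷ _ ∷ _ ∷ _ ∷ []) (_ ∷ _ ∷ _ ∷ _ ∷ []) = l _ _ ⹁ l _ _ ⹁ l _ _ ⹁ l _ _ ⹁ refl
          where l = λ w v → solve 3 (λ t w v → w :+ (:- t) :* v :+ t :* v := w) refl t w v

-- Symplectic frames adapted to given vectors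

module Frames (F : Field) where
  open Field F renaming (Carrier to A)
  open Algebra F
  open Lines F
  open Linear F
  open StandardForm F
  open ≡-Reasoning

  -- The finiteness of the field enters only through the last field.
  record IsPolar (R : V → V → Set) : Set where
    field
      isOrthogonalityLike : OrthogonalityLike R
      hyperplane    : ∀ {u v} → ¬ R u v → ∀ w → ∃ λ c → R u (w +ᵥ c *ᵥ v)
      nondegenerate : ∀ u → (∀ v → R u v) → u ≡ 0ᵥ
      inj⇒surj      : ∀ (f : V → V) → (∀ {x y} → f x ≡ f y → x ≡ y) → ∀ y → ∃ λ x → f x ≡ y
    open OrthogonalityLike isOrthogonalityLike public

  record Frame (R : V → V → Set) : Set where
    field
      to from     : V → V
      to-linear   : IsLinearMap to
      from-linear : IsLinearMap from
      to∘from     : ∀ x → to (from x) ≡ x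
      from∘to     : ∀ x → from (to x) ≡ x
      orth⇒form   : ∀ u v → R u v → form (to u) (to v) ≡ 0#
      form⇒orth   : ∀ u v → form (to u) (to v) ≡ 0# → R u v

  linear-0 : ∀ {f} → IsLinearMap f → f 0ᵥ ≡ 0ᵥ
  linear-0 {f} lf = begin
    f 0ᵥ           ≡⟨ cong f (zeroˡ 0# ⹁ zeroˡ 0# ⹁ zeroˡ 0# ⹁ zeroˡ 0# ⹁ refl) ⟨
    f (0# *ᵥ 0ᵥ)   ≡⟨ IsLinear.homogeneous lf 0# 0ᵥ ⟩
    0# *ᵥ f 0ᵥ     ≡⟨ zero* (f 0ᵥ) ⟩
    0ᵥ             ∎
    where
    zero* : ∀ x → 0# *ᵥ x ≡ 0ᵥ
    zero* (_ ∷ _ ∷ _ ∷ _ ∷ []) = zeroˡ _ ⹁ zeroˡ _ ⹁ zeroˡ _ ⹁ zeroˡ _ ⹁ refl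

  to≢0 : ∀ {R} (φ : Frame R) {u} → u ≢ 0ᵥ → Frame.to φ u ≢ 0ᵥ
  to≢0 φ {u} u≢0 e = u≢0 (trans (sym (from∘to u)) (trans (cong from e) (linear-0 from-linear)))
    where open Frame φ

  from≢0 : ∀ {R} (φ : Frame R) {u} → u ≢ 0ᵥ → Frame.from φ u ≢ 0ᵥ
  from≢0 φ {u} u≢0 e = u≢0 (trans (sym (to∘from u)) (trans (cong to e) (linear-0 to-linear)))
    where open Frame φ

  +-ᵥ : ∀ x y → x +ᵥ -ᵥ y ≡ 0ᵥ → x ≡ y
  +-ᵥ (_ ∷ _ ∷ _ ∷ _ ∷ []) (_ ∷ _ ∷ _ ∷ _ ∷ []) e =
    l (cong first e) ⹁ l (cong second e) ⹁ l (cong third e) ⹁ l (cong fourth e) ⹁ refl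
    where
    l : ∀ {x y} → x + -1# * y ≡ 0# → x ≡ y
    l {x} {y} e = by₁ 1# e (solve 2 (λ x y → x :- y := #1 :* (x :+ (:- #1) :* y :- #0)) refl x y)

  x-x≡0 : ∀ x → x +ᵥ -ᵥ x ≡ 0ᵥ
  x-x≡0 (_ ∷ _ ∷ _ ∷ _ ∷ []) = l _ ⹁ l _ ⹁ l _ ⹁ l _ ⹁ refl
    where l = solve 1 (λ x → x :+ (:- #1) :* x := #0) refl

  module _ {R : V → V → Set} (isPolar : IsPolar R) where
    open IsPolar isPolar

    nonOrthogonal : ∀ {u} → u ≢ 0ᵥ → ∃ λ v → ¬ R u v
    nonOrthogonal {u} u≢0 with R? u ε₁ | R? u ε₂ | R? u ε₃ | R? u ε₄
    ... | no ¬r | _ | _ | _ = ε₁ , ¬r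
    ... | yes _ | no ¬r | _ | _ = ε₂ , ¬r
    ... | yes _ | yes _ | no ¬r | _ = ε₃ , ¬r
    ... | yes _ | yes _ | yes _ | no ¬r = ε₄ , ¬r
    ... | yes r₁ | yes r₂ | yes r₃ | yes r₄ = ⊥-elim (u≢0 (nondegenerate u λ where
      z@(x ∷ y ∷ z′ ∷ w ∷ []) → subst (R u) (trans (sym (comb-sum ε₁ ε₂ ε₃ ε₄ x y z′ w)) (comb-ε z))
        (+-closed (+-closed (*-closed x r₁) (*-closed y r₂)) (+-closed (*-closed z′ r₃) (*-closed w r₄)))))

    module _ {e f : V} (¬Ref : ¬ R e f) where

      record Adjusted (w : V) : Set where
        field
          α β : A
        vector : V
        vector = (w +ᵥ α *ᵥ f) +ᵥ β *ᵥ e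
        field
          e-orthogonal : R e vector
          f-orthogonal : R f vector

      -- Gram-Schmidt without a form: `hyperplane` supplies the coefficients. The second correction,
      -- along e, does not disturb orthogonality to e because e is orthogonal to itself.
      adjust : ∀ w → Adjusted w
      adjust w with c , p ← hyperplane ¬Ref w with d , q ← hyperplane (¬Ref ∘ R-sym) (w +ᵥ c *ᵥ f) =
        record { α = c ; β = d ; e-orthogonal = +-closed p (*-closed d (R-refl e)) ; f-orthogonal = q }

      -- Otherwise ε₁, ε₂ and ε₃ would all be combinations of e and f.
      perpNonZero : ∃ λ g → R e g × R f g × g ≢ 0ᵥ
      perpNonZero with adjust ε₁ | adjust ε₂ | adjust ε₃
      ... | A₁ | A₂ | A₃ with Adjusted.vector A₁ ≟0ᵥ | Adjusted.vector A₂ ≟0ᵥ | Adjusted.vector A₃ ≟0ᵥ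
      ... | no n | _ | _ = _ , Adjusted.e-orthogonal A₁ , Adjusted.f-orthogonal A₁ , n
      ... | yes _ | no n | _ = _ , Adjusted.e-orthogonal A₂ , Adjusted.f-orthogonal A₂ , n
      ... | yes _ | yes _ | no n = _ , Adjusted.e-orthogonal A₃ , Adjusted.f-orthogonal A₃ , n
      ... | yes z₁ | yes z₂ | yes z₃ = ⊥-elim (dependent e f (Adjusted.β A₁) (Adjusted.α A₁) (Adjusted.β A₂) (Adjusted.α A₂) (Adjusted.β A₃) (Adjusted.α A₃) z₁ z₂ z₃)
        where
        dependent : ∀ e f a b a′ b′ a″ b″ → (ε₁ +ᵥ b *ᵥ f) +ᵥ a *ᵥ e ≡ 0ᵥ → (ε₂ +ᵥ b′ *ᵥ f) +ᵥ a′ *ᵥ e ≡ 0ᵥ → (ε₃ +ᵥ b″ *ᵥ f) +ᵥ a″ *ᵥ e ≡ 0ᵥ → ⊥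
        dependent (e₁ ∷ e₂ ∷ e₃ ∷ e₄ ∷ []) (f₁ ∷ f₂ ∷ f₃ ∷ f₄ ∷ []) a b a′ b′ a″ b″ p p′ p″ =
          1≢0 (by₃ 1# (- e₂) (- f₂) (cong second p′) a′≡0 b′≡0
            (solve 4 (λ a b e f → #1 :- #0 := #1 :* (#1 :+ b :* f :+ a :* e :- #0) :+ (:- e) :* (a :- #0) :+ (:- f) :* (b :- #0)) refl a′ b′ e₂ f₂))
          where
          λ≡0 : a * b′ - a′ * b ≡ 0#
          λ≡0 = by₃ (a * b′ - a′ * b) (a′ * b″ - a″ * b′) (a″ * b - a * b″) (cong third p″) (cong third p) (cong third p′)
            (solve 8 (λ a b a′ b′ a″ b″ e f → a :* b′ :- a′ :* b :- #0 :=
              (a :* b′ :- a′ :* b) :* (#1 :+ b″ :* f :+ a″ :* e :- #0) :+ (a′ :* b″ :- a″ :* b′) :* (#0 :+ b :* f :+ a :* e :- #0) :+ (a″ :* b :- a :* b″) :* (#0 :+ b′ :* f :+ a′ :* e :- #0)) refl a b a′ b′ a″ b″ e₃ f₃)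
          b′≡0 : b′ ≡ 0#
          b′≡0 = by₃ b′ (- b) (- e₁) (cong first p) (cong first p′) λ≡0
            (solve 6 (λ a b a′ b′ e f → b′ :- #0 :=
              b′ :* (#1 :+ b :* f :+ a :* e :- #0) :+ (:- b) :* (#0 :+ b′ :* f :+ a′ :* e :- #0) :+ (:- e) :* (a :* b′ :- a′ :* b :- #0)) refl a b a′ b′ e₁ f₁)
          a′≡0 : a′ ≡ 0#
          a′≡0 = by₃ a′ (- a) f₁ (cong first p) (cong first p′) λ≡0
            (solve 6 (λ a b a′ b′ e f → a′ :- #0 :=
              a′ :* (#1 :+ b :* f :+ a :* e :- #0) :+ (:- a) :* (#0 :+ b′ :* f :+ a′ :* e :- #0) :+ f :* (a :* b′ :- a′ :* b :- #0)) refl a b a′ b′ e₁ f₁)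

      record FrameAt (g : V) : Set where
        field
          frame : Frame R
        open Frame frame public
        field
          from-ε₁ : from ε₁ ≡ e
          from-ε₂ : from ε₂ ≡ f
          from-ε₃ : from ε₃ ≡ g

      -- A fourth vector not orthogonal to g is moved into the perp of e and f and then rescaled
      -- until the hypothesis `R-cross` of `StandardForm` holds.
      constructFrame : ∀ {g} → R e g → R f g → g ≢ 0ᵥ → FrameAt g
      constructFrame {g} Reg Rfg g≢0 = record
        { frame = record
          { to = to ; from = from ; to-linear = to-linear ; from-linear = from-linear
          ; to∘from = to∘from ; from∘to = from∘to
          ; orth⇒form = λ u v r → R′⇒form (to u) (to v) (subst₂ R (sym (from∘to u)) (sym (from∘to v)) r)
          ; form⇒orth = λ u v p → subst₂ R (from∘to u) (from∘to v) (form⇒R′ (to u) (to v) p) }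
        ; from-ε₁ = comb-ε₁ e f g h ; from-ε₂ = comb-ε₂ e f g h ; from-ε₃ = comb-ε₃ e f g h }
        where
        h₀ = proj₁ (nonOrthogonal g≢0)
        ¬Rgh₀ = proj₂ (nonOrthogonal g≢0)
        open Adjusted (adjust h₀) renaming (vector to h₁; e-orthogonal to Reh₁; f-orthogonal to Rfh₁)
        undo : ∀ h₀ f e → (((h₀ +ᵥ α *ᵥ f) +ᵥ β *ᵥ e) +ᵥ (- β) *ᵥ e) +ᵥ (- α) *ᵥ f ≡ h₀
        undo (_ ∷ _ ∷ _ ∷ _ ∷ []) (_ ∷ _ ∷ _ ∷ _ ∷ []) (_ ∷ _ ∷ _ ∷ _ ∷ []) = l _ _ _ ⹁ l _ _ _ ⹁ l _ _ _ ⹁ l _ _ _ ⹁ refl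
          where l = λ h f e → solve 5 (λ α β h f e → h :+ α :* f :+ β :* e :+ (:- β) :* e :+ (:- α) :* f := h) refl α β h f e
        ¬Rgh₁ : ¬ R g h₁
        ¬Rgh₁ r = ¬Rgh₀ (subst (R g) (undo h₀ f e) (+-closed (+-closed r (*-closed (- β) (R-sym Reg))) (*-closed (- α) (R-sym Rfg))))
        ¬R-e+g-f : ¬ R (e +ᵥ g) f
        ¬R-e+g-f r = ¬Ref (R-sym (subst (R f) (lemma e g) (+-closed (R-sym r) (*-closed -1# Rfg))))
          where
          lemma : ∀ e g → (e +ᵥ g) +ᵥ -1# *ᵥ g ≡ e
          lemma (_ ∷ _ ∷ _ ∷ _ ∷ []) (_ ∷ _ ∷ _ ∷ _ ∷ []) = l _ _ ⹁ l _ _ ⹁ l _ _ ⹁ l _ _ ⹁ refl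
            where l = solve 2 (λ x y → x :+ y :+ (:- #1) :* y := x) refl
        -- Here e + g is orthogonal to h₁ + c f. Since c is nonzero, division by c turns this vector
        -- into f - h with h = -h₁/c, which is the cross relation.
        c = proj₁ (hyperplane ¬R-e+g-f h₁)
        Rc : R (e +ᵥ g) (h₁ +ᵥ c *ᵥ f)
        Rc = proj₂ (hyperplane ¬R-e+g-f h₁)
        c≢0 : c ≢ 0#
        c≢0 c≡0 = ¬Rgh₁ (R-sym (subst (R h₁) (lemma e g) (+-closed (R-sym (subst (R (e +ᵥ g)) (lemma₀ h₁ f) Rc)) (*-closed -1# (R-sym Reh₁)))))
          where
          lemma : ∀ e g → (e +ᵥ g) +ᵥ -1# *ᵥ e ≡ g
          lemma (_ ∷ _ ∷ _ ∷ _ ∷ []) (_ ∷ _ ∷ _ ∷ _ ∷ []) = l _ _ ⹁ l _ _ ⹁ l _ _ ⹁ l _ _ ⹁ refl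
            where l = solve 2 (λ x y → x :+ y :+ (:- #1) :* x := y) refl
          lemma₀ : ∀ h f → h +ᵥ c *ᵥ f ≡ h
          lemma₀ (_ ∷ _ ∷ _ ∷ _ ∷ []) (_ ∷ _ ∷ _ ∷ _ ∷ []) = l _ _ ⹁ l _ _ ⹁ l _ _ ⹁ l _ _ ⹁ refl
            where l = λ h f → by₁ f c≡0 (solve 3 (λ c h f → h :+ c :* f :- h := f :* (c :- #0)) refl c h f)
        i = proj₁ (inverse c c≢0)
        i-inverse = proj₂ (inverse c c≢0)
        h = (- i) *ᵥ h₁
        from = comb e f g h
        from-linear = comb-linear e f g h
        comb-ε₁ : ∀ e f g h → comb e f g h ε₁ ≡ e
        comb-ε₁ (_ ∷ _ ∷ _ ∷ _ ∷ []) (_ ∷ _ ∷ _ ∷ _ ∷ []) (_ ∷ _ ∷ _ ∷ _ ∷ []) (_ ∷ _ ∷ _ ∷ _ ∷ []) = l _ _ _ _ ⹁ l _ _ _ _ ⹁ l _ _ _ _ ⹁ l _ _ _ _ ⹁ refl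
          where l = solve 4 (λ x y z w → #1 :* x :+ #0 :* y :+ (#0 :* z :+ #0 :* w) := x) refl
        comb-ε₂ : ∀ e f g h → comb e f g h ε₂ ≡ f
        comb-ε₂ (_ ∷ _ ∷ _ ∷ _ ∷ []) (_ ∷ _ ∷ _ ∷ _ ∷ []) (_ ∷ _ ∷ _ ∷ _ ∷ []) (_ ∷ _ ∷ _ ∷ _ ∷ []) = l _ _ _ _ ⹁ l _ _ _ _ ⹁ l _ _ _ _ ⹁ l _ _ _ _ ⹁ refl
          where l = solve 4 (λ x y z w → #0 :* x :+ #1 :* y :+ (#0 :* z :+ #0 :* w) := y) refl
        comb-ε₃ : ∀ e f g h → comb e f g h ε₃ ≡ g
        comb-ε₃ (_ ∷ _ ∷ _ ∷ _ ∷ []) (_ ∷ _ ∷ _ ∷ _ ∷ []) (_ ∷ _ ∷ _ ∷ _ ∷ []) (_ ∷ _ ∷ _ ∷ _ ∷ []) = l _ _ _ _ ⹁ l _ _ _ _ ⹁ l _ _ _ _ ⹁ l _ _ _ _ ⹁ refl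
          where l = solve 4 (λ x y z w → #0 :* x :+ #0 :* y :+ (#1 :* z :+ #0 :* w) := z) refl
        comb-ε₄ : ∀ e f g h → comb e f g h ε₄ ≡ h
        comb-ε₄ (_ ∷ _ ∷ _ ∷ _ ∷ []) (_ ∷ _ ∷ _ ∷ _ ∷ []) (_ ∷ _ ∷ _ ∷ _ ∷ []) (_ ∷ _ ∷ _ ∷ _ ∷ []) = l _ _ _ _ ⹁ l _ _ _ _ ⹁ l _ _ _ _ ⹁ l _ _ _ _ ⹁ refl
          where l = solve 4 (λ x y z w → #0 :* x :+ #0 :* y :+ (#0 :* z :+ #1 :* w) := w) refl
        R′ : V → V → Set
        R′ u v = R (from u) (from v)
        open IsLinear from-linear
        isR′ : OrthogonalityLike R′
        isR′ = record
          { R?       = λ u v → R? (from u) (from v)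
          ; +-closed = λ p q → subst (R _) (sym (additive _ _)) (+-closed p q)
          ; *-closed = λ c p → subst (R _) (sym (homogeneous c _)) (*-closed c p)
          ; R-sym    = R-sym
          ; R-refl   = λ u → R-refl (from u)
          ; R-zero   = λ u → subst (R _) (sym (linear-0 from-linear)) (R-zero (from u)) }
        ¬Rgh : ¬ R g h
        ¬Rgh r = ¬Rgh₁ (subst (R g) (lemma h₁) (*-closed (- c) r))
          where
          lemma : ∀ h → (- c) *ᵥ ((- i) *ᵥ h) ≡ h
          lemma (_ ∷ _ ∷ _ ∷ _ ∷ []) = l _ ⹁ l _ ⹁ l _ ⹁ l _ ⹁ refl
            where l = λ h → by₁ h i-inverse (solve 3 (λ c i h → (:- c) :* ((:- i) :* h) :- h := h :* (c :* i :- #1)) refl c i h)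
        cross : R (e +ᵥ g) (f +ᵥ -ᵥ h)
        cross = subst (R (e +ᵥ g)) (lemma h₁ f) (*-closed i Rc)
          where
          lemma : ∀ h₁ f → i *ᵥ (h₁ +ᵥ c *ᵥ f) ≡ f +ᵥ -ᵥ ((- i) *ᵥ h₁)
          lemma (_ ∷ _ ∷ _ ∷ _ ∷ []) (_ ∷ _ ∷ _ ∷ _ ∷ []) = l _ _ ⹁ l _ _ ⹁ l _ _ ⹁ l _ _ ⹁ refl
            where l = λ h f → by₁ f i-inverse (solve 4 (λ c i h f → i :* (h :+ c :* f) :- (f :+ (:- #1) :* ((:- i) :* h)) := f :* (c :* i :- #1)) refl c i h f)
        ↑ : ∀ {x x′ y y′} → x ≡ x′ → y ≡ y′ → R x′ y′ → R x y
        ↑ p q = subst₂ R (sym p) (sym q)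
        ε₁≡ = comb-ε₁ e f g h
        ε₂≡ = comb-ε₂ e f g h
        ε₃≡ = comb-ε₃ e f g h
        ε₄≡ = comb-ε₄ e f g h
        module S = StandardForm F
        R₁₃ = ↑ ε₁≡ ε₃≡ Reg
        R₁₄ = ↑ ε₁≡ ε₄≡ (*-closed (- i) Reh₁)
        R₂₃ = ↑ ε₂≡ ε₃≡ Rfg
        R₂₄ = ↑ ε₂≡ ε₄≡ (*-closed (- i) Rfh₁)
        ¬R₁₂ = ¬Ref ∘ subst₂ R ε₁≡ ε₂≡
        ¬R₃₄ = ¬Rgh ∘ subst₂ R ε₃≡ ε₄≡
        R-cross = ↑ (trans (additive ε₁ ε₃) (cong₂ _+ᵥ_ ε₁≡ ε₃≡))
                    (trans (additive ε₂ (-ᵥ ε₄)) (cong₂ _+ᵥ_ ε₂≡ (trans (homogeneous -1# ε₄) (cong -ᵥ_ ε₄≡)))) cross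
        form⇒R′ = S.form⇒R isR′ R₁₃ R₁₄ R₂₃ R₂₄ ¬R₁₂ ¬R₃₄ R-cross
        R′⇒form = S.R⇒form isR′ R₁₃ R₁₄ R₂₃ R₂₄ ¬R₁₂ ¬R₃₄ R-cross
        from-injective : ∀ {x y} → from x ≡ from y → x ≡ y
        from-injective {x} {y} p = +-ᵥ x y (S.nonDegenerate isR′ R₁₃ R₁₄ R₂₃ R₂₄ ¬R₁₂ ¬R₃₄ R-cross _ λ v →
          subst (λ x → R x (from v)) (sym from-difference) (R-sym (R-zero (from v))))
          where
          from-difference : from (x +ᵥ -ᵥ y) ≡ 0ᵥ
          from-difference = trans (additive x (-ᵥ y)) (trans (cong₂ _+ᵥ_ p (homogeneous -1# y)) (x-x≡0 (from y)))
        -- No inverse matrix is computed: the kernel of `from` would be orthogonal to everything, so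
        -- `from` is injective, and a finite space leaves it no choice but to be onto.
        to : V → V
        to y = proj₁ (inj⇒surj from from-injective y)
        from∘to : ∀ y → from (to y) ≡ y
        from∘to y = proj₂ (inj⇒surj from from-injective y)
        to∘from : ∀ x → to (from x) ≡ x
        to∘from x = from-injective (from∘to (from x))
        to-linear : IsLinearMap to
        to-linear = record
          { additive    = λ u v → from-injective (trans (from∘to (u +ᵥ v)) (trans (sym (cong₂ _+ᵥ_ (from∘to u) (from∘to v))) (sym (additive (to u) (to v)))))
          ; homogeneous = λ c v → from-injective (trans (from∘to (c *ᵥ v)) (trans (sym (cong (c *ᵥ_) (from∘to v))) (sym (homogeneous c (to v))))) }

      abstract
        frameAt : ∀ {g} → R e g → R f g → g ≢ 0ᵥ → FrameAt g
        frameAt = constructFrame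

open import Defs

-- Arithmetic modulo q and finite sets

module Residues (q : ℕ) .{{_ : NonZero q}} where

  infixl 6 _⊞_
  infixl 7 _⊠_
  _⊞_ _⊠_ : 𝔽 q → 𝔽 q → 𝔽 q
  _⊞_ = _+𝔽_ q
  _⊠_ = _*𝔽_ q

  ⟦_⟧ : ℕ → 𝔽 q
  ⟦ n ⟧ = n mod q

  toℕ-⟦⟧ : ∀ n → toℕ ⟦ n ⟧ ≡ n % q
  toℕ-⟦⟧ n = Fin.toℕ-fromℕ< (m%n<n n q)

  ⟦⟧-cong : ∀ {m n} → m % q ≡ n % q → ⟦ m ⟧ ≡ ⟦ n ⟧
  ⟦⟧-cong {m} {n} e = Fin.toℕ-injective (trans (toℕ-⟦⟧ m) (trans e (sym (toℕ-⟦⟧ n))))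

  ⟦⟧-injective : ∀ {m n} → ⟦ m ⟧ ≡ ⟦ n ⟧ → m % q ≡ n % q
  ⟦⟧-injective {m} {n} e = trans (sym (toℕ-⟦⟧ m)) (trans (cong toℕ e) (toℕ-⟦⟧ n))

  ⟦toℕ⟧ : ∀ a → ⟦ toℕ a ⟧ ≡ a
  ⟦toℕ⟧ a = Fin.toℕ-injective (trans (toℕ-⟦⟧ (toℕ a)) (m<n⇒m%n≡m (Fin.toℕ<n a)))

  ⟦%⟧ : ∀ n → ⟦ n % q ⟧ ≡ ⟦ n ⟧
  ⟦%⟧ n = ⟦⟧-cong (m%n%n≡m%n n q)

  ⟦⟧-+ : ∀ m n → ⟦ m ⟧ ⊞ ⟦ n ⟧ ≡ ⟦ m ℕ.+ n ⟧
  ⟦⟧-+ m n = ⟦⟧-cong (trans (cong₂ (λ x y → (x ℕ.+ y) % q) (toℕ-⟦⟧ m) (toℕ-⟦⟧ n)) (sym (%-distribˡ-+ m n q)))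

  ⟦⟧-* : ∀ m n → ⟦ m ⟧ ⊠ ⟦ n ⟧ ≡ ⟦ m ℕ.* n ⟧
  ⟦⟧-* m n = ⟦⟧-cong (trans (cong₂ (λ x y → (x ℕ.* y) % q) (toℕ-⟦⟧ m) (toℕ-⟦⟧ n)) (sym (%-distribˡ-* m n q)))

  -- Since q - 1 is congruent to -1, this represents negation modulo q without subtraction;
  -- polynomial formulas with signs can therefore be evaluated in ℕ.
  negℕ : ℕ → ℕ
  negℕ n = ℕ.pred q ℕ.* n

  ⊟_ : 𝔽 q → 𝔽 q
  ⊟ a = ⟦ negℕ (toℕ a) ⟧

  ⟦⟧-neg : ∀ n → ⊟ ⟦ n ⟧ ≡ ⟦ negℕ n ⟧
  ⟦⟧-neg n = trans (sym (⟦⟧-* (ℕ.pred q) (toℕ ⟦ n ⟧))) (trans (cong (⟦ ℕ.pred q ⟧ ⊠_) (⟦toℕ⟧ ⟦ n ⟧)) (⟦⟧-* (ℕ.pred q) n))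

  -- Viewing every element as the class of a natural number reduces the ring laws to those of ℕ by
  -- means of `⟦⟧-+` and `⟦⟧-*`.
  data Residue : 𝔽 q → Set where
    residue : ∀ n → Residue ⟦ n ⟧

  view : ∀ a → Residue a
  view a = subst Residue (⟦toℕ⟧ a) (residue (toℕ a))

  ⊞-assoc : ∀ a b c → (a ⊞ b) ⊞ c ≡ a ⊞ (b ⊞ c)
  ⊞-assoc a b c with view a | view b | view c
  ... | residue k | residue m | residue n = begin
    (⟦ k ⟧ ⊞ ⟦ m ⟧) ⊞ ⟦ n ⟧   ≡⟨ cong (_⊞ ⟦ n ⟧) (⟦⟧-+ k m) ⟩
    ⟦ k ℕ.+ m ⟧ ⊞ ⟦ n ⟧       ≡⟨ ⟦⟧-+ (k ℕ.+ m) n ⟩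
    ⟦ k ℕ.+ m ℕ.+ n ⟧         ≡⟨ cong ⟦_⟧ (ℕ.+-assoc k m n) ⟩
    ⟦ k ℕ.+ (m ℕ.+ n) ⟧       ≡⟨ ⟦⟧-+ k (m ℕ.+ n) ⟨
    ⟦ k ⟧ ⊞ ⟦ m ℕ.+ n ⟧       ≡⟨ cong (⟦ k ⟧ ⊞_) (⟦⟧-+ m n) ⟨
    ⟦ k ⟧ ⊞ (⟦ m ⟧ ⊞ ⟦ n ⟧)   ∎
    where open ≡-Reasoning

  ⊠-assoc : ∀ a b c → (a ⊠ b) ⊠ c ≡ a ⊠ (b ⊠ c)
  ⊠-assoc a b c with view a | view b | view c
  ... | residue k | residue m | residue n = begin
    (⟦ k ⟧ ⊠ ⟦ m ⟧) ⊠ ⟦ n ⟧   ≡⟨ cong (_⊠ ⟦ n ⟧) (⟦⟧-* k m) ⟩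
    ⟦ k ℕ.* m ⟧ ⊠ ⟦ n ⟧       ≡⟨ ⟦⟧-* (k ℕ.* m) n ⟩
    ⟦ k ℕ.* m ℕ.* n ⟧         ≡⟨ cong ⟦_⟧ (ℕ.*-assoc k m n) ⟩
    ⟦ k ℕ.* (m ℕ.* n) ⟧       ≡⟨ ⟦⟧-* k (m ℕ.* n) ⟨
    ⟦ k ⟧ ⊠ ⟦ m ℕ.* n ⟧       ≡⟨ cong (⟦ k ⟧ ⊠_) (⟦⟧-* m n) ⟨
    ⟦ k ⟧ ⊠ (⟦ m ⟧ ⊠ ⟦ n ⟧)   ∎
    where open ≡-Reasoning

  ⊠-distribˡ-⊞ : ∀ a b c → a ⊠ (b ⊞ c) ≡ a ⊠ b ⊞ a ⊠ c
  ⊠-distribˡ-⊞ a b c with view a | view b | view c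
  ... | residue k | residue m | residue n = begin
    ⟦ k ⟧ ⊠ (⟦ m ⟧ ⊞ ⟦ n ⟧)              ≡⟨ cong (⟦ k ⟧ ⊠_) (⟦⟧-+ m n) ⟩
    ⟦ k ⟧ ⊠ ⟦ m ℕ.+ n ⟧                  ≡⟨ ⟦⟧-* k (m ℕ.+ n) ⟩
    ⟦ k ℕ.* (m ℕ.+ n) ⟧                  ≡⟨ cong ⟦_⟧ (ℕ.*-distribˡ-+ k m n) ⟩
    ⟦ k ℕ.* m ℕ.+ k ℕ.* n ⟧              ≡⟨ ⟦⟧-+ (k ℕ.* m) (k ℕ.* n) ⟨
    ⟦ k ℕ.* m ⟧ ⊞ ⟦ k ℕ.* n ⟧            ≡⟨ cong₂ _⊞_ (⟦⟧-* k m) (⟦⟧-* k n) ⟨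
    ⟦ k ⟧ ⊠ ⟦ m ⟧ ⊞ ⟦ k ⟧ ⊠ ⟦ n ⟧        ∎
    where open ≡-Reasoning

  ⊞-comm : ∀ a b → a ⊞ b ≡ b ⊞ a
  ⊞-comm a b = cong ⟦_⟧ (ℕ.+-comm (toℕ a) (toℕ b))

  ⊠-comm : ∀ a b → a ⊠ b ≡ b ⊠ a
  ⊠-comm a b = cong ⟦_⟧ (ℕ.*-comm (toℕ a) (toℕ b))

  ⊞-identityˡ : ∀ a → ⟦ 0 ⟧ ⊞ a ≡ a
  ⊞-identityˡ a with view a
  ... | residue n = ⟦⟧-+ 0 n

  ⊠-identityˡ : ∀ a → ⟦ 1 ⟧ ⊠ a ≡ a
  ⊠-identityˡ a with view a
  ... | residue n = trans (⟦⟧-* 1 n) (cong ⟦_⟧ (ℕ.*-identityˡ n))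

  ⊞-inverseʳ : ∀ a → a ⊞ ⊟ a ≡ ⟦ 0 ⟧
  ⊞-inverseʳ a with view a
  ... | residue n = begin
    ⟦ n ⟧ ⊞ ⊟ ⟦ n ⟧              ≡⟨ cong (⟦ n ⟧ ⊞_) (⟦⟧-neg n) ⟩
    ⟦ n ⟧ ⊞ ⟦ ℕ.pred q ℕ.* n ⟧   ≡⟨ ⟦⟧-+ n (ℕ.pred q ℕ.* n) ⟩
    ⟦ suc (ℕ.pred q) ℕ.* n ⟧     ≡⟨ cong (λ k → ⟦ k ℕ.* n ⟧) (ℕ.suc-pred q) ⟩
    ⟦ q ℕ.* n ⟧                  ≡⟨ cong ⟦_⟧ (ℕ.*-comm q n) ⟩
    ⟦ n ℕ.* q ⟧                  ≡⟨ ⟦⟧-cong (trans (m*n%n≡0 n q) (sym (m*n%n≡0 0 q))) ⟩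
    ⟦ 0 ⟧                        ∎
    where open ≡-Reasoning

  comm∧ˡ⇒ʳ : ∀ {_∙_ : 𝔽 q → 𝔽 q → 𝔽 q} {e} → (∀ a b → a ∙ b ≡ b ∙ a) → (∀ a → e ∙ a ≡ a) → ∀ a → a ∙ e ≡ a
  comm∧ˡ⇒ʳ {e = e} comm idˡ a = trans (comm a e) (idˡ a)

  isCommutativeRing : IsCommutativeRing _≡_ _⊞_ _⊠_ ⊟_ ⟦ 0 ⟧ ⟦ 1 ⟧
  isCommutativeRing = record
    { isRing = record
      { +-isAbelianGroup = record
        { isGroup = record
          { isMonoid = record
            { isSemigroup = record
              { isMagma = record { isEquivalence = isEquivalence ; ∙-cong = cong₂ _⊞_ }
              ; assoc = ⊞-assoc }
            ; identity = ⊞-identityˡ , comm∧ˡ⇒ʳ ⊞-comm ⊞-identityˡ }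
          ; inverse = (λ a → trans (⊞-comm (⊟ a) a) (⊞-inverseʳ a)) , ⊞-inverseʳ
          ; ⁻¹-cong = cong ⊟_ }
        ; comm = ⊞-comm }
      ; *-cong = cong₂ _⊠_
      ; *-assoc = ⊠-assoc
      ; *-identity = ⊠-identityˡ , comm∧ˡ⇒ʳ ⊠-comm ⊠-identityˡ
      ; distrib = ⊠-distribˡ-⊞ , λ a b c → trans (⊠-comm (b ⊞ c) a) (trans (⊠-distribˡ-⊞ a b c) (cong₂ _⊞_ (⊠-comm a b) (⊠-comm a c))) }
    ; *-comm = ⊠-comm }

  record IsOddField : Set where
    field
      inverse : ∀ a → a ≢ ⟦ 0 ⟧ → ∃ λ b → a ⊠ b ≡ ⟦ 1 ⟧
      1≢0     : ⟦ 1 ⟧ ≢ ⟦ 0 ⟧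
      2≢0     : ⟦ 1 ⟧ ⊞ ⟦ 1 ⟧ ≢ ⟦ 0 ⟧

  residueField : IsOddField → Field
  residueField isField = record
    { isCommutativeRing = isCommutativeRing ; _≟_ = Fin._≟_
    ; inverse = inverse ; 1≢0 = 1≢0 ; 2≢0 = 2≢0 }
    where open IsOddField isField

module Finite where
  encode : ∀ {q n} → Vec (Fin q) n → Fin (q ℕ.^ n)
  encode []      = Fin.zero
  encode (x ∷ v) = combine x (encode v)

  decode : ∀ {q} n → Fin (q ℕ.^ n) → Vec (Fin q) n
  decode zero    _ = []
  decode {q} (suc n) i = proj₁ (remQuot {q} (q ℕ.^ n) i) ∷ decode n (proj₂ (remQuot {q} (q ℕ.^ n) i))

  encode-decode : ∀ {q} n (i : Fin (q ℕ.^ n)) → encode (decode n i) ≡ i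
  encode-decode zero    Fin.zero = refl
  encode-decode {q} (suc n) i = trans (cong (combine (proj₁ (remQuot {q} (q ℕ.^ n) i))) (encode-decode n _)) (Fin.combine-remQuot {q} (q ℕ.^ n) i)

  encode-injective : ∀ {q n} (u v : Vec (Fin q) n) → encode u ≡ encode v → u ≡ v
  encode-injective []      []      _ = refl
  encode-injective (x ∷ u) (y ∷ v) e with p , r ← Fin.combine-injective x (encode u) y (encode v) e =
    cong₂ _∷_ p (encode-injective u v r)

  -- Pigeonhole principle: a missed value y would extend f to an injection of n + 1 elements into n.
  injective⇒surjectiveFin : ∀ {n} (f : Fin n → Fin n) → (∀ {x y} → f x ≡ f y → x ≡ y) → ∀ y → ∃ λ x → f x ≡ y
  injective⇒surjectiveFin {n} f inj y with Fin.any? (λ x → f x Fin.≟ y)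
  ... | yes p = p
  ... | no ¬p = ⊥-elim (ℕ.1+n≰n (Fin.injective⇒≤ {f = g} g-injective))
    where
    g : Fin (suc n) → Fin n
    g Fin.zero    = y
    g (Fin.suc x) = f x
    g-injective : ∀ {x y} → g x ≡ g y → x ≡ y
    g-injective {Fin.zero}  {Fin.zero}  _ = refl
    g-injective {Fin.zero}  {Fin.suc x} e = ⊥-elim (¬p (x , sym e))
    g-injective {Fin.suc x} {Fin.zero}  e = ⊥-elim (¬p (x , e))
    g-injective {Fin.suc x} {Fin.suc y} e = cong Fin.suc (inj e)

  abstract
    injective⇒surjective : ∀ {q n} (f : Vec (Fin q) n → Vec (Fin q) n) → (∀ {x y} → f x ≡ f y → x ≡ y) → ∀ y → ∃ λ x → f x ≡ y
    injective⇒surjective {q} {n} f inj y = decode n (proj₁ preimage) , encode-injective _ _ (proj₂ preimage)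
      where
      g-injective : ∀ {i j} → encode (f (decode n i)) ≡ encode (f (decode n j)) → i ≡ j
      g-injective {i} {j} e = trans (sym (encode-decode n i)) (trans (cong encode (inj (encode-injective _ _ e))) (encode-decode n j))
      preimage : ∃ λ i → encode (f (decode n i)) ≡ encode y
      preimage = injective⇒surjectiveFin (encode ∘ f ∘ decode n) g-injective (encode y)

-- The polarity as an orthogonality relation on vectors

module Polar (q : ℕ) .{{_ : NonZero q}} (isField : Residues.IsOddField q) (P : SymplecticPolarity q) where
  open Residues q hiding (isCommutativeRing)
  F : Field
  F = residueField isField
  open Field F using (0#; 1#; _*_; _+_; _-_; -_; inverse; 1≢0; 2≢0; _≟_)
  open Algebra F
  open Lines F
  open Linear F
  open StandardForm F using (OrthogonalityLike)
  open Frames F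
  open SymplecticPolarity P using (ζ; antitonic; involutive; absolute)
  open Subspace

  _≟ᵥ_ : ∀ (u v : V) → Dec (u ≡ v)
  _≟ᵥ_ = Vec.≡-dec Fin._≟_

  isMultiple? : ∀ (u v : V) → Dec (∃ λ c → c *ᵥ u ≡ v)
  isMultiple? u v = Fin.any? λ c → (c *ᵥ u) ≟ᵥ v

  ⟨_⟩ : V → Subspace q
  ⟨ u ⟩ = record
    { member   = λ v → ⌊ isMultiple? u v ⌋
    ; 0-closed = fromWitness (0# , 0*ᵥ u)
    ; +-closed = λ v w p r → closed-+ v w (toWitness p) (toWitness r)
    ; *-closed = λ c v p → closed-* c v (toWitness p) }
    where
    closed-+ : ∀ v w → ∃ (λ c → c *ᵥ u ≡ v) → ∃ (λ c → c *ᵥ u ≡ w) → T ⌊ isMultiple? u (v +ᵥ w) ⌋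
    closed-+ _ _ (c , refl) (d , refl) = fromWitness (c + d , sym (distribᵥ c d u))
    closed-* : ∀ c v → ∃ (λ d → d *ᵥ u ≡ v) → T ⌊ isMultiple? u (c *ᵥ v) ⌋
    closed-* c _ (d , refl) = fromWitness (c * d , sym (assocᵥ c d u))

  ∈⟨⟩ : ∀ u → u ∈ ⟨ u ⟩
  ∈⟨⟩ u = fromWitness (1# , 1*ᵥ u)

  ⟨⟩⊆ : ∀ {u} (U : Subspace q) → u ∈ U → ⟨ u ⟩ ⊆ U
  ⟨⟩⊆ {u} U p v r with c , refl ← toWitness {a? = isMultiple? u v} r = *-closed U c u p

  point : ∀ u → u ≢ 0ᵥ → Point q
  point u u≢0 = ⟨ u ⟩ , (u ∷ []) ,
    (λ where (c ∷ []) e → cong (_∷ []) (cancelᵥ u≢0 (trans (sym (+ᵥ0 _)) e))) ,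
    λ v → mk⇔ (λ r → let c , e = toWitness {a? = isMultiple? u v} r in (c ∷ []) , trans (+ᵥ0 _) e)
              (λ where ((c ∷ []) , e) → fromWitness {a? = isMultiple? u v} (c , trans (sym (+ᵥ0 _)) e))

  _⟂_ : V → V → Set
  u ⟂ v = v ∈ ζ ⟨ u ⟩

  ⟂? : ∀ u v → Dec (u ⟂ v)
  ⟂? u v = T? _

  ⟂-sym : ∀ {u v} → u ⟂ v → v ⟂ u
  ⟂-sym {u} {v} p = antitonic (⟨⟩⊆ (ζ ⟨ u ⟩) p) u (proj₂ (involutive ⟨ u ⟩) u (∈⟨⟩ u))

  ⟂-zero : ∀ u → u ⟂ 0ᵥ
  ⟂-zero u = 0-closed (ζ ⟨ u ⟩)

  ⟂-refl : ∀ u → u ⟂ u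
  ⟂-refl u with u ≟ᵥ 0ᵥ
  ... | yes refl = ⟂-zero 0ᵥ
  ... | no u≢0 = absolute (point u u≢0) u (∈⟨⟩ u)

  isOrthogonalityLike : OrthogonalityLike _⟂_
  isOrthogonalityLike = record
    { R? = ⟂? ; +-closed = λ {u} p r → +-closed (ζ ⟨ u ⟩) _ _ p r ; *-closed = λ c {u} p → *-closed (ζ ⟨ u ⟩) c _ p
    ; R-sym = ⟂-sym ; R-refl = ⟂-refl ; R-zero = ⟂-zero }

  ∈ζ⇒⟂ : ∀ U {u v} → v ∈ ζ U → u ∈ U → u ⟂ v
  ∈ζ⇒⟂ U {u} {v} p r = antitonic (⟨⟩⊆ U r) v p

  -- By symmetry U lies in ζ ⟨v⟩, and reversing the inclusion puts v into ζ U. With `∈ζ⇒⟂` this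
  -- describes ζ on all subspaces by the relation on vectors.
  ⟂⇒∈ζ : ∀ U {v} → (∀ u → u ∈ U → u ⟂ v) → v ∈ ζ U
  ⟂⇒∈ζ U {v} h = antitonic {ζ ⟨ v ⟩} {U} (λ u r → ⟂-sym (h u r)) v (proj₂ (involutive ⟨ v ⟩) v (∈⟨⟩ v))

  -- ⟨ u ⟩ is an atom, hence ζ ⟨ u ⟩ is a coatom.
  hyperplane : ∀ {u v} → ¬ u ⟂ v → ∀ w → ∃ λ c → u ⟂ (w +ᵥ c *ᵥ v)
  hyperplane {u} {v} ¬u⟂v w = toWitness (proj₁ (involutive W) w (antitonic {⟨ 0ᵥ ⟩} {ζ W} ζW⊆0 w (⟂-sym (⟂-zero w))))
    where
    W? : ∀ w → Dec (∃ λ c → u ⟂ (w +ᵥ c *ᵥ v))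
    W? w = Fin.any? λ c → ⟂? u (w +ᵥ c *ᵥ v)
    shuffle-+ : ∀ w w′ v c c′ → (w +ᵥ c *ᵥ v) +ᵥ (w′ +ᵥ c′ *ᵥ v) ≡ (w +ᵥ w′) +ᵥ (c + c′) *ᵥ v
    shuffle-+ (_ ∷ _ ∷ _ ∷ _ ∷ []) (_ ∷ _ ∷ _ ∷ _ ∷ []) (_ ∷ _ ∷ _ ∷ _ ∷ []) c c′ = l _ _ _ ⹁ l _ _ _ ⹁ l _ _ _ ⹁ l _ _ _ ⹁ refl
      where l = λ w w′ v → solve 5 (λ w w′ v c c′ → w :+ c :* v :+ (w′ :+ c′ :* v) := w :+ w′ :+ (c :+ c′) :* v) refl w w′ v c c′
    shuffle-* : ∀ w v c k → k *ᵥ (w +ᵥ c *ᵥ v) ≡ k *ᵥ w +ᵥ (k * c) *ᵥ v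
    shuffle-* (_ ∷ _ ∷ _ ∷ _ ∷ []) (_ ∷ _ ∷ _ ∷ _ ∷ []) c k = l _ _ ⹁ l _ _ ⹁ l _ _ ⹁ l _ _ ⹁ refl
      where l = λ w v → solve 4 (λ w v c k → k :* (w :+ c :* v) := k :* w :+ k :* c :* v) refl w v c k
    -- W is ζ ⟨u⟩ + ⟨v⟩, and it is the whole space: ζ W lies in ζ ζ ⟨u⟩ = ⟨u⟩ and is orthogonal to
    -- v, so it is zero. Membership of w in W is the required existence of c.
    W : Subspace q
    W = record
      { member   = λ w → ⌊ W? w ⌋
      ; 0-closed = fromWitness (0# , subst (u ⟂_) (sym (trans (cong (0ᵥ +ᵥ_) (0*ᵥ v)) (+ᵥ0 0ᵥ))) (⟂-zero u))
      ; +-closed = λ w w′ p r → let c , a = toWitness {a? = W? w} p ; c′ , b = toWitness {a? = W? w′} r in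
          fromWitness (c + c′ , subst (u ⟂_) (shuffle-+ w w′ v c c′) (+-closed (ζ ⟨ u ⟩) _ _ a b))
      ; *-closed = λ k w p → let c , a = toWitness {a? = W? w} p in
          fromWitness (k * c , subst (u ⟂_) (shuffle-* w v c k) (*-closed (ζ ⟨ u ⟩) k _ a)) }
    ⊆W : ζ ⟨ u ⟩ ⊆ W
    ⊆W w p = fromWitness {a? = W? w} (0# , subst (u ⟂_) (sym (trans (cong (w +ᵥ_) (0*ᵥ v)) (+ᵥ0 w))) p)
    v∈W : v ∈ W
    v∈W = fromWitness {a? = W? v} (-1# , subst (u ⟂_) (sym (x-x≡0 v)) (⟂-zero u))
    ζW⊆0 : ζ W ⊆ ⟨ 0ᵥ ⟩
    ζW⊆0 z p with c , refl ← toWitness {a? = isMultiple? u z} (proj₁ (involutive ⟨ u ⟩) z (antitonic ⊆W z p)) | c ≟ 0#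
    ... | yes refl = subst (_∈ ⟨ 0ᵥ ⟩) (sym (0*ᵥ u)) (∈⟨⟩ 0ᵥ)
    ... | no c≢0 with i , i-inverse ← inverse c c≢0 = ⊥-elim (¬u⟂v (⟂-sym (subst (v ⟂_)
        (trans (assocᵥ i c u) (trans (cong (_*ᵥ u) (trans (*-comm i c) i-inverse)) (1*ᵥ u)))
        (*-closed (ζ ⟨ v ⟩) i _ (∈ζ⇒⟂ W p v∈W)))))

  nondegenerate : ∀ u → (∀ v → u ⟂ v) → u ≡ 0ᵥ
  nondegenerate u h with c , e ← toWitness {a? = isMultiple? 0ᵥ u} (proj₁ (involutive ⟨ 0ᵥ ⟩) u
      (antitonic {ζ ⟨ u ⟩} {ζ ⟨ 0ᵥ ⟩} (λ v _ → h v) u (proj₂ (involutive ⟨ u ⟩) u (∈⟨⟩ u)))) = trans (sym e) (*ᵥ0 c)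

  isPolar : IsPolar _⟂_
  isPolar = record
    { isOrthogonalityLike = isOrthogonalityLike ; hyperplane = hyperplane ; nondegenerate = nondegenerate
    ; inj⇒surj = Finite.injective⇒surjective }

-- Lines, spreads and their codes

module VectorLemmas (F : Field) where
  open Field F renaming (Carrier to A)
  open Algebra F
  open Lines F
  open Linear F
  open Frames F

  combination : A → V → A → V → V
  combination α x β y = α *ᵥ x +ᵥ β *ᵥ y

  eliminate : ∀ p r α β γ δ x y →
    combination p (combination α x β y) r (combination γ x δ y) ≡ combination (p * α + r * γ) x (p * β + r * δ) y
  eliminate p r α β γ δ (_ ∷ _ ∷ _ ∷ _ ∷ []) (_ ∷ _ ∷ _ ∷ _ ∷ []) = l _ _ ⹁ l _ _ ⹁ l _ _ ⹁ l _ _ ⹁ refl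
    where
    l = λ x y → solve 8 (λ p r α β γ δ x y → p :* (α :* x :+ β :* y) :+ r :* (γ :* x :+ δ :* y) :=
      (p :* α :+ r :* γ) :* x :+ (p :* β :+ r :* δ) :* y) refl p r α β γ δ x y

  combination-0 : ∀ {α β} x y → α ≡ 0# → β ≡ 0# → combination α x β y ≡ 0ᵥ
  combination-0 x y refl refl = trans (cong₂ _+ᵥ_ (0*ᵥ x) (0*ᵥ y)) (+ᵥ0 0ᵥ)

  Independent : V → V → Set
  Independent x y = ∀ α β → combination α x β y ≡ 0ᵥ → α ≡ 0# × β ≡ 0#

  neg≡0 : ∀ {a} → - a ≡ 0# → a ≡ 0#
  neg≡0 {a} e = by₁ -1# e (solve 1 (λ a → a :- #0 := (:- #1) :* ((:- a) :- #0)) refl a)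

  combination-10 : ∀ x y → combination 1# x 0# y ≡ x
  combination-10 x y = trans (cong₂ _+ᵥ_ (1*ᵥ x) (0*ᵥ y)) (+ᵥ0 x)

  combination-01 : ∀ x y → combination 0# x 1# y ≡ y
  combination-01 x y = trans (cong₂ _+ᵥ_ (0*ᵥ x) (1*ᵥ y)) (trans (+ᵥ-comm 0ᵥ y) (+ᵥ0 y))

  -- Cramer's rule. If the determinant vanished, the rows of the adjugate would give vanishing
  -- combinations of u and w, so all four coefficients and with them u would be zero.
  exchange : ∀ {x y u w} → (∃₂ λ α β → combination α x β y ≡ u) → (∃₂ λ γ δ → combination γ x δ y ≡ w) → Independent u w →
             (∃₂ λ p r → combination p u r w ≡ x) × (∃₂ λ p r → combination p u r w ≡ y)
  exchange {x} {y} (α , β , refl) (γ , δ , refl) independent with (α * δ - β * γ) ≟ 0#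
  ... | no D≢0 with i , i-inverse ← inverse _ D≢0 =
    (δ * i , - (β * i) , trans (eliminate _ _ α β γ δ x y) (trans (cong₂ (λ a b → combination a x b y)
      (by₁ 1# i-inverse (solve 5 (λ α β γ δ i → δ :* i :* α :+ (:- (β :* i)) :* γ :- #1 := #1 :* ((α :* δ :- β :* γ) :* i :- #1)) refl α β γ δ i))
      (solve 3 (λ β δ i → δ :* i :* β :+ (:- (β :* i)) :* δ := #0) refl β δ i)) (combination-10 x y))) ,
    (- (γ * i) , α * i , trans (eliminate _ _ α β γ δ x y) (trans (cong₂ (λ a b → combination a x b y)
      (solve 3 (λ α γ i → (:- (γ :* i)) :* α :+ α :* i :* γ := #0) refl α γ i)
      (by₁ 1# i-inverse (solve 5 (λ α β γ δ i → (:- (γ :* i)) :* β :+ α :* i :* δ :- #1 := #1 :* ((α :* δ :- β :* γ) :* i :- #1)) refl α β γ δ i))) (combination-01 x y)))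
  ... | yes D≡0 = ⊥-elim (1≢0 (proj₁ (independent 1# 0# (trans (combination-10 _ _) (combination-0 x y α≡0 β≡0)))))
    where
    first≡0 : δ ≡ 0# × - β ≡ 0#
    first≡0 = independent δ (- β) (trans (eliminate _ _ α β γ δ x y) (combination-0 x y
      (by₁ 1# D≡0 (solve 4 (λ α β γ δ → δ :* α :+ (:- β) :* γ :- #0 := #1 :* (α :* δ :- β :* γ :- #0)) refl α β γ δ))
      (solve 2 (λ β δ → δ :* β :+ (:- β) :* δ := #0) refl β δ)))
    second≡0 : - γ ≡ 0# × α ≡ 0#
    second≡0 = independent (- γ) α (trans (eliminate _ _ α β γ δ x y) (combination-0 x y
      (solve 2 (λ α γ → (:- γ) :* α :+ α :* γ := #0) refl α γ)
      (by₁ 1# D≡0 (solve 4 (λ α β γ δ → (:- γ) :* β :+ α :* δ :- #0 := #1 :* (α :* δ :- β :* γ :- #0)) refl α β γ δ))))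
    α≡0 = proj₂ second≡0
    β≡0 = neg≡0 (proj₂ first≡0)

  form-combinationʳ : ∀ z α x β y → form z (combination α x β y) ≡ α * form z x + β * form z y
  form-combinationʳ z α x β y = trans (form-+ʳ z _ _) (cong₂ _+_ (form-*ʳ z α x) (form-*ʳ z β y))

  form-combinationˡ : ∀ z α x β y → form (combination α x β y) z ≡ α * form x z + β * form y z
  form-combinationˡ z α x β y = trans (form-+ˡ (α *ᵥ x) (β *ᵥ y) z) (cong₂ _+_ (form-*ˡ α x z) (form-*ˡ β y z))

  form-0ˡ : ∀ y → form 0ᵥ y ≡ 0#
  form-0ˡ (x ∷ y ∷ z ∷ w ∷ []) = solve 4 (λ x y z w → #0 :* y :- #0 :* x :+ (#0 :* w :- #0 :* z) := #0) refl x y z w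
  form-0ʳ : ∀ y → form y 0ᵥ ≡ 0#
  form-0ʳ (x ∷ y ∷ z ∷ w ∷ []) = solve 4 (λ x y z w → x :* #0 :- y :* #0 :+ (z :* #0 :- w :* #0) := #0) refl x y z w

  form≢0⇒independent : ∀ {x y} → form x y ≢ 0# → Independent x y
  form≢0⇒independent {x} {y} f≢0 α β e =
    noZeroDivisor f≢0 (by₂ 1# (- β) (trans (sym (form-combinationˡ y α x β y)) (trans (cong (λ z → form z y) e) (form-0ˡ y))) (form-alternating y)
      (solve 4 (λ a b f g → f :* a :- #0 := #1 :* (a :* f :+ b :* g :- #0) :+ (:- b) :* (g :- #0)) refl α β (form x y) (form y y))) ,
    noZeroDivisor f≢0 (by₂ 1# (- α) (trans (sym (form-combinationʳ x α x β y)) (trans (cong (form x) e) (form-0ʳ x))) (form-alternating x)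
      (solve 4 (λ a b f g → f :* b :- #0 := #1 :* (a :* g :+ b :* f :- #0) :+ (:- a) :* (g :- #0)) refl α β (form x y) (form x x)))

  -- Self-adjointness moves `inv v` across the form, so y + `inv v y` pairs with z as y pairs with z
  -- + `inv v z`. The latter vector is fixed; hence y + `inv v y` is orthogonal to everything and
  -- vanishes.
  perpFixed : ∀ v → norm v ≡ 1# → ∀ y → (∀ x → Fixed v x → form x y ≡ 0#) → Fixed (neg₅ v) y
  perpFixed v n y h = trans (inv-neg v y) (sym (+-ᵥ y (-ᵥ inv v y) (trans (cong (y +ᵥ_) (-ᵥ-involutive (inv v y)))
    (form-nondegenerate _ λ z → trans (form-+ˡ y (inv v y) z) (trans (cong (form y z +_) (inv-selfAdjoint v y z))
      (trans (sym (form-+ʳ y z (inv v z))) (trans (form-anti (z +ᵥ inv v z) y) (trans (cong -_ (h _ (fixedPart v n z))) neg0))))))))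
    where
    neg0 : - 0# ≡ 0#
    neg0 = solve 0 (:- #0 := #0) refl

  fixed-perp : ∀ v x y → Fixed v x → Fixed (neg₅ v) y → form x y ≡ 0#
  fixed-perp v x y p r = noZeroDivisor 2≢0 (by₁ 1# (begin
      form x y                ≡⟨ cong (λ x → form x y) p ⟨
      form (inv v x) y        ≡⟨ inv-selfAdjoint v x y ⟩
      form x (inv v y)        ≡⟨ cong (form x) (-ᵥ-involutive (inv v y)) ⟨
      form x (-ᵥ -ᵥ inv v y)  ≡⟨ cong (λ y → form x (-ᵥ y)) (trans (sym (inv-neg v y)) r) ⟩
      form x (-ᵥ y)           ≡⟨ form-*ʳ x -1# y ⟩
      -1# * form x y          ∎)
    (solve 1 (λ f → (#1 :+ #1) :* f :- #0 := #1 :* (f :- (:- #1) :* f)) refl (form x y)))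
    where open ≡-Reasoning

module Spreads (q : ℕ) .{{_ : NonZero q}} (isField : Residues.IsOddField q) (P : SymplecticPolarity q) where
  open Polar q isField P
  open Field F using (0#; 1#; _*_; _+_; _-_; -_; inverse; 1≢0; 2≢0; _≟_)
  open Algebra F
  open Lines F
  open Linear F
  open Frames F hiding (module Frame)
  open VectorLemmas F
  open SymplecticPolarity P using (ζ)
  open Subspace

  module LineBasis (ℓ : Line q) where
    b₁ b₂ : V
    b₁ = head (proj₁ (proj₂ ℓ))
    b₂ = head (tail (proj₁ (proj₂ ℓ)))

    fromBasis : ∀ {w} → w ∈ proj₁ ℓ → ∃₂ λ α β → combination α b₁ β b₂ ≡ w
    fromBasis {w} p with x ∷ y ∷ [] , _ , spans ← proj₂ ℓ with (α ∷ β ∷ []) , e ← Equivalence.to (spans w) p =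
      α , β , trans (cong (α *ᵥ x +ᵥ_) (sym (+ᵥ0 _))) e

    toLine : ∀ α β → combination α b₁ β b₂ ∈ proj₁ ℓ
    toLine α β with x ∷ y ∷ [] , _ , spans ← proj₂ ℓ =
      Equivalence.from (spans _) ((α ∷ β ∷ []) , cong (α *ᵥ x +ᵥ_) (+ᵥ0 _))

    b₁∈ : b₁ ∈ proj₁ ℓ
    b₁∈ = subst (_∈ proj₁ ℓ) (combination-10 b₁ b₂) (toLine 1# 0#)

    b₂∈ : b₂ ∈ proj₁ ℓ
    b₂∈ = subst (_∈ proj₁ ℓ) (combination-01 b₁ b₂) (toLine 0# 1#)

    independent : Independent b₁ b₂
    independent α β e with x ∷ y ∷ [] , li , _ ← proj₂ ℓ
      with refl ← li (α ∷ β ∷ []) (trans (cong (α *ᵥ x +ᵥ_) (+ᵥ0 _)) e) = refl , refl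

    b₁≢0 : b₁ ≢ 0ᵥ
    b₁≢0 e = 1≢0 (proj₁ (independent 1# 0# (trans (combination-10 b₁ b₂) e)))

    basis⊆ : ∀ (U : Subspace q) → b₁ ∈ U → b₂ ∈ U → proj₁ ℓ ⊆ U
    basis⊆ U p r w w∈ with α , β , refl ← fromBasis w∈ = +-closed U _ _ (*-closed U α _ p) (*-closed U β _ r)

  line⊆⇒⊇ : ∀ (ℓ m : Line q) → proj₁ ℓ ⊆ proj₁ m → proj₁ m ⊆ proj₁ ℓ
  line⊆⇒⊇ ℓ m ℓ⊆m = M.basis⊆ (proj₁ ℓ) (belongs (proj₁ swapped)) (belongs (proj₂ swapped))
    where
    module L = LineBasis ℓ
    module M = LineBasis m
    swapped = exchange (M.fromBasis (ℓ⊆m _ L.b₁∈)) (M.fromBasis (ℓ⊆m _ L.b₂∈)) L.independent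
    belongs : ∀ {z} → (∃₂ λ p r → combination p L.b₁ r L.b₂ ≡ z) → z ∈ proj₁ ℓ
    belongs (p , r , refl) = L.toLine p r

  ≈ₗ-sym : ∀ {ℓ m : Line q} → ℓ ≈ₗ m → m ≈ₗ ℓ
  ≈ₗ-sym (p , r) = r , p

  ≈ₗ-trans : ∀ {ℓ m n : Line q} → ℓ ≈ₗ m → m ≈ₗ n → ℓ ≈ₗ n
  ≈ₗ-trans (p , p′) (r , r′) = (λ v → r v ∘ p v) , (λ v → p′ v ∘ r′ v)

  generator : Point q → V
  generator x = head (proj₁ (proj₂ x))

  generator∈ : ∀ x → generator x ∈ proj₁ x
  generator∈ (U , g ∷ [] , _ , spans) = Equivalence.from (spans g) ((1# ∷ []) , trans (+ᵥ0 _) (1*ᵥ g))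

  generates : ∀ x {v} → v ∈ proj₁ x → ∃ λ c → c *ᵥ generator x ≡ v
  generates (U , g ∷ [] , _ , spans) {v} p with (c ∷ []) , e ← Equivalence.to (spans v) p = c , trans (sym (+ᵥ0 _)) e

  generator≢0 : ∀ x → generator x ≢ 0ᵥ
  generator≢0 (U , g ∷ [] , li , _) refl = 1≢0 (cong head (li (1# ∷ []) (trans (+ᵥ0 _) (*ᵥ0 1#))))

  point⊆ : ∀ x (U : Subspace q) → generator x ∈ U → proj₁ x ⊆ U
  point⊆ x U p v v∈ with c , refl ← generates x v∈ = *-closed U c _ p

  on⇒∈ : ∀ x (ℓ : Line q) → x on ℓ → generator x ∈ proj₁ ℓ
  on⇒∈ x ℓ p = p _ (generator∈ x)

  orthogonal⇒⟂ : ∀ x y → Orthogonal P x y → generator x ⟂ generator y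
  orthogonal⇒⟂ x y o = ∈ζ⇒⟂ (proj₁ x) (o _ (generator∈ y)) (generator∈ x)

  ⟂-combination : ∀ {u x y} α β → u ⟂ x → u ⟂ y → u ⟂ combination α x β y
  ⟂-combination {u} α β p r = +-closed (ζ ⟨ u ⟩) _ _ (*-closed (ζ ⟨ u ⟩) α _ p) (*-closed (ζ ⟨ u ⟩) β _ r)

  ⟂-* : ∀ {u x} c → u ⟂ x → u ⟂ (c *ᵥ x)
  ⟂-* {u} c p = *-closed (ζ ⟨ u ⟩) c _ p

  ⟂⇒orthogonal : ∀ x y → generator x ⟂ generator y → Orthogonal P x y
  ⟂⇒orthogonal x y p = point⊆ y (ζ (proj₁ x)) (⟂⇒∈ζ (proj₁ x) λ u u∈ → multiple (generates x u∈))
    where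
    multiple : ∀ {u} → (∃ λ c → c *ᵥ generator x ≡ u) → u ⟂ generator y
    multiple (c , refl) = ⟂-sym (⟂-* c (⟂-sym p))

  pointwise⇒⟂ : ∀ (ℓ m : Line q) → (∀ x y → x on ℓ → y on m → Orthogonal P x y) → ∀ {u w} → u ∈ proj₁ ℓ → w ∈ proj₁ m → u ⟂ w
  pointwise⇒⟂ ℓ m orthogonal {u} {w} u∈ w∈ with u ≟ᵥ 0ᵥ | w ≟ᵥ 0ᵥ
  ... | yes refl | _        = ⟂-sym (⟂-zero w)
  ... | no _     | yes refl = ⟂-zero u
  ... | no u≢0   | no w≢0   = orthogonal⇒⟂ (point u u≢0) (point w w≢0)
    (orthogonal (point u u≢0) (point w w≢0) (⟨⟩⊆ (proj₁ ℓ) u∈) (⟨⟩⊆ (proj₁ m) w∈))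

  -- The nontrivial inclusion of ζ ℓ in ℓ is read off in a frame with ℓ = ⟨ε₁, ε₃⟩. To obtain one,
  -- b₂ is replaced by g = b₂ + d b₁, which is orthogonal to a vector f not orthogonal to b₁.
  isotropicBasis⇒isotropic : ∀ ℓ → LineBasis.b₁ ℓ ⟂ LineBasis.b₂ ℓ → TotallyIsotropic P ℓ
  isotropicBasis⇒isotropic ℓ b₁⟂b₂ = ζℓ⊆ℓ , ℓ⊆ζℓ
    where
    open LineBasis ℓ
    pairwise : ∀ u w → u ∈ proj₁ ℓ → w ∈ proj₁ ℓ → u ⟂ w
    pairwise u w u∈ w∈ with α , β , refl ← fromBasis u∈ | γ , δ , refl ← fromBasis w∈ =
      ⟂-combination γ δ (⟂-sym (⟂-combination α β (⟂-refl b₁) b₁⟂b₂))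
                        (⟂-sym (⟂-combination α β (⟂-sym b₁⟂b₂) (⟂-refl b₂)))
    ℓ⊆ζℓ : proj₁ ℓ ⊆ ζ (proj₁ ℓ)
    ℓ⊆ζℓ w w∈ = ⟂⇒∈ζ (proj₁ ℓ) λ u u∈ → pairwise u w u∈ w∈
    f = proj₁ (nonOrthogonal isPolar b₁≢0)
    ¬b₁⟂f = proj₂ (nonOrthogonal isPolar b₁≢0)
    d = proj₁ (hyperplane (¬b₁⟂f ∘ ⟂-sym) b₂)
    f⟂g = proj₂ (hyperplane (¬b₁⟂f ∘ ⟂-sym) b₂)
    g = b₂ +ᵥ d *ᵥ b₁
    g≡ : g ≡ combination d b₁ 1# b₂
    g≡ = trans (+ᵥ-comm b₂ (d *ᵥ b₁)) (cong (d *ᵥ b₁ +ᵥ_) (sym (1*ᵥ b₂)))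
    b₁⟂g : b₁ ⟂ g
    b₁⟂g = subst (b₁ ⟂_) (sym g≡) (⟂-combination d 1# (⟂-refl b₁) b₁⟂b₂)
    open FrameAt (frameAt isPolar ¬b₁⟂f b₁⟂g f⟂g (λ g≡0 → 1≢0 (proj₂ (independent d 1# (trans (sym g≡) g≡0)))))
    formOf : ∀ {u w z} → from z ≡ u → u ⟂ w → form z (to w) ≡ 0#
    formOf {u} {w} {z} refl p = subst (λ z → form z (to w) ≡ 0#) (to∘from z) (orth⇒form (from z) w p)
    ζℓ⊆ℓ : ζ (proj₁ ℓ) ⊆ proj₁ ℓ
    ζℓ⊆ℓ w w∈ = subst (_∈ proj₁ ℓ) (from∘to w) (subst (λ z → from z ∈ proj₁ ℓ) (sym to-w)
        (subst (_∈ proj₁ ℓ) (sym (trans (additive (a *ᵥ ε₁) (c *ᵥ ε₃)) (cong₂ _+ᵥ_ (trans (homogeneous a ε₁) (cong (a *ᵥ_) from-ε₁)) (trans (homogeneous c ε₃) (cong (c *ᵥ_) from-ε₃)))))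
          (+-closed (proj₁ ℓ) _ _ (*-closed (proj₁ ℓ) a _ b₁∈) (*-closed (proj₁ ℓ) c _ g∈))))
      where
      open IsLinear from-linear
      a = first (to w)
      c = third (to w)
      g∈ : g ∈ proj₁ ℓ
      g∈ = subst (_∈ proj₁ ℓ) (sym g≡) (toLine d 1#)
      coordinates : ∀ z → form ε₁ z ≡ 0# → form ε₃ z ≡ 0# → z ≡ combination (first z) ε₁ (third z) ε₃
      coordinates (x ∷ y ∷ z ∷ w ∷ []) p r =
        solve 2 (λ x z → x := x :* #1 :+ z :* #0) refl x z ⹁
        by₁ 1# p (solve 4 (λ x y z w → y :- (x :* #0 :+ z :* #0) := #1 :* (#1 :* y :- #0 :* x :+ (#0 :* w :- #0 :* z) :- #0)) refl x y z w) ⹁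
        solve 2 (λ x z → z := x :* #0 :+ z :* #1) refl x z ⹁
        by₁ 1# r (solve 4 (λ x y z w → w :- (x :* #0 :+ z :* #0) := #1 :* (#0 :* y :- #0 :* x :+ (#1 :* w :- #0 :* z) :- #0)) refl x y z w) ⹁ refl
      to-w : to w ≡ combination (first (to w)) ε₁ (third (to w)) ε₃
      to-w = coordinates (to w) (formOf from-ε₁ (∈ζ⇒⟂ (proj₁ ℓ) w∈ b₁∈)) (formOf from-ε₃ (∈ζ⇒⟂ (proj₁ ℓ) w∈ g∈))

module FrameLines (q : ℕ) .{{_ : NonZero q}} (isField : Residues.IsOddField q) (P : SymplecticPolarity q) where
  open Polar q isField P
  open Field F using (0#; 1#; _*_; _+_; _-_; -_; inverse; 1≢0; 2≢0; _≟_)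
  open Algebra F
  open Lines F
  open Linear F
  open Frames F
  open VectorLemmas F
  open SymplecticPolarity P using (ζ)
  open Spreads q isField P
  open Subspace

  Coordinates : Set
  Coordinates = Frame _⟂_

  module _ (C : Coordinates) where
    open Frame C

    fixed? : ∀ v w → Dec (Fixed v (to w))
    fixed? v w = inv v (to w) ≟ᵥ to w

    lineSubspace : Vec (𝔽 q) 5 → Subspace q
    lineSubspace v = record
      { member   = λ w → ⌊ fixed? v w ⌋
      ; 0-closed = fromWitness {a? = fixed? v 0ᵥ} (subst (Fixed v) (sym (linear-0 to-linear)) (Fixed-0 v))
      ; +-closed = λ u w p r → fromWitness {a? = fixed? v (u +ᵥ w)} (subst (Fixed v) (sym (IsLinear.additive to-linear u w))
          (Fixed-+ v (toWitness {a? = fixed? v u} p) (toWitness {a? = fixed? v w} r)))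
      ; *-closed = λ c w p → fromWitness {a? = fixed? v (c *ᵥ w)} (subst (Fixed v) (sym (IsLinear.homogeneous to-linear c w))
          (Fixed-* v c (toWitness {a? = fixed? v w} p))) }

    Fixed⇒∈ : ∀ v w → Fixed v (to w) → w ∈ lineSubspace v
    Fixed⇒∈ v w = fromWitness {a? = fixed? v w}

    ∈⇒Fixed : ∀ v w → w ∈ lineSubspace v → Fixed v (to w)
    ∈⇒Fixed v w = toWitness {a? = fixed? v w}

    from-combination : ∀ α x β y → from (combination α x β y) ≡ combination α (from x) β (from y)
    from-combination α x β y = trans (IsLinear.additive from-linear (α *ᵥ x) (β *ᵥ y))
      (cong₂ _+ᵥ_ (IsLinear.homogeneous from-linear α x) (IsLinear.homogeneous from-linear β y))

    lineOf : ∀ v → norm v ≡ 1# → Line q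
    lineOf v n = lineSubspace v , (from x ∷ from y ∷ []) , independent , λ w → mk⇔ (forward w) (backward w)
      where
      open HyperbolicBasis (hyperbolicBasis v n)
      independent : LinearlyIndependent (from x ∷ from y ∷ [])
      independent (α ∷ β ∷ []) e = cong₂ (λ a b → a ∷ b ∷ []) (proj₁ both) (proj₂ both)
        where
        open ≡-Reasoning
        both : α ≡ 0# × β ≡ 0#
        both = form≢0⇒independent form≢0 α β (begin
          combination α x β y                       ≡⟨ to∘from _ ⟨
          to (from (combination α x β y))           ≡⟨ cong to (from-combination α x β y) ⟩
          to (combination α (from x) β (from y))    ≡⟨ cong to (trans (cong (α *ᵥ from x +ᵥ_) (sym (+ᵥ0 _))) e) ⟩
          to 0ᵥ                                     ≡⟨ linear-0 to-linear ⟩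
          0ᵥ                                        ∎)
      forward : ∀ w → w ∈ lineSubspace v → ∃ λ c → linearCombination c (from x ∷ from y ∷ []) ≡ w
      forward w p = let α , β , e = spanning (∈⇒Fixed v w p) in
        (α ∷ β ∷ []) , trans (cong (α *ᵥ from x +ᵥ_) (+ᵥ0 _)) (trans (sym (from-combination α x β y)) (trans (cong from e) (from∘to w)))
      backward : ∀ w → (∃ λ c → linearCombination c (from x ∷ from y ∷ []) ≡ w) → w ∈ lineSubspace v
      backward w ((α ∷ β ∷ []) , e) = Fixed⇒∈ v w (subst (Fixed v) fixed≡ (Fixed-+ v (Fixed-* v α fixed-x) (Fixed-* v β fixed-y)))
        where
        fixed≡ : combination α x β y ≡ to w
        fixed≡ = trans (sym (to∘from _)) (cong to (trans (from-combination α x β y) (trans (cong (α *ᵥ from x +ᵥ_) (sym (+ᵥ0 _))) e)))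

    -- The line of S is compared with the code v by its vectors only. Under a change of coordinates
    -- the line stays the same and just the condition `Fixed` has to be translated.
    record InSpread (S : LineSet q) (v : Vec (𝔽 q) 5) : Set where
      constructor mkInSpread
      field
        line     : Line q
        line∈    : line ∈ₗ S
        ∈⇒fixed  : ∀ w → w ∈ proj₁ line → Fixed v (to w)
        fixed⇒∈  : ∀ w → Fixed v (to w) → w ∈ proj₁ line

    capture : ∀ {S} ℓ v → norm v ≡ 1# → ℓ ∈ₗ S → Fixed v (to (LineBasis.b₁ ℓ)) → Fixed v (to (LineBasis.b₂ ℓ)) → InSpread S v
    capture ℓ v n ℓ∈ p r = mkInSpread ℓ ℓ∈ (λ w → ∈⇒Fixed v w ∘ ℓ⊆ w) (λ w → ⊆ℓ w ∘ Fixed⇒∈ v w)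
      where
      ℓ⊆ : proj₁ ℓ ⊆ lineSubspace v
      ℓ⊆ = LineBasis.basis⊆ ℓ (lineSubspace v) (Fixed⇒∈ v _ p) (Fixed⇒∈ v _ r)
      ⊆ℓ : lineSubspace v ⊆ proj₁ ℓ
      ⊆ℓ = line⊆⇒⊇ ℓ (lineOf v n) ℓ⊆

  module SpecialSpreadProperties (𝒮 : SpecialSpread P) where
    S = proj₁ 𝒮
    open IsSpecialSpread (proj₂ 𝒮)

    lineAt : ∀ u → u ≢ 0ᵥ → ∃ λ ℓ → ℓ ∈ₗ S × u ∈ proj₁ ℓ
    lineAt u u≢0 = let ℓ , (ℓ∈ , u-on) , _ = isSpread (point u u≢0) in ℓ , ℓ∈ , u-on u (∈⟨⟩ u)

    sameLine : ∀ {u} → u ≢ 0ᵥ → ∀ ℓ m → ℓ ∈ₗ S → m ∈ₗ S → u ∈ proj₁ ℓ → u ∈ proj₁ m → ℓ ≈ₗ m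
    sameLine {u} u≢0 ℓ m ℓ∈ m∈ u∈ℓ u∈m = let n , _ , unique = isSpread (point u u≢0) in
      ≈ₗ-trans {ℓ} {n} {m} (≈ₗ-sym {n} {ℓ} (unique (ℓ∈ , ⟨⟩⊆ (proj₁ ℓ) u∈ℓ))) (unique (m∈ , ⟨⟩⊆ (proj₁ m) u∈m))

    hyperbolic : ∀ ℓ → ℓ ∈ₗ S → ¬ LineBasis.b₁ ℓ ⟂ LineBasis.b₂ ℓ
    hyperbolic ℓ ℓ∈ = notTotallyIsotropic ℓ ℓ∈ ∘ isotropicBasis⇒isotropic ℓ

    module _ (C : Coordinates) where
      open Frame C

      form-on : ∀ ℓ → ℓ ∈ₗ S → form (to (LineBasis.b₁ ℓ)) (to (LineBasis.b₂ ℓ)) ≢ 0#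
      form-on ℓ ℓ∈ = hyperbolic ℓ ℓ∈ ∘ form⇒orth _ _

      coded : ∀ ℓ → ℓ ∈ₗ S → ∃ λ v → norm v ≡ 1# × InSpread C S v × (∀ w → w ∈ proj₁ ℓ → Fixed v (to w))
      coded ℓ ℓ∈ = let v , n , p , r = lineThrough _ _ (form-on ℓ ℓ∈) in
        v , n , capture C ℓ v n ℓ∈ p r , InSpread.∈⇒fixed (capture C {S} ℓ v n ℓ∈ p r)

      codeAt : ∀ p → p ≢ 0ᵥ → ∃ λ v → norm v ≡ 1# × InSpread C S v × Fixed v p
      codeAt p p≢0 = let ℓ , ℓ∈ , u∈ = lineAt (from p) (from≢0 C p≢0) ; v , n , i , fixed = coded ℓ ℓ∈ in
        v , n , i , subst (Fixed v) (to∘from p) (fixed (from p) u∈)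

      memberThrough : ∀ y z w → ∃₂ λ a b → InSpread C S (through 1# y z w a b) × norm (through 1# y z w a b) ≡ 1# × Fixed (through 1# y z w a b) (1# ∷ y ∷ z ∷ w ∷ [])
      memberThrough y z w =
        let v , n , i , fixed = codeAt (1# ∷ y ∷ z ∷ w ∷ []) (1≢0 ∘ cong first)
            a , b , e = fixed⇒through v y z w fixed in
        a , b , subst (InSpread C S) e i , subst (λ v → norm v ≡ 1#) e n , subst (λ v → Fixed v (1# ∷ y ∷ z ∷ w ∷ [])) e fixed

      -- Two lines of a spread through the same point coincide. In this form the lemma contradicts a
      -- line through p that meets a line of the configuration missing p.
      noConflict : ∀ {v w r p} → InSpread C S v → InSpread C S w → r ≢ 0ᵥ → Fixed v r → Fixed w r → Fixed v p → Fixed w p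
      noConflict {v} {w} {r} {p} (mkInSpread ℓ ℓ∈ ∈⇒v v⇒∈) (mkInSpread m m∈ ∈⇒w w⇒∈) r≢0 vr wr vp =
        subst (Fixed w) (to∘from p) (∈⇒w (from p) (proj₁ same (from p) (v⇒∈ (from p) (subst (Fixed v) (sym (to∘from p)) vp))))
        where
        same : ℓ ≈ₗ m
        same = sameLine (from≢0 C r≢0) ℓ m ℓ∈ m∈ (v⇒∈ (from r) (subst (Fixed v) (sym (to∘from r)) vr)) (w⇒∈ (from r) (subst (Fixed w) (sym (to∘from r)) wr))

      -- The partner of a line consists of vectors orthogonal to it, which `perpFixed` places on the
      -- line of -v. This is where being special is used, and why configurations need one vector per
      -- pair of lines.
      negated : ∀ {v} → norm v ≡ 1# → InSpread C S v → InSpread C S (neg₅ v)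
      negated {v} n (mkInSpread ℓ ℓ∈ ∈⇒v v⇒∈) = let m , (m∈ , orthogonal) , _ = partner ℓ ℓ∈ in
        capture C m (neg₅ v) (trans (norm-neg v) n) m∈
          (perpendicular m orthogonal _ (LineBasis.b₁∈ m)) (perpendicular m orthogonal _ (LineBasis.b₂∈ m))
        where
        perpendicular : ∀ (m : Line q) → (∀ x y → x on ℓ → y on m → Orthogonal P x y) → ∀ w → w ∈ proj₁ m → Fixed (neg₅ v) (to w)
        perpendicular m orthogonal w w∈ = perpFixed v n (to w) λ x fixed → subst (λ x → form x (to w) ≡ 0#) (to∘from x)
          (orth⇒form (from x) w (pointwise⇒⟂ ℓ m orthogonal (v⇒∈ (from x) (subst (Fixed v) (sym (to∘from x)) fixed)) w∈))

  -- The list contains both signs, thus one vector per line of the spread rather than one per pair.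
  record IsCode (L : List (Vec (𝔽 q) 5)) : Set where
    field
      unit       : ∀ {v} → v ∈ˡ L → norm v ≡ 1#
      neg-closed : ∀ {v} → v ∈ˡ L → neg₅ v ∈ˡ L
      covers     : ∀ p → p ≢ 0ᵥ → ∃ λ v → v ∈ˡ L × Fixed v p
      disjoint   : ∀ {v w p} → v ∈ˡ L → w ∈ˡ L → p ≢ 0ᵥ → Fixed v p → Fixed w p → v ≡ w

  module CodedSpread (C : Coordinates) {L : List (Vec (𝔽 q) 5)} (isCode : IsCode L) where
    open Frame C
    open IsCode isCode

    Fits : Line q → Vec (𝔽 q) 5 → Set
    Fits ℓ v = Fixed v (to (LineBasis.b₁ ℓ)) × Fixed v (to (LineBasis.b₂ ℓ))

    fits? : ∀ ℓ v → Dec (Fits ℓ v)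
    fits? ℓ v = fixed? C v (LineBasis.b₁ ℓ) ×-dec fixed? C v (LineBasis.b₂ ℓ)

    fits⇒⊆ : ∀ ℓ v → Fits ℓ v → proj₁ ℓ ⊆ lineSubspace C v
    fits⇒⊆ ℓ v (p , r) = LineBasis.basis⊆ ℓ (lineSubspace C v) (Fixed⇒∈ C v _ p) (Fixed⇒∈ C v _ r)

    ⊆⇒fits : ∀ ℓ v → proj₁ ℓ ⊆ lineSubspace C v → Fits ℓ v
    ⊆⇒fits ℓ v ⊆v = ∈⇒Fixed C v _ (⊆v _ (LineBasis.b₁∈ ℓ)) , ∈⇒Fixed C v _ (⊆v _ (LineBasis.b₂∈ ℓ))

    member? : ∀ ℓ → Dec (Any (Fits ℓ) L)
    member? ℓ = Any.any? (fits? ℓ) L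

    lineSet : LineSet q
    lineSet = record
      { member = λ ℓ → ⌊ member? ℓ ⌋
      ; resp-≈ = λ {ℓ} {m} ℓ≈m p → fromWitness {a? = member? m}
          (Any.map (λ {v} f → ⊆⇒fits m v (λ w → fits⇒⊆ ℓ v f w ∘ proj₂ ℓ≈m w)) (toWitness {a? = member? ℓ} p)) }

    ∈⇒code : ∀ ℓ → ℓ ∈ₗ lineSet → ∃ λ v → v ∈ˡ L × proj₁ ℓ ⊆ lineSubspace C v
    ∈⇒code ℓ p = let v , v∈ , f = find (toWitness {a? = member? ℓ} p) in v , v∈ , fits⇒⊆ ℓ v f

    code⇒∈ : ∀ {v} (v∈ : v ∈ˡ L) → lineOf C v (unit v∈) ∈ₗ lineSet
    code⇒∈ {v} v∈ = fromWitness {a? = member? (lineOf C v (unit v∈))} (lose v∈ (⊆⇒fits (lineOf C v (unit v∈)) v (λ _ p → p)))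

    inSpread : ∀ {v} → v ∈ˡ L → InSpread C lineSet v
    inSpread {v} v∈ = mkInSpread (lineOf C v (unit v∈)) (code⇒∈ v∈) (∈⇒Fixed C v) (Fixed⇒∈ C v)

    ⊆same⇒≈ : ∀ ℓ m {v} (v∈ : v ∈ˡ L) → proj₁ ℓ ⊆ lineSubspace C v → proj₁ m ⊆ lineSubspace C v → ℓ ≈ₗ m
    ⊆same⇒≈ ℓ m {v} v∈ p r =
      (λ w → line⊆⇒⊇ m (lineOf C v (unit v∈)) r w ∘ p w) , (λ w → line⊆⇒⊇ ℓ (lineOf C v (unit v∈)) p w ∘ r w)

    isSpread : IsSpread lineSet
    isSpread x = let v , v∈ , fixed = covers (to (generator x)) (to≢0 C (generator≢0 x)) in
      lineOf C v (unit v∈) , (code⇒∈ v∈ , point⊆ x (lineSubspace C v) (Fixed⇒∈ C v _ fixed)) , λ {m} → unique v∈ fixed {m}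
      where
      unique : ∀ {v} (v∈ : v ∈ˡ L) → Fixed v (to (generator x)) → ∀ {m} → m ∈ₗ lineSet × x on m → lineOf C v (unit v∈) ≈ₗ m
      unique {v} v∈ fixed {m} (m∈ , x-on) = ⊆same⇒≈ (lineOf C v (unit v∈)) m v∈ (λ _ p → p)
        (let w , w∈ , m⊆ = ∈⇒code m m∈ in
         subst (λ w → proj₁ m ⊆ lineSubspace C w) (sym (disjoint v∈ w∈ (to≢0 C (generator≢0 x)) fixed (∈⇒Fixed C w _ (m⊆ _ (on⇒∈ x m x-on))))) m⊆)

    coded⇒form≢0 : ∀ v (n : norm v ≡ 1#) → let open LineBasis (lineOf C v n) in ¬ b₁ ⟂ b₂
    coded⇒form≢0 v n p = HyperbolicBasis.form≢0 (hyperbolicBasis v n)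
      (subst₂ (λ x y → form x y ≡ 0#) (to∘from _) (to∘from _) (orth⇒form _ _ p))

    isSpecialSpread : IsSpecialSpread P lineSet
    isSpecialSpread = record { isSpread = isSpread ; notTotallyIsotropic = notIsotropic ; partner = partner }
      where
      module _ (ℓ : Line q) {v : Vec (𝔽 q) 5} (v∈ : v ∈ˡ L) (ℓ⊆ : proj₁ ℓ ⊆ lineSubspace C v) where
        ⊇ : lineSubspace C v ⊆ proj₁ ℓ
        ⊇ = line⊆⇒⊇ ℓ (lineOf C v (unit v∈)) ℓ⊆
        notIsotropic′ : ¬ TotallyIsotropic P ℓ
        notIsotropic′ (_ , ℓ⊆ζℓ) = coded⇒form≢0 v (unit v∈)
          (∈ζ⇒⟂ (proj₁ ℓ) (ℓ⊆ζℓ _ (⊇ _ (LineBasis.b₂∈ (lineOf C v (unit v∈))))) (⊇ _ (LineBasis.b₁∈ (lineOf C v (unit v∈)))))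
        perp : Line q
        perp = lineOf C (neg₅ v) (unit (neg-closed v∈))
        orthogonal : ∀ x y → x on ℓ → y on perp → Orthogonal P x y
        orthogonal x y x-on y-on = ⟂⇒orthogonal x y (form⇒orth _ _ (fixed-perp v _ _
          (∈⇒Fixed C v _ (ℓ⊆ _ (on⇒∈ x ℓ x-on))) (∈⇒Fixed C (neg₅ v) _ (on⇒∈ y perp y-on))))
        unique : ∀ {m} → m ∈ₗ lineSet × (∀ x y → x on ℓ → y on m → Orthogonal P x y) → perp ≈ₗ m
        unique {m} (m∈ , orth) = ⊆same⇒≈ perp m (neg-closed v∈) (λ _ p → p)
          (LineBasis.basis⊆ m (lineSubspace C (neg₅ v)) (perpendicular _ (LineBasis.b₁∈ m)) (perpendicular _ (LineBasis.b₂∈ m)))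
          where
          perpendicular : ∀ w → w ∈ proj₁ m → w ∈ lineSubspace C (neg₅ v)
          perpendicular w w∈ = Fixed⇒∈ C (neg₅ v) w (perpFixed v (unit v∈) (to w) λ x fixed →
            subst (λ x → form x (to w) ≡ 0#) (to∘from x) (orth⇒form (from x) w
              (pointwise⇒⟂ ℓ m orth (⊇ _ (Fixed⇒∈ C v _ (subst (Fixed v) (sym (to∘from x)) fixed))) w∈)))
      notIsotropic : ∀ ℓ → ℓ ∈ₗ lineSet → ¬ TotallyIsotropic P ℓ
      notIsotropic ℓ ℓ∈ = let v , v∈ , ℓ⊆ = ∈⇒code ℓ ℓ∈ in notIsotropic′ ℓ v∈ ℓ⊆
      partner : ∀ ℓ → ℓ ∈ₗ lineSet → ∃! _≈ₗ_ λ m → m ∈ₗ lineSet × (∀ x y → x on ℓ → y on m → Orthogonal P x y)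
      partner ℓ ℓ∈ = let v , v∈ , ℓ⊆ = ∈⇒code ℓ ℓ∈ in
        perp ℓ v∈ ℓ⊆ , (code⇒∈ (neg-closed v∈) , orthogonal ℓ v∈ ℓ⊆) , λ {m} → unique ℓ v∈ ℓ⊆ {m}

    specialSpread : SpecialSpread P
    specialSpread = lineSet , isSpecialSpread

  -- Changes of coordinates as graph automorphisms

  module Change (C C′ : Coordinates) where
    private
      module C = Frame C
      module C′ = Frame C′

    move back : V → V
    move u = C′.from (C.to u)
    back u = C.from (C′.to u)

    move-linear : IsLinearMap move
    move-linear = ∘-linear C′.from-linear C.to-linear

    back-linear : IsLinearMap back
    back-linear = ∘-linear C.from-linear C′.to-linear

    back-move : ∀ u → back (move u) ≡ u
    back-move u = trans (cong C.from (C′.to∘from _)) (C.from∘to u)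

    move-back : ∀ u → move (back u) ≡ u
    move-back u = trans (cong C′.from (C.to∘from _)) (C′.from∘to u)

    image : Subspace q → Subspace q
    image U = record
      { member   = λ w → member U (back w)
      ; 0-closed = subst (_∈ U) (sym (linear-0 back-linear)) (0-closed U)
      ; +-closed = λ u w p r → subst (_∈ U) (sym (IsLinear.additive back-linear u w)) (+-closed U _ _ p r)
      ; *-closed = λ c w p → subst (_∈ U) (sym (IsLinear.homogeneous back-linear c w)) (*-closed U c _ p) }

    move-scaled : ∀ c g → move (c *ᵥ g +ᵥ 0ᵥ) ≡ c *ᵥ move g +ᵥ 0ᵥ
    move-scaled c g = trans (cong move (+ᵥ0 _)) (trans (IsLinear.homogeneous move-linear c g) (sym (+ᵥ0 _)))

    movePoint : Point q → Point q
    movePoint (U , g ∷ [] , independent , spans) = image U , (move g ∷ []) ,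
      (λ where (c ∷ []) e → independent (c ∷ []) (trans (sym (back-move _)) (trans (cong back (trans (move-scaled c g) e)) (linear-0 back-linear)))) ,
      λ w → mk⇔ (forward w) (backward w)
      where
      forward : ∀ w → back w ∈ U → ∃ λ c → linearCombination c (move g ∷ []) ≡ w
      forward w p = go (Equivalence.to (spans (back w)) p)
        where
        go : (∃ λ c → linearCombination c (g ∷ []) ≡ back w) → ∃ λ c → linearCombination c (move g ∷ []) ≡ w
        go ((c ∷ []) , e) = (c ∷ []) , trans (sym (move-scaled c g)) (trans (cong move e) (move-back w))
      backward : ∀ w → (∃ λ c → linearCombination c (move g ∷ []) ≡ w) → back w ∈ U
      backward w ((c ∷ []) , e) = Equivalence.from (spans (back w)) ((c ∷ []) , trans (sym (back-move _)) (cong back (trans (move-scaled c g) e)))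

    move-generator : ∀ x → generator (movePoint x) ≡ move (generator x)
    move-generator (U , g ∷ [] , _) = refl

    movePoint-member : ∀ x w → w ∈ proj₁ (movePoint x) → back w ∈ proj₁ x
    movePoint-member (U , g ∷ [] , _) w p = p

    member-movePoint : ∀ x w → back w ∈ proj₁ x → w ∈ proj₁ (movePoint x)
    member-movePoint (U , g ∷ [] , _) w p = p

    move-⟂ : ∀ {u w} → u ⟂ w → move u ⟂ move w
    move-⟂ {u} {w} p = C′.form⇒orth _ _ (subst₂ (λ x y → form x y ≡ 0#) (sym (C′.to∘from _)) (sym (C′.to∘from _)) (C.orth⇒form u w p))

    move-orthogonal : ∀ x y → Orthogonal P x y → Orthogonal P (movePoint x) (movePoint y)
    move-orthogonal x y o = ⟂⇒orthogonal (movePoint x) (movePoint y)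
      (subst₂ _⟂_ (sym (move-generator x)) (sym (move-generator y)) (move-⟂ (orthogonal⇒⟂ x y o)))

    move-≈ : ∀ x y → x ≈ₚ y → movePoint x ≈ₚ movePoint y
    move-≈ x y (p , r) = (λ w → member-movePoint y w ∘ p _ ∘ movePoint-member x w) , (λ w → member-movePoint x w ∘ r _ ∘ movePoint-member y w)

    move-≈⁻ : ∀ x y → movePoint x ≈ₚ movePoint y → x ≈ₚ y
    move-≈⁻ x y (p , r) = transfer x y p , transfer y x r
      where
      transfer : ∀ x y → proj₁ (movePoint x) ⊆ proj₁ (movePoint y) → proj₁ x ⊆ proj₁ y
      transfer x y p w w∈ = subst (_∈ proj₁ y) (back-move w) (movePoint-member y _ (p (move w) (member-movePoint x _ (subst (_∈ proj₁ x) (sym (back-move w)) w∈))))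

  module _ (C C′ : Coordinates) where
    open Change C C′
    private module B = Change C′ C

    ⟂-resp : ∀ {u u′ w w′} → u ≡ u′ → w ≡ w′ → u ⟂ w → u′ ⟂ w′
    ⟂-resp refl refl p = p

    reflect-orthogonal : ∀ x y → Orthogonal P (movePoint x) (movePoint y) → Orthogonal P x y
    reflect-orthogonal x y o = ⟂⇒orthogonal x y (⟂-resp (back-move _) (back-move _)
      (B.move-⟂ (⟂-resp (move-generator x) (move-generator y) (orthogonal⇒⟂ (movePoint x) (movePoint y) o))))

    isGraphAutomorphism : IsGraphAutomorphism P movePoint
    isGraphAutomorphism = record
      { isOrderMonomorphism = record
        { isOrderHomomorphism = record
          { cong = λ {x} {y} → move-≈ x y
          ; mono = λ {x} {y} (x≉y , o) → (x≉y ∘ move-≈⁻ x y) , move-orthogonal x y o }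
        ; injective = λ {x} {y} → move-≈⁻ x y
        ; cancel = λ {x} {y} (x≉y , o) → (x≉y ∘ move-≈ x y) , reflect-orthogonal x y o }
      ; surjective = λ y → B.movePoint y , λ {z} z≈ →
          (λ w w∈ → subst (_∈ proj₁ y) (move-back w) (B.movePoint-member y _ (proj₁ z≈ _ (movePoint-member z w w∈)))) ,
          (λ w w∈ → member-movePoint z w (proj₂ z≈ _ (B.member-movePoint y _ (subst (_∈ proj₁ y) (sym (move-back w)) w∈)))) }

    -- The linear map from the first coordinates to the second matches lines with equal codes. It is
    -- enough that each spread contains the lines of L: these already cover all points, so every
    -- line of either spread is among them.
    sameCode⇒equivalent : ∀ {L} → IsCode L → (𝒮 𝒮′ : SpecialSpread P) →
      (∀ {v} → v ∈ˡ L → InSpread C (proj₁ 𝒮) v) → (∀ {v} → v ∈ˡ L → InSpread C′ (proj₁ 𝒮′) v) → Equivalent P 𝒮 𝒮′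
    sameCode⇒equivalent isCode 𝒮 𝒮′ in₁ in₂ = movePoint , isGraphAutomorphism , forwards , backwards
      where
      module S = SpecialSpreadProperties 𝒮
      module S′ = SpecialSpreadProperties 𝒮′
      open IsCode isCode
      module C = Frame C
      module C′ = Frame C′
      maps : ∀ {v} (i : InSpread C (proj₁ 𝒮) v) (j : InSpread C′ (proj₁ 𝒮′) v) → MapsLine movePoint (InSpread.line i) (InSpread.line j)
      maps {v} (mkInSpread ℓ _ ∈⇒v v⇒∈) (mkInSpread m _ ∈⇒v′ v′⇒∈) x = mk⇔
        (λ inc w w∈ → v′⇒∈ w (subst (Fixed v) (C.to∘from _) (∈⇒v _ (inc _ (movePoint-member x w w∈)))))
        (λ inc w w∈ → v⇒∈ w (subst (Fixed v) (C′.to∘from _) (∈⇒v′ (move w) (inc (move w) (member-movePoint x _ (subst (_∈ proj₁ x) (sym (back-move w)) w∈))))))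
      codeOf : ∀ (D : Coordinates) (𝒯 : SpecialSpread P) (ins : ∀ {v} → v ∈ˡ _ → InSpread D (proj₁ 𝒯) v) ℓ → ℓ ∈ₗ proj₁ 𝒯 →
               ∃ λ v → ∃ λ (v∈ : v ∈ˡ _) → InSpread.line (ins v∈) ≈ₗ ℓ
      codeOf D 𝒯 ins ℓ ℓ∈ = let v , v∈ , fixed = covers (Frame.to D (LineBasis.b₁ ℓ)) (to≢0 D (LineBasis.b₁≢0 ℓ)) in
        v , v∈ , SpecialSpreadProperties.sameLine 𝒯 (LineBasis.b₁≢0 ℓ) (InSpread.line (ins v∈)) ℓ (InSpread.line∈ (ins v∈)) ℓ∈
          (InSpread.fixed⇒∈ (ins v∈) _ fixed) (LineBasis.b₁∈ ℓ)
      forwards : ∀ ℓ → ℓ ∈ₗ proj₁ 𝒮 → ∃ λ m → m ∈ₗ proj₁ 𝒮′ × MapsLine movePoint ℓ m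
      forwards ℓ ℓ∈ = let v , v∈ , same = codeOf C 𝒮 in₁ ℓ ℓ∈ in
        InSpread.line (in₂ v∈) , InSpread.line∈ (in₂ v∈) , λ x → mk⇔
          (λ inc → Equivalence.to (maps (in₁ v∈) (in₂ v∈) x) (λ w → proj₂ same w ∘ inc w))
          (λ inc w → proj₁ same w ∘ Equivalence.from (maps (in₁ v∈) (in₂ v∈) x) inc w)
      backwards : ∀ m → m ∈ₗ proj₁ 𝒮′ → ∃ λ ℓ → ℓ ∈ₗ proj₁ 𝒮 × MapsLine movePoint ℓ m
      backwards m m∈ = let v , v∈ , same = codeOf C′ 𝒮′ in₂ m m∈ in
        InSpread.line (in₁ v∈) , InSpread.line∈ (in₁ v∈) , λ x → mk⇔
          (λ inc w → proj₁ same w ∘ Equivalence.to (maps (in₁ v∈) (in₂ v∈) x) inc w)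
          (λ inc → Equivalence.from (maps (in₁ v∈) (in₂ v∈) x) (λ w → proj₂ same w ∘ inc w))

-- A configuration is a list of lines assumed to lie in the spread. In  use k c₁ c₂ c₃ c₄
-- the matrix with these columns maps the k-th configuration already treated into the
-- current one; branch p ts has one subtree for every line through p which is disjoint
-- from the lines of the current configuration.
data Tree : Set where
  use    : (index c₁ c₂ c₃ c₄ : ℕ) → Tree
  branch : (pivot : ℕ) → List Tree → Tree

-- The checker, evaluated in ℕ modulo q

module Checker (q : ℕ) .{{_ : NonZero q}} where
  open Residues q using (negℕ)
  open Formulas ℕ._+_ ℕ._*_ negℕ public

  V₄ V₅ Matrix : Set
  V₄ = Vec ℕ 4
  V₅ = Vec ℕ 5
  Matrix = Vec V₄ 4

  _≈ᵇ_ : ℕ → ℕ → Bool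
  m ≈ᵇ n = (m % q) ≡ᵇ (n % q)

  _≈ᵛ_ : ∀ {n} → Vec ℕ n → Vec ℕ n → Bool
  []      ≈ᵛ []      = true
  (x ∷ u) ≈ᵛ (y ∷ v) = (x ≈ᵇ y) ∧ (u ≈ᵛ v)

  reduce : ∀ {n} → Vec ℕ n → Vec ℕ n
  reduce []      = []
  reduce (x ∷ v) = x % q ∷ reduce v

  neg : ∀ {n} → Vec ℕ n → Vec ℕ n
  neg = map negℕ

  plus : V₄ → V₄ → V₄
  plus = zipWith ℕ._+_

  e₁ e₂ e₃ e₄ : V₄
  e₁ = 1 ∷ 0 ∷ 0 ∷ 0 ∷ []
  e₂ = 0 ∷ 1 ∷ 0 ∷ 0 ∷ []
  e₃ = 0 ∷ 0 ∷ 1 ∷ 0 ∷ []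
  e₄ = 0 ∷ 0 ∷ 0 ∷ 1 ∷ []

  apply : Matrix → V₄ → V₄
  apply (e ∷ f ∷ g ∷ h ∷ []) = comb e f g h

  -- Twice the polarization of norm: the line of v meets that of w or of - w iff it is ±2.
  -- It is used as a filter only, since meet exhibits the common point.
  inner : V₅ → V₅ → ℕ
  inner (s ∷ a ∷ b ∷ c ∷ d ∷ []) (s′ ∷ a′ ∷ b′ ∷ c′ ∷ d′ ∷ []) =
    2 ℕ.* (s ℕ.* s′) ℕ.+ (a ℕ.* d′ ℕ.+ d ℕ.* a′) ℕ.+ negℕ (b ℕ.* c′ ℕ.+ c ℕ.* b′)

  fixes : V₅ → V₄ → Bool
  fixes v x = inv v x ≈ᵛ x

  isCommon : V₅ → V₅ → V₄ → Bool
  isCommon v w r = not (r ≈ᵛ (0 ∷ 0 ∷ 0 ∷ 0 ∷ [])) ∧ fixes v r ∧ fixes w r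

  -- If the inner product is 2, then N = `inv v` - `inv w` squares to zero and anticommutes with
  -- `inv v`. Hence with u = N x the vector u + `inv v u` is fixed by `inv v` and annihilated by N,
  -- so it is fixed by `inv w` as well. It may be zero for some x; `isCommon` tests the result.
  commonPoint : V₅ → V₅ → V₄ → V₄
  commonPoint v w x = reduce (plus u (inv v u))
    where u = reduce (plus (inv v x) (neg (inv w x)))

  -- The candidate v passes through p. A common point alone is no contradiction, since v and w might
  -- be the same line; it becomes one when w misses p.
  meet : V₄ → V₅ → V₅ → Bool
  meet p v w = not (fixes w p) ∧ any (λ x → isCommon v w (commonPoint v w x)) (e₁ ∷ e₂ ∷ e₃ ∷ e₄ ∷ [])

  conflict : V₄ → V₅ → V₅ → Bool
  conflict p v w with inner v w % q
  ... | k = if k ≡ᵇ 2 % q then meet p v w else false ∨ (if k ≡ᵇ negℕ 2 % q then meet p v (neg w) else false)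

  candidates : V₄ → List V₅
  candidates (x ∷ y ∷ z ∷ w ∷ []) = cartesianProductWith (λ a b → reduce (through x y z w a b)) (upTo q) (upTo q)

  dead : V₄ → List V₅ → V₅ → Bool
  dead p C v = not (norm v ≈ᵇ 1) ∨ any (conflict p v) C

  -- Vectors are stored as decimal numbers, the last entry first.
  digits : ∀ n → ℕ → Vec ℕ n
  digits zero    _ = []
  digits (suc n) m = m % 10 ∷ digits n (m / 10)

  pivotOf : ℕ → V₄
  pivotOf m = 1 ∷ digits 3 m

  basis : List V₄
  basis = e₁ ∷ e₂ ∷ e₃ ∷ e₄ ∷ []

  -- For a similitude the columns e, f and g, h are two orthogonal hyperbolic pairs of form μ. Then
  -- the coordinates of z are `form z f`, `form e z`, `form z h`, `form g z` divided by μ, and 1/μ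
  -- is the power with exponent q - 2 by Fermat. Its correctness is not assumed: `isSimilitude`
  -- tests both products.
  inverseMatrix : Matrix → Matrix
  inverseMatrix (e ∷ f ∷ g ∷ h ∷ []) = column e₁ ∷ column e₂ ∷ column e₃ ∷ column e₄ ∷ []
    where
    i : ℕ
    i = ((form e f % q) ℕ.^ (q ℕ.∸ 2)) % q
    column : V₄ → V₄
    column z = reduce (i ℕ.* form z f ∷ i ℕ.* form e z ∷ i ℕ.* form z h ∷ i ℕ.* form g z ∷ [])

  scaleOf : Matrix → ℕ
  scaleOf (e ∷ f ∷ _) = form e f

  isSimilitude : Matrix → Matrix → ℕ → Bool
  isSimilitude H M μ =
    not (μ ≈ᵇ 0) ∧
    all (λ x → apply H (apply M x) ≈ᵛ x) basis ∧
    all (λ x → apply M (apply H x) ≈ᵛ x) basis ∧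
    all (λ x → all (λ y → form (apply H x) (apply H y) ≈ᵇ (μ ℕ.* form x y)) basis) basis

  intertwines : Matrix → V₅ → V₅ → Bool
  intertwines H v w = all (λ x → inv v (apply H x) ≈ᵛ apply H (inv w x)) basis

  -- Signs are free because a special spread contains ℓ and ℓ^ζ together, so a similitude may
  -- exchange the lines of a pair.
  transported : Matrix → List V₅ → List V₅ → Bool
  transported H C = all (λ w → any (λ v → intertwines H v w ∨ intertwines H (neg v) w) C)

  lookupOr[] : List (List V₅) → ℕ → List V₅
  lookupOr[] []       _       = []
  lookupOr[] (L ∷ Ls) zero    = L
  lookupOr[] (L ∷ Ls) (suc n) = lookupOr[] Ls n

  check         : List (List V₅) → Tree → List V₅ → Bool
  checkChildren : List (List V₅) → List Tree → V₄ → List V₅ → List V₅ → Bool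
  check Ls (use k c₁ c₂ c₃ c₄) C =
    (k ℕ.<ᵇ length Ls) ∧ isSimilitude H (inverseMatrix H) (scaleOf H) ∧ transported H C (lookupOr[] Ls k)
    where
    H : Matrix
    H = digits 4 c₁ ∷ digits 4 c₂ ∷ digits 4 c₃ ∷ digits 4 c₄ ∷ []
  check Ls (branch p ts) C = checkChildren Ls ts (pivotOf p) (candidates (pivotOf p)) C
  checkChildren Ls ts p []       C = true
  checkChildren Ls ts p (v ∷ vs) C with dead p C v
  checkChildren Ls ts       p (v ∷ vs) C | true  = checkChildren Ls ts p vs C
  checkChildren Ls []       p (v ∷ vs) C | false = false
  checkChildren Ls (t ∷ ts) p (v ∷ vs) C | false = check Ls t (v ∷ C) ∧ checkChildren Ls ts p vs C

  -- A treated configuration is put in front, so the index in `use` counts back from the most recent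
  -- one and the representatives come last.
  checkAll : List (List V₅) → List (List V₅ × Tree) → Bool
  checkAll Ls []             = true
  checkAll Ls ((C , t) ∷ cs) = check Ls t C ∧ checkAll (C ∷ Ls) cs

  normalized : List V₄
  normalized =
    cartesianProductWith (λ y zw → 1 ∷ y ∷ zw) (upTo q) (cartesianProductWith (λ z w → z ∷ w ∷ []) (upTo q) (upTo q)) ++
    cartesianProductWith (λ z w → 0 ∷ 1 ∷ z ∷ w ∷ []) (upTo q) (upTo q) ++
    List.map (λ w → 0 ∷ 0 ∷ 1 ∷ w ∷ []) (upTo q) ++
    e₄ ∷ []

  onPair : V₄ → V₅ → Bool
  onPair p v = (u ≈ᵛ p) ∨ (u ≈ᵛ neg p)
    where u = inv v p

  isSingleton : ∀ {A : Set} → List A → Bool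
  isSingleton (_ ∷ []) = true
  isSingleton _        = false

  distinct : List V₅ → Bool
  distinct []      = true
  distinct (v ∷ L) = all (λ w → not (v ≈ᵛ w) ∧ not (v ≈ᵛ neg w)) L ∧ distinct L

  -- L holds one vector per pair {ℓ, ℓ^ζ}. As ℓ and ℓ^ζ are disjoint, exactly one pair through each
  -- point means exactly one line through it.
  isCode : List V₅ → Bool
  isCode L = all (λ v → norm v ≈ᵇ 1) L ∧ distinct L ∧ all (λ p → isSingleton (filterᵇ (onPair p) L)) normalized

  -- The vectors of `basis⁻` and `basis⁺`, the Boolean telling whether s = -1.
  basisBy : Bool → V₅ → V₄ × V₄
  basisBy true  (s ∷ a ∷ b ∷ c ∷ d ∷ []) = (a ∷ c ∷ 1 ℕ.+ negℕ s ∷ 0 ∷ []) , (b ∷ d ∷ 0 ∷ 1 ℕ.+ negℕ s ∷ [])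
  basisBy false (s ∷ a ∷ b ∷ c ∷ d ∷ []) = (1 ℕ.+ s ∷ 0 ∷ d ∷ negℕ c ∷ []) , (0 ∷ 1 ℕ.+ s ∷ negℕ b ∷ a ∷ [])

  pointsOn : V₄ × V₄ → List V₄
  pointsOn (x , y) = y ∷ List.map (λ t → plus x (map (t ℕ.*_) y)) (upTo q)

  lineBasis : V₅ → V₄ × V₄
  lineBasis v = basisBy ((1 ℕ.+ head v) ≈ᵇ 0) v

  linePoints : V₅ → List V₄
  linePoints v = pointsOn (lineBasis v)

  images : V₅ → List V₄ → List V₄
  images v = List.map (λ x → reduce (inv v x))

  anyOrthogonal : List V₄ → List V₄ → Bool
  anyOrthogonal (x ∷ xs) (y ∷ ys) = (form x y ≈ᵇ 0) ∨ anyOrthogonal xs ys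
  anyOrthogonal _        _        = false

  total : ∀ {A : Set} → (A → ℕ) → List A → ℕ
  total f L = sumˡ (List.map f L)

  indicator : Bool → ℕ
  indicator b = if b then 1 else 0

  -- The sum over all ordered pairs for a symmetric f, with about half of the evaluations.
  symmetricTotal : ∀ {A : Set} → (A → A → ℕ) → List A → ℕ
  symmetricTotal f []      = 0
  symmetricTotal f (x ∷ L) = f x x ℕ.+ 2 ℕ.* total (f x) L ℕ.+ symmetricTotal f L

  crossings : List V₄ → List V₄ → ℕ
  crossings r s = indicator (anyOrthogonal r s)

  countRows : List (List V₄) → ℕ
  countRows = symmetricTotal crossings

  -- Counts the ordered triples of pairs {ℓ, ℓ^ζ} which have a common totally isotropic
  -- transversal: for x on ℓ, the projections of x to m and n are orthogonal iff
  -- inv v x and inv w x are, whatever the signs of v and w.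
  triads : List V₅ → ℕ
  triads L = total (λ u → countRows (List.map (λ v → images v (linePoints u)) L)) L

∧⁻ : ∀ {a b} → T (a ∧ b) → T a × T b
∧⁻ = Equivalence.to T-∧

T-injective : ∀ {a b} → (T a → T b) → (T b → T a) → a ≡ b
T-injective {true}  {true}  _ _ = refl
T-injective {false} {false} _ _ = refl
T-injective {true}  {false} f _ = ⊥-elim (f _)
T-injective {false} {true}  _ g = ⊥-elim (g _)

not⁻ : ∀ {b} → T (not b) → ¬ T b
not⁻ {false} _ ()

-- Soundness of the search

module Homomorphism (q : ℕ) .{{_ : NonZero q}} (isField : Residues.IsOddField q) where
  open Residues q
  private
    module N = Checker q
    F = residueField isField
  open Field F using (0#; 1#; _*_; _+_; _-_; -_)
  open Algebra F
  open N using (_≈ᵇ_; _≈ᵛ_; reduce)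

  infix 10 ⟪_⟫
  ⟪_⟫ : ∀ {n} → Vec ℕ n → Vec (𝔽 q) n
  ⟪_⟫ = map ⟦_⟧

  infixl 6 _⊕_
  infixl 7 _⊗_
  infix  8 ⊖_
  _⊕_ : ∀ {m n a b} → ⟦ m ⟧ ≡ a → ⟦ n ⟧ ≡ b → ⟦ m ℕ.+ n ⟧ ≡ a + b
  _⊕_ {m} {n} refl refl = sym (⟦⟧-+ m n)

  _⊗_ : ∀ {m n a b} → ⟦ m ⟧ ≡ a → ⟦ n ⟧ ≡ b → ⟦ m ℕ.* n ⟧ ≡ a * b
  _⊗_ {m} {n} refl refl = sym (⟦⟧-* m n)

  ⊖_ : ∀ {m a} → ⟦ m ⟧ ≡ a → ⟦ negℕ m ⟧ ≡ - a
  ⊖_ {m} refl = sym (⟦⟧-neg m)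

  val : ∀ m → ⟦ m ⟧ ≡ ⟦ m ⟧
  val _ = refl

  ⟪reduce⟫ : ∀ {n} (v : Vec ℕ n) → ⟪ reduce v ⟫ ≡ ⟪ v ⟫
  ⟪reduce⟫ []      = refl
  ⟪reduce⟫ (x ∷ v) = cong₂ _∷_ (⟦%⟧ x) (⟪reduce⟫ v)

  ≈ᵇ⇒≡ : ∀ m n → T (m ≈ᵇ n) → ⟦ m ⟧ ≡ ⟦ n ⟧
  ≈ᵇ⇒≡ m n t = ⟦⟧-cong (ℕ.≡ᵇ⇒≡ _ _ t)

  ≡⇒≈ᵇ : ∀ m n → ⟦ m ⟧ ≡ ⟦ n ⟧ → T (m ≈ᵇ n)
  ≡⇒≈ᵇ m n e = ℕ.≡⇒≡ᵇ _ _ (⟦⟧-injective e)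

  ≈ᵛ⇒≡ : ∀ {n} (u v : Vec ℕ n) → T (u ≈ᵛ v) → ⟪ u ⟫ ≡ ⟪ v ⟫
  ≈ᵛ⇒≡ []      []      _ = refl
  ≈ᵛ⇒≡ (x ∷ u) (y ∷ v) t = cong₂ _∷_ (≈ᵇ⇒≡ x y (proj₁ (∧⁻ t))) (≈ᵛ⇒≡ u v (proj₂ (∧⁻ {x ≈ᵇ y} t)))

  ≡⇒≈ᵛ : ∀ {n} (u v : Vec ℕ n) → ⟪ u ⟫ ≡ ⟪ v ⟫ → T (u ≈ᵛ v)
  ≡⇒≈ᵛ []      []      _ = _
  ≡⇒≈ᵛ (x ∷ u) (y ∷ v) e = Equivalence.from T-∧ (≡⇒≈ᵇ x y (cong head e) , ≡⇒≈ᵛ u v (cong tail e))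

  ⟪inv⟫ : ∀ v x → ⟪ N.inv v x ⟫ ≡ inv ⟪ v ⟫ ⟪ x ⟫
  ⟪inv⟫ (s ∷ a ∷ b ∷ c ∷ d ∷ []) (x ∷ y ∷ z ∷ w ∷ []) =
    pos s x a z b w ⹁ pos s y c z d w ⹁ mix d x b y s z ⹁ mix a y c x s w ⹁ refl
    where
    pos = λ s x a z b w → val s ⊗ val x ⊕ (val a ⊗ val z ⊕ val b ⊗ val w)
    mix = λ s x a z b w → val s ⊗ val x ⊕ ⊖ (val a ⊗ val z ⊕ val b ⊗ val w)

  ⟪norm⟫ : ∀ v → ⟦ N.norm v ⟧ ≡ norm ⟪ v ⟫
  ⟪norm⟫ (s ∷ a ∷ b ∷ c ∷ d ∷ []) = val s ⊗ val s ⊕ (val a ⊗ val d ⊕ ⊖ (val b ⊗ val c))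

  ⟪form⟫ : ∀ x y → ⟦ N.form x y ⟧ ≡ form ⟪ x ⟫ ⟪ y ⟫
  ⟪form⟫ (x ∷ y ∷ z ∷ w ∷ []) (X ∷ Y ∷ Z ∷ W ∷ []) =
    (val x ⊗ val Y ⊕ ⊖ (val y ⊗ val X)) ⊕ (val z ⊗ val W ⊕ ⊖ (val w ⊗ val Z))

  ⟪comb⟫ : ∀ e f g h z → ⟪ N.comb e f g h z ⟫ ≡ comb ⟪ e ⟫ ⟪ f ⟫ ⟪ g ⟫ ⟪ h ⟫ ⟪ z ⟫
  ⟪comb⟫ (e₁ ∷ e₂ ∷ e₃ ∷ e₄ ∷ []) (f₁ ∷ f₂ ∷ f₃ ∷ f₄ ∷ []) (g₁ ∷ g₂ ∷ g₃ ∷ g₄ ∷ []) (h₁ ∷ h₂ ∷ h₃ ∷ h₄ ∷ []) (x ∷ y ∷ z ∷ w ∷ []) =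
    row e₁ f₁ g₁ h₁ ⹁ row e₂ f₂ g₂ h₂ ⹁ row e₃ f₃ g₃ h₃ ⹁ row e₄ f₄ g₄ h₄ ⹁ refl
    where row = λ e f g h → (val x ⊗ val e ⊕ val y ⊗ val f) ⊕ (val z ⊗ val g ⊕ val w ⊗ val h)

  ⟪through-toℕ⟫ : ∀ y z w a b → ⟪ N.through 1 y z w (toℕ a) (toℕ b) ⟫ ≡ through 1# ⟦ y ⟧ ⟦ z ⟧ ⟦ w ⟧ a b
  ⟪through-toℕ⟫ y z w a b =
    s ⹁ ⟦toℕ⟧ a ⹁ ⟦toℕ⟧ b ⹁ (⟦toℕ⟧ a ⊗ val y ⊕ ⊖ (val w ⊗ (val 1 ⊕ s))) ⹁ (⟦toℕ⟧ b ⊗ val y ⊕ val z ⊗ (val 1 ⊕ s)) ⹁ refl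
    where s = val 1 ⊕ ⊖ (⟦toℕ⟧ a ⊗ val z ⊕ ⟦toℕ⟧ b ⊗ val w)

  -1≡ : ∀ a → - a ≡ -1# * a
  -1≡ = solve 1 (λ a → :- a := (:- #1) :* a) refl

  ⟪neg₄⟫ : ∀ x → ⟪ N.neg x ⟫ ≡ -ᵥ ⟪ x ⟫
  ⟪neg₄⟫ (x ∷ y ∷ z ∷ w ∷ []) = n x ⹁ n y ⹁ n z ⹁ n w ⹁ refl
    where n = λ x → trans (⊖ val x) (-1≡ ⟦ x ⟧)

  ⟪neg₅⟫ : ∀ v → ⟪ N.neg v ⟫ ≡ neg₅ ⟪ v ⟫
  ⟪neg₅⟫ (x ∷ y ∷ z ∷ w ∷ v ∷ []) = n x ⹁ n y ⹁ n z ⹁ n w ⹁ n v ⹁ refl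
    where n = λ x → trans (⊖ val x) (-1≡ ⟦ x ⟧)

  ⟪plus⟫ : ∀ x y → ⟪ N.plus x y ⟫ ≡ ⟪ x ⟫ +ᵥ ⟪ y ⟫
  ⟪plus⟫ (x ∷ y ∷ z ∷ w ∷ []) (X ∷ Y ∷ Z ∷ W ∷ []) = val x ⊕ val X ⹁ val y ⊕ val Y ⹁ val z ⊕ val Z ⹁ val w ⊕ val W ⹁ refl

  open Lines F using (Fixed)

  fixes⇒Fixed : ∀ v x → T (N.fixes v x) → Fixed ⟪ v ⟫ ⟪ x ⟫
  fixes⇒Fixed v x t = trans (sym (⟪inv⟫ v x)) (≈ᵛ⇒≡ _ _ t)

  Fixed⇒fixes : ∀ v x → Fixed ⟪ v ⟫ ⟪ x ⟫ → T (N.fixes v x)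
  Fixed⇒fixes v x e = ≡⇒≈ᵛ (N.inv v x) x (trans (⟪inv⟫ v x) e)

∨⁻ : ∀ {a b} → T (a ∨ b) → T a ⊎ T b
∨⁻ = Equivalence.to T-∨

all⁻ : ∀ {A : Set} (p : A → Bool) xs → T (all p xs) → ∀ {x} → x ∈ˡ xs → T (p x)
all⁻ p (x ∷ xs) t (here refl) = proj₁ (∧⁻ t)
all⁻ p (x ∷ xs) t (there x∈)  = all⁻ p xs (proj₂ (∧⁻ {p x} t)) x∈

any⁻ : ∀ {A : Set} (p : A → Bool) xs → T (any p xs) → ∃ λ x → x ∈ˡ xs × T (p x)
any⁻ p xs t = find (Any.any⁻ p xs t)

module CheckerInversion (q : ℕ) .{{_ : NonZero q}} where
  open Checker q public
  open Residues q using (negℕ)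

  meet⁻ : ∀ p v w → T (meet p v w) → ∃ λ r → T (not (fixes w p)) × T (not (r ≈ᵛ (0 ∷ 0 ∷ 0 ∷ 0 ∷ []))) × T (fixes v r) × T (fixes w r)
  meet⁻ p v w t =
    let x , _ , t₂ = any⁻ (λ x → isCommon v w (commonPoint v w x)) basis (proj₂ (∧⁻ {not (fixes w p)} t))
        r = commonPoint v w x
        nonzero , t₃ = ∧⁻ {not (r ≈ᵛ (0 ∷ 0 ∷ 0 ∷ 0 ∷ []))} t₂
    in r , proj₁ (∧⁻ t) , nonzero , ∧⁻ {fixes v r} t₃

  conflict⁻ : ∀ p v w → T (conflict p v w) → T (meet p v w) ⊎ T (meet p v (neg w))
  conflict⁻ p v w t with (inner v w ℕ.% q) ℕ.≡ᵇ (2 ℕ.% q) | (inner v w ℕ.% q) ℕ.≡ᵇ (negℕ 2 ℕ.% q)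
  ... | true  | _    = inj₁ t
  ... | false | true = inj₂ t

  children[]⁻ : ∀ {Ls p v vs C} → T (checkChildren Ls [] p (v ∷ vs) C) → T (dead p C v) × T (checkChildren Ls [] p vs C)
  children[]⁻ {p = p} {v} {C = C} t with dead p C v
  ... | true = _ , t

  children∷⁻ : ∀ {Ls s ts p v vs C} → T (checkChildren Ls (s ∷ ts) p (v ∷ vs) C) →
    (T (dead p C v) × T (checkChildren Ls (s ∷ ts) p vs C)) ⊎ (T (check Ls s (v ∷ C)) × T (checkChildren Ls ts p vs C))
  children∷⁻ {Ls} {s} {p = p} {v} {C = C} t with dead p C v
  ... | true  = inj₁ (_ , t)
  ... | false = inj₂ (∧⁻ {check Ls s (v ∷ C)} t)

module ChangeFrame (F : Field) where
  open Field F renaming (Carrier to A)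
  open Algebra F
  open Linear F
  open Frames F

  record Similitude : Set where
    field
      h m      : V → V
      h-linear : IsLinearMap h
      m-linear : IsLinearMap m
      h∘m      : ∀ x → h (m x) ≡ x
      m∘h      : ∀ x → m (h x) ≡ x
      μ        : A
      μ≢0      : μ ≢ 0#
      scales   : ∀ x y → form (h x) (h y) ≡ μ * form x y

  module _ {R : V → V → Set} (σ : Similitude) (φ : Frame R) where
    open Similitude σ
    open Frame φ
    transform : Frame R
    transform = record
      { to = m ∘ to ; from = from ∘ h
      ; to-linear = ∘-linear m-linear to-linear ; from-linear = ∘-linear from-linear h-linear
      ; to∘from = λ x → trans (cong m (to∘from (h x))) (m∘h x)
      ; from∘to = λ x → trans (cong from (h∘m (to x))) (from∘to x)
      ; orth⇒form = λ u v r → noZeroDivisor μ≢0 (trans (scaled u v) (orth⇒form u v r))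
      ; form⇒orth = λ u v e → form⇒orth u v (trans (sym (scaled u v)) (trans (cong (μ *_) e) (zeroʳ μ))) }
      where
      scaled : ∀ u v → μ * form (m (to u)) (m (to v)) ≡ form (to u) (to v)
      scaled u v = trans (sym (scales _ _)) (cong₂ form (h∘m (to u)) (h∘m (to v)))

module Soundness (q : ℕ) .{{_ : NonZero q}} (isField : Residues.IsOddField q)
                 (P : SymplecticPolarity q) (𝒮 : SpecialSpread P) (Goal : Set) where
  open Residues q hiding (isCommutativeRing)
  open Homomorphism q isField
  private
    module N = CheckerInversion q
    F = residueField isField
  open Field F using (0#; 1#; _*_; _+_; _-_; -_)
  open Algebra F
  open Lines F
  open Linear F
  open ChangeFrame F
  open FrameLines q isField P
  open SpecialSpreadProperties 𝒮
  open Frames F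

  Known : Coordinates → N.V₅ → Set
  Known C v = norm ⟪ v ⟫ ≡ 1# × InSpread C S ⟪ v ⟫

  -- The quantification over all coordinates is what makes the implication stable under similitudes.
  LemmaHolds : List N.V₅ → Set
  LemmaHolds L = ∀ C → All (Known C) L → Goal

  known-neg : ∀ {C v} → Known C v → Known C (N.neg v)
  known-neg {C} {v} (n , i) = subst (λ v → norm v ≡ 1#) (sym (⟪neg₅⟫ v)) (trans (norm-neg ⟪ v ⟫) n) ,
                              subst (InSpread C S) (sym (⟪neg₅⟫ v)) (negated C n i)

  linear⇒agree : ∀ {f g : V → V} → IsLinearMap f → IsLinearMap g → (∀ {x} → x ∈ˡ N.basis → f ⟪ x ⟫ ≡ g ⟪ x ⟫) → ∀ x → f x ≡ g x
  linear⇒agree lf lg e = agree _ _ lf lg (record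
    { at₁ = e (here refl) ; at₂ = e (there (here refl)) ; at₃ = e (there (there (here refl))) ; at₄ = e (there (there (there (here refl)))) })

  functional⇒agree : ∀ {f g : V → Field.Carrier F} → IsFunctional f → IsFunctional g → (∀ {x} → x ∈ˡ N.basis → f ⟪ x ⟫ ≡ g ⟪ x ⟫) → ∀ x → f x ≡ g x
  functional⇒agree lf lg e = agree _ _ lf lg (record
    { at₁ = e (here refl) ; at₂ = e (there (here refl)) ; at₃ = e (there (there (here refl))) ; at₄ = e (there (there (there (here refl)))) })

  applyᶠ : N.Matrix → V → V
  applyᶠ (e ∷ f ∷ g ∷ h ∷ []) = comb ⟪ e ⟫ ⟪ f ⟫ ⟪ g ⟫ ⟪ h ⟫

  ⟪apply⟫ : ∀ H x → ⟪ N.apply H x ⟫ ≡ applyᶠ H ⟪ x ⟫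
  ⟪apply⟫ (e ∷ f ∷ g ∷ h ∷ []) x = ⟪comb⟫ e f g h x

  applyᶠ-linear : ∀ H → IsLinearMap (applyᶠ H)
  applyᶠ-linear (e ∷ f ∷ g ∷ h ∷ []) = comb-linear ⟪ e ⟫ ⟪ f ⟫ ⟪ g ⟫ ⟪ h ⟫

  mutuallyInverse : ∀ H M → T (all (λ x → N.apply H (N.apply M x) N.≈ᵛ x) N.basis) → ∀ x → applyᶠ H (applyᶠ M x) ≡ x
  mutuallyInverse H M t = linear⇒agree (∘-linear (applyᶠ-linear H) (applyᶠ-linear M)) id-linear λ {x} x∈ →
    trans (sym (trans (⟪apply⟫ H (N.apply M x)) (cong (applyᶠ H) (⟪apply⟫ M x)))) (≈ᵛ⇒≡ (N.apply H (N.apply M x)) x (all⁻ (λ x → N.apply H (N.apply M x) N.≈ᵛ x) N.basis t x∈))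

  similitude : ∀ H M μ → T (N.isSimilitude H M μ) → Similitude
  similitude H M μ t = record
    { h = applyᶠ H ; m = applyᶠ M ; h-linear = applyᶠ-linear H ; m-linear = applyᶠ-linear M
    ; h∘m = mutuallyInverse H M (proj₁ (∧⁻ t₁))
    ; m∘h = mutuallyInverse M H (proj₁ (∧⁻ t₂))
    ; μ = ⟦ μ ⟧
    ; μ≢0 = not⁻ (proj₁ (∧⁻ t)) ∘ ≡⇒≈ᵇ μ 0
    ; scales = λ x y → functional⇒agree (formˡ-linear (applyᶠ H y) (applyᶠ-linear H)) (scaled-linear ⟦ μ ⟧ (formˡ-linear y id-linear))
        (λ {x} x∈ → functional⇒agree (formʳ-linear (applyᶠ H ⟪ x ⟫) (applyᶠ-linear H)) (scaled-linear ⟦ μ ⟧ (formʳ-linear ⟪ x ⟫ id-linear))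
          (λ {y} y∈ → trans (sym (trans (⟪form⟫ (N.apply H x) (N.apply H y)) (cong₂ form (⟪apply⟫ H x) (⟪apply⟫ H y))))
            (trans (≈ᵇ⇒≡ (N.form (N.apply H x) (N.apply H y)) (μ ℕ.* N.form x y) (all⁻ (λ y → N.form (N.apply H x) (N.apply H y) N.≈ᵇ (μ ℕ.* N.form x y)) N.basis
              (all⁻ (λ x → all (λ y → N.form (N.apply H x) (N.apply H y) N.≈ᵇ (μ ℕ.* N.form x y)) N.basis) N.basis t₃ x∈) y∈)) (val μ ⊗ ⟪form⟫ x y))) y) x }
    where
    t₁ = proj₂ (∧⁻ {not (μ N.≈ᵇ 0)} t)
    t₂ = proj₂ (∧⁻ {all (λ x → N.apply H (N.apply M x) N.≈ᵛ x) N.basis} t₁)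
    t₃ = proj₂ (∧⁻ {all (λ x → N.apply M (N.apply H x) N.≈ᵛ x) N.basis} t₂)

  intertwining : ∀ H v w → T (N.intertwines H v w) → ∀ x → inv ⟪ v ⟫ (applyᶠ H x) ≡ applyᶠ H (inv ⟪ w ⟫ x)
  intertwining H v w t = linear⇒agree (∘-linear (inv-linear ⟪ v ⟫) (applyᶠ-linear H)) (∘-linear (applyᶠ-linear H) (inv-linear ⟪ w ⟫)) λ {x} x∈ →
    trans (sym (trans (⟪inv⟫ v (N.apply H x)) (cong (inv ⟪ v ⟫) (⟪apply⟫ H x))))
      (trans (≈ᵛ⇒≡ (N.inv v (N.apply H x)) (N.apply H (N.inv w x)) (all⁻ (λ x → N.inv v (N.apply H x) N.≈ᵛ N.apply H (N.inv w x)) N.basis t x∈))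
        (trans (⟪apply⟫ H (N.inv w x)) (cong (applyᶠ H) (⟪inv⟫ w x))))

  open Similitude using (h; m; h∘m; m∘h)

  module Transport (H M : N.Matrix) (μ : ℕ) (t : T (N.isSimilitude H M μ)) (C : Coordinates) where
    σ = similitude H M μ t
    C′ : Coordinates
    C′ = transform σ C

    -- H takes the line of w to the line of v, and the new coordinates are the old ones followed by
    -- the inverse of H. The same line of the spread, encoded by v before, is now encoded by w.
    transport : ∀ {v w} → T (N.intertwines H v w) → Known C v → Known C′ w
    transport {v} {w} iw (n , mkInSpread ℓ ℓ∈ ∈⇒v v⇒∈) = norm≡ , mkInSpread ℓ ℓ∈
      (λ u u∈ → Equivalence.from (equivalent u) (∈⇒v u u∈)) (λ u e → v⇒∈ u (Equivalence.to (equivalent u) e))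
      where
      open Frame C
      intertwine = intertwining H v w iw
      equivalent : ∀ u → Fixed ⟪ w ⟫ (m σ (to u)) ⇔ Fixed ⟪ v ⟫ (to u)
      equivalent u = mk⇔
        (λ e → trans (cong (inv ⟪ v ⟫) (sym (h∘m σ (to u)))) (trans (intertwine (m σ (to u))) (trans (cong (h σ) e) (h∘m σ (to u)))))
        (λ e → trans (sym (m∘h σ _)) (trans (cong (m σ) (sym (intertwine (m σ (to u))))) (cong (m σ) (trans (cong (inv ⟪ v ⟫) (h∘m σ (to u))) e))))
      -- The norm of w comes from the intertwining relation: `inv w` is conjugate to `inv v`, so its
      -- square is the identity.
      square : ∀ x → norm ⟪ w ⟫ *ᵥ x ≡ 1# *ᵥ x
      square x = trans (sym (inv-inv ⟪ w ⟫ x)) (trans (sym (m∘h σ _)) (trans (cong (m σ) (trans (sym (intertwine _)) (trans (cong (inv ⟪ v ⟫) (sym (intertwine x)))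
        (inv-involutive ⟪ v ⟫ n (h σ x))))) (trans (m∘h σ x) (sym (1*ᵥ x)))))
      norm≡ : norm ⟪ w ⟫ ≡ 1#
      norm≡ = trans (sym (*1 _)) (trans (cong first (square ε₁)) (*1 1#))
        where
        *1 : ∀ x → x * 1# ≡ x
        *1 x = trans (*-comm x 1#) (*-identityˡ x)

    transported : ∀ {L D} → T (N.transported H D L) → All (Known C) D → All (Known C′) L
    transported {L} {D} t known = All.tabulate λ {w} w∈ → image (any⁻ (λ v → N.intertwines H v w ∨ N.intertwines H (N.neg v) w) D
        (all⁻ (λ w → any (λ v → N.intertwines H v w ∨ N.intertwines H (N.neg v) w) D) L t w∈))
      where
      image : ∀ {w} → (∃ λ v → v ∈ˡ D × T (N.intertwines H v w ∨ N.intertwines H (N.neg v) w)) → Known C′ w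
      image {w} (v , v∈ , t) =
        [ (λ t → transport {v} {w} t (All.lookup known v∈)) , (λ t → transport {N.neg v} {w} t (known-neg (All.lookup known v∈))) ]′
        (∨⁻ {N.intertwines H v w} t)

  not-meet : ∀ {C p v w} → Known C v → Fixed ⟪ v ⟫ ⟪ p ⟫ → Known C w → ¬ T (N.meet p v w)
  not-meet {C} {p} {v} {w} (_ , i) fixed (_ , j) t =
    let r , ¬wp , nonzero , tv , tw = N.meet⁻ p v w t in
    not⁻ ¬wp (Fixed⇒fixes w p (noConflict C i j (not⁻ nonzero ∘ ≡⇒≈ᵛ r (0 ∷ 0 ∷ 0 ∷ 0 ∷ [])) (fixes⇒Fixed v r tv) (fixes⇒Fixed w r tw) fixed))

  not-conflict : ∀ {C p v w} → Known C v → Fixed ⟪ v ⟫ ⟪ p ⟫ → Known C w → ¬ T (N.conflict p v w)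
  not-conflict {C} {p} {v} {w} kv fixed kw t =
    [ not-meet {C} {p} {v} {w} kv fixed kw , not-meet {C} {p} {v} {N.neg w} kv fixed (known-neg kw) ]′ (N.conflict⁻ p v w t)

  not-dead : ∀ {C p v D} → Known C v → Fixed ⟪ v ⟫ ⟪ p ⟫ → All (Known C) D → ¬ T (N.dead p D v)
  not-dead {C} {p} {v} {D} kv fixed known t =
    [ (λ t → not⁻ t (≡⇒≈ᵇ (N.norm v) 1 (trans (⟪norm⟫ v) (proj₁ kv))))
    , (λ t → let w , w∈ , t = any⁻ (N.conflict p v) D t in not-conflict {C} {p} {v} {w} kv fixed (All.lookup known w∈) t) ]′
    (∨⁻ {not (N.norm v N.≈ᵇ 1)} t)

  code : ℕ → ℕ → ℕ → 𝔽 q → 𝔽 q → N.V₅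
  code y z w a b = N.reduce (N.through 1 y z w (toℕ a) (toℕ b))

  code≡ : ∀ y z w a b → ⟪ code y z w a b ⟫ ≡ through 1# ⟦ y ⟧ ⟦ z ⟧ ⟦ w ⟧ a b
  code≡ y z w a b = trans (⟪reduce⟫ (N.through 1 y z w (toℕ a) (toℕ b))) (⟪through-toℕ⟫ y z w a b)

  code∈ : ∀ y z w a b → code y z w a b ∈ˡ N.candidates (1 ∷ y ∷ z ∷ w ∷ [])
  code∈ y z w a b = ∈-cartesianProductWith⁺ (λ a b → N.reduce (N.through 1 y z w a b)) (∈-upTo⁺ (Fin.toℕ<n a)) (∈-upTo⁺ (Fin.toℕ<n b))

  record Candidate (C : Coordinates) (p : N.V₄) : Set where
    constructor mkCandidate
    field
      vector    : N.V₅
      candidate∈ : vector ∈ˡ N.candidates p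
      known     : Known C vector
      fixed     : Fixed ⟪ vector ⟫ ⟪ p ⟫

  candidate : ∀ C y z w → Candidate C (1 ∷ y ∷ z ∷ w ∷ [])
  candidate C y z w = fromMember (memberThrough C ⟦ y ⟧ ⟦ z ⟧ ⟦ w ⟧)
    where
    fromMember : (∃₂ λ a b → InSpread C S (through 1# ⟦ y ⟧ ⟦ z ⟧ ⟦ w ⟧ a b) × norm (through 1# ⟦ y ⟧ ⟦ z ⟧ ⟦ w ⟧ a b) ≡ 1# ×
                   Fixed (through 1# ⟦ y ⟧ ⟦ z ⟧ ⟦ w ⟧ a b) (1# ∷ ⟦ y ⟧ ∷ ⟦ z ⟧ ∷ ⟦ w ⟧ ∷ [])) → Candidate C (1 ∷ y ∷ z ∷ w ∷ [])
    fromMember (a , b , i , n , fixed) = mkCandidate (code y z w a b) (code∈ y z w a b)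
      (subst (λ v → norm v ≡ 1#) (sym (code≡ y z w a b)) n , subst (InSpread C S) (sym (code≡ y z w a b)) i)
      (subst (λ v → Fixed v ⟪ 1 ∷ y ∷ z ∷ w ∷ [] ⟫) (sym (code≡ y z w a b)) fixed)

  lookupLemma : ∀ {Ls k} → All LemmaHolds Ls → T (k ℕ.<ᵇ length Ls) → LemmaHolds (N.lookupOr[] Ls k)
  lookupLemma {k = zero}  (p ∷ _)  _ = p
  lookupLemma {k = suc k} (_ ∷ ps) t = lookupLemma {k = k} ps t

  check-sound : ∀ {Ls} → All LemmaHolds Ls → ∀ t D → T (N.check Ls t D) → LemmaHolds D
  -- The line of the spread through p occurs among the candidates still to be scanned and is never
  -- dead. So the scan does not skip it, and the subtree consumed there treats the configuration
  -- enlarged by it.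
  children-sound : ∀ {Ls} → All LemmaHolds Ls → ∀ ts p vs D → T (N.checkChildren Ls ts p vs D) →
                   ∀ C → All (Known C) D → ∀ {v} → v ∈ˡ vs → Known C v → Fixed ⟪ v ⟫ ⟪ p ⟫ → Goal
  check-sound {Ls} holds (use k c₁ c₂ c₃ c₄) D t C known =
    lookupLemma {k = k} holds (proj₁ (∧⁻ t)) C′ (transported {N.lookupOr[] Ls k} {D} (proj₂ (∧⁻ {N.isSimilitude H M μ} t₁)) known)
    where
    H M : N.Matrix
    H = N.digits 4 c₁ ∷ N.digits 4 c₂ ∷ N.digits 4 c₃ ∷ N.digits 4 c₄ ∷ []
    M = N.inverseMatrix H
    μ = N.scaleOf H
    t₁ = proj₂ (∧⁻ {k ℕ.<ᵇ length Ls} t)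
    open Transport H M μ (proj₁ (∧⁻ t₁)) C
  check-sound holds (branch p ts) D t C known = 
    children-sound holds ts (N.pivotOf p) (N.candidates (N.pivotOf p)) D t C known (Candidate.candidate∈ c) (Candidate.known c) (Candidate.fixed c)
    where
    c : Candidate C (N.pivotOf p)
    c = candidate C _ _ _
  children-sound holds [] p (u ∷ vs) D t C known (here refl) kv fixed =
    ⊥-elim (not-dead {C} {p} {u} {D} kv fixed known (proj₁ (N.children[]⁻ t)))
  children-sound holds [] p (u ∷ vs) D t C known (there v∈) kv fixed =
    children-sound holds [] p vs D (proj₂ (N.children[]⁻ {p = p} {u} {vs} {D} t)) C known v∈ kv fixed
  children-sound {Ls} holds (t′ ∷ ts) p (u ∷ vs) D t C known (here refl) kv fixed =
    [ (λ x → ⊥-elim (not-dead {C} {p} {u} {D} kv fixed known (proj₁ x)))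
    , (λ x → check-sound holds t′ (u ∷ D) (proj₁ x) C (kv ∷ known)) ]′ (N.children∷⁻ {Ls} {t′} {ts} {p} {u} {vs} {D} t)
  children-sound {Ls} holds (t′ ∷ ts) p (u ∷ vs) D t C known (there v∈) kv fixed =
    [ (λ x → children-sound holds (t′ ∷ ts) p vs D (proj₂ x) C known v∈ kv fixed)
    , (λ x → children-sound holds ts p vs D (proj₂ x) C known v∈ kv fixed) ]′ (N.children∷⁻ {Ls} {t′} {ts} {p} {u} {vs} {D} t)

  checkAll-sound : ∀ {Ls} → All LemmaHolds Ls → ∀ cs → T (N.checkAll Ls cs) → ∀ {D} → D ∈ˡ List.map proj₁ cs → LemmaHolds D
  checkAll-sound {Ls} holds ((D , t) ∷ cs) p (here refl) = check-sound holds t D (proj₁ (∧⁻ p))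
  checkAll-sound {Ls} holds ((D , t) ∷ cs) p (there D∈)  =
    checkAll-sound (check-sound holds t D (proj₁ (∧⁻ p)) ∷ holds) cs (proj₂ (∧⁻ {N.check Ls t D} p)) D∈

-- The invariant

module Triads (F : Field) where
  open Field F renaming (Carrier to A)
  open Algebra F
  open Lines F
  open Plane F
  open Frames F
  open VectorLemmas F
  open ≡-Reasoning

  OnPair : Vec A 5 → V → Set
  OnPair v x = Fixed v x ⊎ Fixed (neg₅ v) x

  onPair-neg : ∀ v {x} → OnPair (neg₅ v) x → OnPair v x
  onPair-neg v (inj₁ e) = inj₂ e
  onPair-neg v {x} (inj₂ e) = inj₁ (subst (λ v → Fixed v x) (neg-neg v) e)

  neg-onPair : ∀ v {x} → OnPair v x → OnPair (neg₅ v) x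
  neg-onPair v (inj₂ e) = inj₁ e
  neg-onPair v {x} (inj₁ e) = inj₂ (subst (λ v → Fixed v x) (sym (neg-neg v)) e)

  -- The quadrangle of points and totally isotropic lines has no triangles, so pairwise orthogonal
  -- points lie on a common totally isotropic line. Stated with orthogonal points, the condition is
  -- visibly preserved by automorphisms of the graph.
  record Triad (u v w : Vec A 5) : Set where
    constructor mkTriad
    field
      {x y z} : V
      x≢0 : x ≢ 0ᵥ
      y≢0 : y ≢ 0ᵥ
      z≢0 : z ≢ 0ᵥ
      x∈u : OnPair u x
      y∈v : OnPair v y
      z∈w : OnPair w z
      xy : form x y ≡ 0#
      yz : form y z ≡ 0#
      xz : form x z ≡ 0#

  form-sym0 : ∀ x y → form x y ≡ 0# → form y x ≡ 0#
  form-sym0 x y e = trans (form-anti x y) (trans (cong -_ e) (solve 0 (:- #0 := #0) refl))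

  form-neg : ∀ x y → form (-ᵥ x) y ≡ - form x y
  form-neg x y = trans (form-*ˡ -1# x y) (solve 1 (λ f → (:- #1) :* f := :- f) refl (form x y))

  form-negʳ : ∀ x y → form x (-ᵥ y) ≡ - form x y
  form-negʳ x y = trans (form-*ʳ x -1# y) (solve 1 (λ f → (:- #1) :* f := :- f) refl (form x y))

  -- Self-adjointness and alternation make the value equal to its own negative.
  form-self : ∀ v x → form x (inv v x) ≡ 0#
  form-self v x = noZeroDivisor 2≢0 (by₁ 1# (trans (form-anti (inv v x) x) (cong -_ (inv-selfAdjoint v x x)))
    (solve 1 (λ f → (#1 :+ #1) :* f :- #0 := #1 :* (f :- :- f)) refl (form x (inv v x))))

  -- Twice the projection of x onto the line of v.
  proj : Vec A 5 → V → V
  proj v x = x +ᵥ inv v x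

  form-projˡ : ∀ v x y → form (proj v x) y ≡ form x y + form (inv v x) y
  form-projˡ v x y = form-+ˡ x (inv v x) y

  form-projʳ : ∀ v x y → form x (proj v y) ≡ form x y + form x (inv v y)
  form-projʳ v x y = form-+ʳ x y (inv v y)

  sum0 : ∀ {a b} → a ≡ 0# → b ≡ 0# → a + b ≡ 0#
  sum0 refl refl = +-identityʳ 0#

  form-proj : ∀ v w x → form (proj v x) (proj w x) ≡ form (inv v x) (inv w x)
  form-proj v w x = begin
    form (proj v x) (proj w x)                                                ≡⟨ form-projˡ v x (proj w x) ⟩
    form x (proj w x) + form (inv v x) (proj w x)                             ≡⟨ cong₂ _+_ (form-projʳ w x x) (form-projʳ w (inv v x) x) ⟩
    (form x x + form x (inv w x)) + (form (inv v x) x + form (inv v x) (inv w x))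
      ≡⟨ cong₂ (λ a b → a + (b + form (inv v x) (inv w x))) (sum0 (form-alternating x) (form-self w x)) (form-sym0 x (inv v x) (form-self v x)) ⟩
    0# + (0# + form (inv v x) (inv w x))                                      ≡⟨ trans (+-identityˡ _) (+-identityˡ _) ⟩
    form (inv v x) (inv w x)                                                  ∎

  -- On a hyperbolic line the form is a nonzero multiple of the determinant in a basis, so form zero
  -- means proportional.
  proportional : ∀ v → norm v ≡ 1# → ∀ {a y} → Fixed v a → Fixed v y → y ≢ 0ᵥ → form a y ≡ 0# → ∃ λ α → α *ᵥ y ≡ a
  proportional v n {a} {y} va vy y≢0 e = go (spanning va) (spanning vy)
    where
    open HyperbolicBasis (hyperbolicBasis v n) renaming (x to b; y to c)
    go : (∃₂ λ α β → combination α b β c ≡ a) → (∃₂ λ γ δ → combination γ b δ c ≡ y) → ∃ λ t → t *ᵥ y ≡ a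
    go (α , β , refl) (γ , δ , refl) = scaled (nonZeroPair? γ δ)
      where
      det≡0 : γ * β - δ * α ≡ 0#
      det≡0 = noZeroDivisor form≢0 (by₃ -1# (α * γ) (β * δ) e′ (form-alternating b) (form-alternating c)
        (solve 7 (λ α β γ δ f bb cc → f :* (γ :* β :- δ :* α) :- #0 :=
          (:- #1) :* (γ :* (α :* bb :+ β :* (:- f)) :+ δ :* (α :* f :+ β :* cc) :- #0) :+ α :* γ :* (bb :- #0) :+ β :* δ :* (cc :- #0))
          refl α β γ δ (form b c) (form b b) (form c c)))
        where
        e′ : γ * (α * form b b + β * (- form b c)) + δ * (α * form b c + β * form c c) ≡ 0#
        e′ = trans (sym (trans (form-combinationʳ (combination α b β c) γ b δ c) (cong₂ (λ X Y → γ * X + δ * Y)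
          (trans (form-combinationˡ b α b β c) (cong (λ X → α * form b b + β * X) (form-anti b c)))
          (form-combinationˡ c α b β c)))) e
      scale : ∀ t b c → t *ᵥ combination γ b δ c ≡ combination (t * γ) b (t * δ) c
      scale t (_ ∷ _ ∷ _ ∷ _ ∷ []) (_ ∷ _ ∷ _ ∷ _ ∷ []) = l _ _ ⹁ l _ _ ⹁ l _ _ ⹁ l _ _ ⹁ refl
        where l = λ x y → solve 5 (λ t γ δ x y → t :* (γ :* x :+ δ :* y) := t :* γ :* x :+ t :* δ :* y) refl t γ δ x y
      scaled : (γ ≡ 0# × δ ≡ 0#) ⊎ NonZeroPair γ δ → ∃ λ t → t *ᵥ combination γ b δ c ≡ combination α b β c
      scaled (inj₁ (γ≡0 , δ≡0)) = ⊥-elim (y≢0 (combination-0 b c γ≡0 δ≡0))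
      scaled (inj₂ nz) = let t , p , r = parallel {γ} {δ} {α} {β} nz det≡0 in
        t , trans (scale t b c) (cong₂ (λ α β → combination α b β c) p r)

  projection-proportional : ∀ v → norm v ≡ 1# → ∀ {x y} → Fixed v y → y ≢ 0ᵥ → form x y ≡ 0# → ∃ λ α → α *ᵥ y ≡ proj v x
  projection-proportional v n {x} {y} vy y≢0 e = proportional v n (fixedPart v n x) vy y≢0
    (trans (form-projˡ v x y) (sum0 e (trans (inv-selfAdjoint v x y) (trans (cong (form x) vy) e))))

  -- The only point of the line of v orthogonal to x is the projection of x, when that is nonzero.
  -- So the projections of x onto the two lines are multiples of y and z, and their form, which
  -- `form-proj` evaluates, is a multiple of that of y and z.
  crossing⁺ : ∀ v w → norm v ≡ 1# → norm w ≡ 1# → ∀ {x y z} → Fixed v y → Fixed w z → y ≢ 0ᵥ → z ≢ 0ᵥ →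
              form x y ≡ 0# → form x z ≡ 0# → form y z ≡ 0# → form (inv v x) (inv w x) ≡ 0#
  crossing⁺ v w n n′ {x} {y} {z} vy wz y≢0 z≢0 xy xz yz
    with α , e ← projection-proportional v n {x} vy y≢0 xy with β , e′ ← projection-proportional w n′ {x} wz z≢0 xz = begin
    form (inv v x) (inv w x)       ≡⟨ form-proj v w x ⟨
    form (proj v x) (proj w x)     ≡⟨ cong₂ form e e′ ⟨
    form (α *ᵥ y) (β *ᵥ z)         ≡⟨ form-*ˡ α y (β *ᵥ z) ⟩
    α * form y (β *ᵥ z)            ≡⟨ cong (α *_) (trans (form-*ʳ y β z) (trans (cong (β *_) yz) (zeroʳ β))) ⟩
    α * 0#                         ≡⟨ zeroʳ α ⟩
    0#                             ∎

  crossing : ∀ v w → norm v ≡ 1# → norm w ≡ 1# → ∀ {x y z} → OnPair v y → OnPair w z → y ≢ 0ᵥ → z ≢ 0ᵥ →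
             form x y ≡ 0# → form x z ≡ 0# → form y z ≡ 0# → form (inv v x) (inv w x) ≡ 0#
  crossing v w n n′ {x} (inj₁ a) (inj₁ b) y≢0 z≢0 xy xz yz = crossing⁺ v w n n′ {x} a b y≢0 z≢0 xy xz yz
  crossing v w n n′ {x} (inj₂ a) (inj₁ b) y≢0 z≢0 xy xz yz = neg≡0 (trans (sym (form-neg (inv v x) (inv w x)))
    (trans (cong (λ y → form y (inv w x)) (sym (inv-neg v x))) (crossing⁺ (neg₅ v) w (trans (norm-neg v) n) n′ {x} a b y≢0 z≢0 xy xz yz)))
  crossing v w n n′ {x} (inj₁ a) (inj₂ b) y≢0 z≢0 xy xz yz = neg≡0 (trans (sym (form-negʳ (inv v x) (inv w x)))
    (trans (cong (form (inv v x)) (sym (inv-neg w x))) (crossing⁺ v (neg₅ w) n (trans (norm-neg w) n′) {x} a b y≢0 z≢0 xy xz yz)))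
  crossing v w n n′ {x} (inj₂ a) (inj₂ b) y≢0 z≢0 xy xz yz = neg≡0 (neg≡0 (trans (cong -_ (sym (form-negʳ (inv v x) (inv w x)))) (trans (sym (form-neg (inv v x) (-ᵥ inv w x)))
    (trans (cong₂ form (sym (inv-neg v x)) (sym (inv-neg w x))) (crossing⁺ (neg₅ v) (neg₅ w) (trans (norm-neg v) n) (trans (norm-neg w) n′) {x} a b y≢0 z≢0 xy xz yz)))))

  proj≡0⇒ : ∀ v x → proj v x ≡ 0ᵥ → inv v x ≡ -ᵥ x
  proj≡0⇒ v x e = +-ᵥ _ _ (trans (cong (inv v x +ᵥ_) (-ᵥ-involutive x)) (trans (+ᵥ-comm (inv v x) x) e))

  double : ∀ x → x +ᵥ x ≡ 0ᵥ → x ≡ 0ᵥ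
  double (_ ∷ _ ∷ _ ∷ _ ∷ []) e = l (cong first e) ⹁ l (cong second e) ⹁ l (cong third e) ⹁ l (cong fourth e) ⹁ refl
    where
    l : ∀ {x} → x + x ≡ 0# → x ≡ 0#
    l {x} e = noZeroDivisor 2≢0 (trans (solve 1 (λ x → (#1 :+ #1) :* x := x :+ x) refl x) e)

  -- The projection onto ℓ vanishes if x lies on ℓ^ζ. Passing to -v then projects onto ℓ^ζ instead
  -- and changes `inv v x` by a sign only, which does not affect whether the crossing form is zero.
  signed : ∀ v → norm v ≡ 1# → ∀ {x} → x ≢ 0ᵥ → ∃ λ v′ → norm v′ ≡ 1# × proj v′ x ≢ 0ᵥ × (∀ {y} → Fixed v′ y → OnPair v y) ×
           (inv v′ x ≡ inv v x ⊎ inv v′ x ≡ -ᵥ inv v x)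
  signed v n {x} x≢0 with proj v x ≟0ᵥ
  ... | no nz = v , n , nz , inj₁ , inj₁ refl
  ... | yes z = neg₅ v , trans (norm-neg v) n ,
    (λ e → x≢0 (double x (trans (cong (x +ᵥ_) (sym (trans (inv-neg v x) (trans (cong -ᵥ_ (proj≡0⇒ v x z)) (-ᵥ-involutive x))))) e))) ,
    inj₂ , inj₂ (inv-neg v x)

  crossing⇒triad : ∀ u v w → norm v ≡ 1# → norm w ≡ 1# → ∀ {x} → x ≢ 0ᵥ → Fixed u x → form (inv v x) (inv w x) ≡ 0# → Triad u v w
  crossing⇒triad u v w n n′ {x} x≢0 ux e
    with v′ , m , y≢0 , on , s ← signed v n x≢0 with w′ , m′ , z≢0 , on′ , s′ ← signed w n′ x≢0 =
    mkTriad x≢0 y≢0 z≢0 (inj₁ ux) (on (fixedPart v′ m x)) (on′ (fixedPart w′ m′ x))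
      (perp v′) (trans (form-proj v′ w′ x) (signs s s′)) (perp w′)
    where
    perp : ∀ v → form x (proj v x) ≡ 0#
    perp v = trans (form-projʳ v x x) (sum0 (form-alternating x) (form-self v x))
    neg0 : ∀ {a} → a ≡ 0# → - a ≡ 0#
    neg0 refl = solve 0 (:- #0 := #0) refl
    signs : ∀ {a b} → (a ≡ inv v x ⊎ a ≡ -ᵥ inv v x) → (b ≡ inv w x ⊎ b ≡ -ᵥ inv w x) → form a b ≡ 0#
    signs (inj₁ refl) (inj₁ refl) = e
    signs (inj₂ refl) (inj₁ refl) = trans (form-neg (inv v x) (inv w x)) (neg0 e)
    signs (inj₁ refl) (inj₂ refl) = trans (form-negʳ (inv v x) (inv w x)) (neg0 e)
    signs (inj₂ refl) (inj₂ refl) = trans (form-neg (inv v x) (-ᵥ inv w x)) (neg0 (trans (form-negʳ (inv v x) (inv w x)) (neg0 e)))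

  -- The checker runs over the points of one line of the pair u only. If x lies on the other line,
  -- the projection of y or of z onto the first line replaces it: the projection of y to the other
  -- line is a multiple of x, so nothing is lost in orthogonality to z. If both projections vanish,
  -- y and z lie on ℓ^ζ and every point of ℓ will do.
  triad-positive : ∀ u v w → norm u ≡ 1# → Triad u v w → ∃ λ x → x ≢ 0ᵥ × Fixed u x × (∃₂ λ y z → y ≢ 0ᵥ × z ≢ 0ᵥ × OnPair v y × OnPair w z ×
    form x y ≡ 0# × form x z ≡ 0# × form y z ≡ 0#)
  triad-positive u v w n (mkTriad {x} {y} {z} x≢0 y≢0 z≢0 (inj₁ ux) vy wz xy yz xz) = x , x≢0 , ux , y , z , y≢0 , z≢0 , vy , wz , xy , xz , yz
  triad-positive u v w n (mkTriad {x} {y} {z} x≢0 y≢0 z≢0 (inj₂ ux) vy wz xy yz xz) with proj u y ≟0ᵥ | proj u z ≟0ᵥ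
  ... | no nz | _ = proj u y , nz , fixedPart u n y , y , z , y≢0 , z≢0 , vy , wz ,
    form-sym0 y (proj u y) (trans (form-projʳ u y y) (sum0 (form-alternating y) (form-self u y))) ,
    trans (form-projˡ u y z) (sum0 yz invyz) , yz
    where
    n′ = trans (norm-neg u) n
    invyz : form (inv u y) z ≡ 0#
    invyz with α , e ← projection-proportional (neg₅ u) n′ {y} ux x≢0 (form-sym0 x y xy) =
      neg≡0 (trans (sym (form-neg (inv u y) z)) (trans (cong (λ t → form t z) (sym (inv-neg u y)))
        (by₂ 1# -1# (trans (sym (form-projˡ (neg₅ u) y z)) (trans (cong (λ t → form t z) (sym e)) (trans (form-*ˡ α x z) (trans (cong (α *_) xz) (zeroʳ α))))) yz
          (solve 2 (λ a b → b :- #0 := #1 :* (a :+ b :- #0) :+ (:- #1) :* (a :- #0)) refl (form y z) (form (inv (neg₅ u) y) z)))))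
  ... | yes e | no nz = proj u z , nz , fixedPart u n z , y , z , y≢0 , z≢0 , vy , wz ,
    trans (form-projˡ u z y) (sum0 (form-sym0 y z yz) (trans (inv-selfAdjoint u z y) (trans (cong (form z) (proj≡0⇒ u y e)) (trans (form-negʳ z y) (trans (cong -_ (form-sym0 y z yz)) (solve 0 (:- #0 := #0) refl)))))) ,
    form-sym0 z (proj u z) (trans (form-projʳ u z z) (sum0 (form-alternating z) (form-self u z))) , yz
  ... | yes e | yes e′ = b , b≢0 , fixed-x , y , z , y≢0 , z≢0 , vy , wz ,
    fixed-perp u b y fixed-x (opposite y e) , fixed-perp u b z fixed-x (opposite z e′) , yz
    where
    open HyperbolicBasis (hyperbolicBasis u n) renaming (x to b; y to c)
    opposite : ∀ y → proj u y ≡ 0ᵥ → Fixed (neg₅ u) y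
    opposite y e = trans (inv-neg u y) (trans (cong -ᵥ_ (proj≡0⇒ u y e)) (-ᵥ-involutive y))
    b≢0 : b ≢ 0ᵥ
    b≢0 e = 1≢0 (proj₁ (form≢0⇒independent form≢0 1# 0# (trans (combination-10 b c) e)))

  normalise⁺ : ∀ i α β → i * α ≡ 1# → ∀ x y → i *ᵥ combination α x β y ≡ x +ᵥ (i * β) *ᵥ y
  normalise⁺ i α β e (_ ∷ _ ∷ _ ∷ _ ∷ []) (_ ∷ _ ∷ _ ∷ _ ∷ []) = l _ _ ⹁ l _ _ ⹁ l _ _ ⹁ l _ _ ⹁ refl
    where l = λ x y → by₁ x e (solve 5 (λ i α β x y → i :* (α :* x :+ β :* y) :- (x :+ i :* β :* y) := x :* (i :* α :- #1)) refl i α β x y)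

  normalise⁻ : ∀ i α β → α ≡ 0# → i * β ≡ 1# → ∀ x y → i *ᵥ combination α x β y ≡ y
  normalise⁻ i α β z e (_ ∷ _ ∷ _ ∷ _ ∷ []) (_ ∷ _ ∷ _ ∷ _ ∷ []) = l _ _ ⹁ l _ _ ⹁ l _ _ ⹁ l _ _ ⹁ refl
    where l = λ x y → by₂ y (i * x) e z (solve 5 (λ i α β x y → i :* (α :* x :+ β :* y) :- y := y :* (i :* β :- #1) :+ i :* x :* (α :- #0)) refl i α β x y)

module Decision (q : ℕ) .{{_ : NonZero q}} (isField : Residues.IsOddField q) where
  open Residues q hiding (isCommutativeRing)
  open Homomorphism q isField
  private
    module N = Checker q
    F = residueField isField
  open Field F using (0#; 1#; _*_; _+_; _-_; -_; inverse; 1≢0; 2≢0; _≟_)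
  open Algebra F
  open Lines F
  open VectorLemmas F
  open Triads F

  record ComputedBasis (v : N.V₅) (xy : N.V₄ × N.V₄) : Set where
    field
      basis : HyperbolicBasis ⟪ v ⟫
    open HyperbolicBasis basis public
    field
      x≡ : ⟪ proj₁ xy ⟫ ≡ x
      y≡ : ⟪ proj₂ xy ⟫ ≡ y

  basisBy-correct : ∀ t v → norm ⟪ v ⟫ ≡ 1# → (T t → 1# + first₅ ⟪ v ⟫ ≡ 0#) → (1# + first₅ ⟪ v ⟫ ≡ 0# → T t) → ComputedBasis v (N.basisBy t v)
  basisBy-correct true (s ∷ a ∷ b ∷ c ∷ d ∷ []) n f g = record
    { basis = basis⁻ _ n (f _)
    ; x≡ = refl ⹁ refl ⹁ val 1 ⊕ ⊖ val s ⹁ refl ⹁ refl ; y≡ = refl ⹁ refl ⹁ refl ⹁ val 1 ⊕ ⊖ val s ⹁ refl }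
  basisBy-correct false (s ∷ a ∷ b ∷ c ∷ d ∷ []) n f g = record
    { basis = basis⁺ _ n g
    ; x≡ = val 1 ⊕ val s ⹁ refl ⹁ refl ⹁ ⊖ val c ⹁ refl ; y≡ = refl ⹁ val 1 ⊕ val s ⹁ ⊖ val b ⹁ refl ⹁ refl }

  computedBasis : ∀ v → norm ⟪ v ⟫ ≡ 1# → ComputedBasis v (N.lineBasis v)
  computedBasis v@(s ∷ _) n = basisBy-correct ((1 ℕ.+ s) N.≈ᵇ 0) v n
    (λ t → trans (⟦⟧-+ 1 s) (≈ᵇ⇒≡ (1 ℕ.+ s) 0 t)) (λ e → ≡⇒≈ᵇ (1 ℕ.+ s) 0 (trans (val 1 ⊕ val s) e))

  ⟪scale⟫ : ∀ t y → ⟪ map (t ℕ.*_) y ⟫ ≡ ⟦ t ⟧ *ᵥ ⟪ y ⟫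
  ⟪scale⟫ t (x ∷ y ∷ z ∷ w ∷ []) = val t ⊗ val x ⹁ val t ⊗ val y ⹁ val t ⊗ val z ⹁ val t ⊗ val w ⹁ refl

  module _ (v : N.V₅) where
    points-fixed : ∀ xy → ComputedBasis v xy → ∀ {p} → p ∈ˡ N.pointsOn xy → ⟪ p ⟫ ≢ 0ᵥ × Fixed ⟪ v ⟫ ⟪ p ⟫
    points-fixed (x , y) cb (here refl) =
      (λ e → 1≢0 (proj₂ (independent 0# 1# (trans (combination-01 b c) (trans (sym y≡) e))))) , subst (Fixed ⟪ v ⟫) (sym y≡) fixed-y
      where
      open ComputedBasis cb renaming (x to b; y to c)
      independent = form≢0⇒independent form≢0
    points-fixed (x , y) cb (there p∈) = shifted (∈-map⁻ _ p∈)
      where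
      open ComputedBasis cb renaming (x to b; y to c)
      independent = form≢0⇒independent form≢0
      p≡ : ∀ t → ⟪ N.plus x (map (t ℕ.*_) y) ⟫ ≡ combination 1# b ⟦ t ⟧ c
      p≡ t = trans (⟪plus⟫ x (map (t ℕ.*_) y)) (cong₂ _+ᵥ_ (trans x≡ (sym (1*ᵥ b))) (trans (⟪scale⟫ t y) (cong (⟦ t ⟧ *ᵥ_) y≡)))
      shifted : ∀ {p} → (∃ λ t → t ∈ˡ upTo q × p ≡ N.plus x (map (t ℕ.*_) y)) → ⟪ p ⟫ ≢ 0ᵥ × Fixed ⟪ v ⟫ ⟪ p ⟫
      shifted (t , _ , refl) =
        (λ e → 1≢0 (proj₁ (independent 1# ⟦ t ⟧ (trans (sym (p≡ t)) e)))) ,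
        subst (Fixed ⟪ v ⟫) (sym (p≡ t)) (Fixed-+ ⟪ v ⟫ (Fixed-* ⟪ v ⟫ 1# fixed-x) (Fixed-* ⟪ v ⟫ ⟦ t ⟧ fixed-y))

    points-complete : ∀ xy → ComputedBasis v xy → ∀ {z} → z ≢ 0ᵥ → Fixed ⟪ v ⟫ z → ∃₂ λ p k → p ∈ˡ N.pointsOn xy × ⟪ p ⟫ ≡ k *ᵥ z
    points-complete (x , y) cb {z} z≢0 fixed = coordinates (spanning fixed)
      where
      open ComputedBasis cb renaming (x to b; y to c)
      shifted : ∀ α β → α ≢ 0# → combination α b β c ≡ z → ∃₂ λ p k → p ∈ˡ N.pointsOn (x , y) × ⟪ p ⟫ ≡ k *ᵥ z
      shifted α β α≢0 e = N.plus x (map (toℕ (i * β) ℕ.*_) y) , i , there (∈-map⁺ (λ t → N.plus x (map (t ℕ.*_) y)) (∈-upTo⁺ (Fin.toℕ<n (i * β)))) ,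
        trans (⟪plus⟫ x (map (toℕ (i * β) ℕ.*_) y)) (trans (cong₂ _+ᵥ_ x≡ (trans (⟪scale⟫ (toℕ (i * β)) y) (cong₂ _*ᵥ_ (⟦toℕ⟧ (i * β)) y≡)))
          (sym (trans (cong (i *ᵥ_) (sym e)) (normalise⁺ i α β (trans (*-comm i α) (proj₂ (inverse α α≢0))) b c))))
        where i = proj₁ (inverse α α≢0)
      unshifted : ∀ α β → α ≡ 0# → β ≢ 0# → combination α b β c ≡ z → ∃₂ λ p k → p ∈ˡ N.pointsOn (x , y) × ⟪ p ⟫ ≡ k *ᵥ z
      unshifted α β α≡0 β≢0 e = y , i , here refl ,
        trans y≡ (sym (trans (cong (i *ᵥ_) (sym e)) (normalise⁻ i α β α≡0 (trans (*-comm i β) (proj₂ (inverse β β≢0))) b c)))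
        where i = proj₁ (inverse β β≢0)
      coordinates : (∃₂ λ α β → combination α b β c ≡ z) → ∃₂ λ p k → p ∈ˡ N.pointsOn (x , y) × ⟪ p ⟫ ≡ k *ᵥ z
      coordinates (α , β , e) = case α ≟ 0# of λ where
        (no α≢0)  → shifted α β α≢0 e
        (yes α≡0) → case β ≟ 0# of λ where
          (no β≢0)  → unshifted α β α≡0 β≢0 e
          (yes β≡0) → ⊥-elim (z≢0 (trans (sym e) (combination-0 b c α≡0 β≡0)))

    linePoints-fixed : norm ⟪ v ⟫ ≡ 1# → ∀ {p} → p ∈ˡ N.linePoints v → ⟪ p ⟫ ≢ 0ᵥ × Fixed ⟪ v ⟫ ⟪ p ⟫
    linePoints-fixed n = points-fixed (N.lineBasis v) (computedBasis v n)

    linePoints-complete : norm ⟪ v ⟫ ≡ 1# → ∀ {z} → z ≢ 0ᵥ → Fixed ⟪ v ⟫ z → ∃₂ λ p k → p ∈ˡ N.linePoints v × ⟪ p ⟫ ≡ k *ᵥ z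
    linePoints-complete n = points-complete (N.lineBasis v) (computedBasis v n)

  isTriad : N.V₅ → N.V₅ → N.V₅ → Bool
  isTriad u v w = N.anyOrthogonal (N.images v (N.linePoints u)) (N.images w (N.linePoints u))

  ⟪crossing⟫ : ∀ v w p → ⟦ N.form (N.reduce (N.inv v p)) (N.reduce (N.inv w p)) ⟧ ≡ form (inv ⟪ v ⟫ ⟪ p ⟫) (inv ⟪ w ⟫ ⟪ p ⟫)
  ⟪crossing⟫ v w p = trans (⟪form⟫ (N.reduce (N.inv v p)) (N.reduce (N.inv w p)))
    (cong₂ form (trans (⟪reduce⟫ (N.inv v p)) (⟪inv⟫ v p)) (trans (⟪reduce⟫ (N.inv w p)) (⟪inv⟫ w p)))

  anyOrthogonal⁻ : ∀ v w ps → T (N.anyOrthogonal (N.images v ps) (N.images w ps)) → ∃ λ p → p ∈ˡ ps × form (inv ⟪ v ⟫ ⟪ p ⟫) (inv ⟪ w ⟫ ⟪ p ⟫) ≡ 0#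
  anyOrthogonal⁻ v w (p ∷ ps) t with ∨⁻ {N.form (N.reduce (N.inv v p)) (N.reduce (N.inv w p)) N.≈ᵇ 0} t
  ... | inj₁ t = p , here refl , trans (sym (⟪crossing⟫ v w p)) (≈ᵇ⇒≡ (N.form (N.reduce (N.inv v p)) (N.reduce (N.inv w p))) 0 t)
  ... | inj₂ t with p′ , p∈ , e ← anyOrthogonal⁻ v w ps t = p′ , there p∈ , e

  anyOrthogonal⁺ : ∀ v w {p ps} → p ∈ˡ ps → form (inv ⟪ v ⟫ ⟪ p ⟫) (inv ⟪ w ⟫ ⟪ p ⟫) ≡ 0# → T (N.anyOrthogonal (N.images v ps) (N.images w ps))
  anyOrthogonal⁺ v w {p} (here refl) e = Equivalence.from T-∨ (inj₁ (≡⇒≈ᵇ (N.form (N.reduce (N.inv v p)) (N.reduce (N.inv w p))) 0 (trans (⟪crossing⟫ v w p) e)))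
  anyOrthogonal⁺ v w (there {x = p} p∈) e = Equivalence.from (T-∨ {N.form (N.reduce (N.inv v p)) (N.reduce (N.inv w p)) N.≈ᵇ 0}) (inj₂ (anyOrthogonal⁺ v w p∈ e))

  isTriad⇒Triad : ∀ u v w → norm ⟪ u ⟫ ≡ 1# → norm ⟪ v ⟫ ≡ 1# → norm ⟪ w ⟫ ≡ 1# → T (isTriad u v w) → Triad ⟪ u ⟫ ⟪ v ⟫ ⟪ w ⟫
  isTriad⇒Triad u v w nu nv nw t with p , p∈ , e ← anyOrthogonal⁻ v w (N.linePoints u) t with p≢0 , fixed ← linePoints-fixed u nu p∈ =
    crossing⇒triad ⟪ u ⟫ ⟪ v ⟫ ⟪ w ⟫ nv nw p≢0 fixed e

  Triad⇒isTriad : ∀ u v w → norm ⟪ u ⟫ ≡ 1# → norm ⟪ v ⟫ ≡ 1# → norm ⟪ w ⟫ ≡ 1# → Triad ⟪ u ⟫ ⟪ v ⟫ ⟪ w ⟫ → T (isTriad u v w)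
  Triad⇒isTriad u v w nu nv nw triad
    with x , x≢0 , ux , y , z , y≢0 , z≢0 , vy , wz , xy , xz , yz ← triad-positive ⟪ u ⟫ ⟪ v ⟫ ⟪ w ⟫ nu triad
    with p , k , p∈ , p≡ ← linePoints-complete u nu x≢0 ux =
    anyOrthogonal⁺ v w p∈ (begin
      form (inv ⟪ v ⟫ ⟪ p ⟫) (inv ⟪ w ⟫ ⟪ p ⟫)               ≡⟨ cong₂ (λ s t → form (inv ⟪ v ⟫ s) (inv ⟪ w ⟫ t)) p≡ p≡ ⟩
      form (inv ⟪ v ⟫ (k *ᵥ x)) (inv ⟪ w ⟫ (k *ᵥ x))         ≡⟨ cong₂ form (inv-* ⟪ v ⟫ k x) (inv-* ⟪ w ⟫ k x) ⟩
      form (k *ᵥ inv ⟪ v ⟫ x) (k *ᵥ inv ⟪ w ⟫ x)             ≡⟨ form-*ˡ k (inv ⟪ v ⟫ x) (k *ᵥ inv ⟪ w ⟫ x) ⟩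
      k * form (inv ⟪ v ⟫ x) (k *ᵥ inv ⟪ w ⟫ x)              ≡⟨ cong (k *_) (form-*ʳ (inv ⟪ v ⟫ x) k (inv ⟪ w ⟫ x)) ⟩
      -- The tested point is k x rather than x; the crossing form is quadratic in the point, so its
      -- vanishing is a property of the projective point.
      k * (k * form (inv ⟪ v ⟫ x) (inv ⟪ w ⟫ x))             ≡⟨ cong (λ f → k * (k * f)) (crossing ⟪ v ⟫ ⟪ w ⟫ nv nw vy wz y≢0 z≢0 xy xz yz) ⟩
      k * (k * 0#)                                           ≡⟨ trans (cong (k *_) (zeroʳ k)) (zeroʳ k) ⟩
      0#                                                     ∎)
    where open ≡-Reasoning

module ListSums (q : ℕ) .{{_ : NonZero q}} where
  open Algebra.Properties.CommutativeMonoid.Sum ℕ.+-0-commutativeMonoid using (sum; sum-cong-≗; sum-permute) public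
  open Checker q using (total; symmetricTotal)
  open ≡-Reasoning

  total-lookup : ∀ {A B : Set} (f : B → ℕ) (h : A → B) (L : List A) → total f (List.map h L) ≡ sum (λ i → f (h (lookup L i)))
  total-lookup f h []      = refl
  total-lookup f h (x ∷ L) = cong (f (h x) ℕ.+_) (total-lookup f h L)

  total-cong : ∀ {A : Set} {f g : A → ℕ} → (∀ x → f x ≡ g x) → ∀ L → total f L ≡ total g L
  total-cong e []      = refl
  total-cong e (x ∷ L) = cong₂ ℕ._+_ (e x) (total-cong e L)

  interchange : ∀ a b c d → a ℕ.+ b ℕ.+ (c ℕ.+ d) ≡ a ℕ.+ c ℕ.+ (b ℕ.+ d)
  interchange = solve-∀

  regroup : ∀ a b c → a ℕ.+ 2 ℕ.* b ℕ.+ c ≡ a ℕ.+ b ℕ.+ (b ℕ.+ c)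
  regroup = solve-∀

  total-+ : ∀ {A : Set} (f g : A → ℕ) L → total (λ x → f x ℕ.+ g x) L ≡ total f L ℕ.+ total g L
  total-+ f g []      = refl
  total-+ f g (x ∷ L) = begin
    f x ℕ.+ g x ℕ.+ total (λ x → f x ℕ.+ g x) L        ≡⟨ cong (f x ℕ.+ g x ℕ.+_) (total-+ f g L) ⟩
    f x ℕ.+ g x ℕ.+ (total f L ℕ.+ total g L)          ≡⟨ interchange (f x) (g x) (total f L) (total g L) ⟩
    f x ℕ.+ total f L ℕ.+ (g x ℕ.+ total g L)          ∎

  symmetricTotal-total : ∀ {A : Set} (f : A → A → ℕ) → (∀ x y → f x y ≡ f y x) → ∀ L → symmetricTotal f L ≡ total (λ x → total (f x) L) L
  symmetricTotal-total f f-sym []      = refl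
  symmetricTotal-total f f-sym (x ∷ L) = begin
    f x x ℕ.+ 2 ℕ.* total (f x) L ℕ.+ symmetricTotal f L
      ≡⟨ cong (f x x ℕ.+ 2 ℕ.* total (f x) L ℕ.+_) (symmetricTotal-total f f-sym L) ⟩
    f x x ℕ.+ 2 ℕ.* total (f x) L ℕ.+ total (λ y → total (f y) L) L
      ≡⟨ regroup (f x x) (total (f x) L) (total (λ y → total (f y) L) L) ⟩
    f x x ℕ.+ total (f x) L ℕ.+ (total (f x) L ℕ.+ total (λ y → total (f y) L) L)
      ≡⟨ cong (λ t → f x x ℕ.+ total (f x) L ℕ.+ (t ℕ.+ total (λ y → total (f y) L) L)) (total-cong (f-sym x) L) ⟩
    f x x ℕ.+ total (f x) L ℕ.+ (total (λ y → f y x) L ℕ.+ total (λ y → total (f y) L) L)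
      ≡⟨ cong (f x x ℕ.+ total (f x) L ℕ.+_) (total-+ (λ y → f y x) (λ y → total (f y) L) L) ⟨
    f x x ℕ.+ total (f x) L ℕ.+ total (λ y → f y x ℕ.+ total (f y) L) L ∎

module Codes (q : ℕ) .{{_ : NonZero q}} (isField : Residues.IsOddField q) where
  open Residues q hiding (isCommutativeRing)
  open Homomorphism q isField
  private
    module N = Checker q
    F = residueField isField
  open Field F using (0#; 1#; _*_; _+_; _-_; -_; inverse; 1≢0; 2≢0; _≟_)
  open Algebra F
  open Lines F
  open Frames F using (x-x≡0)
  open Triads F
  open Decision q isField
  open ListSums q

  -- The checker stores one vector per pair; this restores both lines.
  signedCode : List N.V₅ → List (Vec (𝔽 q) 5)
  signedCode L = List.map ⟪_⟫ L ++ List.map (neg₅ ∘ ⟪_⟫) L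

  normalize : ∀ p → p ≢ 0ᵥ → ∃₂ λ n k → n ∈ˡ N.normalized × ⟪ n ⟫ ≡ k *ᵥ p × k ≢ 0#
  normalize (x ∷ y ∷ z ∷ w ∷ []) p≢0 = cases (x ≟ 0#) (y ≟ 0#) (z ≟ 0#) (w ≟ 0#)
    where
    n₁ : List N.V₄
    n₁ = cartesianProductWith (λ y zw → 1 ∷ y ∷ zw) (upTo q) (cartesianProductWith (λ z w → z ∷ w ∷ []) (upTo q) (upTo q))
    n₂ : List N.V₄
    n₂ = cartesianProductWith (λ z w → 0 ∷ 1 ∷ z ∷ w ∷ []) (upTo q) (upTo q)
    n₃ : List N.V₄
    n₃ = List.map (λ w → 0 ∷ 0 ∷ 1 ∷ w ∷ []) (upTo q)
    <q : ∀ (a : 𝔽 q) → toℕ a ∈ˡ upTo q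
    <q a = ∈-upTo⁺ (Fin.toℕ<n a)
    unit≢0 : ∀ {a i} → a * i ≡ 1# → i ≢ 0#
    unit≢0 {a} e refl = 1≢0 (trans (sym e) (zeroʳ a))
    zero* : ∀ {a} i → a ≡ 0# → ⟦ 0 ⟧ ≡ i * a
    zero* i refl = sym (zeroʳ i)
    one* : ∀ {a i} → a * i ≡ 1# → ⟦ 1 ⟧ ≡ i * a
    one* {a} {i} e = sym (trans (*-comm i a) e)
    cases : Dec (x ≡ 0#) → Dec (y ≡ 0#) → Dec (z ≡ 0#) → Dec (w ≡ 0#) → ∃₂ λ n k → n ∈ˡ N.normalized × ⟪ n ⟫ ≡ k *ᵥ (x ∷ y ∷ z ∷ w ∷ []) × k ≢ 0#
    cases (no x≢0) _ _ _ = let i , e = inverse x x≢0 in _ , i ,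
      ∈-++⁺ˡ (∈-cartesianProductWith⁺ _ (<q (i * y)) (∈-cartesianProductWith⁺ _ (<q (i * z)) (<q (i * w)))) ,
      (one* {x} {i} e ⹁ ⟦toℕ⟧ (i * y) ⹁ ⟦toℕ⟧ (i * z) ⹁ ⟦toℕ⟧ (i * w) ⹁ refl) , unit≢0 {x} {i} e
    cases (yes x≡0) (no y≢0) _ _ = let i , e = inverse y y≢0 in _ , i ,
      ∈-++⁺ʳ n₁ (∈-++⁺ˡ (∈-cartesianProductWith⁺ _ (<q (i * z)) (<q (i * w)))) ,
      (zero* {x} i x≡0 ⹁ one* {y} {i} e ⹁ ⟦toℕ⟧ (i * z) ⹁ ⟦toℕ⟧ (i * w) ⹁ refl) , unit≢0 {y} {i} e
    cases (yes x≡0) (yes y≡0) (no z≢0) _ = let i , e = inverse z z≢0 in _ , i ,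
      ∈-++⁺ʳ n₁ (∈-++⁺ʳ n₂ (∈-++⁺ˡ (∈-map⁺ _ (<q (i * w))))) ,
      (zero* {x} i x≡0 ⹁ zero* {y} i y≡0 ⹁ one* {z} {i} e ⹁ ⟦toℕ⟧ (i * w) ⹁ refl) , unit≢0 {z} {i} e
    cases (yes x≡0) (yes y≡0) (yes z≡0) (no w≢0) = let i , e = inverse w w≢0 in _ , i ,
      ∈-++⁺ʳ n₁ (∈-++⁺ʳ n₂ (∈-++⁺ʳ n₃ (here refl))) ,
      (zero* {x} i x≡0 ⹁ zero* {y} i y≡0 ⹁ zero* {z} i z≡0 ⹁ one* {w} {i} e ⹁ refl) , unit≢0 {w} {i} e
    cases (yes refl) (yes refl) (yes refl) (yes refl) = ⊥-elim (p≢0 refl)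

  onPair⇒OnPair : ∀ p v → T (N.onPair p v) → OnPair ⟪ v ⟫ ⟪ p ⟫
  onPair⇒OnPair p v t = Sum.map (fixes⇒Fixed v p)
    (λ t → trans (inv-neg ⟪ v ⟫ ⟪ p ⟫) (trans (cong -ᵥ_ (trans (sym (⟪inv⟫ v p)) (trans (≈ᵛ⇒≡ (N.inv v p) (N.neg p) t) (⟪neg₄⟫ p)))) (-ᵥ-involutive ⟪ p ⟫)))
    (∨⁻ {N.inv v p N.≈ᵛ p} t)

  OnPair⇒onPair : ∀ p v → OnPair ⟪ v ⟫ ⟪ p ⟫ → T (N.onPair p v)
  OnPair⇒onPair p v (inj₁ e) = Equivalence.from T-∨ (inj₁ (Fixed⇒fixes v p e))
  OnPair⇒onPair p v (inj₂ e) = Equivalence.from (T-∨ {N.inv v p N.≈ᵛ p}) (inj₂ (≡⇒≈ᵛ (N.inv v p) (N.neg p)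
    (trans (⟪inv⟫ v p) (trans (sym (-ᵥ-involutive _)) (trans (cong -ᵥ_ (trans (sym (inv-neg ⟪ v ⟫ ⟪ p ⟫)) e)) (sym (⟪neg₄⟫ p)))))))

  Fixed-scale : ∀ v {n k p} → n ≡ k *ᵥ p → k ≢ 0# → Fixed v n → Fixed v p
  Fixed-scale v {k = k} {p} refl k≢0 fixed = let i , e = inverse k k≢0 in
    subst (Fixed v) (trans (assocᵥ i k p) (trans (cong (_*ᵥ p) (trans (*-comm i k) e)) (1*ᵥ p))) (Fixed-* v i fixed)

  OnPair-* : ∀ v {p} k → OnPair v p → OnPair v (k *ᵥ p)
  OnPair-* v k (inj₁ e) = inj₁ (Fixed-* v k e)
  OnPair-* v k (inj₂ e) = inj₂ (Fixed-* (neg₅ v) k e)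

  bothSigns⇒0 : ∀ v p → Fixed v p → Fixed (neg₅ v) p → p ≡ 0ᵥ
  bothSigns⇒0 v p e e′ = double p (trans (cong (p +ᵥ_) (trans (sym e′) (trans (inv-neg v p) (cong -ᵥ_ e)))) (x-x≡0 p))

  singleton-unique : ∀ {A : Set} {xs : List A} {x y} → T (N.isSingleton xs) → x ∈ˡ xs → y ∈ˡ xs → x ≡ y
  singleton-unique {xs = _ ∷ []} _ (here refl) (here refl) = refl

  singleton-element : ∀ {A : Set} {xs : List A} → T (N.isSingleton xs) → ∃ λ x → x ∈ˡ xs
  singleton-element {xs = x ∷ []} _ = x , here refl

  module CheckedCode (L : List N.V₅) (t : T (N.isCode L)) where
    unit-L : ∀ {v} → v ∈ˡ L → norm ⟪ v ⟫ ≡ 1#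
    unit-L {v} v∈ = trans (sym (⟪norm⟫ v)) (≈ᵇ⇒≡ (N.norm v) 1 (all⁻ _ L (proj₁ (∧⁻ t)) v∈))

    t₁ = proj₂ (∧⁻ {all (λ v → N.norm v N.≈ᵇ 1) L} t)

    exactlyOne : ∀ {p} → p ∈ˡ N.normalized → T (N.isSingleton (filterᵇ (N.onPair p) L))
    exactlyOne = all⁻ _ N.normalized (proj₂ (∧⁻ {N.distinct L} t₁))

    distinct-lookup : ∀ L → T (N.distinct L) → ∀ i j → lookup L i ≡ lookup L j → i ≡ j
    distinct-lookup (v ∷ L) t Fin.zero    Fin.zero    e = refl
    distinct-lookup (v ∷ L) t Fin.zero    (Fin.suc j) e = ⊥-elim (not⁻ (proj₁ (∧⁻ (all⁻ _ L (proj₁ (∧⁻ t)) (∈-lookup {xs = L} j)))) (≡⇒≈ᵛ v (lookup L j) (cong ⟪_⟫ e)))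
    distinct-lookup (v ∷ L) t (Fin.suc i) Fin.zero    e = ⊥-elim (not⁻ (proj₁ (∧⁻ (all⁻ _ L (proj₁ (∧⁻ t)) (∈-lookup {xs = L} i)))) (≡⇒≈ᵛ v (lookup L i) (cong ⟪_⟫ (sym e))))
    distinct-lookup (v ∷ L) t (Fin.suc i) (Fin.suc j) e = cong Fin.suc (distinct-lookup L (proj₂ (∧⁻ {all (λ w → not (v N.≈ᵛ w) ∧ not (v N.≈ᵛ N.neg w)) L} t)) i j e)

    injective : ∀ i j → lookup L i ≡ lookup L j → i ≡ j
    injective = distinct-lookup L (proj₁ (∧⁻ t₁))

    pair-unique : ∀ {v w p} → v ∈ˡ L → w ∈ˡ L → p ≢ 0ᵥ → OnPair ⟪ v ⟫ p → OnPair ⟪ w ⟫ p → v ≡ w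
    pair-unique {v} {w} {p} v∈ w∈ p≢0 pv pw = let n , k , n∈ , e , _ = normalize p p≢0 in
      singleton-unique (exactlyOne n∈) (member {n} {k} e v v∈ pv) (member {n} {k} e w w∈ pw)
      where
      member : ∀ {n k} → ⟪ n ⟫ ≡ k *ᵥ p → ∀ v → v ∈ˡ L → OnPair ⟪ v ⟫ p → v ∈ˡ filterᵇ (N.onPair n) L
      member {n} {k} e v v∈ pv = ∈-filter⁺ (T? ∘ N.onPair n) v∈ (OnPair⇒onPair n v (subst (OnPair ⟪ v ⟫) (sym e) (OnPair-* ⟪ v ⟫ k pv)))

    covering : ∀ p → p ≢ 0ᵥ → ∃ λ v → v ∈ˡ L × OnPair ⟪ v ⟫ p
    covering p p≢0 =
      let n , k , n∈ , e , k≢0 = normalize p p≢0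
          v , v∈ = singleton-element (exactlyOne n∈)
          v∈L , on = ∈-filter⁻ (T? ∘ N.onPair n) {xs = L} v∈
      in v , v∈L , Sum.map (Fixed-scale ⟪ v ⟫ {k = k} e k≢0) (Fixed-scale (neg₅ ⟪ v ⟫) {k = k} e k≢0) (onPair⇒OnPair n v on)

    positive : ∀ {v} → v ∈ˡ L → ⟪ v ⟫ ∈ˡ signedCode L
    positive v∈ = ∈-++⁺ˡ (∈-map⁺ ⟪_⟫ v∈)

    negative : ∀ {v} → v ∈ˡ L → neg₅ ⟪ v ⟫ ∈ˡ signedCode L
    negative v∈ = ∈-++⁺ʳ (List.map ⟪_⟫ L) (∈-map⁺ (neg₅ ∘ ⟪_⟫) v∈)

    signed⁻ : ∀ {u} → u ∈ˡ signedCode L → ∃ λ v → v ∈ˡ L × (u ≡ ⟪ v ⟫ ⊎ u ≡ neg₅ ⟪ v ⟫)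
    signed⁻ u∈ =
      [ (λ u∈ → let v , v∈ , e = ∈-map⁻ ⟪_⟫ u∈ in v , v∈ , inj₁ e)
      , (λ u∈ → let v , v∈ , e = ∈-map⁻ (neg₅ ∘ ⟪_⟫) u∈ in v , v∈ , inj₂ e) ]′ (∈-++⁻ (List.map ⟪_⟫ L) u∈)

    module _ (P : SymplecticPolarity q) where
      open FrameLines q isField P using (IsCode)

      isCodeSigned : IsCode (signedCode L)
      isCodeSigned = record { unit = unit ; neg-closed = neg-closed ; covers = covers ; disjoint = disjoint }
        where
        unit : ∀ {u} → u ∈ˡ signedCode L → norm u ≡ 1#
        unit u∈ = go (signed⁻ u∈)
          where
          go : ∀ {u} → (∃ λ v → v ∈ˡ L × (u ≡ ⟪ v ⟫ ⊎ u ≡ neg₅ ⟪ v ⟫)) → norm u ≡ 1#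
          go (v , v∈ , inj₁ refl) = unit-L v∈
          go (v , v∈ , inj₂ refl) = trans (norm-neg ⟪ v ⟫) (unit-L v∈)
        neg-closed : ∀ {u} → u ∈ˡ signedCode L → neg₅ u ∈ˡ signedCode L
        neg-closed u∈ = go (signed⁻ u∈)
          where
          go : ∀ {u} → (∃ λ v → v ∈ˡ L × (u ≡ ⟪ v ⟫ ⊎ u ≡ neg₅ ⟪ v ⟫)) → neg₅ u ∈ˡ signedCode L
          go (v , v∈ , inj₁ refl) = negative v∈
          go (v , v∈ , inj₂ refl) = subst (_∈ˡ signedCode L) (sym (neg-neg ⟪ v ⟫)) (positive v∈)
        covers : ∀ p → p ≢ 0ᵥ → ∃ λ v → v ∈ˡ signedCode L × Fixed v p
        covers p p≢0 = go (covering p p≢0)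
          where
          go : (∃ λ v → v ∈ˡ L × OnPair ⟪ v ⟫ p) → ∃ λ v → v ∈ˡ signedCode L × Fixed v p
          go (v , v∈ , inj₁ f) = ⟪ v ⟫ , positive v∈ , f
          go (v , v∈ , inj₂ f) = neg₅ ⟪ v ⟫ , negative v∈ , f
        disjoint : ∀ {v w p} → v ∈ˡ signedCode L → w ∈ˡ signedCode L → p ≢ 0ᵥ → Fixed v p → Fixed w p → v ≡ w
        disjoint {p = p} u∈ u′∈ p≢0 f f′ = go (signed⁻ u∈) (signed⁻ u′∈) f f′
          where
          opposite : ∀ {v w} → v ≡ w → Fixed ⟪ v ⟫ p → Fixed (neg₅ ⟪ w ⟫) p → ⊥
          opposite {v} refl f f′ = p≢0 (bothSigns⇒0 ⟪ v ⟫ p f f′)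
          go : ∀ {u u′} → (∃ λ v → v ∈ˡ L × (u ≡ ⟪ v ⟫ ⊎ u ≡ neg₅ ⟪ v ⟫)) → (∃ λ v → v ∈ˡ L × (u′ ≡ ⟪ v ⟫ ⊎ u′ ≡ neg₅ ⟪ v ⟫)) →
               Fixed u p → Fixed u′ p → u ≡ u′
          go (v , v∈ , inj₁ refl) (w , w∈ , inj₁ refl) f f′ = cong ⟪_⟫ (pair-unique v∈ w∈ p≢0 (inj₁ f) (inj₁ f′))
          go (v , v∈ , inj₂ refl) (w , w∈ , inj₂ refl) f f′ = cong (neg₅ ∘ ⟪_⟫) (pair-unique v∈ w∈ p≢0 (inj₂ f) (inj₂ f′))
          go (v , v∈ , inj₁ refl) (w , w∈ , inj₂ refl) f f′ = ⊥-elim (opposite (pair-unique v∈ w∈ p≢0 (inj₁ f) (inj₂ f′)) f f′)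
          go (v , v∈ , inj₂ refl) (w , w∈ , inj₁ refl) f f′ = ⊥-elim (opposite (pair-unique w∈ v∈ p≢0 (inj₁ f′) (inj₂ f)) f′ f)

  -- Summation over positions lets a permutation of the pairs act on the count.
  triads-sum : ∀ L → N.triads L ≡ sum (λ i → sum (λ j → sum (λ k → N.indicator (isTriad (lookup L i) (lookup L j) (lookup L k)))))
  triads-sum L = begin
    N.triads L
      ≡⟨ trans (cong (N.total countOf) (sym (List.map-id L))) (total-lookup countOf (λ u → u) L) ⟩
    sum (λ i → countOf (lookup L i))
      ≡⟨ sum-cong-≗ (λ i → symmetricTotal-total N.crossings crossings-sym (rows (lookup L i))) ⟩
    sum (λ i → N.total (λ r → N.total (N.crossings r) (rows (lookup L i))) (rows (lookup L i)))
      ≡⟨ sum-cong-≗ (λ i → total-lookup (λ r → N.total (N.crossings r) (rows (lookup L i))) (row (lookup L i)) L) ⟩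
    sum (λ i → sum (λ j → N.total (N.crossings (row (lookup L i) (lookup L j))) (rows (lookup L i))))
      ≡⟨ sum-cong-≗ (λ i → sum-cong-≗ λ j → total-lookup (N.crossings (row (lookup L i) (lookup L j))) (row (lookup L i)) L) ⟩
    sum (λ i → sum (λ j → sum (λ k → N.indicator (isTriad (lookup L i) (lookup L j) (lookup L k))))) ∎
    where
    open ≡-Reasoning
    row : N.V₅ → N.V₅ → List N.V₄
    row u v = N.images v (N.linePoints u)
    rows : N.V₅ → List (List N.V₄)
    rows u = List.map (row u) L
    countOf : N.V₅ → ℕ
    countOf u = N.countRows (rows u)
    anyOrthogonal-sym : ∀ r s → N.anyOrthogonal r s ≡ N.anyOrthogonal s r
    anyOrthogonal-sym []      []      = refl
    anyOrthogonal-sym []      (_ ∷ _) = refl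
    anyOrthogonal-sym (_ ∷ _) []      = refl
    anyOrthogonal-sym (x ∷ r) (y ∷ s) = cong₂ _∨_ (T-injective (swapped x y) (swapped y x)) (anyOrthogonal-sym r s)
      where
      swapped : ∀ x y → T (N.form x y N.≈ᵇ 0) → T (N.form y x N.≈ᵇ 0)
      swapped x y t = ≡⇒≈ᵇ (N.form y x) 0 (trans (⟪form⟫ y x) (form-sym0 ⟪ x ⟫ ⟪ y ⟫ (trans (sym (⟪form⟫ x y)) (≈ᵇ⇒≡ (N.form x y) 0 t))))
    crossings-sym : ∀ r s → N.crossings r s ≡ N.crossings s r
    crossings-sym r s = cong N.indicator (anyOrthogonal-sym r s)

-- Invariance of the triad count under graph automorphisms

module Invariance (q : ℕ) .{{_ : NonZero q}} (isField : Residues.IsOddField q) (P : SymplecticPolarity q) where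
  open Residues q hiding (isCommutativeRing)
  open Homomorphism q isField
  open Polar q isField P hiding (F)
  private
    module N = Checker q
    F = residueField isField
  open Field F using (0#; 1#; _*_; _+_; _-_; -_; inverse; 1≢0; 2≢0; _≟_)
  open Algebra F
  open Lines F
  open Frames F
  open VectorLemmas F
  open Triads F
  open Decision q isField
  open Codes q isField
  open ListSums q
  open Spreads q isField P
  open FrameLines q isField P
  open SymplecticPolarity P using (ζ; absolute)

  ≈ₚ? : ∀ x y → Dec (x ≈ₚ y)
  ≈ₚ? x y = decide (T? (Subspace.member (proj₁ x) (generator y)))
    where
    invert : (∃ λ c → c *ᵥ generator x ≡ generator y) → generator x ∈ proj₁ y
    invert (c , e) = case c ≟ 0# of λ where
      (yes c≡0) → ⊥-elim (generator≢0 y (trans (sym e) (trans (cong (_*ᵥ generator x) c≡0) (0*ᵥ (generator x)))))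
      (no c≢0) → let i , i-inverse = inverse c c≢0 in subst (_∈ proj₁ y)
        (trans (cong (i *ᵥ_) (sym e)) (trans (assocᵥ i c (generator x)) (trans (cong (_*ᵥ generator x) (trans (*-comm i c) i-inverse)) (1*ᵥ (generator x)))))
        (Subspace.*-closed (proj₁ y) i _ (generator∈ y))
    decide : Dec (generator y ∈ proj₁ x) → Dec (x ≈ₚ y)
    decide (no ¬∈)  = no λ x≈y → ¬∈ (proj₂ x≈y _ (generator∈ y))
    decide (yes ∈x) = yes (point⊆ x (proj₁ y) (invert (generates x ∈x)) , point⊆ y (proj₁ x) ∈x)

  ≈⇒orthogonal : ∀ x y → x ≈ₚ y → Orthogonal P x y
  ≈⇒orthogonal x y (_ , y⊆x) w = absolute x w ∘ y⊆x w

  orthogonal-≈ : ∀ x x′ y y′ → x′ ≈ₚ x → y′ ≈ₚ y → Orthogonal P x y → Orthogonal P x′ y′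
  orthogonal-≈ x x′ y y′ (x′⊆x , _) (y′⊆y , _) o w w∈ = SymplecticPolarity.antitonic P x′⊆x w (o w (y′⊆y w w∈))

  module _ (φ : Point q → Point q) (isAut : IsGraphAutomorphism P φ) where
    open IsOrderIsomorphism isAut renaming (cong to φ-cong; mono to φ-mono; injective to φ-injective; cancel to φ-cancel; surjective to φ-surjective)

    -- Adjacency concerns distinct points only. Equality of points is decidable and equal points are
    -- orthogonal, since all points are absolute; so orthogonality is recovered from adjacency.
    φ-orthogonal : ∀ x y → Orthogonal P x y → Orthogonal P (φ x) (φ y)
    φ-orthogonal x y o = case ≈ₚ? x y of λ where
      (yes x≈y) → ≈⇒orthogonal (φ x) (φ y) (φ-cong {x} {y} x≈y)
      (no x≉y)  → proj₂ (φ-mono {x} {y} (x≉y , o))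

    φ-orthogonal⁻ : ∀ x y → Orthogonal P (φ x) (φ y) → Orthogonal P x y
    φ-orthogonal⁻ x y o = case ≈ₚ? x y of λ where
      (yes x≈y) → ≈⇒orthogonal x y x≈y
      (no x≉y)  → proj₂ (φ-cancel {x} {y} ((λ e → x≉y (φ-injective {x} {y} e)) , o))

    φ-onto : ∀ y → ∃ λ x → φ x ≈ₚ y
    φ-onto y = let x , h = φ-surjective y in x , h {x} ((λ _ p → p) , (λ _ p → p))

    PerpTo : Line q → Point q → Set
    PerpTo ℓ x = ∀ y → y on ℓ → Orthogonal P y x

    perpTo⁺ : ∀ ℓ m → MapsLine φ ℓ m → ∀ x → PerpTo ℓ x → PerpTo m (φ x)
    perpTo⁺ ℓ m maps x perp y′ y′-on = let y , φy≈y′ = φ-onto y′ in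
      orthogonal-≈ (φ y) y′ (φ x) (φ x) (proj₂ φy≈y′ , proj₁ φy≈y′) ((λ _ p → p) , (λ _ p → p)) (φ-orthogonal y x (perp y (Equivalence.from (maps y) (λ w → y′-on w ∘ proj₁ φy≈y′ w))))

    perpTo⁻ : ∀ ℓ m → MapsLine φ ℓ m → ∀ x → PerpTo m (φ x) → PerpTo ℓ x
    perpTo⁻ ℓ m maps x perp y y-on = φ-orthogonal⁻ y x (perp (φ y) (Equivalence.to (maps y) y-on))

    module _ (C : Coordinates) where
      open Frame C

      coordinate : Point q → V
      coordinate x = to (generator x)

      coordinate≢0 : ∀ x → coordinate x ≢ 0ᵥ
      coordinate≢0 x = to≢0 C (generator≢0 x)

      OnPairOf : Vec (𝔽 q) 5 → Point q → Set
      OnPairOf v x = OnPair v (coordinate x)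

      module _ {v : Vec (𝔽 q) 5} {ℓ : Line q} (ℓ⊆ : proj₁ ℓ ⊆ lineSubspace C v) (⊆ℓ : lineSubspace C v ⊆ proj₁ ℓ) (n : norm v ≡ 1#) where
        on⇒fixed : ∀ x → x on ℓ → Fixed v (coordinate x)
        on⇒fixed x x-on = ∈⇒Fixed C v _ (ℓ⊆ _ (on⇒∈ x ℓ x-on))

        fixed⇒on : ∀ x → Fixed v (coordinate x) → x on ℓ
        fixed⇒on x f = point⊆ x (proj₁ ℓ) (⊆ℓ _ (Fixed⇒∈ C v _ f))

        perp⇒fixed : ∀ x → PerpTo ℓ x → Fixed (neg₅ v) (coordinate x)
        perp⇒fixed x perp = perpFixed v n (coordinate x) λ z f → case z ≟0ᵥ of λ where
          (yes z≡0) → trans (cong (λ z → form z (coordinate x)) z≡0) (form-0ˡ (coordinate x))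
          (no z≢0)  → subst (λ z → form z (coordinate x) ≡ 0#) (to∘from z) (orth⇒form (from z) (generator x)
            (orthogonal⇒⟂ (point (from z) (from≢0 C z≢0)) x (perp (point (from z) (from≢0 C z≢0))
              (⟨⟩⊆ (proj₁ ℓ) (⊆ℓ _ (Fixed⇒∈ C v _ (subst (Fixed v) (sym (to∘from z)) f)))))))

        fixed⇒perp : ∀ x → Fixed (neg₅ v) (coordinate x) → PerpTo ℓ x
        fixed⇒perp x f y y-on = ⟂⇒orthogonal y x (form⇒orth _ _ (fixed-perp v _ _ (on⇒fixed y y-on) f))

      Corresponds : Vec (𝔽 q) 5 → Vec (𝔽 q) 5 → Set
      Corresponds v v′ = ∀ x → OnPairOf v x ⇔ OnPairOf v′ (φ x)

      -- The hypothesis speaks of ℓ and m alone. Their perps correspond as well, because the points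
      -- of ℓ^ζ are those orthogonal to all points of ℓ, a condition that φ preserves in both
      -- directions.
      linesCorrespond : ∀ {v v′} (n : norm v ≡ 1#) (n′ : norm v′ ≡ 1#) (ℓ m : Line q) →
        proj₁ ℓ ⊆ lineSubspace C v → proj₁ m ⊆ lineSubspace C v′ → MapsLine φ ℓ m → Corresponds v v′
      linesCorrespond {v} {v′} n n′ ℓ m ℓ⊆ m⊆ maps x = mk⇔ forward backward
        where
        ⊆ℓ : lineSubspace C v ⊆ proj₁ ℓ
        ⊆ℓ = line⊆⇒⊇ ℓ (lineOf C v n) ℓ⊆
        ⊆m : lineSubspace C v′ ⊆ proj₁ m
        ⊆m = line⊆⇒⊇ m (lineOf C v′ n′) m⊆
        forward : OnPairOf v x → OnPairOf v′ (φ x)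
        forward (inj₁ f) = inj₁ (on⇒fixed {v′} {m} m⊆ ⊆m n′ (φ x) (Equivalence.to (maps x) (fixed⇒on {v} {ℓ} ℓ⊆ ⊆ℓ n x f)))
        forward (inj₂ f) = inj₂ (perp⇒fixed {v′} {m} m⊆ ⊆m n′ (φ x) (perpTo⁺ ℓ m maps x (fixed⇒perp {v} {ℓ} ℓ⊆ ⊆ℓ n x f)))
        backward : OnPairOf v′ (φ x) → OnPairOf v x
        backward (inj₁ f) = inj₁ (on⇒fixed {v} {ℓ} ℓ⊆ ⊆ℓ n x (Equivalence.from (maps x) (fixed⇒on {v′} {m} m⊆ ⊆m n′ (φ x) f)))
        backward (inj₂ f) = inj₂ (perp⇒fixed {v} {ℓ} ℓ⊆ ⊆ℓ n x (perpTo⁻ ℓ m maps x (fixed⇒perp {v′} {m} m⊆ ⊆m n′ (φ x) f)))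

      OnPairOf-≈ : ∀ v x y → x ≈ₚ y → OnPairOf v x → OnPairOf v y
      OnPairOf-≈ v x y (_ , y⊆x) on-x = let c , e = generates x (y⊆x _ (generator∈ y)) in
        subst (OnPair v) (trans (sym (IsLinear′.homogeneous c (generator x))) (cong to e)) (OnPair-* v c on-x)
        where module IsLinear′ = Linear.IsLinear to-linear

      pointOf : ∀ {z} → z ≢ 0ᵥ → Point q
      pointOf {z} z≢0 = point (from z) (from≢0 C z≢0)

      pointOf-on : ∀ v {z} (z≢0 : z ≢ 0ᵥ) → OnPair v z → OnPairOf v (pointOf z≢0)
      pointOf-on v {z} _ = subst (OnPair v) (sym (to∘from z))

      form⇒orthogonal : ∀ {z w} (z≢0 : z ≢ 0ᵥ) (w≢0 : w ≢ 0ᵥ) → form z w ≡ 0# → Orthogonal P (pointOf z≢0) (pointOf w≢0)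
      form⇒orthogonal {z} {w} z≢0 w≢0 e = ⟂⇒orthogonal (pointOf z≢0) (pointOf w≢0)
        (form⇒orth _ _ (subst₂ (λ z w → form z w ≡ 0#) (sym (to∘from z)) (sym (to∘from w)) e))

      orthogonal⇒form : ∀ x y → Orthogonal P x y → form (coordinate x) (coordinate y) ≡ 0#
      orthogonal⇒form x y o = orth⇒form _ _ (orthogonal⇒⟂ x y o)

      triad⁺ : ∀ {u v w u′ v′ w′} → Corresponds u u′ → Corresponds v v′ → Corresponds w w′ → Triad u v w → Triad u′ v′ w′
      triad⁺ cu cv cw (mkTriad x≢0 y≢0 z≢0 xu yv zw xy yz xz) = mkTriad
        (coordinate≢0 (φ X)) (coordinate≢0 (φ Y)) (coordinate≢0 (φ Z))
        (Equivalence.to (cu X) (pointOf-on _ x≢0 xu)) (Equivalence.to (cv Y) (pointOf-on _ y≢0 yv)) (Equivalence.to (cw Z) (pointOf-on _ z≢0 zw))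
        (image X Y (form⇒orthogonal x≢0 y≢0 xy)) (image Y Z (form⇒orthogonal y≢0 z≢0 yz)) (image X Z (form⇒orthogonal x≢0 z≢0 xz))
        where
        X = pointOf x≢0
        Y = pointOf y≢0
        Z = pointOf z≢0
        image : ∀ x y → Orthogonal P x y → form (coordinate (φ x)) (coordinate (φ y)) ≡ 0#
        image x y o = orthogonal⇒form (φ x) (φ y) (φ-orthogonal x y o)

      triad⁻ : ∀ {u v w u′ v′ w′} → Corresponds u u′ → Corresponds v v′ → Corresponds w w′ → Triad u′ v′ w′ → Triad u v w
      triad⁻ {u} {v} {w} {u′} {v′} {w′} cu cv cw (mkTriad x≢0 y≢0 z≢0 xu yv zw xy yz xz) = mkTriad
        (coordinate≢0 X) (coordinate≢0 Y) (coordinate≢0 Z)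
        (pull cu x≢0 xu) (pull cv y≢0 yv) (pull cw z≢0 zw)
        (preimage x≢0 y≢0 xy) (preimage y≢0 z≢0 yz) (preimage x≢0 z≢0 xz)
        where
        back : ∀ {z} → z ≢ 0ᵥ → Point q
        back z≢0 = proj₁ (φ-onto (pointOf z≢0))
        φ-back : ∀ {z} (z≢0 : z ≢ 0ᵥ) → φ (back z≢0) ≈ₚ pointOf z≢0
        φ-back z≢0 = proj₂ (φ-onto (pointOf z≢0))
        X = back x≢0
        Y = back y≢0
        Z = back z≢0
        pull : ∀ {v v′ z} → Corresponds v v′ → (z≢0 : z ≢ 0ᵥ) → OnPair v′ z → OnPairOf v (back z≢0)
        pull {v′ = v′} c z≢0 on-z = Equivalence.from (c (back z≢0)) (OnPairOf-≈ v′ (pointOf z≢0) (φ (back z≢0)) (proj₂ (φ-back z≢0) , proj₁ (φ-back z≢0)) (pointOf-on v′ z≢0 on-z))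
        preimage : ∀ {z w} (z≢0 : z ≢ 0ᵥ) (w≢0 : w ≢ 0ᵥ) → form z w ≡ 0# → form (coordinate (back z≢0)) (coordinate (back w≢0)) ≡ 0#
        preimage z≢0 w≢0 e = orthogonal⇒form (back z≢0) (back w≢0) (φ-orthogonal⁻ (back z≢0) (back w≢0)
          (orthogonal-≈ (pointOf z≢0) (φ (back z≢0)) (pointOf w≢0) (φ (back w≢0)) (φ-back z≢0) (φ-back w≢0) (form⇒orthogonal z≢0 w≢0 e)))

      module _ {L L′ : List N.V₅} (t : T (N.isCode L)) (t′ : T (N.isCode L′)) where
        private
          module K = CheckedCode L t
          module K′ = CheckedCode L′ t′
          module S = CodedSpread C (K.isCodeSigned P)
          module S′ = CodedSpread C (K′.isCodeSigned P)

        module _ (maps : MapsLineSet φ S.lineSet S′.lineSet) where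

          corresponds-neg : ∀ {v v′} → Corresponds v (neg₅ v′) → Corresponds v v′
          corresponds-neg {v} {v′} c x = mk⇔ (onPair-neg v′ ∘ Equivalence.to (c x)) (Equivalence.from (c x) ∘ neg-onPair v′)

          neg-corresponds : ∀ {v v′} → Corresponds (neg₅ v) v′ → Corresponds v v′
          neg-corresponds {v} {v′} c x = mk⇔ (Equivalence.to (c x) ∘ neg-onPair v) (onPair-neg v ∘ Equivalence.from (c x))

          source-signs : ∀ {u b v} → (u ≡ b ⊎ u ≡ neg₅ b) → Corresponds u v → Corresponds b v
          source-signs         (inj₁ refl) c = c
          source-signs {b = b} {v} (inj₂ refl) c = neg-corresponds {b} {v} c

          target-signs : ∀ {u b v} → (u ≡ b ⊎ u ≡ neg₅ b) → Corresponds v u → Corresponds v b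
          target-signs         (inj₁ refl) c = c
          target-signs {b = b} {v} (inj₂ refl) c = corresponds-neg {v} {b} c

          lineIn : ∀ {v} → v ∈ˡ L → Line q
          lineIn {v} v∈ = lineOf C ⟪ v ⟫ (IsCode.unit (K.isCodeSigned P) (K.positive v∈))

          lineIn′ : ∀ {v} → v ∈ˡ L′ → Line q
          lineIn′ {v} v∈ = lineOf C ⟪ v ⟫ (IsCode.unit (K′.isCodeSigned P) (K′.positive v∈))

          forward : ∀ i → ∃ λ j → Corresponds ⟪ lookup L i ⟫ ⟪ lookup L′ j ⟫
          forward i =
            let v∈ = ∈-lookup {xs = L} i
                m , m∈ , mapsℓ = proj₁ maps (lineIn v∈) (S.code⇒∈ (K.positive v∈))
                u , u∈ , m⊆ = S′.∈⇒code m m∈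
                b , b∈ , sign = K′.signed⁻ u∈
            in index b∈ , subst (λ b → Corresponds ⟪ lookup L i ⟫ ⟪ b ⟫) (Any.lookup-index b∈) (target-signs {u} {⟪ b ⟫} {⟪ lookup L i ⟫} sign
                (linesCorrespond (K.unit-L v∈) (IsCode.unit (K′.isCodeSigned P) u∈) (lineIn v∈) m (λ _ p → p) m⊆ mapsℓ))

          backward : ∀ j → ∃ λ i → Corresponds ⟪ lookup L i ⟫ ⟪ lookup L′ j ⟫
          backward j =
            let v∈ = ∈-lookup {xs = L′} j
                ℓ , ℓ∈ , mapsℓ = proj₂ maps (lineIn′ v∈) (S′.code⇒∈ (K′.positive v∈))
                u , u∈ , ℓ⊆ = S.∈⇒code ℓ ℓ∈
                b , b∈ , sign = K.signed⁻ u∈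
            in index b∈ , subst (λ b → Corresponds ⟪ b ⟫ ⟪ lookup L′ j ⟫) (Any.lookup-index b∈) (source-signs {u} {⟪ b ⟫} {⟪ lookup L′ j ⟫} sign
                (linesCorrespond (IsCode.unit (K.isCodeSigned P) u∈) (K′.unit-L v∈) ℓ (lineIn′ v∈) ℓ⊆ (λ _ p → p) mapsℓ))

          somePoint : ∀ v → norm v ≡ 1# → ∃ λ x → OnPairOf v x
          somePoint v n = pointOf b≢0 , pointOf-on v b≢0 (inj₁ fixed-x)
            where
            open HyperbolicBasis (hyperbolicBasis v n) renaming (x to b; y to c)
            b≢0 : b ≢ 0ᵥ
            b≢0 e = 1≢0 (proj₁ (form≢0⇒independent form≢0 1# 0# (trans (combination-10 b c) e)))

          -- The image of any one point of the i-th pair lies on a single pair of L′. Together with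
          -- `source-unique` this makes `π` and `ρ` mutually inverse.
          target-unique : ∀ {i j j′} → Corresponds ⟪ lookup L i ⟫ ⟪ lookup L′ j ⟫ → Corresponds ⟪ lookup L i ⟫ ⟪ lookup L′ j′ ⟫ → j ≡ j′
          target-unique {i} {j} {j′} c c′ = let x , on-x = somePoint ⟪ lookup L i ⟫ (K.unit-L (∈-lookup {xs = L} i)) in
            K′.injective j j′ (K′.pair-unique (∈-lookup {xs = L′} j) (∈-lookup {xs = L′} j′) (coordinate≢0 (φ x)) (Equivalence.to (c x) on-x) (Equivalence.to (c′ x) on-x))

          source-unique : ∀ {i i′ j} → Corresponds ⟪ lookup L i ⟫ ⟪ lookup L′ j ⟫ → Corresponds ⟪ lookup L i′ ⟫ ⟪ lookup L′ j ⟫ → i ≡ i′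
          source-unique {i} {i′} {j} c c′ = let x , on-x = somePoint ⟪ lookup L i ⟫ (K.unit-L (∈-lookup {xs = L} i)) in
            K.injective i i′ (K.pair-unique (∈-lookup {xs = L} i) (∈-lookup {xs = L} i′) (coordinate≢0 x) on-x (Equivalence.from (c′ x) (Equivalence.to (c x) on-x)))

          π : Fin (length L) → Fin (length L′)
          π i = proj₁ (forward i)

          ρ : Fin (length L′) → Fin (length L)
          ρ j = proj₁ (backward j)

          π-corresponds : ∀ i → Corresponds ⟪ lookup L i ⟫ ⟪ lookup L′ (π i) ⟫
          π-corresponds i = proj₂ (forward i)

          ρ-corresponds : ∀ j → Corresponds ⟪ lookup L (ρ j) ⟫ ⟪ lookup L′ j ⟫
          ρ-corresponds j = proj₂ (backward j)

          perm = permutation π ρ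
            (λ j → target-unique {ρ j} {π (ρ j)} {j} (π-corresponds (ρ j)) (ρ-corresponds j))
            (λ i → source-unique {ρ (π i)} {i} {π i} (ρ-corresponds (π i)) (π-corresponds i))

          triad-preserved : ∀ i j k → isTriad (lookup L i) (lookup L j) (lookup L k) ≡ isTriad (lookup L′ (π i)) (lookup L′ (π j)) (lookup L′ (π k))
          triad-preserved i j k = T-injective
            (λ t → Triad⇒isTriad _ _ _ (u′ i) (u′ j) (u′ k) (triad⁺ (π-corresponds i) (π-corresponds j) (π-corresponds k) (isTriad⇒Triad _ _ _ (u i) (u j) (u k) t)))
            (λ t → Triad⇒isTriad _ _ _ (u i) (u j) (u k) (triad⁻ (π-corresponds i) (π-corresponds j) (π-corresponds k) (isTriad⇒Triad _ _ _ (u′ i) (u′ j) (u′ k) t)))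
            where
            u : ∀ i → norm ⟪ lookup L i ⟫ ≡ 1#
            u i = K.unit-L (∈-lookup {xs = L} i)
            u′ : ∀ i → norm ⟪ lookup L′ (π i) ⟫ ≡ 1#
            u′ i = K′.unit-L (∈-lookup {xs = L′} (π i))

          triads-equal : N.triads L ≡ N.triads L′
          triads-equal = begin
            N.triads L
              ≡⟨ triads-sum L ⟩
            sum (λ i → sum (λ j → sum (λ k → N.indicator (isTriad (lookup L i) (lookup L j) (lookup L k)))))
              ≡⟨ sum-cong-≗ (λ i → sum-cong-≗ λ j → sum-cong-≗ λ k → cong N.indicator (triad-preserved i j k)) ⟩
            sum (λ i → sum (λ j → sum (λ k → g (π i) (π j) (π k))))
              ≡⟨ sum-cong-≗ (λ i → sum-cong-≗ λ j → sum-permute (g (π i) (π j)) perm) ⟨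
            sum (λ i → sum (λ j → sum (g (π i) (π j))))
              ≡⟨ sum-cong-≗ (λ i → sum-permute (λ j → sum (g (π i) j)) perm) ⟨
            sum (λ i → sum (λ j → sum (g (π i) j)))
              ≡⟨ sum-permute (λ i → sum (λ j → sum (g i j))) perm ⟨
            sum (λ i → sum (λ j → sum (g i j)))
              ≡⟨ triads-sum L′ ⟨
            N.triads L′ ∎
            where
            open ≡-Reasoning
            g : Fin (length L′) → Fin (length L′) → Fin (length L′) → ℕ
            g i j k = N.indicator (isTriad (lookup L′ i) (lookup L′ j) (lookup L′ k))

-- Representatives and search certificates, found by computer

codes₃ : List (List ℕ)
codes₃ =
  (1 ∷ 2100 ∷ 10010 ∷ 21110 ∷ 22210 ∷ []) ∷ []

-- A triple with a repeated pair always counts, so n pairs contribute 3n² - 2n from such triples: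
-- 65, 481 and 1825 for n = 5, 13 and 25. The excess is six times the number of sets of three
-- distinct pairs with a transversal; for q = 3 there are none.
counts₃ : List ℕ
counts₃ = 65 ∷ []

-- Entries are ordered so that each tree refers to representatives and earlier entries only; the
-- single line with code 1 comes last. The columns 1, 10, 100, 1000 form the identity matrix, used
-- when the target is contained in the current configuration up to signs. A branch with an empty
-- list is a dead end: no admissible line passes through its point.
certificate₃ : List (List ℕ × Tree)
certificate₃ =
  ((1 ∷ 2100 ∷ 10010 ∷ 21110 ∷ 22210 ∷ []) , use 0 1 10 100 1000) ∷
  ((1 ∷ 2100 ∷ 10010 ∷ 21110 ∷ []) , branch 210 (use 0 1 10 100 1000 ∷ [])) ∷
  ((1 ∷ 2100 ∷ 10010 ∷ []) , branch 110 (use 0 1 10 100 1000 ∷ [])) ∷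
  ((1 ∷ 2100 ∷ []) , branch 10 (use 0 1 10 100 1000 ∷ [])) ∷
  ((1 ∷ []) , branch 100 (use 0 1 10 100 1000 ∷ use 0 22 2 1000 1100 ∷ use 0 2 20 1100 1000 ∷ [])) ∷ []

codes₅ : List (List ℕ)
codes₅ =
  (1 ∷ 4100 ∷ 2200 ∷ 10022 ∷ 40032 ∷ 24442 ∷ 14420 ∷ 34412 ∷ 31112 ∷ 11120 ∷ 23210 ∷ 22310 ∷ 21142 ∷ []) ∷
  (1 ∷ 4100 ∷ 2200 ∷ 10010 ∷ 30020 ∷ 41220 ∷ 32110 ∷ 42120 ∷ 43420 ∷ 44320 ∷ 31210 ∷ 33410 ∷ 34310 ∷ []) ∷ []

counts₅ : List ℕ
counts₅ = 817 ∷ 757 ∷ []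

certificate₅ : List (List ℕ × Tree)
certificate₅ =
  ((1 ∷ 4100 ∷ 2200 ∷ 10022 ∷ 40032 ∷ []) , branch 120 (branch 110 (branch 210 (branch 310 (branch 410 (branch 220 (branch 320 (branch 420 (use 0 1 10
    100 1000 ∷ []) ∷ []) ∷ []) ∷ []) ∷ []) ∷ []) ∷ []) ∷ branch 420 (branch 110 (branch 210 (branch 310 (branch 410 (branch 220 (branch 320 (use 0
    1000 200 40 3 ∷ []) ∷ []) ∷ []) ∷ []) ∷ []) ∷ branch 210 (branch 310 (branch 410 (branch 220 (branch 320 (use 0 410 1001 1004 110 ∷ []) ∷ []) ∷
    []) ∷ []) ∷ []) ∷ []) ∷ []) ∷ [])) ∷
  ((1 ∷ 4100 ∷ 2200 ∷ 10022 ∷ []) , branch 30 (use 0 1 10 100 1000 ∷ [])) ∷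
  ((1 ∷ 4100 ∷ 2200 ∷ 10010 ∷ 30020 ∷ []) , branch 110 (branch 320 (branch 210 (branch 310 (branch 130 (branch 230 (branch 330 (branch 430 (use 3 1342
    1243 4343 1313 ∷ []) ∷ []) ∷ []) ∷ []) ∷ []) ∷ []) ∷ []) ∷ branch 140 (branch 210 (branch 310 (branch 410 (branch 220 (branch 130 (branch 430 (use
    3 4003 310 340 1003 ∷ []) ∷ []) ∷ []) ∷ []) ∷ []) ∷ []) ∷ []) ∷ branch 230 (branch 210 (branch 310 (branch 410 (branch 120 (branch 420 (branch 330
    (use 3 1004 440 140 1001 ∷ []) ∷ []) ∷ []) ∷ []) ∷ []) ∷ []) ∷ []) ∷ branch 410 (branch 210 (branch 310 (branch 120 (branch 220 (branch 320
    (branch 420 (use 3 4423 4122 4133 1123 ∷ []) ∷ []) ∷ []) ∷ []) ∷ []) ∷ []) ∷ []) ∷ branch 220 (branch 210 (branch 310 (branch 410 (branch 120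
    (branch 320 (branch 420 (use 3 1 10 100 1000 ∷ []) ∷ []) ∷ []) ∷ []) ∷ []) ∷ []) ∷ []) ∷ [])) ∷
  ((1 ∷ 4100 ∷ 2200 ∷ 10010 ∷ []) , branch 20 (use 0 1 10 100 1000 ∷ [])) ∷
  ((1 ∷ 4100 ∷ 2200 ∷ []) , branch 10 (use 0 1 10 100 1000 ∷ use 2 1 10 100 1000 ∷ use 2 1 30 300 1000 ∷ [])) ∷
  ((1 ∷ 4100 ∷ []) , branch 200 (use 0 1 10 100 1000 ∷ use 0 44 4 1000 4100 ∷ use 0 43 2 3000 3100 ∷ use 0 1 42 3400 1000 ∷ use 0 4 32 3300 4000 ∷
    [])) ∷
  ((1 ∷ 4202 ∷ 1312 ∷ 10322 ∷ []) , branch 321 (use 0 220 3334 2122 1241 ∷ [])) ∷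
  ((1 ∷ 4202 ∷ 1312 ∷ 20112 ∷ []) , branch 10 (use 1 4320 322 2214 211 ∷ use 1 3444 1113 3003 120 ∷ [])) ∷
  ((1 ∷ 4202 ∷ 1312 ∷ []) , branch 20 (use 1 1 10 100 1000 ∷ use 2 44 10 3400 3100 ∷ use 0 1 10 100 1000 ∷ [])) ∷
  ((1 ∷ 4202 ∷ 1302 ∷ []) , branch 10 (use 3 11 31 2400 1100 ∷ use 3 3 32 2100 300 ∷ use 3 13 2 300 1400 ∷ use 3 2144 140 2423 4001 ∷ use 3 3444 4112
    1241 2312 ∷ use 3 2221 4002 3433 4004 ∷ use 3 3411 4323 340 3212 ∷ [])) ∷
  ((1 ∷ 4202 ∷ []) , branch 300 (use 0 1 10 100 1000 ∷ use 1 1 10 100 1000 ∷ use 1 3 43 1400 3000 ∷ use 1 1 24 3200 1000 ∷ use 1 4 11 2100 4000 ∷ []))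
    ∷
  ((1 ∷ []) , branch 100 (use 5 1 10 100 1000 ∷ use 0 1 10 100 1000 ∷ use 0 3 13 3200 4000 ∷ use 5 44 1 4000 3100 ∷ use 0 14 22 200 3300 ∷ use 0 24 4
    4000 4200 ∷ use 5 22 41 1400 1300 ∷ use 0 20 43 400 1100 ∷ use 0 40 23 1400 3400 ∷ use 5 20 23 4300 4200 ∷ use 0 14 2 4000 1300 ∷ use 0 42 24 1400
    3400 ∷ use 5 34 2 2000 4300 ∷ use 0 21 43 4400 3100 ∷ use 0 41 4 4000 4400 ∷ [])) ∷ []

codes₇ : List (List ℕ)
codes₇ =
  (1 ∷ 6100 ∷ 5212 ∷ 2522 ∷ 60032 ∷ 25220 ∷ 30062 ∷ 15223 ∷ 62553 ∷ 24142 ∷ 34422 ∷ 13200 ∷ 11412 ∷ 62610 ∷ 12300 ∷ 35132 ∷ 13313 ∷ 66252 ∷ 21530 ∷ 33310 ∷ 64463 ∷ 50452 ∷ 43262 ∷ 42362 ∷ 53052 ∷ []) ∷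
  (1 ∷ 6100 ∷ 5212 ∷ 2522 ∷ 60032 ∷ 64310 ∷ 22513 ∷ 54353 ∷ 25213 ∷ 36510 ∷ 42123 ∷ 30062 ∷ 24330 ∷ 51220 ∷ 65230 ∷ 25202 ∷ 46523 ∷ 55620 ∷ 63433 ∷ 55263 ∷ 32110 ∷ 50052 ∷ 54362 ∷ 42502 ∷ 34363 ∷ []) ∷
  (1 ∷ 6100 ∷ 5212 ∷ 2522 ∷ 60032 ∷ 64310 ∷ 22513 ∷ 54353 ∷ 25213 ∷ 36510 ∷ 42123 ∷ 20333 ∷ 13313 ∷ 23033 ∷ 12300 ∷ 61122 ∷ 53610 ∷ 23200 ∷ 66252 ∷ 60113 ∷ 56533 ∷ 61263 ∷ 66013 ∷ 64463 ∷ 56332 ∷ []) ∷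
  (1 ∷ 6100 ∷ 5212 ∷ 2522 ∷ 40153 ∷ 66603 ∷ 16333 ∷ 46213 ∷ 16042 ∷ 44313 ∷ 24312 ∷ 26353 ∷ 63410 ∷ 12130 ∷ 64032 ∷ 14133 ∷ 50643 ∷ 63433 ∷ 52223 ∷ 64523 ∷ 46020 ∷ 50652 ∷ 44122 ∷ 53222 ∷ 31103 ∷ []) ∷
  (1 ∷ 6100 ∷ 5212 ∷ 2522 ∷ 60332 ∷ 51562 ∷ 22630 ∷ 65543 ∷ 61510 ∷ 12233 ∷ 65230 ∷ 30062 ∷ 35552 ∷ 33322 ∷ 23653 ∷ 64120 ∷ 26342 ∷ 16603 ∷ 54030 ∷ 63662 ∷ 61103 ∷ 54123 ∷ 50452 ∷ 44012 ∷ 56612 ∷ []) ∷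
  (1 ∷ 6100 ∷ 5212 ∷ 2522 ∷ 10063 ∷ 46213 ∷ 12233 ∷ 33353 ∷ 36642 ∷ 21512 ∷ 52653 ∷ 10342 ∷ 64120 ∷ 43663 ∷ 33322 ∷ 13313 ∷ 14010 ∷ 11103 ∷ 50443 ∷ 64013 ∷ 54123 ∷ 54442 ∷ 52232 ∷ 56612 ∷ 36603 ∷ []) ∷
  (1 ∷ 6100 ∷ 5212 ∷ 2502 ∷ 16312 ∷ 40412 ∷ 51043 ∷ 52133 ∷ 24153 ∷ 14112 ∷ 40653 ∷ 13042 ∷ 15202 ∷ 44313 ∷ 13253 ∷ 16063 ∷ 24142 ∷ 23252 ∷ 14343 ∷ 60113 ∷ 56323 ∷ 55413 ∷ 46322 ∷ 55422 ∷ 36553 ∷ []) ∷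
  (1 ∷ 6100 ∷ 5212 ∷ 2502 ∷ 16312 ∷ 40412 ∷ 51043 ∷ 21523 ∷ 20622 ∷ 41542 ∷ 10442 ∷ 13063 ∷ 62220 ∷ 13042 ∷ 12162 ∷ 44163 ∷ 25202 ∷ 24142 ∷ 23332 ∷ 21530 ∷ 56323 ∷ 55263 ∷ 54362 ∷ 55422 ∷ 43262 ∷ []) ∷
  (1 ∷ 6100 ∷ 5212 ∷ 2502 ∷ 53052 ∷ 33310 ∷ 32343 ∷ 44533 ∷ 45433 ∷ 33243 ∷ 14430 ∷ 46322 ∷ 61552 ∷ 10010 ∷ 16562 ∷ 15662 ∷ 36642 ∷ 10463 ∷ 65202 ∷ 23022 ∷ 21512 ∷ 60313 ∷ 43630 ∷ 45530 ∷ 56332 ∷ []) ∷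
  (1 ∷ 6100 ∷ 2300 ∷ 3210 ∷ 54420 ∷ 56520 ∷ 42230 ∷ 43630 ∷ 63200 ∷ 10010 ∷ 23263 ∷ 11262 ∷ 41223 ∷ 43323 ∷ 13362 ∷ 10363 ∷ 13253 ∷ 11063 ∷ 60013 ∷ 53333 ∷ 55523 ∷ 51233 ∷ 54123 ∷ 53222 ∷ 34543 ∷ []) ∷
  (1 ∷ 6100 ∷ 2300 ∷ 3210 ∷ 54420 ∷ 15630 ∷ 13330 ∷ 10363 ∷ 34543 ∷ 11262 ∷ 34410 ∷ 43233 ∷ 63200 ∷ 12162 ∷ 51220 ∷ 65612 ∷ 10010 ∷ 66512 ∷ 56030 ∷ 60413 ∷ 41430 ∷ 42230 ∷ 44130 ∷ 32110 ∷ 46020 ∷ []) ∷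
  (1 ∷ 6100 ∷ 2300 ∷ 3200 ∷ 10010 ∷ 50030 ∷ 40020 ∷ 61420 ∷ 51410 ∷ 46330 ∷ 11230 ∷ 12130 ∷ 14430 ∷ 64120 ∷ 62220 ∷ 52210 ∷ 53320 ∷ 54110 ∷ 55620 ∷ 56520 ∷ 36510 ∷ 35610 ∷ 43630 ∷ 33310 ∷ 45530 ∷ []) ∷
  (1 ∷ 6100 ∷ 2300 ∷ 3200 ∷ 10010 ∷ 20022 ∷ 50052 ∷ 64412 ∷ 62112 ∷ 61212 ∷ 36510 ∷ 46330 ∷ 15662 ∷ 16562 ∷ 13362 ∷ 14430 ∷ 12130 ∷ 11230 ∷ 53320 ∷ 55620 ∷ 56520 ∷ 35610 ∷ 43630 ∷ 33310 ∷ 45530 ∷ []) ∷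
  (1 ∷ 6100 ∷ 2300 ∷ 3200 ∷ 10010 ∷ 20022 ∷ 50052 ∷ 51220 ∷ 52120 ∷ 54420 ∷ 41430 ∷ 42230 ∷ 44130 ∷ 61510 ∷ 65110 ∷ 53320 ∷ 45530 ∷ 62610 ∷ 63410 ∷ 64310 ∷ 66210 ∷ 55620 ∷ 56520 ∷ 43630 ∷ 46330 ∷ []) ∷ []

counts₇ : List ℕ
counts₇ = 7765 ∷ 6883 ∷ 6649 ∷ 7525 ∷ 8515 ∷ 7705 ∷ 6361 ∷ 7651 ∷ 6913 ∷ 7225 ∷ 6001 ∷ 4753 ∷ 5185 ∷ 4537 ∷ []

certificate₇ : List (List ℕ × Tree)
certificate₇ =
  ((1 ∷ 6100 ∷ 5212 ∷ 2522 ∷ 60032 ∷ []) , branch 133 (branch 412 (branch 262 (branch 321 ([]) ∷ []) ∷ branch 231 (branch 350 (branch 320 (branch 110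
    (branch 410 (branch 610 (branch 210 (branch 510 (branch 310 (branch 120 (branch 520 (branch 620 (branch 430 (branch 530 (branch 40 (branch 440
    (branch 540 (branch 640 (use 0 1 10 100 1000 ∷ []) ∷ []) ∷ []) ∷ []) ∷ []) ∷ []) ∷ []) ∷ []) ∷ []) ∷ []) ∷ []) ∷ []) ∷ []) ∷ []) ∷ []) ∷ branch
    610 (branch 210 (branch 510 (branch 110 (branch 310 (branch 410 (branch 120 (branch 520 (branch 620 (branch 230 (branch 330 (branch 40 (branch 240
    (branch 340 (branch 640 (use 0 1000 100 60 6 ∷ []) ∷ []) ∷ []) ∷ []) ∷ []) ∷ []) ∷ []) ∷ []) ∷ []) ∷ []) ∷ []) ∷ []) ∷ []) ∷ []) ∷ []) ∷ []) ∷ [])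
    ∷ []) ∷ []) ∷ branch 214 (branch 410 (branch 610 (branch 613 ([]) ∷ []) ∷ []) ∷ []) ∷ branch 610 (branch 42 ([]) ∷ branch 601 (branch 30 ([]) ∷
    []) ∷ branch 640 (branch 210 (branch 120 ([]) ∷ []) ∷ []) ∷ branch 630 (branch 220 (branch 110 (branch 130 ([]) ∷ []) ∷ []) ∷ branch 440 (branch
    130 (branch 210 (branch 120 (branch 10 (branch 310 (branch 510 (branch 220 (branch 320 (branch 520 (branch 620 (branch 30 (branch 230 (branch 330
    (branch 430 (branch 530 (branch 140 (use 2 1000 100 60 6 ∷ []) ∷ []) ∷ []) ∷ []) ∷ []) ∷ []) ∷ []) ∷ []) ∷ []) ∷ []) ∷ []) ∷ []) ∷ []) ∷ []) ∷ [])
    ∷ branch 620 (branch 10 (branch 120 (branch 210 (branch 510 (branch 220 (branch 320 (branch 420 (branch 520 (branch 30 (branch 230 (branch 330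
    (branch 430 (branch 530 (branch 540 (use 2 1 10 100 1000 ∷ []) ∷ []) ∷ []) ∷ []) ∷ []) ∷ []) ∷ []) ∷ []) ∷ []) ∷ []) ∷ []) ∷ []) ∷ []) ∷ branch
    320 (branch 120 (branch 510 (branch 220 (branch 420 (branch 520 (branch 230 (branch 430 (branch 530 (branch 40 (branch 140 (branch 540 (branch 550
    (use 1 1 10 100 1000 ∷ []) ∷ []) ∷ []) ∷ []) ∷ []) ∷ []) ∷ []) ∷ []) ∷ []) ∷ []) ∷ []) ∷ []) ∷ []) ∷ []) ∷ []) ∷ []) ∷ []) ∷ []) ∷ []) ∷ [])) ∷
  ((1 ∷ 6100 ∷ 5212 ∷ 2522 ∷ 40153 ∷ []) , branch 243 (branch 42 (use 0 6240 6415 4640 1323 ∷ branch 210 (branch 110 (branch 610 (branch 320 (branch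
    410 (branch 310 (branch 510 (branch 120 (branch 620 (branch 30 (branch 230 (branch 330 (branch 530 (branch 630 (branch 40 (branch 340 (branch 640
    (branch 350 (use 4 1 10 100 1000 ∷ []) ∷ []) ∷ []) ∷ []) ∷ []) ∷ []) ∷ []) ∷ []) ∷ []) ∷ []) ∷ []) ∷ []) ∷ []) ∷ []) ∷ []) ∷ []) ∷ branch 410
    (branch 510 (branch 310 (branch 610 (branch 320 (branch 520 (branch 620 (branch 30 (branch 130 (branch 330 (branch 530 (branch 630 (branch 40
    (branch 140 (branch 240 (branch 150 (use 4 3000 1300 41 4 ∷ []) ∷ []) ∷ []) ∷ []) ∷ []) ∷ []) ∷ []) ∷ []) ∷ []) ∷ []) ∷ []) ∷ []) ∷ []) ∷ []) ∷
    []) ∷ []) ∷ []) ∷ []) ∷ []) ∷ branch 114 (branch 610 (branch 560 (branch 420 (branch 240 ([]) ∷ []) ∷ []) ∷ branch 240 (branch 220 ([]) ∷ []) ∷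
    []) ∷ branch 665 (branch 660 ([]) ∷ []) ∷ use 0 1 14 3100 1000 ∷ []) ∷ branch 341 (branch 610 (branch 511 ([]) ∷ []) ∷ []) ∷ branch 462 (branch
    115 ([]) ∷ []) ∷ [])) ∷
  ((1 ∷ 6100 ∷ 5212 ∷ 2522 ∷ 60332 ∷ []) , branch 324 (branch 450 (branch 10 (branch 30 ([]) ∷ branch 510 (use 1 4006 4412 3643 1004 ∷ []) ∷ []) ∷ use
    1 3236 3333 5346 1353 ∷ []) ∷ use 0 4006 2416 645 1004 ∷ branch 216 (branch 130 (branch 110 (branch 610 (branch 460 ([]) ∷ []) ∷ branch 640
    (branch 310 (branch 410 (branch 10 (branch 210 (branch 510 (branch 610 (branch 220 (branch 420 (branch 620 (branch 30 (branch 230 (branch 330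
    (branch 430 (branch 530 (branch 630 (use 4 1 16 1100 1000 ∷ []) ∷ []) ∷ []) ∷ []) ∷ []) ∷ []) ∷ []) ∷ []) ∷ []) ∷ []) ∷ []) ∷ []) ∷ []) ∷ []) ∷
    []) ∷ []) ∷ branch 431 (branch 510 (branch 10 (branch 310 (branch 610 (branch 210 (branch 410 (branch 120 (branch 220 (branch 420 (branch 620
    (branch 330 (branch 630 (branch 40 (branch 340 (branch 540 (use 6 1 10 100 1000 ∷ []) ∷ []) ∷ []) ∷ []) ∷ []) ∷ []) ∷ []) ∷ []) ∷ []) ∷ []) ∷ [])
    ∷ branch 410 (branch 210 (branch 120 (branch 220 (branch 420 (branch 620 (branch 430 (branch 630 (branch 40 (branch 440 (branch 540 (use 6 5000
    1500 21 2 ∷ []) ∷ []) ∷ []) ∷ []) ∷ []) ∷ []) ∷ []) ∷ []) ∷ []) ∷ []) ∷ []) ∷ []) ∷ []) ∷ []) ∷ []) ∷ []) ∷ []) ∷ branch 450 ([]) ∷ []) ∷ use 1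
    4541 2021 502 1353 ∷ []) ∷ [])) ∷
  ((1 ∷ 6100 ∷ 5212 ∷ 2522 ∷ 10463 ∷ []) , branch 320 (branch 110 (use 1 1 16 1100 1000 ∷ branch 260 (use 1 4006 413 4640 1004 ∷ []) ∷ []) ∷ branch
    535 (use 2 4006 5410 1642 1004 ∷ branch 521 (branch 30 (branch 330 (branch 510 ([]) ∷ []) ∷ branch 561 ([]) ∷ []) ∷ []) ∷ []) ∷ branch 130 (branch
    620 ([]) ∷ use 0 4006 5410 1642 1004 ∷ use 0 6256 3613 1666 220 ∷ []) ∷ use 2 1 12 5100 1000 ∷ [])) ∷
  ((1 ∷ 6100 ∷ 5212 ∷ 2522 ∷ 20622 ∷ []) , branch 434 (branch 112 (branch 12 (branch 312 ([]) ∷ []) ∷ []) ∷ use 1 6165 2262 2215 1665 ∷ use 0 4006 413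
    4640 1004 ∷ [])) ∷
  ((1 ∷ 6100 ∷ 5212 ∷ 2522 ∷ 40653 ∷ []) , branch 120 (use 4 1 13 4100 1000 ∷ branch 460 (use 0 4006 6415 6641 1004 ∷ branch 454 (branch 640 ([]) ∷
    []) ∷ use 4 1 14 3100 1000 ∷ []) ∷ branch 232 (use 4 4006 1411 2646 1004 ∷ branch 310 (branch 30 (branch 130 (branch 520 (branch 410 (branch 220
    (branch 210 (use 4 4006 6415 6641 1004 ∷ []) ∷ []) ∷ []) ∷ []) ∷ []) ∷ []) ∷ branch 160 (branch 30 ([]) ∷ []) ∷ []) ∷ []) ∷ use 1 1 13 4100 1000 ∷
    [])) ∷
  ((1 ∷ 6100 ∷ 5212 ∷ 2522 ∷ 10063 ∷ []) , branch 420 (use 3 1 15 2100 1000 ∷ use 1 1 15 2100 1000 ∷ branch 660 (branch 142 (branch 30 (branch 320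
    (branch 230 (branch 110 (branch 210 (branch 310 (branch 610 (branch 220 (branch 510 (branch 520 (branch 430 (branch 530 (branch 630 (branch 240
    (branch 540 (branch 640 (branch 50 (use 11 1 15 2100 1000 ∷ []) ∷ []) ∷ []) ∷ []) ∷ []) ∷ []) ∷ []) ∷ []) ∷ []) ∷ []) ∷ []) ∷ []) ∷ []) ∷ []) ∷
    []) ∷ []) ∷ branch 320 (branch 10 (branch 220 (branch 210 (branch 310 (branch 110 (branch 610 (branch 520 (branch 620 (branch 130 (branch 230
    (branch 530 (branch 240 (branch 340 (branch 640 (branch 350 (use 11 1000 100 60 6 ∷ []) ∷ []) ∷ []) ∷ []) ∷ []) ∷ []) ∷ []) ∷ []) ∷ []) ∷ []) ∷
    []) ∷ []) ∷ []) ∷ []) ∷ []) ∷ []) ∷ []) ∷ []) ∷ use 1 4006 5410 1642 1004 ∷ use 5 1 16 1100 1000 ∷ []) ∷ branch 431 (use 1 4006 6415 6641 1004 ∷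
    branch 22 (branch 130 (branch 620 (branch 330 (branch 10 (branch 410 (branch 110 (branch 610 (branch 120 (branch 310 (branch 520 (branch 30
    (branch 530 (branch 630 (branch 140 (branch 440 (branch 540 (branch 450 (use 11 1 10 100 1000 ∷ []) ∷ []) ∷ []) ∷ []) ∷ []) ∷ []) ∷ []) ∷ []) ∷
    []) ∷ []) ∷ []) ∷ []) ∷ []) ∷ []) ∷ []) ∷ []) ∷ branch 620 (branch 510 (branch 520 (branch 10 (branch 110 (branch 410 (branch 610 (branch 120
    (branch 220 (branch 230 (branch 330 (branch 630 (branch 140 (branch 240 (branch 540 (branch 50 (use 11 3000 1300 41 4 ∷ []) ∷ []) ∷ []) ∷ []) ∷
    []) ∷ []) ∷ []) ∷ []) ∷ []) ∷ []) ∷ []) ∷ []) ∷ []) ∷ []) ∷ []) ∷ []) ∷ []) ∷ []) ∷ use 3 4006 6415 6641 1004 ∷ []) ∷ [])) ∷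
  ((1 ∷ 6100 ∷ 5212 ∷ 2522 ∷ 50330 ∷ []) , branch 246 (branch 442 (branch 104 (branch 130 (branch 220 (use 6 1 16 1100 1000 ∷ []) ∷ []) ∷ []) ∷ use 6
    1 13 4100 1000 ∷ use 5 4006 2416 645 1004 ∷ []) ∷ use 6 1 11 6100 1000 ∷ branch 430 (use 4 4006 2416 645 1004 ∷ use 2 4006 4412 3643 1004 ∷ branch
    560 (branch 10 (use 4 3154 6542 4564 1562 ∷ use 3 4006 1411 2646 1004 ∷ use 1 3154 3465 5356 1562 ∷ []) ∷ []) ∷ []) ∷ [])) ∷
  ((1 ∷ 6100 ∷ 5212 ∷ 2522 ∷ 40353 ∷ []) , branch 620 (use 1 1 14 3100 1000 ∷ branch 511 (use 2 4006 5410 1642 1004 ∷ use 7 4006 1411 2646 1004 ∷ [])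
    ∷ use 3 1 14 3100 1000 ∷ use 5 1 14 3100 1000 ∷ [])) ∷
  ((1 ∷ 6100 ∷ 5212 ∷ 2522 ∷ 50130 ∷ []) , branch 520 (use 8 1 11 6100 1000 ∷ use 5 1 11 6100 1000 ∷ branch 333 (use 3 4006 3414 5644 1004 ∷ use 8
    4006 6415 6641 1004 ∷ []) ∷ use 3 1 11 6100 1000 ∷ [])) ∷
  ((1 ∷ 6100 ∷ 5212 ∷ 2522 ∷ 20422 ∷ []) , branch 521 (use 7 1 16 1100 1000 ∷ branch 210 (use 4 1 15 2100 1000 ∷ branch 310 (use 8 1 14 3100 1000 ∷
    branch 220 (use 3 1 16 1100 1000 ∷ use 9 1 16 1100 1000 ∷ []) ∷ []) ∷ use 8 1 15 2100 1000 ∷ use 7 11 14 3100 1600 ∷ branch 610 (branch 420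
    (branch 230 (use 8 11 40 400 1600 ∷ []) ∷ []) ∷ branch 230 ([]) ∷ []) ∷ []) ∷ branch 131 (use 0 1 13 4100 1000 ∷ use 6 1 16 1100 1000 ∷ branch 410
    (use 9 6166 3003 3004 1666 ∷ []) ∷ []) ∷ branch 130 (branch 420 (use 8 1 15 2100 1000 ∷ use 3 1 15 2100 1000 ∷ []) ∷ branch 144 ([]) ∷ use 2 4311
    1206 2651 1633 ∷ []) ∷ [])) ∷
  ((1 ∷ 6100 ∷ 5212 ∷ 2522 ∷ []) , branch 20 (use 5 1 10 100 1000 ∷ use 2 1 10 100 1000 ∷ use 9 1 10 100 1000 ∷ use 10 1 10 100 1000 ∷ use 8 1 10 100
    1000 ∷ use 3 1 10 100 1000 ∷ use 1 1 10 100 1000 ∷ use 6 1 10 100 1000 ∷ use 0 1 10 100 1000 ∷ use 4 1 10 100 1000 ∷ use 7 1 10 100 1000 ∷ [])) ∷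
  ((1 ∷ 6100 ∷ 5212 ∷ 2532 ∷ []) , branch 311 (use 9 1001 5525 2225 1006 ∷ use 2 1001 5525 2225 1006 ∷ use 10 1001 5525 2225 1006 ∷ use 8 1001 5525
    2225 1006 ∷ use 7 1001 5525 2225 1006 ∷ use 4 1001 5525 2225 1006 ∷ use 3 1001 5525 2225 1006 ∷ use 11 1001 5525 2225 1006 ∷ use 5 1001 5525 2225
    1006 ∷ use 1 1001 5525 2225 1006 ∷ use 6 1001 5525 2225 1006 ∷ [])) ∷
  ((1 ∷ 6100 ∷ 5212 ∷ 2542 ∷ []) , branch 40 (use 11 6 20 500 1000 ∷ use 4 6 20 500 1000 ∷ use 7 6 20 500 1000 ∷ use 3 6 20 500 1000 ∷ use 5 6 20 500
    1000 ∷ use 6 6 20 500 1000 ∷ use 9 6 20 500 1000 ∷ use 12 6 20 500 1000 ∷ use 10 6 20 500 1000 ∷ use 2 6 20 500 1000 ∷ use 8 6 20 500 1000 ∷ []))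
    ∷
  ((1 ∷ 6100 ∷ 5212 ∷ 2552 ∷ []) , branch 11 (use 7 6006 4614 4663 1006 ∷ use 13 6006 4614 4663 1006 ∷ use 11 6006 4614 4663 1006 ∷ use 3 6006 4614
    4663 1006 ∷ use 9 6006 4614 4663 1006 ∷ use 8 6006 4614 4663 1006 ∷ use 4 6006 4614 4663 1006 ∷ use 12 6006 4614 4663 1006 ∷ use 5 6006 4614 4663
    1006 ∷ use 10 6006 4614 4663 1006 ∷ use 6 6006 4614 4663 1006 ∷ [])) ∷
  ((1 ∷ 6100 ∷ 5212 ∷ 2502 ∷ 16312 ∷ []) , branch 312 (branch 360 (branch 140 (branch 222 ([]) ∷ branch 222 (branch 630 (branch 436 ([]) ∷ []) ∷ []) ∷
    []) ∷ branch 211 (branch 442 (branch 640 (branch 102 (branch 120 (branch 610 (branch 220 (branch 510 (branch 210 (branch 420 (branch 520 (branch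
    620 (branch 130 (branch 330 (branch 430 (branch 630 (branch 240 (branch 150 (use 21 1 12 5100 1000 ∷ []) ∷ []) ∷ []) ∷ []) ∷ []) ∷ []) ∷ []) ∷ [])
    ∷ []) ∷ []) ∷ []) ∷ []) ∷ []) ∷ branch 210 (branch 410 (branch 510 (branch 610 (branch 220 (branch 320 (branch 420 (branch 620 (branch 230 (branch
    430 (branch 140 (branch 340 (branch 440 (use 22 1 10 100 1000 ∷ []) ∷ []) ∷ []) ∷ []) ∷ []) ∷ []) ∷ []) ∷ []) ∷ []) ∷ []) ∷ []) ∷ []) ∷ []) ∷ [])
    ∷ []) ∷ []) ∷ []) ∷ branch 221 (branch 310 (branch 20 (branch 410 (branch 210 (branch 610 (branch 120 (branch 220 (branch 320 (branch 420 (branch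
    620 (branch 30 (branch 230 (branch 430 (branch 140 (branch 340 (branch 450 (use 21 1 10 100 1000 ∷ []) ∷ []) ∷ []) ∷ []) ∷ []) ∷ []) ∷ []) ∷ []) ∷
    []) ∷ []) ∷ []) ∷ []) ∷ []) ∷ []) ∷ []) ∷ []) ∷ []) ∷ []) ∷ branch 640 (branch 651 ([]) ∷ []) ∷ []) ∷ branch 212 (branch 150 (branch 420 (branch
    20 (branch 430 (branch 210 (branch 530 (branch 40 (branch 140 (branch 310 (branch 410 (branch 610 (branch 220 (branch 320 (branch 620 (branch 130
    (branch 330 (branch 240 (branch 340 (use 22 11 65 2600 1600 ∷ []) ∷ []) ∷ []) ∷ []) ∷ []) ∷ []) ∷ []) ∷ []) ∷ []) ∷ branch 610 (branch 410 (branch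
    120 (branch 220 (branch 320 (branch 230 (branch 330 (branch 340 (branch 640 (use 22 41 22 5200 1300 ∷ []) ∷ []) ∷ []) ∷ []) ∷ []) ∷ []) ∷ []) ∷
    []) ∷ []) ∷ branch 410 (branch 610 (branch 120 (branch 220 (branch 320 (branch 620 (branch 130 (branch 340 (branch 440 (use 22 3000 1300 41 4 ∷
    []) ∷ []) ∷ []) ∷ []) ∷ []) ∷ []) ∷ []) ∷ []) ∷ []) ∷ []) ∷ []) ∷ []) ∷ []) ∷ []) ∷ []) ∷ branch 530 (branch 210 (branch 310 (branch 10 (branch
    410 (branch 610 (branch 220 (branch 320 (branch 520 (branch 230 (branch 330 (branch 140 (branch 240 (branch 340 (branch 640 (use 22 1 13 4100 1000
    ∷ []) ∷ []) ∷ []) ∷ []) ∷ []) ∷ []) ∷ []) ∷ []) ∷ []) ∷ []) ∷ []) ∷ []) ∷ []) ∷ []) ∷ []) ∷ branch 10 (branch 210 (branch 220 (branch 310 (branch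
    410 (branch 610 (branch 320 (branch 520 (branch 130 (branch 230 (branch 330 (branch 530 (branch 240 (branch 340 (branch 350 (use 21 3000 1300 41 4
    ∷ []) ∷ []) ∷ []) ∷ []) ∷ []) ∷ []) ∷ []) ∷ []) ∷ []) ∷ []) ∷ []) ∷ []) ∷ []) ∷ branch 620 (branch 410 (branch 610 (branch 120 (branch 220 (branch
    320 (branch 230 (branch 430 (branch 530 (branch 140 (branch 340 (branch 440 (branch 640 (use 22 1500 1200 51 56 ∷ []) ∷ []) ∷ []) ∷ []) ∷ []) ∷
    []) ∷ []) ∷ []) ∷ []) ∷ []) ∷ []) ∷ []) ∷ []) ∷ []) ∷ []) ∷ []) ∷ []) ∷ []) ∷ branch 124 (branch 520 (branch 140 ([]) ∷ []) ∷ []) ∷ []) ∷ branch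
    211 (branch 201 (branch 620 (branch 140 (branch 10 ([]) ∷ []) ∷ branch 240 (branch 20 ([]) ∷ []) ∷ []) ∷ []) ∷ branch 630 (branch 30 (branch 620
    (branch 130 (branch 220 (branch 210 (branch 10 (branch 310 (branch 410 (branch 510 (branch 610 (branch 20 (branch 420 (branch 230 (branch 430
    (branch 340 (branch 440 (branch 650 (use 21 1 11 6100 1000 ∷ []) ∷ []) ∷ []) ∷ []) ∷ []) ∷ []) ∷ []) ∷ []) ∷ []) ∷ []) ∷ []) ∷ []) ∷ []) ∷ []) ∷
    []) ∷ []) ∷ branch 430 (branch 510 (branch 210 (branch 10 (branch 310 (branch 410 (branch 610 (branch 20 (branch 220 (branch 320 (branch 620
    (branch 230 (branch 140 (branch 240 (branch 340 (branch 440 (use 22 1600 100 60 66 ∷ []) ∷ []) ∷ []) ∷ []) ∷ []) ∷ []) ∷ []) ∷ []) ∷ []) ∷ []) ∷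
    []) ∷ []) ∷ []) ∷ []) ∷ []) ∷ []) ∷ []) ∷ branch 560 ([]) ∷ []) ∷ branch 544 (use 7 4004 3163 2005 1226 ∷ []) ∷ []) ∷ branch 330 (branch 340
    (branch 10 (branch 320 ([]) ∷ []) ∷ []) ∷ use 7 2 46 6000 1100 ∷ []) ∷ [])) ∷
  ((1 ∷ 6100 ∷ 5212 ∷ 2502 ∷ 53052 ∷ []) , branch 430 (branch 650 (use 0 6240 4006 5512 1323 ∷ branch 531 (branch 630 (branch 510 (branch 110 (branch
    210 (branch 10 (branch 310 (branch 610 (branch 20 (branch 120 (branch 320 (branch 420 (branch 620 (branch 230 (branch 330 (branch 40 (branch 240
    (branch 550 (use 24 3000 1300 41 4 ∷ []) ∷ []) ∷ []) ∷ []) ∷ []) ∷ []) ∷ []) ∷ []) ∷ []) ∷ []) ∷ []) ∷ []) ∷ []) ∷ []) ∷ []) ∷ []) ∷ []) ∷ branch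
    110 (branch 630 ([]) ∷ []) ∷ []) ∷ branch 422 (branch 410 (branch 250 (branch 310 (branch 151 (branch 220 (branch 10 (branch 110 (branch 210
    (branch 510 (branch 20 (branch 320 (branch 420 (branch 620 (branch 30 (branch 330 (branch 530 (branch 540 (use 24 1 10 100 1000 ∷ []) ∷ []) ∷ [])
    ∷ []) ∷ []) ∷ []) ∷ []) ∷ []) ∷ []) ∷ []) ∷ []) ∷ use 0 115 3241 1401 231 ∷ []) ∷ []) ∷ []) ∷ []) ∷ []) ∷ []) ∷ []) ∷ []) ∷ use 8 3613 5615 5332
    1116 ∷ use 8 4164 3253 2445 1116 ∷ [])) ∷
  ((1 ∷ 6100 ∷ 5212 ∷ 2502 ∷ 64162 ∷ []) , branch 324 (use 0 11 1 6000 1600 ∷ use 1 11 1 6000 1600 ∷ use 1 1 11 6100 1000 ∷ use 0 1 11 6100 1000 ∷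
    [])) ∷
  ((1 ∷ 6100 ∷ 5212 ∷ 2502 ∷ 42642 ∷ []) , branch 324 (use 2 11 42 5400 1600 ∷ branch 245 (use 2 41 23 4200 1300 ∷ use 2 1 12 5100 1000 ∷ use 2 11 53
    4500 1600 ∷ []) ∷ use 2 1 11 6100 1000 ∷ use 1 1 11 6100 1000 ∷ [])) ∷
  ((1 ∷ 6100 ∷ 5212 ∷ 2502 ∷ 20422 ∷ []) , branch 312 (use 0 1 13 4100 1000 ∷ use 3 1 13 4100 1000 ∷ use 2 1 13 4100 1000 ∷ use 3 11 3 4000 1600 ∷
    [])) ∷
  ((1 ∷ 6100 ∷ 5212 ∷ 2502 ∷ []) , branch 341 (use 4 1 10 100 1000 ∷ use 0 1 10 100 1000 ∷ use 1 1 10 100 1000 ∷ use 3 1 10 100 1000 ∷ use 2 1 10 100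
    1000 ∷ [])) ∷
  ((1 ∷ 6100 ∷ 5212 ∷ 2512 ∷ []) , branch 30 (use 1 4006 6653 6260 1004 ∷ use 5 4006 6653 6260 1004 ∷ use 3 4006 6653 6260 1004 ∷ use 4 4006 6653 6260
    1004 ∷ use 2 4006 6653 6260 1004 ∷ [])) ∷
  ((1 ∷ 6100 ∷ 5212 ∷ 2562 ∷ []) , branch 211 (use 4 3001 2654 4515 1004 ∷ use 3 3001 2654 4515 1004 ∷ use 2 3001 2654 4515 1004 ∷ use 5 3001 2654
    4515 1004 ∷ use 6 3001 2654 4515 1004 ∷ [])) ∷
  ((1 ∷ 6100 ∷ 5212 ∷ []) , branch 400 (use 2 1 10 100 1000 ∷ use 1 1 10 100 1000 ∷ use 11 1 10 100 1000 ∷ use 10 1 10 100 1000 ∷ use 9 1 10 100 1000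
    ∷ use 8 1 10 100 1000 ∷ use 0 1 10 100 1000 ∷ [])) ∷
  ((1 ∷ 6100 ∷ 2300 ∷ 3210 ∷ 21530 ∷ []) , branch 422 (branch 111 (branch 312 (branch 420 ([]) ∷ []) ∷ branch 213 (branch 333 ([]) ∷ branch 521
    (branch 10 (use 0 22 46 1100 4100 ∷ branch 30 (branch 220 (branch 120 (use 0 13 24 6100 6300 ∷ []) ∷ []) ∷ []) ∷ use 0 25 6 3000 6400 ∷ use 0 14
    33 3400 3100 ∷ []) ∷ []) ∷ []) ∷ []) ∷ branch 22 (branch 554 (use 0 1361 5512 3353 651 ∷ []) ∷ use 0 16 66 6100 1100 ∷ use 0 30 15 200 3100 ∷ [])
    ∷ branch 411 (branch 133 (branch 130 (branch 210 (branch 20 (branch 610 (branch 420 (branch 510 (branch 220 (branch 320 (branch 330 (branch 10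
    (branch 310 (branch 120 (branch 520 (branch 30 (branch 230 (branch 430 (branch 530 (use 26 5622 6515 1036 101 ∷ []) ∷ []) ∷ []) ∷ []) ∷ []) ∷ [])
    ∷ []) ∷ branch 310 (branch 120 (branch 520 (branch 40 (branch 240 (branch 340 (branch 540 (use 30 3156 4520 1360 1563 ∷ []) ∷ []) ∷ []) ∷ []) ∷
    []) ∷ []) ∷ []) ∷ []) ∷ []) ∷ []) ∷ []) ∷ []) ∷ []) ∷ []) ∷ []) ∷ []) ∷ []) ∷ []) ∷ []) ∷ [])) ∷
  ((1 ∷ 6100 ∷ 2300 ∷ 3210 ∷ 54420 ∷ []) , branch 415 (branch 10 (use 1 36 50 500 6400 ∷ use 1 520 3343 3664 3114 ∷ use 1 21 24 4500 6200 ∷ []) ∷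
    branch 23 (use 0 3100 1600 65 50 ∷ branch 136 (branch 310 (branch 111 (branch 210 (branch 610 (branch 510 (branch 110 (branch 410 (branch 20
    (branch 120 (branch 520 (branch 30 (branch 130 (branch 430 (branch 530 (branch 630 (branch 640 (branch 550 (use 34 1 10 100 1000 ∷ []) ∷ []) ∷ [])
    ∷ []) ∷ []) ∷ []) ∷ []) ∷ []) ∷ []) ∷ []) ∷ []) ∷ []) ∷ []) ∷ []) ∷ branch 20 (branch 110 (branch 410 (branch 510 (branch 610 (branch 120 (branch
    320 (branch 520 (branch 30 (branch 430 (branch 530 (branch 630 (branch 450 (branch 550 (use 34 3600 1300 41 64 ∷ []) ∷ []) ∷ []) ∷ []) ∷ []) ∷ [])
    ∷ []) ∷ []) ∷ []) ∷ []) ∷ []) ∷ []) ∷ []) ∷ []) ∷ []) ∷ []) ∷ branch 211 ([]) ∷ []) ∷ []) ∷ []) ∷ branch 322 (branch 20 (branch 110 (branch 510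
    (branch 620 (branch 520 (branch 10 (branch 310 (branch 610 (branch 120 (branch 320 (branch 30 (branch 130 (branch 330 (branch 430 (branch 530
    (branch 630 (branch 150 (branch 550 (use 34 50 66 1600 200 ∷ []) ∷ []) ∷ []) ∷ []) ∷ []) ∷ []) ∷ []) ∷ []) ∷ []) ∷ []) ∷ []) ∷ []) ∷ []) ∷ []) ∷
    []) ∷ []) ∷ []) ∷ branch 314 (branch 421 (branch 461 (branch 110 (branch 310 (branch 10 (branch 510 (branch 320 (branch 120 (branch 520 (branch 30
    (branch 130 (branch 230 (branch 430 (branch 530 (branch 630 (branch 540 (use 34 2000 1200 51 5 ∷ []) ∷ []) ∷ []) ∷ []) ∷ []) ∷ []) ∷ []) ∷ []) ∷
    []) ∷ []) ∷ []) ∷ []) ∷ []) ∷ branch 310 (branch 510 (branch 120 (branch 320 (branch 10 (branch 520 (branch 620 (branch 30 (branch 130 (branch 230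
    (branch 430 (branch 530 (branch 630 (use 35 1 10 100 1000 ∷ []) ∷ []) ∷ []) ∷ []) ∷ []) ∷ []) ∷ []) ∷ []) ∷ []) ∷ []) ∷ []) ∷ []) ∷ []) ∷ []) ∷
    []) ∷ []) ∷ []) ∷ []) ∷ []) ∷ [])) ∷
  ((1 ∷ 6100 ∷ 2300 ∷ 3210 ∷ 10310 ∷ []) , branch 410 (branch 610 (branch 20 (use 2 33 2 5000 3400 ∷ use 2 52 42 2300 5500 ∷ branch 30 (branch 210
    (branch 620 (use 1 2243 1524 1644 1246 ∷ []) ∷ use 2 5134 3453 6425 1005 ∷ branch 220 (use 2 260 2404 5654 4456 ∷ []) ∷ []) ∷ use 2 5455 404 502
    3243 ∷ use 2 3436 6064 5125 1163 ∷ []) ∷ use 2 4543 6663 3540 5422 ∷ use 2 1114 303 106 4336 ∷ []) ∷ use 2 14 34 1200 6400 ∷ use 2 34 3 3000 3300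
    ∷ []) ∷ use 2 21 55 4400 1400 ∷ branch 360 (use 2 54 6 2000 1100 ∷ branch 120 (use 2 635 1346 5666 1565 ∷ []) ∷ []) ∷ use 2 62 3 6000 3300 ∷ []))
    ∷
  ((1 ∷ 6100 ∷ 2300 ∷ 3210 ∷ 12130 ∷ []) , branch 232 (use 2 1000 400 60 3 ∷ branch 33 (use 1 1000 400 60 3 ∷ branch 415 (branch 320 (use 1 2 13 1200
    1000 ∷ []) ∷ []) ∷ []) ∷ use 2 3400 1000 4 12 ∷ [])) ∷
  ((1 ∷ 6100 ∷ 2300 ∷ 3210 ∷ 43200 ∷ []) , branch 220 (branch 112 (use 4 4521 4116 3263 6344 ∷ branch 163 (use 4 52 4 4000 5500 ∷ []) ∷ []) ∷ use 4 43
    50 100 1200 ∷ branch 112 (use 4 43 4 5500 5400 ∷ branch 520 (use 4 11 4 6000 2300 ∷ branch 120 (branch 110 (branch 201 (branch 10 (branch 630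
    (branch 230 (use 4 15 50 500 5600 ∷ use 4 66 4 2000 5500 ∷ []) ∷ []) ∷ []) ∷ []) ∷ branch 12 (branch 410 (branch 130 (branch 630 (use 4 15 6 5000
    4400 ∷ use 4 16 24 3400 4500 ∷ []) ∷ []) ∷ []) ∷ []) ∷ branch 122 (branch 610 (branch 230 (branch 130 (use 4 66 24 6100 5400 ∷ use 4 25 21 1500
    2200 ∷ []) ∷ []) ∷ []) ∷ []) ∷ []) ∷ []) ∷ []) ∷ use 4 66 64 2400 4200 ∷ []) ∷ branch 60 (use 4 52 1 3000 6400 ∷ branch 160 (branch 521 (branch
    140 (use 4 2522 6616 4443 3224 ∷ []) ∷ []) ∷ use 4 6644 5003 4353 6425 ∷ []) ∷ branch 331 (branch 520 (branch 542 (use 2 3403 6012 4303 1012 ∷ [])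
    ∷ []) ∷ []) ∷ []) ∷ branch 511 (use 4 3135 1220 113 3262 ∷ branch 36 (use 4 66 41 1600 5500 ∷ []) ∷ []) ∷ use 4 63 41 6400 3100 ∷ branch 442
    (branch 411 (use 4 31 35 3200 5500 ∷ []) ∷ use 4 3542 1516 1104 2316 ∷ []) ∷ use 4 22 64 4100 5200 ∷ [])) ∷
  ((1 ∷ 6100 ∷ 2300 ∷ 3210 ∷ []) , branch 434 (use 0 1 10 100 1000 ∷ use 2 1 10 100 1000 ∷ use 3 1 10 100 1000 ∷ use 4 1 10 100 1000 ∷ use 1 1 10 100
    1000 ∷ [])) ∷
  ((1 ∷ 6100 ∷ 2300 ∷ 3200 ∷ 10010 ∷ []) , branch 20 (branch 30 (branch 110 (use 6 1243 2656 6543 5156 ∷ use 6 51 11 5400 2100 ∷ branch 210 (branch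
    410 (branch 411 (branch 520 (branch 230 (branch 610 (use 6 6364 1003 150 3155 ∷ branch 310 (branch 120 (branch 220 (branch 320 (branch 420 (branch
    620 (branch 130 (branch 330 (branch 430 (branch 530 (branch 630 (use 41 600 1000 1 60 ∷ []) ∷ []) ∷ []) ∷ []) ∷ []) ∷ []) ∷ []) ∷ []) ∷ []) ∷ [])
    ∷ []) ∷ []) ∷ []) ∷ []) ∷ use 6 1533 3652 5236 4462 ∷ []) ∷ []) ∷ []) ∷ branch 120 (branch 630 (branch 511 (use 6 4164 3003 440 6441 ∷ branch 510
    (branch 310 (branch 410 (use 6 1611 4254 1666 4223 ∷ branch 210 (branch 220 (branch 320 (branch 420 (branch 520 (branch 620 (branch 130 (branch
    230 (branch 330 (branch 430 (branch 530 (use 41 1 10 100 1000 ∷ []) ∷ []) ∷ []) ∷ []) ∷ []) ∷ []) ∷ []) ∷ []) ∷ []) ∷ []) ∷ []) ∷ []) ∷ []) ∷ [])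
    ∷ []) ∷ []) ∷ []) ∷ use 6 14 36 6400 3100 ∷ use 6 6436 2252 2555 3664 ∷ []) ∷ []) ∷ branch 40 (branch 120 (use 6 6654 5651 2621 5466 ∷ branch 420
    (branch 220 (branch 521 (branch 140 (branch 210 (branch 110 (branch 410 (branch 310 (branch 510 (branch 610 (branch 320 (branch 520 (branch 620
    (branch 230 (branch 330 (branch 430 (branch 530 (use 42 1 10 100 1000 ∷ []) ∷ []) ∷ []) ∷ []) ∷ []) ∷ []) ∷ []) ∷ []) ∷ []) ∷ []) ∷ []) ∷ []) ∷
    []) ∷ []) ∷ []) ∷ []) ∷ use 0 4343 4242 4532 1265 ∷ []) ∷ use 6 14 31 6300 4600 ∷ use 6 6436 2342 4223 4113 ∷ branch 220 (branch 210 (branch 160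
    (branch 130 (branch 230 (branch 330 (branch 530 (branch 310 (branch 510 (branch 610 (branch 320 (branch 520 (branch 620 (branch 630 (branch 350
    (branch 550 (branch 650 (use 42 506 5060 105 1050 ∷ []) ∷ []) ∷ []) ∷ []) ∷ []) ∷ []) ∷ []) ∷ []) ∷ []) ∷ []) ∷ []) ∷ []) ∷ []) ∷ []) ∷ []) ∷ [])
    ∷ use 0 1531 1133 4316 1421 ∷ []) ∷ branch 220 (use 0 3131 2121 6215 1463 ∷ branch 420 (branch 130 (use 6 1653 4245 3235 5316 ∷ use 6 51 46 1400
    1200 ∷ branch 230 (use 6 26 14 4600 1200 ∷ branch 430 (branch 110 (branch 310 (branch 330 (branch 150 (branch 210 (branch 410 (branch 510 (branch
    610 (branch 530 (branch 630 (branch 250 (branch 450 (use 42 301 4060 603 1040 ∷ []) ∷ []) ∷ []) ∷ []) ∷ []) ∷ []) ∷ []) ∷ branch 410 (branch 510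
    (branch 610 (branch 320 (branch 520 (branch 530 (branch 630 (use 40 2500 1200 45 11 ∷ []) ∷ []) ∷ []) ∷ []) ∷ []) ∷ []) ∷ []) ∷ []) ∷ []) ∷ []) ∷
    []) ∷ branch 610 (branch 520 (branch 630 (branch 210 (branch 310 (branch 410 (branch 510 (branch 320 (branch 620 (branch 330 (branch 530 (use 42
    600 1000 1 60 ∷ []) ∷ []) ∷ []) ∷ []) ∷ []) ∷ []) ∷ []) ∷ branch 310 (branch 410 (branch 510 (branch 620 (branch 330 (branch 530 (branch 450 (use
    40 22 51 5300 1600 ∷ []) ∷ []) ∷ []) ∷ []) ∷ []) ∷ []) ∷ []) ∷ []) ∷ []) ∷ []) ∷ []) ∷ branch 510 (branch 320 (branch 530 (branch 210 (branch 310
    (branch 410 (branch 610 (branch 620 (branch 330 (branch 630 (branch 250 (use 40 2600 1100 46 14 ∷ []) ∷ []) ∷ []) ∷ []) ∷ []) ∷ []) ∷ []) ∷ branch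
    310 (branch 410 (branch 610 (branch 520 (branch 620 (branch 330 (branch 630 (use 43 1 10 100 1000 ∷ []) ∷ []) ∷ []) ∷ []) ∷ []) ∷ []) ∷ []) ∷ [])
    ∷ []) ∷ []) ∷ []) ∷ []) ∷ []) ∷ use 6 11 20 500 6100 ∷ []) ∷ use 6 43 51 1200 4400 ∷ use 6 4005 6244 4462 230 ∷ []) ∷ []) ∷ []) ∷ []) ∷ []) ∷
    branch 30 (branch 110 (branch 410 (branch 210 (branch 140 (branch 310 (branch 230 (branch 610 (branch 510 (branch 120 (branch 220 (branch 320
    (branch 420 (branch 520 (branch 620 (branch 130 (branch 330 (branch 430 (branch 530 (use 41 101 1010 1060 601 ∷ []) ∷ []) ∷ []) ∷ []) ∷ []) ∷ [])
    ∷ []) ∷ []) ∷ []) ∷ []) ∷ []) ∷ use 6 65 45 1300 3500 ∷ []) ∷ []) ∷ []) ∷ use 6 12 63 4600 2600 ∷ []) ∷ []) ∷ []) ∷ branch 121 (branch 330 (branch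
    220 (branch 420 (branch 120 (branch 210 (branch 310 (branch 410 (branch 510 (branch 610 (branch 320 (branch 520 (branch 620 (branch 130 (branch
    430 (branch 530 (branch 630 (use 41 1060 106 606 1010 ∷ []) ∷ []) ∷ []) ∷ []) ∷ []) ∷ []) ∷ []) ∷ []) ∷ []) ∷ []) ∷ []) ∷ use 6 4005 6534 4312 540
    ∷ []) ∷ []) ∷ []) ∷ use 6 1003 5241 2231 3465 ∷ []) ∷ []) ∷ []) ∷ use 6 65 5 2000 5100 ∷ use 6 430 5435 4003 4223 ∷ use 6 21 23 3500 6200 ∷ use 6
    610 1161 6111 6001 ∷ []) ∷ []) ∷ [])) ∷
  ((1 ∷ 6100 ∷ 2300 ∷ 3200 ∷ 10042 ∷ []) , branch 20 (use 0 501 4030 303 1020 ∷ branch 40 (branch 110 (branch 210 (branch 660 (use 7 2004 5513 4146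
    630 ∷ []) ∷ use 7 450 6645 6562 1565 ∷ branch 510 (branch 610 (branch 120 (branch 620 (branch 130 (use 7 33 45 4200 6200 ∷ branch 230 (branch 310
    (branch 410 (branch 320 (branch 420 (branch 330 (branch 430 (branch 530 (branch 630 (branch 250 (branch 550 (use 40 6100 1300 66 41 ∷ []) ∷ []) ∷
    []) ∷ []) ∷ []) ∷ []) ∷ []) ∷ []) ∷ []) ∷ []) ∷ []) ∷ []) ∷ []) ∷ []) ∷ []) ∷ []) ∷ []) ∷ branch 150 (use 1 51 11 6100 1200 ∷ []) ∷ use 7 41 13
    4100 1300 ∷ use 7 21 23 3500 6200 ∷ branch 310 (branch 420 (branch 340 (branch 410 (branch 320 (branch 130 (branch 220 (branch 520 (branch 230
    (branch 210 (branch 510 (branch 330 (branch 430 (branch 530 (branch 630 (branch 150 (branch 650 (use 40 14 65 5200 1500 ∷ []) ∷ []) ∷ []) ∷ []) ∷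
    []) ∷ []) ∷ []) ∷ []) ∷ []) ∷ []) ∷ []) ∷ use 7 54 65 2600 4200 ∷ []) ∷ []) ∷ []) ∷ []) ∷ []) ∷ branch 210 (branch 330 (use 7 410 5411 4622 1004 ∷
    []) ∷ use 7 64 44 4300 3600 ∷ []) ∷ use 7 53 42 3200 6100 ∷ []) ∷ use 7 52 50 2400 3100 ∷ []) ∷ []) ∷ branch 160 (use 1 220 5662 340 1341 ∷ use 1
    6616 1611 1666 1116 ∷ use 1 220 6331 520 1341 ∷ []) ∷ [])) ∷
  ((1 ∷ 6100 ∷ 2300 ∷ 3200 ∷ 20033 ∷ []) , branch 20 (use 0 1 60 600 1000 ∷ use 1 1 50 500 1000 ∷ use 0 1 20 200 1000 ∷ [])) ∷
  ((1 ∷ 6100 ∷ 2300 ∷ 3200 ∷ []) , branch 10 (use 2 1 10 100 1000 ∷ use 1 1 10 100 1000 ∷ use 0 1 10 100 1000 ∷ use 0 1 20 200 1000 ∷ use 1 1 30 300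
    1000 ∷ [])) ∷
  ((1 ∷ 6100 ∷ 2300 ∷ []) , branch 300 (use 0 1 10 100 1000 ∷ use 4 1 60 600 1000 ∷ use 4 1 30 300 1000 ∷ use 4 1 20 200 1000 ∷ use 4 1 50 500 1000 ∷
    use 4 1 40 400 1000 ∷ use 4 1 10 100 1000 ∷ [])) ∷
  ((1 ∷ 6100 ∷ 5202 ∷ 2502 ∷ 10010 ∷ []) , branch 210 (use 0 3434 6363 4631 4433 ∷ use 0 3466 1232 4565 6634 ∷ use 0 5252 4141 4136 2552 ∷ use 0 540
    6545 3212 4005 ∷ use 0 3232 303 1661 5423 ∷ use 11 45 66 1100 4500 ∷ branch 130 (use 11 61 41 4100 1600 ∷ use 11 4344 2612 6551 4443 ∷ branch 310
    (use 0 1111 6565 6512 6611 ∷ use 0 4126 6652 640 2131 ∷ use 0 4126 410 6003 2641 ∷ use 11 24 61 1600 2400 ∷ branch 440 (use 11 610 1001 110 6001 ∷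
    branch 530 (use 0 5414 530 4002 1454 ∷ use 0 5535 2554 2523 2235 ∷ use 0 4126 4366 1134 2641 ∷ []) ∷ []) ∷ use 0 16 36 4100 1600 ∷ use 0 4524 5005
    220 2445 ∷ []) ∷ []) ∷ use 0 53 26 5100 5300 ∷ use 0 3131 1010 2255 3641 ∷ use 11 3253 6256 5662 2445 ∷ [])) ∷
  ((1 ∷ 6100 ∷ 5202 ∷ 2502 ∷ 10310 ∷ []) , branch 620 (use 1 4562 222 3103 3625 ∷ branch 160 (use 1 4543 2423 2454 3243 ∷ use 1 4415 2022 2055 3315 ∷
    use 1 6663 6360 6310 1163 ∷ []) ∷ branch 40 (use 1 505 5455 5422 205 ∷ use 1 303 1013 1064 403 ∷ use 1 303 3436 3441 403 ∷ use 1 14 4 300 1100 ∷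
    branch 311 (branch 121 (branch 240 (branch 610 (use 1 24 35 1000 3500 ∷ []) ∷ branch 33 (branch 310 (branch 120 (use 12 2650 2441 5564 4510 ∷ [])
    ∷ branch 520 (use 12 6413 2543 5321 3011 ∷ []) ∷ []) ∷ []) ∷ []) ∷ branch 12 ([]) ∷ []) ∷ use 12 66 30 4200 6200 ∷ []) ∷ []) ∷ use 1 2625 1013
    1064 5125 ∷ branch 610 (use 12 56 16 6400 5500 ∷ use 1 665 6654 4121 3403 ∷ use 12 34 10 1400 4500 ∷ use 1 2423 3234 3243 5323 ∷ use 12 6532 4006
    4322 6263 ∷ use 1 2145 2663 2614 5645 ∷ []) ∷ branch 541 (use 1 4240 5455 5422 3540 ∷ branch 20 (branch 610 (branch 350 (use 12 1522 1121 604 5212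
    ∷ []) ∷ branch 110 (branch 520 (branch 210 (branch 310 (branch 410 (branch 510 (branch 120 (branch 320 (branch 420 (branch 130 (branch 330 (branch
    530 (branch 630 (branch 440 (branch 540 (branch 250 (use 42 4155 5406 1040 1211 ∷ []) ∷ []) ∷ []) ∷ []) ∷ []) ∷ []) ∷ []) ∷ []) ∷ []) ∷ []) ∷ [])
    ∷ []) ∷ []) ∷ []) ∷ []) ∷ branch 510 (use 12 4331 1145 2134 1623 ∷ []) ∷ []) ∷ []) ∷ use 12 4 56 2200 400 ∷ []) ∷ use 1 6663 5455 5422 1163 ∷ use
    1 44 45 3000 4600 ∷ use 1 505 1511 1566 205 ∷ []) ∷ branch 140 (use 12 2533 6412 130 4132 ∷ branch 121 (use 12 12 44 4600 6100 ∷ branch 340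
    (branch 321 (branch 111 (branch 130 (branch 630 (branch 310 (use 1 3101 1434 1443 4601 ∷ use 12 10 44 3100 1400 ∷ []) ∷ []) ∷ []) ∷ []) ∷ []) ∷
    []) ∷ []) ∷ use 12 2413 4006 6643 6003 ∷ branch 450 (use 1 62 12 6100 6500 ∷ branch 210 (branch 150 ([]) ∷ []) ∷ []) ∷ []) ∷ use 1 3335 5354 5323
    4435 ∷ branch 631 (use 1 6432 363 314 1332 ∷ use 1 3234 1215 1262 4534 ∷ use 1 4341 5051 5026 3441 ∷ []) ∷ [])) ∷
  ((1 ∷ 6100 ∷ 5202 ∷ 2502 ∷ 10142 ∷ []) , branch 530 (use 0 4656 5654 4262 1514 ∷ branch 40 (branch 560 (use 0 150 2544 3422 210 ∷ branch 241 (branch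
    110 (use 0 4344 5525 5552 3444 ∷ []) ∷ []) ∷ []) ∷ use 2 6141 506 2332 4460 ∷ use 0 20 14 3100 500 ∷ use 0 3343 2162 2115 4443 ∷ use 13 5264 3602
    6420 3445 ∷ []) ∷ branch 561 (use 0 250 2432 2445 550 ∷ branch 620 (branch 630 (branch 40 ([]) ∷ []) ∷ use 0 51 36 1300 1200 ∷ []) ∷ branch 560
    (branch 661 (use 0 1125 4126 6513 2261 ∷ []) ∷ branch 30 (use 13 2144 5024 6101 4255 ∷ branch 220 (branch 620 (use 0 4536 4006 6003 1324 ∷ []) ∷
    branch 120 (use 0 5414 6122 2511 3135 ∷ []) ∷ []) ∷ use 13 4205 6565 1014 2564 ∷ []) ∷ []) ∷ use 13 53 33 6300 3600 ∷ []) ∷ use 13 2350 4232 2340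
    505 ∷ use 2 2325 2401 6045 5542 ∷ use 13 5324 6416 4011 3261 ∷ use 0 2653 4246 6323 4512 ∷ branch 301 (use 0 360 3411 1644 640 ∷ branch 160 (use
    13 5234 4055 562 1055 ∷ branch 621 (use 0 6616 1521 1556 1116 ∷ []) ∷ []) ∷ branch 111 (branch 630 (use 2 6520 4535 4542 1220 ∷ []) ∷ branch 410
    (branch 30 (branch 20 (use 13 3563 3606 2540 6506 ∷ []) ∷ []) ∷ use 0 2413 6362 2131 4132 ∷ use 13 3104 2532 4605 6631 ∷ []) ∷ []) ∷ use 13 5003
    2624 2566 420 ∷ []) ∷ branch 320 (use 0 1622 6235 2356 2566 ∷ use 13 1066 4136 505 2044 ∷ use 0 3466 3156 1563 6144 ∷ branch 610 (branch 20
    (branch 140 (use 13 3140 3044 4112 6250 ∷ []) ∷ []) ∷ branch 210 (branch 433 (branch 220 (use 0 5233 1232 5351 3422 ∷ []) ∷ branch 120 (use 0 2314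
    3006 1003 4635 ∷ []) ∷ []) ∷ branch 120 ([]) ∷ []) ∷ use 0 26 53 4500 6500 ∷ []) ∷ use 2 1244 1115 6402 6243 ∷ []) ∷ [])) ∷
  ((1 ∷ 6100 ∷ 5202 ∷ 2502 ∷ []) , branch 10 (use 2 1 10 100 1000 ∷ use 1 1 10 100 1000 ∷ use 1 66 46 1400 6100 ∷ use 1 5345 1161 1116 2445 ∷ use 0 3
    40 300 4000 ∷ use 0 1 10 100 1000 ∷ use 1 3626 5233 4355 6564 ∷ use 0 610 4614 3114 660 ∷ use 0 3523 4524 4553 4223 ∷ use 1 2003 3411 1644 4002 ∷
    use 1 1125 360 130 2261 ∷ use 0 5525 2522 2555 2225 ∷ use 0 4524 3343 4443 4553 ∷ use 1 5233 620 210 3422 ∷ use 1 520 2342 2335 220 ∷ use 0 10 61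
    6600 600 ∷ use 0 15 56 6200 2100 ∷ [])) ∷
  ((1 ∷ 6100 ∷ 5202 ∷ []) , branch 400 (use 0 1 10 100 1000 ∷ use 15 3 40 300 4000 ∷ use 15 4 50 200 3000 ∷ use 15 1 20 500 6000 ∷ use 15 6 21 1500
    1000 ∷ use 15 3 56 6200 4000 ∷ use 15 6 63 3100 1000 ∷ [])) ∷
  ((1 ∷ 6100 ∷ []) , branch 200 (use 5 1 10 100 1000 ∷ use 0 1 10 100 1000 ∷ use 5 2002 160 110 5002 ∷ use 5 1 56 1500 1000 ∷ use 16 6 12 5100 6000 ∷
    use 5 1001 3613 3664 6001 ∷ use 5 6 33 4300 6000 ∷ use 16 4 55 2500 4000 ∷ use 5 2002 2252 2225 5002 ∷ use 5 2 54 3500 2000 ∷ use 16 1 20 200 1000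
    ∷ use 5 5005 5165 5112 2005 ∷ use 5 5 65 2600 5000 ∷ use 16 2 33 4300 2000 ∷ use 5 4004 3523 3554 3004 ∷ use 5 3 25 2200 3000 ∷ use 16 4 25 2200
    4000 ∷ use 5 6006 2522 2555 1006 ∷ use 5 4 51 6500 4000 ∷ use 16 1 10 100 1000 ∷ use 5 3003 6256 6221 4003 ∷ [])) ∷
  ((1 ∷ 6402 ∷ 5202 ∷ 3112 ∷ 46213 ∷ []) , branch 40 (branch 31 (use 0 6224 5111 3003 5465 ∷ use 0 2123 2363 1264 4322 ∷ use 0 62 30 1100 1200 ∷ []) ∷
    branch 641 (use 0 2226 220 6006 2542 ∷ branch 612 ([]) ∷ []) ∷ branch 440 (branch 350 (branch 640 (branch 540 ([]) ∷ branch 10 (use 0 5534 4366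
    5456 2641 ∷ use 0 1125 3001 2321 130 ∷ use 0 3224 6243 2223 6166 ∷ use 0 6114 4115 2002 1461 ∷ []) ∷ []) ∷ branch 630 (branch 410 (branch 661 ([])
    ∷ []) ∷ []) ∷ []) ∷ branch 310 (use 0 34 54 4200 4000 ∷ []) ∷ branch 350 (use 0 4426 6424 4001 615 ∷ branch 630 (branch 220 (use 0 1443 1663 150
    6626 ∷ []) ∷ []) ∷ []) ∷ []) ∷ [])) ∷
  ((1 ∷ 6402 ∷ 5202 ∷ 3112 ∷ 62342 ∷ []) , branch 621 (use 1 1006 3420 615 2251 ∷ use 1 4555 6224 540 5625 ∷ use 1 2653 6242 6643 2451 ∷ use 1 20 64
    4100 6000 ∷ use 1 3 12 600 4200 ∷ use 1 5441 1333 1621 6316 ∷ use 1 53 5 200 5200 ∷ [])) ∷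
  ((1 ∷ 6402 ∷ 5202 ∷ 3112 ∷ 15453 ∷ []) , branch 230 (use 1 4555 3002 2002 1541 ∷ branch 261 (use 2 1553 1003 1231 4234 ∷ use 1 410 3361 4132 1454 ∷
    []) ∷ use 2 66 62 6500 2000 ∷ use 2 4445 6334 5465 5005 ∷ [])) ∷
  ((1 ∷ 6402 ∷ 5202 ∷ 3112 ∷ 23102 ∷ []) , branch 140 (branch 350 (branch 41 (branch 430 (use 3 1616 1126 2444 3326 ∷ branch 530 (branch 10 (use 3 52
    3 400 5100 ∷ branch 610 (branch 520 ([]) ∷ []) ∷ branch 320 (use 3 6114 5001 1151 2312 ∷ []) ∷ branch 250 (use 3 10 13 5600 3000 ∷ []) ∷ []) ∷ [])
    ∷ []) ∷ use 3 5 14 6400 4300 ∷ use 3 3143 146 3614 6252 ∷ []) ∷ use 3 120 6532 5136 3005 ∷ use 3 2446 4445 1001 4314 ∷ use 3 1422 1006 2343 6160 ∷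
    []) ∷ use 3 2665 3644 4021 3146 ∷ use 3 1365 4416 450 1514 ∷ use 3 3364 630 1652 4541 ∷ use 3 2226 4555 5545 3623 ∷ use 3 5661 5111 5005 1151 ∷
    use 3 1266 2105 3506 5243 ∷ use 3 3566 1145 5342 3345 ∷ [])) ∷
  ((1 ∷ 6402 ∷ 5202 ∷ 3112 ∷ []) , branch 420 (use 0 1 10 100 1000 ∷ use 4 16 6 4200 5400 ∷ use 2 1 10 100 1000 ∷ use 1 1 10 100 1000 ∷ use 3 1 10 100
    1000 ∷ [])) ∷
  ((1 ∷ 6402 ∷ 5202 ∷ 3102 ∷ 34422 ∷ []) , branch 460 (use 5 5661 2446 5545 1621 ∷ use 5 5505 2016 1212 4362 ∷ use 5 6114 6664 1541 2462 ∷ use 5 24 35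
    2200 6500 ∷ branch 311 (use 5 220 6664 540 4544 ∷ use 5 4633 4423 3526 1522 ∷ branch 620 (branch 315 ([]) ∷ branch 240 (branch 350 (branch 10
    (branch 310 (use 5 1422 2523 3264 1654 ∷ []) ∷ use 5 4651 5166 6143 6531 ∷ []) ∷ []) ∷ []) ∷ []) ∷ []) ∷ use 5 321 3303 5132 3636 ∷ branch 610
    (use 5 5111 5661 2622 3313 ∷ use 5 32 25 1400 4600 ∷ use 5 5414 410 4322 640 ∷ []) ∷ [])) ∷
  ((1 ∷ 6402 ∷ 5202 ∷ 3102 ∷ 34512 ∷ []) , branch 160 (use 6 6224 2226 5625 540 ∷ use 6 15 21 200 1500 ∷ branch 220 (use 6 5460 5652 331 3140 ∷ use 6
    43 4 6600 3100 ∷ use 6 31 63 3600 1300 ∷ branch 420 (use 0 2 20 400 1000 ∷ use 6 3115 1366 112 3042 ∷ branch 620 (branch 530 (use 6 4264 4333 3130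
    246 ∷ []) ∷ use 6 35 23 2500 1200 ∷ []) ∷ []) ∷ use 6 3634 5142 4251 160 ∷ branch 430 (branch 610 (branch 440 (branch 10 (use 6 44 46 3100 4400 ∷
    use 6 1566 6561 2434 1162 ∷ use 6 1104 2543 1055 4524 ∷ use 6 1102 2352 2554 4542 ∷ use 6 6242 2123 6643 5456 ∷ []) ∷ []) ∷ []) ∷ use 6 3403 6230
    6656 6102 ∷ []) ∷ []) ∷ [])) ∷
  ((1 ∷ 6402 ∷ 5202 ∷ 3102 ∷ 25213 ∷ []) , branch 410 (use 1 40 6 1000 300 ∷ use 1 2 10 200 1000 ∷ branch 420 (use 1 2 20 400 1000 ∷ branch 330 (use 7
    6041 1511 4065 2663 ∷ use 7 3506 3460 6515 143 ∷ branch 401 (use 7 12 51 6100 200 ∷ branch 610 (branch 650 ([]) ∷ use 0 10 5 1000 500 ∷ []) ∷ [])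
    ∷ use 7 5221 550 4314 2232 ∷ branch 530 (use 7 63 30 5500 5600 ∷ branch 620 (use 0 20 5 1000 300 ∷ branch 630 ([]) ∷ []) ∷ []) ∷ []) ∷ use 1 10 6
    1000 600 ∷ use 7 32 42 4100 2000 ∷ []) ∷ use 7 45 55 3300 2500 ∷ branch 512 (use 1 110 5001 1001 150 ∷ use 7 6444 5331 5155 4234 ∷ branch 430 (use
    1 2 30 600 1000 ∷ branch 210 (use 1 40 5 1000 600 ∷ use 7 3263 551 5362 3022 ∷ branch 130 (use 1 1 30 300 1000 ∷ branch 10 (use 7 1 34 4300 100 ∷
    use 7 2642 5354 4261 5430 ∷ use 2 3343 3465 2445 1363 ∷ []) ∷ []) ∷ []) ∷ []) ∷ []) ∷ [])) ∷
  ((1 ∷ 6402 ∷ 5202 ∷ 3102 ∷ []) , branch 110 (use 2 40 3 1000 500 ∷ use 8 1535 3411 4512 6003 ∷ use 1 1 10 100 1000 ∷ use 2 1 10 100 1000 ∷ use 8 21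
    64 5400 5300 ∷ use 0 40 3 1000 500 ∷ use 8 23 65 1200 3500 ∷ use 8 40 4 4400 1500 ∷ use 8 2556 4555 150 5005 ∷ use 8 2666 6334 4464 4234 ∷ use 8
    5124 5004 5266 320 ∷ use 0 1 10 100 1000 ∷ [])) ∷
  ((1 ∷ 6402 ∷ 5202 ∷ []) , branch 400 (use 0 1 10 100 1000 ∷ use 4 1 60 600 1000 ∷ use 4 1 30 300 1000 ∷ use 4 1 20 200 1000 ∷ use 4 1 50 500 1000 ∷
    use 4 1 40 400 1000 ∷ use 4 1 10 100 1000 ∷ [])) ∷
  ((1 ∷ 6402 ∷ 6603 ∷ 2413 ∷ 64013 ∷ []) , branch 662 (branch 260 (branch 641 (use 10 5551 2446 5545 150 ∷ branch 110 (use 10 3133 5060 5642 1632 ∷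
    use 10 1 51 3500 6600 ∷ []) ∷ []) ∷ branch 513 (use 10 2666 6554 1541 6316 ∷ use 10 153 6342 6145 4534 ∷ []) ∷ use 10 30 56 2000 6200 ∷ use 10
    5111 3332 6466 5235 ∷ []) ∷ use 0 5001 6334 4004 2152 ∷ use 10 31 50 6100 2300 ∷ use 10 3001 1161 3004 4510 ∷ use 10 5566 4632 3006 530 ∷ use 10
    30 5 5200 3000 ∷ [])) ∷
  ((1 ∷ 6402 ∷ 6603 ∷ 2413 ∷ 32023 ∷ []) , branch 634 (use 11 44 56 4000 5100 ∷ use 11 53 34 100 3500 ∷ use 11 23 64 2500 4500 ∷ use 11 25 53 4200
    1100 ∷ [])) ∷
  ((1 ∷ 6402 ∷ 6603 ∷ 2413 ∷ 13042 ∷ []) , branch 610 (use 2 2421 6423 1412 2534 ∷ use 12 6002 4341 5323 2133 ∷ branch 120 (use 2 34 12 3100 4200 ∷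
    use 1 3132 2005 3001 1526 ∷ use 12 4103 5654 161 1202 ∷ []) ∷ use 1 256 2003 2005 1455 ∷ [])) ∷
  ((1 ∷ 6402 ∷ 6603 ∷ 2413 ∷ []) , branch 650 (use 2 1 10 100 1000 ∷ use 3 35 66 2600 5200 ∷ use 13 41 6 6500 4500 ∷ use 0 1 10 100 1000 ∷ use 1 1 10
    100 1000 ∷ [])) ∷
  ((1 ∷ 6402 ∷ 6603 ∷ 2403 ∷ 12622 ∷ []) , branch 520 (branch 660 (use 4 22 36 2300 2600 ∷ use 4 34 12 4100 5000 ∷ branch 120 (use 0 440 4005 1461
    1311 ∷ branch 40 (use 14 56 55 4100 3300 ∷ use 14 1553 3002 6466 2312 ∷ []) ∷ []) ∷ use 4 2561 2351 6365 4121 ∷ use 4 11 51 5200 200 ∷ []) ∷ use 0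
    3246 1532 4422 1214 ∷ use 0 3246 4651 2211 1214 ∷ [])) ∷
  ((1 ∷ 6402 ∷ 6603 ∷ 2403 ∷ 24563 ∷ []) , branch 40 (use 15 1443 6114 5155 460 ∷ use 15 55 52 4600 3600 ∷ use 15 2006 3112 6156 1541 ∷ use 15 6114
    2226 1001 540 ∷ use 15 4665 3222 4154 5005 ∷ [])) ∷
  ((1 ∷ 6402 ∷ 6603 ∷ 2403 ∷ []) , branch 510 (use 0 1 10 100 1000 ∷ use 6 2421 5566 1532 4531 ∷ use 16 2141 3355 4651 1002 ∷ use 6 26 53 1500 6600 ∷
    use 16 1663 5441 3003 2542 ∷ use 16 65 5 3200 1600 ∷ use 1 2006 440 310 1001 ∷ use 16 64 15 1000 5500 ∷ use 6 42 61 5600 2500 ∷ use 1 1 10 100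
    1000 ∷ use 16 2351 3635 650 1362 ∷ use 6 2141 2211 6245 4361 ∷ [])) ∷
  ((1 ∷ 6402 ∷ 6603 ∷ []) , branch 300 (use 0 1 10 100 1000 ∷ use 3 1 10 100 1000 ∷ use 3 1 40 400 1000 ∷ use 3 1 50 500 1000 ∷ use 3 1 20 200 1000 ∷
    use 3 1 30 300 1000 ∷ use 3 1 60 600 1000 ∷ [])) ∷
  ((1 ∷ 6402 ∷ []) , branch 200 (use 18 6334 3002 1001 5625 ∷ use 8 1 10 100 1000 ∷ use 0 1 10 100 1000 ∷ use 18 440 3332 5155 4154 ∷ use 8 5 64 6600
    5000 ∷ use 0 3 65 4600 3000 ∷ use 18 2666 5661 6236 2542 ∷ use 8 1 61 5600 1000 ∷ use 0 1 42 3400 1000 ∷ use 18 3002 3442 3623 6006 ∷ use 8 1 53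
    1500 1000 ∷ use 0 6 43 1400 6000 ∷ use 18 2006 3112 4544 4004 ∷ use 8 1 62 3600 1000 ∷ use 0 5 22 3200 5000 ∷ use 18 440 6664 230 6156 ∷ use 8 2
    22 3200 2000 ∷ use 0 6 32 3300 6000 ∷ use 18 4555 2556 1461 3313 ∷ use 8 6 63 1600 6000 ∷ use 0 5 54 6500 5000 ∷ [])) ∷
  ((1 ∷ 5303 ∷ []) , branch 200 (use 0 15 5 3000 2400 ∷ use 19 1 55 3100 5000 ∷ use 0 3 16 4400 6000 ∷ use 0 1 60 2100 6000 ∷ use 19 10 1 5000 1300 ∷
    use 0 66 32 5500 6200 ∷ use 0 21 11 5600 3100 ∷ use 19 35 62 5300 2200 ∷ use 0 15 41 5200 1500 ∷ use 0 1 66 4100 6000 ∷ use 19 51 11 2400 3100 ∷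
    use 0 2 11 2400 4000 ∷ use 0 16 46 1300 5400 ∷ use 19 62 61 5400 300 ∷ use 0 60 33 5500 4200 ∷ use 0 52 23 500 2600 ∷ use 19 52 53 3100 6600 ∷ use
    0 54 53 3600 4400 ∷ use 0 13 61 100 3400 ∷ use 19 25 40 3500 6100 ∷ use 0 25 32 500 5300 ∷ [])) ∷
  ((1 ∷ []) , branch 100 (use 20 1 10 100 1000 ∷ use 1 1 10 100 1000 ∷ use 0 1 10 100 1000 ∷ use 0 21 10 400 2200 ∷ use 1 23 40 600 2200 ∷ use 20 16 4
    3000 600 ∷ use 1 36 15 6100 3200 ∷ use 0 5 61 6600 5000 ∷ use 0 3 42 3200 6000 ∷ use 1 46 33 4100 1400 ∷ use 20 53 26 4200 6200 ∷ use 1 65 31 3300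
    400 ∷ use 0 62 16 6100 3500 ∷ use 0 41 11 5400 6400 ∷ use 1 41 40 5600 4400 ∷ use 20 2 43 6400 2000 ∷ use 1 53 54 1500 2100 ∷ use 0 23 35 2300 400
    ∷ use 0 24 60 1300 4200 ∷ use 1 55 40 4600 2500 ∷ use 20 24 40 2300 2200 ∷ use 1 60 42 400 4400 ∷ use 0 46 4 2000 5100 ∷ use 0 63 45 2200 4600 ∷
    use 1 34 2 2000 3300 ∷ use 20 21 46 5300 3200 ∷ use 1 6 60 4600 6000 ∷ use 0 20 32 6300 2400 ∷ use 0 16 54 5600 4100 ∷ use 1 21 15 2500 6200 ∷ use
    20 20 25 3500 2200 ∷ use 1 65 33 2300 4400 ∷ use 0 46 45 400 1100 ∷ use 0 55 42 1200 4500 ∷ use 1 2 32 1100 6000 ∷ [])) ∷ []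

-- Assembly of the classification

module Classification (q : ℕ) .{{_ : NonZero q}} (isField : Residues.IsOddField q)
                      (codes : List (List ℕ)) (counts : List ℕ) (certificate : List (List ℕ × Tree)) where
  private module N = CheckerInversion q
  open N using (digits)
  open Residues q using (⟦_⟧)

  decode : List ℕ → List N.V₅
  decode = List.map (digits 5)

  decodeEntry : List ℕ × Tree → List N.V₅ × Tree
  decodeEntry (C , t) = decode C , t

  allDistinct : List ℕ → Bool
  allDistinct []       = true
  allDistinct (x ∷ xs) = all (λ y → not (x ℕ.≡ᵇ y)) xs ∧ allDistinct xs

  validCodes validCertificate : Bool
  validCodes       = all (N.isCode ∘ decode) codes
  validCertificate = N.checkAll (List.map decode codes) (List.map decodeEntry certificate)

  true⇒T : ∀ {b} → b ≡ true → T b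
  true⇒T refl = _

  distinct-lookup : ∀ {A : Set} (f : A → ℕ) L → T (allDistinct (List.map f L)) → ∀ i j → f (lookup L i) ≡ f (lookup L j) → i ≡ j
  distinct-lookup f (x ∷ L) t Fin.zero    Fin.zero    e = refl
  distinct-lookup f (x ∷ L) t Fin.zero    (Fin.suc j) e =
    ⊥-elim (not⁻ (all⁻ (λ y → not (f x ℕ.≡ᵇ y)) (List.map f L) (proj₁ (∧⁻ t)) (∈-map⁺ f (∈-lookup {xs = L} j))) (ℕ.≡⇒≡ᵇ _ _ e))
  distinct-lookup f (x ∷ L) t (Fin.suc i) Fin.zero    e =
    ⊥-elim (not⁻ (all⁻ (λ y → not (f x ℕ.≡ᵇ y)) (List.map f L) (proj₁ (∧⁻ t)) (∈-map⁺ f (∈-lookup {xs = L} i))) (ℕ.≡⇒≡ᵇ _ _ (sym e)))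
  distinct-lookup f (x ∷ L) t (Fin.suc i) (Fin.suc j) e =
    cong Fin.suc (distinct-lookup f L (proj₂ (∧⁻ {all (λ y → not (f x ℕ.≡ᵇ y)) (List.map f L)} t)) i j e)

  -- A record, so that comparing two instances of its type does not run the checks.
  record Checks : Set where
    field
      codesValid       : validCodes ≡ true
      countsCorrect    : List.map (N.triads ∘ decode) codes ≡ counts
      countsDistinct   : allDistinct counts ≡ true
      certificateValid : validCertificate ≡ true
      root             : Any ((1 ∷ []) ≡_) (List.map proj₁ certificate)

  module _ (checks : Checks) (P : SymplecticPolarity q) where
    open Checks checks
    private F = Residues.residueField q isField
    open Field F using (0#; 1#; 1≢0)
    open Algebra F
    open Lines F
    open Frames F
    open Homomorphism q isField using (⟪_⟫)
    open Codes q isField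
    open Polar q isField P using (isPolar; _⟂_)
    open Spreads q isField P
    open FrameLines q isField P
    open Invariance q isField P using (triads-equal)

    coordinates : ∀ {e f} → ¬ e ⟂ f → ∃ λ (C : Coordinates) → Frame.from C ε₁ ≡ e × Frame.from C ε₂ ≡ f
    coordinates ¬e⟂f = let g , e⟂g , f⟂g , g≢0 = perpNonZero isPolar ¬e⟂f ; φ = frameAt isPolar ¬e⟂f e⟂g f⟂g g≢0 in
      FrameAt.frame φ , FrameAt.from-ε₁ φ , FrameAt.from-ε₂ φ

    -- All representatives are realized in one arbitrary system of coordinates; by
    -- `sameCode⇒equivalent` another choice would give equivalent spreads.
    C₀ : Coordinates
    C₀ = proj₁ (coordinates (proj₂ (nonOrthogonal isPolar {ε₁} (1≢0 ∘ cong first))))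

    validCode : ∀ i → T (N.isCode (decode (lookup codes i)))
    validCode i = all⁻ (N.isCode ∘ decode) codes (true⇒T codesValid) (∈-lookup {xs = codes} i)

    module Rep (i : Fin (length codes)) where
      open CheckedCode (decode (lookup codes i)) (validCode i) public
      open CodedSpread C₀ (isCodeSigned P) public using (specialSpread; inSpread)

    representative : Fin (length codes) → SpecialSpread P
    representative i = Rep.specialSpread i

    inequivalent : ∀ {i j} → Equivalent P (representative i) (representative j) → i ≡ j
    inequivalent {i} {j} (φ , isAut , maps) = distinct-lookup (N.triads ∘ decode) codes (true⇒T (trans (cong allDistinct countsCorrect) countsDistinct)) i j
      (triads-equal φ isAut C₀ {decode (lookup codes i)} {decode (lookup codes j)} (validCode i) (validCode j) maps)

    module Reach (𝒮 : SpecialSpread P) where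
      Goal : Set
      Goal = ∃ λ i → Equivalent P (representative i) 𝒮
      open Soundness q isField P 𝒮 Goal
      open SpecialSpreadProperties 𝒮

      -- The base case of the search: a spread that contains all lines of a representative, in
      -- whatever coordinates, is equivalent to it.
      reached : ∀ i → LemmaHolds (decode (lookup codes i))
      reached i C known = i , sameCode⇒equivalent C₀ C (Rep.isCodeSigned i P) (representative i) 𝒮 (Rep.inSpread i)
        (λ v∈ → member (Rep.signed⁻ i v∈))
        where
        member : ∀ {u} → (∃ λ v → v ∈ˡ decode (lookup codes i) × (u ≡ ⟪ v ⟫ ⊎ u ≡ neg₅ ⟪ v ⟫)) → InSpread C S u
        member (v , v∈ , inj₁ refl) = proj₂ (All.lookup known v∈)
        member (v , v∈ , inj₂ refl) = let n , s = All.lookup known v∈ in negated C n s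

      allReached : All LemmaHolds (List.map decode codes)
      allReached = All.tabulate λ D∈ → let c , c∈ , e = ∈-map⁻ decode D∈ in
        subst LemmaHolds (sym (trans e (cong decode (Any.lookup-index c∈)))) (reached (index c∈))

      rootHolds : LemmaHolds (decode (1 ∷ []))
      rootHolds = checkAll-sound allReached (List.map decodeEntry certificate) (true⇒T certificateValid) (entry certificate root)
        where
        entry : ∀ cs → (1 ∷ []) ∈ˡ List.map proj₁ cs → decode (1 ∷ []) ∈ˡ List.map proj₁ (List.map decodeEntry cs)
        entry ((_ , _) ∷ cs) (here refl) = here refl
        entry ((_ , _) ∷ cs) (there p)   = there (entry cs p)

      -- The value of the stored code 1, whose line is ⟨ε₁, ε₂⟩; this is the root configuration of
      -- the certificate.
      v₀ : Vec (𝔽 q) 5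
      v₀ = 1# ∷ 0# ∷ 0# ∷ 0# ∷ 0# ∷ []

      norm-v₀ : norm v₀ ≡ 1#
      norm-v₀ = solve 0 (#1 :* #1 :+ (#0 :* #0 :- #0 :* #0) := #1) refl

      fixed-ε₁ : Fixed v₀ ε₁
      fixed-ε₁ = solve 0 (#1 :* #1 :+ (#0 :* #0 :+ #0 :* #0) := #1) refl ⹁ solve 0 (#1 :* #0 :+ (#0 :* #0 :+ #0 :* #0) := #0) refl ⹁
        solve 0 (#0 :* #1 :- (#0 :* #0 :+ #1 :* #0) := #0) refl ⹁ solve 0 (#0 :* #0 :- (#0 :* #1 :+ #1 :* #0) := #0) refl ⹁ refl

      fixed-ε₂ : Fixed v₀ ε₂
      fixed-ε₂ = solve 0 (#1 :* #0 :+ (#0 :* #0 :+ #0 :* #0) := #0) refl ⹁ solve 0 (#1 :* #1 :+ (#0 :* #0 :+ #0 :* #0) := #1) refl ⹁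
        solve 0 (#0 :* #0 :- (#0 :* #1 :+ #1 :* #0) := #0) refl ⹁ solve 0 (#0 :* #1 :- (#0 :* #0 :+ #1 :* #0) := #0) refl ⹁ refl

      goal : Goal
      goal = start (lineAt ε₁ (1≢0 ∘ cong first))
        where
        start : (∃ λ ℓ → ℓ ∈ₗ S × ε₁ ∈ proj₁ ℓ) → Goal
        -- The vector `ε₁` served only to produce some line of the spread. The new coordinates send
        -- the basis of that line to `ε₁` and `ε₂`, which is possible because the line is not
        -- totally isotropic.
        start (ℓ , ℓ∈ , _) = finish (coordinates (hyperbolic ℓ ℓ∈))
          where
          finish : (∃ λ (C : Coordinates) → Frame.from C ε₁ ≡ LineBasis.b₁ ℓ × Frame.from C ε₂ ≡ LineBasis.b₂ ℓ) → Goal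
          finish (C , e₁ , e₂) = rootHolds C ((norm-v₀ , capture C ℓ v₀ norm-v₀ ℓ∈ (fixedAt e₁ fixed-ε₁) (fixedAt e₂ fixed-ε₂)) ∷ [])
            where
            fixedAt : ∀ {z u} → Frame.from C z ≡ u → Fixed v₀ z → Fixed v₀ (Frame.to C u)
            fixedAt {z} e f = subst (λ u → Fixed v₀ (Frame.to C u)) e (subst (Fixed v₀) (sym (Frame.to∘from C z)) f)

    classification : ExactlyUpTo (length codes) (Equivalent P)
    classification = representative , inequivalent , λ 𝒮 → proj₁ (Reach.goal 𝒮) , λ where refl → proj₂ (Reach.goal 𝒮)

module OddField (q : ℕ) .{{_ : NonZero q}} where
  open Residues q

  inverses? : Dec (∀ a → a ≢ ⟦ 0 ⟧ → ∃ λ b → a ⊠ b ≡ ⟦ 1 ⟧)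
  inverses? = Fin.all? λ a → ¬? (a Fin.≟ ⟦ 0 ⟧) →-dec Fin.any? λ b → (a ⊠ b) Fin.≟ ⟦ 1 ⟧

  isOddField : True inverses? → ⟦ 1 ⟧ ≢ ⟦ 0 ⟧ → ⟦ 1 ⟧ ⊞ ⟦ 1 ⟧ ≢ ⟦ 0 ⟧ → IsOddField
  isOddField t 1≢0 2≢0 = record { inverse = toWitness {a? = inverses?} t ; 1≢0 = 1≢0 ; 2≢0 = 2≢0 }

isOddField₃ : Residues.IsOddField 3
isOddField₃ = OddField.isOddField 3 _ (λ ()) (λ ())

isOddField₅ : Residues.IsOddField 5
isOddField₅ = OddField.isOddField 5 _ (λ ()) (λ ())

isOddField₇ : Residues.IsOddField 7
isOddField₇ = OddField.isOddField 7 _ (λ ()) (λ ())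

module C₃ = Classification 3 isOddField₃ codes₃ counts₃ certificate₃
module C₅ = Classification 5 isOddField₅ codes₅ counts₅ certificate₅
module C₇ = Classification 7 isOddField₇ codes₇ counts₇ certificate₇

root? : ∀ (cs : List (List ℕ × Tree)) → Dec (Any ((1 ∷ []) ≡_) (List.map proj₁ cs))
root? cs = Any.any? (λ C → List.≡-dec ℕ._≟_ (1 ∷ []) C) (List.map proj₁ cs)

abstract
  checks₃ : C₃.Checks
  checks₃ = record { codesValid = refl ; countsCorrect = refl ; countsDistinct = refl ; certificateValid = refl ; root = toWitness {a? = root? certificate₃} _ }

  checks₅ : C₅.Checks
  checks₅ = record { codesValid = refl ; countsCorrect = refl ; countsDistinct = refl ; certificateValid = refl ; root = toWitness {a? = root? certificate₅} _ }

  checks₇ : C₇.Checks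
  checks₇ = record { codesValid = refl ; countsCorrect = refl ; countsDistinct = refl ; certificateValid = refl ; root = toWitness {a? = root? certificate₇} _ }

theorem4 : ((P : SymplecticPolarity 3) → ExactlyUpTo 1 (Equivalent P)) ×
    ((P : SymplecticPolarity 5) → ExactlyUpTo 2 (Equivalent P)) ×
    ((P : SymplecticPolarity 7) → ExactlyUpTo 14 (Equivalent P))
theorem4 = C₃.classification checks₃ , C₅.classification checks₅ , C₇.classification checks₇
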